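{- Fix a permutation $\pi$ and a mixed $k$-chain $\mathbf{c}$ for $\pi$. Then the Schubert polynomial satisfies \[\mathfrak{S}_\pi=\sum_{Q}\operatorname{wt}(Q),\] the sum over all biwords $Q$ whose recording chain for left insertion is $\mathbf{c}$, i.e. such that $\mathcal{L}(Q)=(D,\mathbf c)$ for some BPD $D$.
   Context: Permutations are in one-line notation, $\ell$ is length, $\pi t_{ab}$ swaps the entries of $\pi$ in positions $a,b$; $\rho\lessdot_k\pi$ means $\pi=\rho t_{ab}$ with $a\le k<b$ and $\ell(\pi)=\ell(\rho)+1$. A mixed $k$-chain for $\pi$ is a chain $\mathrm{id}\lessdot_{k_1}\pi_1\lessdot_{k_2}\cdots\lessdot_{k_\ell}\pi_\ell=\pi$ together with its labels $k_i$. Bumpless pipe dreams. Cells $(i,j)$ of the $n\times n$ grid (row $i$ from the top, column $j$ from the left) carry tiles recording which cell edges are joined by pipe segments: blank (none), horizontal (W–E), vertical (S–N), cross (W–E and S–N, two pipes), r-elbow (S–E), j-elbow (W–N), and, in intermediate stages only, bump (a W–N elbow and an S–E elbow carried by two different pipes). A bumpless pipe dream (BPD) of $\pi\in S_n$ is a tiling by the first six tiles whose segments form pipes such that for each $c$ the pipe $c$ enters at the bottom of column $c$, moves only north and east, and exits at the right end of row $\pi^{ -1}(c)$ ("pipe $c$ exits from row $\pi^{ -1}(c)$"), any two pipes crossing at most once; $\mathrm{BPD}(\pi)$ is the set of these, $\mathrm{perm}(D)=\pi$, and $I$ is the unique BPD of the identity. The weight of $D$ is $\prod x_i$ over the blank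 tiles $(i,j)$, and $\mathfrak S_\pi=\sum_{D\in\mathrm{BPD}(\pi)}\operatorname{wt}(D)$. During the algorithm one cell may be a bump; pipes, exits and crossings are traced the same way. A pipe has an r-turn at a cell where it enters from the south and leaves east (r-elbow or SE part of a bump). Moves. min-droop at $(a,b)$, where pipe $p$ has an r-turn: let $x>0$ be smallest with $(a+x,b)$ not a cross and $y>0$ smallest with $(a,b+y)$ not a cross. Within the rectangle with corners $(a,b)$ and $(a+x,b+y)$, $p$ runs up the left column from $(a+x,b)$ to $(a,b)$ and then along the top row to $(a,b+y)$; replace this by the route along the bottom row from $(a+x,b)$ to $(a+x,b+y)$ and up the right column to $(a,b+y)$, other pipes unchanged, tiles redetermined by the segments (so $p$ gets a W–N turn at $(a+x,b+y)$, which becomes a j-elbow if it was blank and a bump if it was an r-elbow). Set $\operatorname{min-droop}(a,b)=(a+x,b+y)$. cross-bump-swap at a bump $(a,b)$ whose two pipes also cross at $(a',b')$: $(a,b)$ becomes a cross and $(a',b')$ a bump; $\operatorname{cross-bump-swap}(a,b)=(a',b')$. A biletter $b_k$ is a pair of positive integers with $b\le k$; a biword is a word of biletters; its weight is $\operatorname{wt}((b_1)_{k_1}\cdots(b_\ell)_{k_\ell})=\prod_i x_{b_i}$. Left insertion $b_k\rightarrow D$: let $(i,j)$ be the r-elbow in row $b$ with $j$ minimal. (1) min-droop at $(i,j)$; let $(i_1,j_1)=\operatorname{min-droop}(i,j)$. (2) If $(i_1,j_1)$ is a j-elbow: (a) if $i_1\le k$, let $(i_1,j_2)$ be the r-elbow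 in row $i_1$ with $j_2>j_1$ minimal, set $(i,j)=(i_1,j_2)$, go to (1); (b) otherwise let $(i_1,j_0)$ be the r-elbow in row $i_1$ with $j_0<j_1$ maximal, set $(i,j)=(i_1,j_0)$, go to (1). (3) Otherwise $(i_1,j_1)$ is a bump: (a) if the pipe with the r-turn there exits from a row $r\le k$, set $(i,j)=(i_1,j_1)$ and go to (1); (b) otherwise, if the two pipes through $(i_1,j_1)$ cross somewhere, perform cross-bump-swap, set $(i,j)=\operatorname{cross-bump-swap}(i_1,j_1)$ and go to (1); if not, replace the bump by a cross and stop. For $D\in\mathrm{BPD}(\pi)$ the output lies in $\mathrm{BPD}(\pi t_{\alpha\beta})$ for some $\alpha\le k<\beta$ with $\pi\lessdot_k\pi t_{\alpha\beta}$. Recording chain for left insertion: $\mathcal L(\emptyset)=(I,\mathrm{id})$, and if $Q=b_kQ'$ with $\mathcal L(Q')=(D,\mathbf c')$ then $\mathcal L(Q)=(b_k\rightarrow D,\ \mathbf c'\lessdot_k\mathrm{perm}(b_k\rightarrow D))$ (the chain $\mathbf c'$ extended by one step labelled $k$). The second component is the recording chain for left insertion of $Q$. -}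

module Defs where

-- Conventions: everything is 1-indexed, as in the paper.  Rows/columns and
-- permutation entries are natural numbers in 1..n.  A permutation of S_n is
-- written in one-line notation as a list of length n.  A grid is a list of
-- n rows, each a list of n tiles; (i , j) = row i from the top, column j
-- from the left.

open import Data.Nat using (ℕ; zero; suc; _+_; _*_; _∸_; _⊔_; _≤_; _<_; _≡ᵇ_; _≤ᵇ_; _<ᵇ_)
open import Data.Bool using (Bool; true; false; _∧_; _∨_; not; if_then_else_; T)
open import Data.List using (List; []; _∷_; _++_; length; map; filterᵇ; findᵇ; applyUpTo; upTo; last)
open import Data.List.Relation.Binary.Permutation.Propositional using (_↭_)
open import Data.Maybe using (Maybe; just; nothing; _>>=_; fromMaybe)
open import Data.Product using (Σ; _×_; _,_; proj₁; proj₂)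
open import Relation.Binary.PropositionalEquality using (_≡_)

oneTo : ℕ → List ℕ
oneTo n = applyUpTo suc n

rangeFrom : ℕ → ℕ → List ℕ
rangeFrom lo len = applyUpTo (lo +_) len

nth : {A : Set} → List A → ℕ → Maybe A
nth []       _             = nothing
nth (x ∷ xs) zero          = nothing
nth (x ∷ xs) (suc zero)    = just x
nth (x ∷ xs) (suc (suc i)) = nth xs (suc i)

modNth : {A : Set} → (A → Maybe A) → ℕ → List A → Maybe (List A)
modNth f _             []       = nothing
modNth f zero          (x ∷ xs) = nothing
modNth f (suc zero)    (x ∷ xs) = f x >>= λ y → just (y ∷ xs)
modNth f (suc (suc i)) (x ∷ xs) = modNth f (suc i) xs >>= λ ys → just (x ∷ ys)

boolEq : Bool → Bool → Bool
boolEq true  y = y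
boolEq false y = not y

allᵇ : {A : Set} → (A → Bool) → List A → Bool
allᵇ p []       = true
allᵇ p (x ∷ xs) = p x ∧ allᵇ p xs

anyᵇ : {A : Set} → (A → Bool) → List A → Bool
anyᵇ p []       = false
anyᵇ p (x ∷ xs) = p x ∨ anyᵇ p xs

countᵇ : {A : Set} → (A → Bool) → List A → ℕ
countᵇ p xs = length (filterᵇ p xs)

Perm : Set
Perm = List ℕ

IsPerm : ℕ → Perm → Set
IsPerm n π = π ↭ oneTo n

idPerm : ℕ → Perm
idPerm n = oneTo n

inversions : Perm → ℕ
inversions []       = 0
inversions (x ∷ xs) = countᵇ (λ y → y <ᵇ x) xs + inversions xs

swapPos : Perm → ℕ → ℕ → Perm
swapPos ρ a b = map f (oneTo (length ρ))
  where
  get : ℕ → ℕ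
  get i = fromMaybe 0 (nth ρ i)
  f : ℕ → ℕ
  f i = if i ≡ᵇ a then get b else (if i ≡ᵇ b then get a else get i)

Covers : ℕ → ℕ → Perm → Perm → Set
Covers n k ρ σ =
  Σ ℕ λ a → Σ ℕ λ b →
    (1 ≤ a) × (a ≤ k) × (k < b) × (b ≤ n) ×
    (σ ≡ swapPos ρ a b) × (inversions σ ≡ suc (inversions ρ))

-- A labelled chain: the list of steps (k_i , π_i), i = 1..ℓ.
Chain : Set
Chain = List (ℕ × Perm)

data IsChain (n : ℕ) : Perm → Chain → Perm → Set where
  chain-nil  : ∀ {ρ} → IsChain n ρ [] ρ
  chain-cons : ∀ {ρ σ τ k c} → Covers n k ρ σ → IsChain n σ c τ →
               IsChain n ρ ((k , σ) ∷ c) τ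

MixedChain : ℕ → Chain → Perm → Set
MixedChain n c π = IsChain n (idPerm n) c π

data Tile : Set where
  blank hor ver cross relbow jelbow bump : Tile

-- a tile as its set of segments W–E, S–N, S–E, W–N
record Segs : Set where
  constructor segs
  field we sn se wn : Bool
open Segs

data Seg : Set where
  WE SN SE WN : Seg

tileSegs : Tile → Segs
tileSegs blank  = segs false false false false
tileSegs hor    = segs true  false false false
tileSegs ver    = segs false true  false false
tileSegs cross  = segs true  true  false false
tileSegs relbow = segs false false true  false
tileSegs jelbow = segs false false false true
tileSegs bump   = segs false false true  true

segsTile : Segs → Maybe Tile
segsTile (segs false false false false) = just blank
segsTile (segs true  false false false) = just hor
segsTile (segs false true  false false) = just ver
segsTile (segs true  true  false false) = just cross
segsTile (segs false false true  false) = just relbow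
segsTile (segs false false false true ) = just jelbow
segsTile (segs false false true  true ) = just bump
segsTile _                              = nothing

getSeg : Seg → Segs → Bool
getSeg WE s = we s
getSeg SN s = sn s
getSeg SE s = se s
getSeg WN s = wn s

putSeg : Seg → Bool → Segs → Segs
putSeg WE v (segs a b c d) = segs v b c d
putSeg SN v (segs a b c d) = segs a v c d
putSeg SE v (segs a b c d) = segs a b v d
putSeg WN v (segs a b c d) = segs a b c v

hasSeg : Seg → Tile → Bool
hasSeg s t = getSeg s (tileSegs t)

addSeg : Seg → Tile → Maybe Tile
addSeg s t = if hasSeg s t then nothing else segsTile (putSeg s true (tileSegs t))

remSeg : Seg → Tile → Maybe Tile
remSeg s t = if hasSeg s t then segsTile (putSeg s false (tileSegs t)) else nothing

hasW hasE hasS hasN : Tile → Bool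
hasW t = hasSeg WE t ∨ hasSeg WN t
hasE t = hasSeg WE t ∨ hasSeg SE t
hasS t = hasSeg SN t ∨ hasSeg SE t
hasN t = hasSeg SN t ∨ hasSeg WN t

isTile : Tile → Tile → Bool
isTile blank  blank  = true
isTile hor    hor    = true
isTile ver    ver    = true
isTile cross  cross  = true
isTile relbow relbow = true
isTile jelbow jelbow = true
isTile bump   bump   = true
isTile _      _      = false

isTileAt : Tile → Maybe Tile → Bool
isTileAt t (just u) = isTile t u
isTileAt t nothing  = false

Grid : Set
Grid = List (List Tile)

tileAt : Grid → ℕ → ℕ → Maybe Tile
tileAt g i j = nth g i >>= λ row → nth row j

modTile : (Tile → Maybe Tile) → ℕ → ℕ → Grid → Maybe Grid
modTile f i j g = modNth (modNth f j) i g

setTile : Tile → ℕ → ℕ → Grid → Maybe Grid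
setTile t = modTile (λ _ → just t)

forEach : List ℕ → (ℕ → Grid → Maybe Grid) → Grid → Maybe Grid
forEach []       f g = just g
forEach (x ∷ xs) f g = f x g >>= forEach xs f

Cell : Set
Cell = ℕ × ℕ

cellEq : Cell → Cell → Bool
cellEq (i , j) (i' , j') = (i ≡ᵇ i') ∧ (j ≡ᵇ j')

memCell : Cell → List Cell → Bool
memCell c cs = anyᵇ (cellEq c) cs

-- Tracing pipes.  A pipe moves only north and east, so it visits at most
-- 2n-1 cells of the n×n grid; fuel 2n is therefore always sufficient.

data Dir : Set where
  fromS fromW : Dir

-- traceF n g fuel i j d : the pipe enters cell (i , j) from direction d;
-- result: just (r , cells visited in order) if it exits at the right end
-- of row r; nothing if it breaks, leaves through the top, or leaves the grid.
traceF : ℕ → Grid → ℕ → ℕ → ℕ → Dir → Maybe (ℕ × List Cell)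
traceF n g zero    i j d = nothing
traceF n g (suc f) i j d = tileAt g i j >>= λ t → go t d
  where
  north : Maybe (ℕ × List Cell)
  north = if i ≤ᵇ 1 then nothing
          else (traceF n g f (i ∸ 1) j fromS >>= λ { (r , p) → just (r , (i , j) ∷ p) })
  east : Maybe (ℕ × List Cell)
  east = if n ≤ᵇ j then just (i , (i , j) ∷ [])
         else (traceF n g f i (suc j) fromW >>= λ { (r , p) → just (r , (i , j) ∷ p) })
  go : Tile → Dir → Maybe (ℕ × List Cell)
  go t fromS = if hasSeg SN t then north else (if hasSeg SE t then east else nothing)
  go t fromW = if hasSeg WE t then east else (if hasSeg WN t then north else nothing)

tracePipe : ℕ → Grid → ℕ → Maybe (ℕ × List Cell)
tracePipe n g c = traceF n g (2 * n) n c fromS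

pathOf : Maybe (ℕ × List Cell) → List Cell
pathOf (just (_ , p)) = p
pathOf nothing        = []

commonCrosses : Grid → List Cell → List Cell → List Cell
commonCrosses g p q =
  filterᵇ (λ { (i , j) → memCell (i , j) q ∧ isTileAt cross (tileAt g i j) }) p

isBPD : ℕ → Perm → Grid → Bool
isBPD n π g = shape ∧ noBump ∧ edges ∧ pipes ∧ crossings
  where
  idx : List ℕ
  idx = oneTo n
  tile : ℕ → ℕ → Tile
  tile i j = fromMaybe blank (tileAt g i j)
  shape : Bool
  shape = (length g ≡ᵇ n) ∧ allᵇ (λ row → length row ≡ᵇ n) g ∧ (length π ≡ᵇ n)
  noBump : Bool
  noBump = allᵇ (λ i → allᵇ (λ j → not (isTile bump (tile i j))) idx) idx
  cellOK : ℕ → ℕ → Bool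
  cellOK i j =
    (if j ≡ᵇ n then hasE (tile i j) else boolEq (hasE (tile i j)) (hasW (tile i (suc j)))) ∧
    (if i ≡ᵇ 1 then not (hasN (tile i j)) else boolEq (hasN (tile i j)) (hasS (tile (i ∸ 1) j))) ∧
    (if j ≡ᵇ 1 then not (hasW (tile i j)) else true) ∧
    (if i ≡ᵇ n then hasS (tile i j) else true)
  edges : Bool
  edges = allᵇ (λ i → allᵇ (λ j → cellOK i j) idx) idx
  pipeOK : ℕ → Bool
  pipeOK c with tracePipe n g c
  ... | nothing      = false
  ... | just (r , _) = fromMaybe false (nth π r >>= λ v → just (v ≡ᵇ c))
  pipes : Bool
  pipes = allᵇ pipeOK idx
  crossings : Bool
  crossings = allᵇ (λ c → allᵇ (λ d →
      if c <ᵇ d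
      then length (commonCrosses g (pathOf (tracePipe n g c)) (pathOf (tracePipe n g d))) ≤ᵇ 1
      else true) idx) idx

BPD : ℕ → Perm → Set
BPD n π = Σ Grid λ D → T (isBPD n π D)

idBPD : ℕ → Grid
idBPD n = map (λ i → map (λ j → if i ≡ᵇ j then relbow else (if j <ᵇ i then ver else hor)) (oneTo n)) (oneTo n)

-- a monomial x^e in x_1..x_n is its exponent list e = (e_1 , … , e_n)
Monomial : Set
Monomial = List ℕ

wtBPD : ℕ → Grid → Monomial
wtBPD n g = map (λ i → countᵇ (λ j → isTileAt blank (tileAt g i j)) (oneTo n)) (oneTo n)

-- a biletter b_k is the pair (b , k); a biword is a list of biletters
Biword : Set
Biword = List (ℕ × ℕ)

validBiword : Biword → Bool
validBiword Q = allᵇ (λ { (b , k) → (1 ≤ᵇ b) ∧ (b ≤ᵇ k) }) Q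

wtBiword : ℕ → Biword → Monomial
wtBiword n Q = map (λ i → countᵇ (λ bk → proj₁ bk ≡ᵇ i) Q) (oneTo n)

-- The insertion algorithm works in the (conceptually infinite) grid: a
-- stored M×M grid g stands for the grid that agrees with g on the M×M
-- square and carries the tiles of the identity BPD outside it (horizontal
-- tiles to the right of the square, vertical tiles below it, and the
-- identity pattern in the south-east).  Before a tile outside the square
-- is modified, the square is enlarged.  (Needed: e.g. 1_2 → D for D the
-- BPD of 132 produces a BPD of 1423 ∉ S_3.)

vtile : Grid → ℕ → ℕ → Maybe Tile
vtile g zero    j       = nothing
vtile g (suc i) zero    = nothing
vtile g (suc i) (suc j) =
  if (suc i ≤ᵇ M) ∧ (suc j ≤ᵇ M) then tileAt g (suc i) (suc j)
  else (if suc i ≤ᵇ M then just hor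
  else (if suc j ≤ᵇ M then just ver
  else (if i ≡ᵇ j then just relbow else (if j <ᵇ i then just ver else just hor))))
  where
  M : ℕ
  M = length g

grow : Grid → Grid
grow g = map (λ row → row ++ (hor ∷ [])) g ++ ((map (λ _ → ver) g ++ (relbow ∷ [])) ∷ [])

growN : ℕ → Grid → Grid
growN zero    g = g
growN (suc m) g = growN m (grow g)

ensureSize : ℕ → Grid → Grid
ensureSize m g = growN (m ∸ length g) g

minDroop : Grid → ℕ → ℕ → Maybe (Grid × Cell)
minDroop g a b =
  (if hasSeg SE (fromMaybe blank (vtile g a b)) then just 0 else nothing) >>= λ _ →
  -- beyond the stored square no cell is a cross, so these searches succeed
  findᵇ (λ i → not (isTileAt cross (vtile g i b))) (rangeFrom (suc a) (suc M ∸ a)) >>= λ ax →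
  findᵇ (λ j → not (isTileAt cross (vtile g a j))) (rangeFrom (suc b) (suc M ∸ b)) >>= λ by →
  -- old route of p: up the left column, along the top row
  modTile (remSeg SE) a b (ensureSize (ax ⊔ by) g) >>=
  forEach (rangeFrom (suc a) (ax ∸ suc a)) (λ i → modTile (remSeg SN) i b) >>=
  modTile bottomLeft ax b >>=
  forEach (rangeFrom (suc b) (by ∸ suc b)) (λ j → modTile (remSeg WE) a j) >>=
  modTile topRight a by >>=
  -- new route of p: along the bottom row, up the right column
  forEach (rangeFrom (suc b) (by ∸ suc b)) (λ j → modTile (addSeg WE) ax j) >>=
  forEach (rangeFrom (suc a) (ax ∸ suc a)) (λ i → modTile (addSeg SN) i by) >>=
  modTile (addSeg WN) ax by >>= λ g' →
  just (g' , (ax , by))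
  where
  M : ℕ
  M = length g
  -- p's segment at (a+x , b) ends at N; it now ends at E
  bottomLeft : Tile → Maybe Tile
  bottomLeft t = if hasSeg SN t then (remSeg SN t >>= addSeg SE)
                 else (if hasSeg WN t then (remSeg WN t >>= addSeg WE) else nothing)
  -- p's segment at (a , b+y) starts at W; it now starts at S
  topRight : Tile → Maybe Tile
  topRight t = if hasSeg WE t then (remSeg WE t >>= addSeg SE)
               else (if hasSeg WN t then (remSeg WN t >>= addSeg SN) else nothing)

data Phase : Set where
  begin   : Phase
  droopAt : ℕ → ℕ → Phase

record State : Set where
  constructor st
  field grid  : Grid
        phase : Phase

data Result : Set where
  continue : State → Result
  stop     : Grid → Result
  fail     : Result

isRElbowAt : Grid → ℕ → ℕ → Bool
isRElbowAt g i j = isTileAt relbow (tileAt g i j)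

-- r-elbow in row i with column > j minimal (none lie outside the square
-- in rows inside it)
rElbowAfter : Grid → ℕ → ℕ → Maybe ℕ
rElbowAfter g i j = findᵇ (λ j' → (j <ᵇ j') ∧ isRElbowAt g i j') (oneTo (length g))

rElbowBefore : Grid → ℕ → ℕ → Maybe ℕ
rElbowBefore g i j = last (filterᵇ (λ j' → (j' <ᵇ j) ∧ isRElbowAt g i j') (oneTo (length g)))

-- the pipes through a cell (pipes c > size never enter the stored square)
pipesThrough : Grid → Cell → List (List Cell)
pipesThrough g c =
  filterᵇ (memCell c) (map (λ col → pathOf (tracePipe (length g) g col)) (oneTo (length g)))

data CrossInfo : Set where
  noCross  : CrossInfo
  crossAt  : Cell → CrossInfo
  badCross : CrossInfo

crossOfBump : Grid → Cell → CrossInfo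
crossOfBump g c with pipesThrough g c
... | p ∷ q ∷ [] with commonCrosses g p q
...   | []       = noCross
...   | x ∷ []   = crossAt x
...   | _        = badCross
crossOfBump g c | _ = badCross

afterDroop : ℕ → Grid → ℕ → ℕ → Maybe Tile → Result
afterDroop k g i₁ j₁ (just jelbow) =
  if i₁ ≤ᵇ k
  then (fromMaybe fail (rElbowAfter g i₁ j₁ >>= λ j₂ → just (continue (st g (droopAt i₁ j₂)))))
  else (fromMaybe fail (rElbowBefore g i₁ j₁ >>= λ j₀ → just (continue (st g (droopAt i₁ j₀)))))
afterDroop k g i₁ j₁ (just bump) with traceF (length g) g (2 * length g) i₁ j₁ fromS
... | nothing = fail
... | just (r , _) =
  if r ≤ᵇ k
  then continue (st g (droopAt i₁ j₁))
  else cbs (crossOfBump g (i₁ , j₁))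
  where
  cbs : CrossInfo → Result
  cbs noCross           = fromMaybe fail (setTile cross i₁ j₁ g >>= λ g' → just (stop g'))
  cbs (crossAt (a , b)) = fromMaybe fail
    (setTile cross i₁ j₁ g >>= setTile bump a b >>= λ g' → just (continue (st g' (droopAt a b))))
  cbs badCross          = fail
afterDroop k g i₁ j₁ _ = fail

step : ℕ → ℕ → State → Result
step b k (st g begin) =
  fromMaybe fail (rElbowAfter g' b 0 >>= λ j → just (continue (st g' (droopAt b j))))
  where
  g' : Grid
  g' = ensureSize b g
step b k (st g (droopAt i j)) with minDroop g i j
... | nothing               = fail
... | just (g' , (i₁ , j₁)) = afterDroop k g' i₁ j₁ (tileAt g' i₁ j₁)

data Runs (b k : ℕ) : State → Grid → Set where
  halt : ∀ {s D'}    → step b k s ≡ stop D' → Runs b k s D'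
  next : ∀ {s s' D'} → step b k s ≡ continue s' → Runs b k s' D' → Runs b k s D'

LeftInsert : ℕ → ℕ → Grid → Grid → Set
LeftInsert b k D D' = Runs b k (st D begin) D'

padPerm : ℕ → Perm → Perm
padPerm m π = π ++ rangeFrom (suc (length π)) (m ∸ length π)

-- Recording chain for left insertion:  Rec n Q D c  ⇔  𝓛(Q) = (D , c),
-- starting from the identity BPD I of S_n.  perm(D') = σ is expressed as
-- "D' is a BPD of σ (extended by the identity to the size of D')".

data Rec (n : ℕ) : Biword → Grid → Chain → Set where
  rec-nil  : Rec n [] (idBPD n) []
  rec-cons : ∀ {b k Q D D' c σ} →
             Rec n Q D c → LeftInsert b k D D' →
             T (isBPD (length D') (padPerm (length D') σ) D') →
             Rec n ((b , k) ∷ Q) D' (c ++ ((k , σ) ∷ []))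

{-# OPTIONS --safe #-}
module Submission where

-- Draw the tiles together with the name of the pipe on every edge. Scanning the cells row by row from the
-- bottom, a cross exchanges two neighbouring names on the boundary of the scanned region, so the inversions
-- of the final permutation are the ascending crosses minus the descending ones, and a tiling is reduced iff
-- at each cross the pipe travelling east has the smaller name. Hence the rectangle of a min-droop consists of
-- crosses, and drooping becomes a bijection between tilings with a marked r-turn and tilings with a marked
-- W–N turn. What happens between two droops is also reversible, once k and the permutation are known, and
-- the last crossing is recovered from the two permutations. So each insertion can be traced back uniquely;
-- tracing back ends because the algorithm is deterministic and there are finitely many states.

open import Defs
open import Data.Nat
open import Data.Nat.Properties
open import Data.Nat.Solver using (module +-*-Solver)
open import Data.Bool using (Bool; true; false; _∧_; not; if_then_else_; T)
open import Data.Bool.Properties using (∧-zeroʳ; ∧-identityʳ; T-irrelevant)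
open import Data.Empty using (⊥; ⊥-elim)
open import Data.Fin using (Fin; toℕ)
open import Data.Fin.Properties using (pigeonhole; toℕ<n)
import Data.Fin as Fin
open import Data.List using (List; []; _∷_; _++_; length; map; applyUpTo; filterᵇ; findᵇ; last; lookup; cartesianProduct; cartesianProductWith)
open import Data.List.Properties using (length-++; length-map; length-applyUpTo; ++-identityʳ; ++-assoc; ∷ʳ-injective)
open import Data.List.Membership.Propositional using (_∈_)
open import Data.List.Membership.Propositional.Properties using (∈-++⁺ʳ; ∈-cartesianProduct⁺; ∈-cartesianProductWith⁺; ∈-applyUpTo⁺)
open import Data.List.Relation.Unary.Any using (here; there; index)
open import Data.List.Relation.Unary.Any.Properties using (lookup-index)
open import Data.List.Relation.Unary.All using (All; []; _∷_)
import Data.List.Relation.Unary.All as All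
open import Data.List.Relation.Unary.AllPairs using ([]; _∷_)
open import Data.List.Relation.Unary.Unique.Propositional using (Unique)
open import Data.Maybe using (Maybe; just; nothing; fromMaybe; _>>=_)
open import Data.Maybe.Properties using (just-injective)
open import Data.Product using (Σ; _×_; _,_; proj₁; proj₂)
open import Data.Sum using (_⊎_; inj₁; inj₂; [_,_]′)
import Data.Sum as Sum
open import Data.Unit using (⊤; tt)
open import Function using (id; _∘_)
open import Function.Bundles using (_↔_; mk↔ₛ′)
open import Relation.Nullary
open import Relation.Binary.Definitions using (tri<; tri≈; tri>)
open import Relation.Binary.PropositionalEquality hiding (J)
open +-*-Solver using (solve; _:+_; _:=_; con)

-- The identity is proved coefficientwise, as a bijection between the BPDs of a given weight and the
-- biwords of that weight with recording chain `c`. Between two droops the grid need not be a BPD,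
-- since it may contain a bump. What survives is this invariant: every intermediate grid is a
-- reduced labelled tiling of the old permutation with at most one bump, at the turn of the moving
-- pipe, and that pipe exits from a row at most `k`. Only the final replacement of a bump by a cross
-- changes the permutation. The bound on the exit row is what makes each case distinction of the
-- algorithm readable from its result. After a cross-bump-swap, reducedness is not checked along the
-- pipes: exits and number of crosses are as before, so the count of inversions leaves no room for a
-- descending cross. For the weight, the turn counts as one more blank of its row while it is an
-- elbow and as none while it is a bump. A droop may also leave the square; then the insertion stops
-- at once with a permutation that moves `suc n`, which no chain in S_n records.

private variable
  X Y : Set

-- Labelled tilings and their cuts

In : ℕ → ℕ → Set
In n i = 1 ≤ i × i ≤ n

-- The four labels belong to the west, east, north and south edge, in this order.
data Loc (R : ℕ → ℕ → Set) : Tile → ℕ → ℕ → ℕ → ℕ → Set where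
  blankˡ  : Loc R blank 0 0 0 0
  horˡ    : ∀ {w} → 0 < w → Loc R hor w w 0 0
  verˡ    : ∀ {s} → 0 < s → Loc R ver 0 0 s s
  crossˡ  : ∀ {w s} → 0 < w → 0 < s → R w s → Loc R cross w w s s
  relbowˡ : ∀ {s} → 0 < s → Loc R relbow 0 s 0 s
  jelbowˡ : ∀ {w} → 0 < w → Loc R jelbow w 0 w 0
  bumpˡ   : ∀ {w s} → 0 < w → 0 < s → Loc R bump w s w s

-- R relates the west and the south label of a cross: Any² for arbitrary tilings, _<_ for reduced ones.
Any² : ℕ → ℕ → Set
Any² _ _ = ⊤

-- h i j and v i j are the pipes through the west and the north edge of the cell (i , j), 0 meaning none.
record Lab (R : ℕ → ℕ → Set) (n : ℕ) (T : ℕ → ℕ → Tile) (h v : ℕ → ℕ → ℕ) : Set where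
  field
    loc   : ∀ i j → In n i → In n j → Loc R (T i j) (h i j) (h i (suc j)) (v i j) (v (suc i) j)
    left  : ∀ i → In n i → h i 1 ≡ 0
    top   : ∀ j → In n j → v 1 j ≡ 0
    bot   : ∀ j → In n j → v (suc n) j ≡ j
    right : ∀ i → In n i → 0 < h i (suc n)

weaken : ∀ {R t w e n s} → Loc R t w e n s → Loc Any² t w e n s
weaken blankˡ = blankˡ
weaken (horˡ x) = horˡ x
weaken (verˡ x) = verˡ x
weaken (crossˡ x y _) = crossˡ x y tt
weaken (relbowˡ x) = relbowˡ x
weaken (jelbowˡ x) = jelbowˡ x
weaken (bumpˡ x y) = bumpˡ x y

-- On the boundary of the scanned region a cell replaces the pair (west, south) by (north, east). In
-- `flipW` and `flipS` one of the two edges is empty, so a pair of pipes is exchanged only in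
-- `flipX`.
data Transfer (R : ℕ → ℕ → Set) (t : Tile) (w e n s : ℕ) : Set where
  keep : n ≡ w → e ≡ s → Transfer R t w e n s
  flipW : n ≡ s → e ≡ w → w ≡ 0 → Transfer R t w e n s
  flipS : n ≡ s → e ≡ w → s ≡ 0 → Transfer R t w e n s
  flipX : n ≡ s → e ≡ w → t ≡ cross → R w s → Transfer R t w e n s

transfer : ∀ {R t w e n s} → Loc R t w e n s → Transfer R t w e n s
transfer blankˡ = keep refl refl
transfer (horˡ x) = flipS refl refl refl
transfer (verˡ x) = flipW refl refl refl
transfer (crossˡ x y r) = flipX refl refl refl r
transfer (relbowˡ x) = keep refl refl
transfer (jelbowˡ x) = keep refl refl
transfer (bumpˡ x y) = keep refl refl

crossEqs : ∀ {R t w e n s} → Loc R t w e n s → t ≡ cross → (e ≡ w) × (n ≡ s) × 0 < w × 0 < s × R w s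
crossEqs (crossˡ x y r) refl = refl , refl , x , y , r

-- The scan order: rows come from the bottom, so the larger row index is the earlier one.
data _≼_ : Cell → Cell → Set where
  lower : ∀ {i j i' j'} → i' < i → (i , j) ≼ (i' , j')
  same  : ∀ {i j j'} → j ≤ j' → (i , j) ≼ (i , j')

≼-weaken : ∀ {a b a' b'} → (a , suc b) ≼ (a' , b') → (a , b) ≼ (a' , b')
≼-weaken (lower x) = lower x
≼-weaken (same x) = same (<⇒≤ x)

≼-exit : ∀ {n a b} → In n a → b ≤ n → (a , suc b) ≼ (1 , suc n)
≼-exit (1≤a , _) le with m≤n⇒m<n∨m≡n 1≤a
... | inj₁ lt = lower lt
... | inj₂ refl = same (s≤s le)

≼-total : ∀ i j i' j' → ((i , suc j) ≼ (i' , j')) ⊎ ((i' , suc j') ≼ (i , j)) ⊎ (i ≡ i' × j ≡ j')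
≼-total i j i' j' with <-cmp i i'
... | tri< a _ _ = inj₂ (inj₁ (lower a))
... | tri> _ _ c = inj₁ (lower c)
... | tri≈ _ refl _ with <-cmp j j'
...   | tri< a _ _ = inj₁ (same a)
...   | tri≈ _ refl _ = inj₂ (inj₂ (refl , refl))
...   | tri> _ _ c = inj₂ (inj₁ (same c))

module Cuts {R n T h v} (L : Lab R n T h v) where
  open Lab L

  -- The cells are scanned row by row from the bottom up, each row from left to right. At i j m l: when
  -- (i , j) is about to be scanned, l is the m-th label along the boundary of the scanned region.
  data At (i j : ℕ) : ℕ → ℕ → Set where
    old : ∀ {m} → 1 ≤ m → m < j → At i j m (v i m)
    cur : At i j j (h i j)
    new : ∀ {m} → j ≤ m → m ≤ n → At i j (suc m) (v (suc i) m)
    out : ∀ d → 1 ≤ d → d + i ≤ n → At i j (suc n + d) (h (d + i) (suc n))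

  Before : ℕ → ℕ → ℕ → ℕ → Set
  Before i j c d = Σ ℕ λ m → Σ ℕ λ m' → m < m' × At i j m c × At i j m' d

  -- Two consecutive cuts differ only at the positions `j` and `suc j`, where the west and south
  -- edge of the scanned cell give way to its north and east edge.
  data Cls (i j m l : ℕ) : Set where
    lo : m < j → At i j m l → Cls i j m l
    J  : m ≡ j → l ≡ v i j → Cls i j m l
    J1 : m ≡ suc j → l ≡ h i (suc j) → Cls i j m l
    hi : suc j < m → At i j m l → Cls i j m l

  cls : ∀ {i j m l} → j ≤ n → At i (suc j) m l → Cls i j m l
  cls {j = j} j≤n (old {m} 1≤m m<) with m≤n⇒m<n∨m≡n (≤-pred m<)
  ... | inj₁ m<j = lo m<j (old 1≤m m<j)
  ... | inj₂ refl = J refl refl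
  cls _ cur = J1 refl refl
  cls _ (new j<m m≤n) = hi (s≤s j<m) (new (<⇒≤ j<m) m≤n)
  cls {j = j} j≤n (out d 1≤d d≤) = hi (s≤s (≤-trans (s≤s j≤n) (≤-trans (≤-reflexive (+-comm 1 n)) (+-monoʳ-≤ n 1≤d)))) (out d 1≤d d≤)

  record Moved (i j l : ℕ) : Set where
    constructor moved
    field {pos} : ℕ
          at : At i j pos l
          lb : j ≤ pos
          ub : pos ≤ suc j

  CrossOf : ℕ → ℕ → ℕ → ℕ → Set
  CrossOf i j c d = T i j ≡ cross × h i j ≡ c × v (suc i) j ≡ d

  module Step (i j : ℕ) (pi : In n i) (pj : In n j) where
    private
      tr = transfer (loc i j pi pj)
      W : ∀ {l} → l ≡ h i j → At i j j l
      W refl = cur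
      S : ∀ {l} → l ≡ v (suc i) j → At i j (suc j) l
      S refl = new ≤-refl (proj₂ pj)

    movN : ∀ {l} → l ≡ v i j → Moved i j l
    movN refl with tr
    ... | keep p _ = moved (W p) ≤-refl (n≤1+n _)
    ... | flipW p _ _ = moved (S p) (n≤1+n _) ≤-refl
    ... | flipS p _ _ = moved (S p) (n≤1+n _) ≤-refl
    ... | flipX p _ _ _ = moved (S p) (n≤1+n _) ≤-refl

    movE : ∀ {l} → l ≡ h i (suc j) → Moved i j l
    movE refl with tr
    ... | keep _ p = moved (S p) (n≤1+n _) ≤-refl
    ... | flipW _ p _ = moved (W p) ≤-refl (n≤1+n _)
    ... | flipS _ p _ = moved (W p) ≤-refl (n≤1+n _)
    ... | flipX _ p _ _ = moved (W p) ≤-refl (n≤1+n _)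

    both : ∀ {c d} → 0 < c → 0 < d → c ≡ v i j → d ≡ h i (suc j) → Before i j c d ⊎ (CrossOf i j d c × R d c)
    both 0<c 0<d refl refl with tr
    ... | keep p q = inj₁ (j , suc j , ≤-refl , W p , S q)
    ... | flipW p q z = ⊥-elim (n≮0 (subst (0 <_) (trans q z) 0<d))
    ... | flipS p q z = ⊥-elim (n≮0 (subst (0 <_) (trans p z) 0<c))
    ... | flipX p q x r = inj₂ ((x , sym q , sym p) , subst₂ R (sym q) (sym p) r)

    -- Only the pair at the positions `j` and `suc j` can have been exchanged, and only by a cross;
    -- the pipe at the later position then came from the west.
    stepBack : ∀ {c d} → 0 < c → 0 < d → Before i (suc j) c d → Before i j c d ⊎ (CrossOf i j d c × R d c)
    stepBack 0<c 0<d (m , m' , m<m' , a , b) with cls (proj₂ pj) a | cls (proj₂ pj) b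
    ... | lo x a' | lo y b' = inj₁ (m , m' , m<m' , a' , b')
    ... | lo x a' | J refl q = let open Moved (movN q) in inj₁ (m , pos , <-≤-trans x lb , a' , at)
    ... | lo x a' | J1 refl q = let open Moved (movE q) in inj₁ (m , pos , <-≤-trans x lb , a' , at)
    ... | lo x a' | hi y b' = inj₁ (m , m' , m<m' , a' , b')
    ... | J refl p | lo y b' = ⊥-elim (<-asym m<m' y)
    ... | J refl p | J refl q = ⊥-elim (<-irrefl refl m<m')
    ... | J refl p | J1 refl q = both 0<c 0<d p q
    ... | J refl p | hi y b' = let open Moved (movN p) in inj₁ (pos , m' , ≤-<-trans ub y , at , b')
    ... | J1 refl p | lo y b' = ⊥-elim (<-asym m<m' (m<n⇒m<1+n y))
    ... | J1 refl p | J refl q = ⊥-elim (1+n≰n (<⇒≤ m<m'))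
    ... | J1 refl p | J1 refl q = ⊥-elim (<-irrefl refl m<m')
    ... | J1 refl p | hi y b' = let open Moved (movE p) in inj₁ (pos , m' , ≤-<-trans ub y , at , b')
    ... | hi x a' | lo y b' = ⊥-elim (<-asym m<m' (<-trans y (<-trans (n<1+n _) x)))
    ... | hi x a' | J refl q = ⊥-elim (<-asym m<m' (<-trans (n<1+n _) x))
    ... | hi x a' | J1 refl q = ⊥-elim (<-asym m<m' x)
    ... | hi x a' | hi y b' = inj₁ (m , m' , m<m' , a' , b')

  -- No cell is scanned between the end of one row and the start of the next. The cut only gains an
  -- empty west edge in front, which shifts every position by one.
  rowAt : ∀ {i m c} → In n i → 0 < c → At i 1 m c → Σ ℕ λ m₀ → m ≡ suc m₀ × At (suc i) (suc n) m₀ c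
  rowAt pi 0<c (old 1≤m m<1) = ⊥-elim (<-irrefl refl (≤-<-trans 1≤m m<1))
  rowAt {i} pi 0<c cur = ⊥-elim (n≮0 (subst (0 <_) (left i pi) 0<c))
  rowAt pi 0<c (new 1≤m m≤n) = _ , refl , old 1≤m (s≤s m≤n)
  rowAt {i} pi 0<c (out (suc zero) 1≤d d≤) = suc n , cong suc (+-comm n 1) , cur
  rowAt {i} pi 0<c (out (suc (suc d)) 1≤d d≤) = suc n + suc d , cong suc (+-suc n (suc d)) ,
    subst (λ z → At (suc i) (suc n) (suc n + suc d) (h z (suc n))) (+-suc (suc d) i)
      (out (suc d) (s≤s z≤n) (subst (_≤ n) (sym (+-suc (suc d) i)) d≤))

  rowBack : ∀ {i c d} → In n i → 0 < c → 0 < d → Before i 1 c d → Before (suc i) (suc n) c d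
  rowBack pi 0<c 0<d (m , m' , m<m' , a , b) with rowAt pi 0<c a | rowAt pi 0<d b
  ... | _ , refl , a' | _ , refl , b' = _ , _ , ≤-pred m<m' , a' , b'

  -- On the initial cut pipe `l` stands at position `suc l`, because the bottom edges carry their
  -- column numbers.
  baseOrder : ∀ {c d} → 1 ≤ n → 0 < c → 0 < d → Before n 1 c d → c < d
  baseOrder {c} {d} 1≤n 0<c 0<d (m , m' , m<m' , a , b) with base a 0<c | base b 0<d
    where
    base : ∀ {m l} → At n 1 m l → 0 < l → m ≡ suc l
    base (old x y) _ = ⊥-elim (<-irrefl refl (≤-<-trans x y))
    base cur p = ⊥-elim (n≮0 (subst (0 <_) (left n (1≤n , ≤-refl)) p))
    base (new x y) _ = cong suc (sym (bot _ (x , y)))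
    base (out (suc d) x y) _ = ⊥-elim (1+n≰n (≤-trans (s≤s (m≤n+m n d)) y))
  ... | refl | refl = ≤-pred m<m'

  Earlier : ℕ → ℕ → Cell → Set
  Earlier i j (i' , j') = (i' , suc j') ≼ (i , j)

  Crossed : ℕ → ℕ → ℕ → ℕ → Set
  Crossed i j c d = Σ ℕ λ i' → Σ ℕ λ j' → In n i' × In n j' × Earlier i j (i' , j') × (CrossOf i' j' c d × R c d)

  later : ∀ {i j c d} → Crossed i j c d → Crossed i (suc j) c d
  later (i' , j' , p , q , lower x , r) = i' , j' , p , q , lower x , r
  later (i' , j' , p , q , same x , r) = i' , j' , p , q , same (m≤n⇒m≤1+n x) , r

  -- Going back cell by cell, the order of the two pipes persists until a cross has produced it or
  -- the bottom is reached, where it is numerical. `k` counts the rows below row `i`.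
  history : ∀ k i j {c d} → k + i ≡ n → 1 ≤ i → j ≤ n → 0 < c → 0 < d → Before i (suc j) c d →
    c < d ⊎ Crossed i (suc j) c d ⊎ Crossed i (suc j) d c
  history zero .n zero refl 1≤i _ 0<c 0<d b = inj₁ (baseOrder 1≤i 0<c 0<d b)
  history (suc k) i zero e 1≤i _ 0<c 0<d b =
    Sum.map₂ (Sum.map up up) (history k (suc i) n (trans (+-suc k i) e) (s≤s z≤n) ≤-refl 0<c 0<d
      (rowBack (1≤i , ≤-trans (m≤n+m i (suc k)) (≤-reflexive e)) 0<c 0<d b))
    where
    up : ∀ {c d} → Crossed (suc i) (suc n) c d → Crossed i 1 c d
    up (i' , j' , p , q , lower x , r) = i' , j' , p , q , lower (<⇒≤ x) , r
    up (i' , j' , p , q , same x , r) = i' , j' , p , q , lower ≤-refl , r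
  history k i (suc j) {c} {d} e 1≤i j<n 0<c 0<d b =
    [ (λ b' → Sum.map₂ (Sum.map later later) (history k i j e 1≤i (<⇒≤ j<n) 0<c 0<d b'))
    , (λ x → inj₂ (inj₂ (i , suc j , pi , (s≤s z≤n , j<n) , same ≤-refl , x))) ]′
    (Step.stepBack i (suc j) pi (s≤s z≤n , j<n) 0<c 0<d b)
    where
    pi : In n i
    pi = 1≤i , ≤-trans (m≤n+m i k) (≤-reflexive e)

  -- A repeated label could be traced back to two positions on the bottom. A cross offers no escape:
  -- its west and south edge would again be two positions with this label.
  noTwice : ∀ k i j {c} → k + i ≡ n → 1 ≤ i → j ≤ n → 0 < c → Before i (suc j) c c → ⊥
  noTwice zero .n zero refl 1≤i _ 0<c b = <-irrefl refl (baseOrder 1≤i 0<c 0<c b)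
  noTwice (suc k) i zero e 1≤i _ 0<c b =
    noTwice k (suc i) n (trans (+-suc k i) e) (s≤s z≤n) ≤-refl 0<c
      (rowBack (1≤i , ≤-trans (m≤n+m i (suc k)) (≤-reflexive e)) 0<c 0<c b)
  noTwice k i (suc j) {c} e 1≤i j<n 0<c b =
    noTwice k i j e 1≤i (<⇒≤ j<n) 0<c
      ([ id , (λ { ((_ , p , q) , _) → _ , _ , n<1+n _ , subst (At i (suc j) (suc j)) p cur ,
                     subst (At i (suc j) (suc (suc j))) q (new ≤-refl j<n) }) ]′
       (Step.stepBack i (suc j) (1≤i , ≤-trans (m≤n+m i k) (≤-reflexive e)) (s≤s z≤n , j<n) 0<c 0<c b))

  unique : ∀ i j {c m m'} → In n i → 1 ≤ j → j ≤ suc n → 0 < c → At i j m c → At i j m' c → m ≡ m'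
  unique i (suc j) {c} {m} {m'} (1≤i , i≤n) 1≤j (s≤s j≤) 0<c a b with <-cmp m m'
  ... | tri< lt _ _ = ⊥-elim (noTwice (n ∸ i) i j (m∸n+n≡m i≤n) 1≤i j≤ 0<c (_ , _ , lt , a , b))
  ... | tri≈ _ p _ = p
  ... | tri> _ _ gt = ⊥-elim (noTwice (n ∸ i) i j (m∸n+n≡m i≤n) 1≤i j≤ 0<c (_ , _ , gt , b , a))

  asym : ∀ i j {c d} → In n i → 1 ≤ j → j ≤ suc n → 0 < c → 0 < d → Before i j c d → Before i j d c → ⊥
  asym i j pi 1≤j j≤ 0<c 0<d (m , m' , lt , a , b) (k , k' , lt' , a' , b')
    with unique i j pi 1≤j j≤ 0<c a b' | unique i j pi 1≤j j≤ 0<d b a'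
  ... | refl | refl = <-asym lt lt'

  -- After the whole scan the exits fill the positions after `n`, from the top row downwards; so an
  -- exit further up is earlier on the cut.
  exitAt : ∀ r → In n r → Σ ℕ λ m → m ≡ n + r × At 1 (suc n) m (h r (suc n))
  exitAt (suc zero) p = suc n , +-comm 1 n , cur
  exitAt (suc (suc d)) p = suc n + suc d , sym (+-suc n (suc d)) ,
    subst (λ z → At 1 (suc n) (suc n + suc d) (h z (suc n))) (+-comm (suc d) 1) (out (suc d) (s≤s z≤n) (subst (_≤ n) (+-comm 1 (suc d)) (proj₂ p)))

  exitBefore : ∀ r r' → In n r → In n r' → r < r' → Before 1 (suc n) (h r (suc n)) (h r' (suc n))
  exitBefore r r' p p' lt with exitAt r p | exitAt r' p'
  ... | _ , refl , a | _ , refl , b = _ , _ , +-monoʳ-< n lt , a , b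

  exitUnique : ∀ r r' → In n r → In n r' → h r (suc n) ≡ h r' (suc n) → r ≡ r'
  exitUnique r r' p p' e with exitAt r p | exitAt r' p'
  ... | _ , refl , a | _ , refl , b = +-cancelˡ-≡ n r r' (unique 1 (suc n) (≤-refl , ≤-trans (proj₁ p) (proj₂ p)) (s≤s z≤n) ≤-refl (right r p) a (subst (At _ _ _) (sym e) b))

module Order {n T h v} (L : Lab _<_ n T h v) where
  open Lab L
  open Cuts L

  -- A cross producing this order would have the larger pipe travelling east, which `_<_` forbids.
  -- Hence in a reduced tiling a reversed pair is never put back into numerical order.
  stepBack< : ∀ i j {c c'} → In n i → In n j → 0 < c → c < c' → Before i (suc j) c c' → Before i j c c'
  stepBack< i j pi pj 0<c lt b with Step.stepBack i j pi pj 0<c (<-trans 0<c lt) b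
  ... | inj₁ b' = b'
  ... | inj₂ (_ , r) = ⊥-elim (<-asym lt r)

  backInRow : ∀ e i j {c c'} → In n i → e + j ≤ n → 0 < c → c < c' → Before i (suc (e + j)) c c' → Before i (suc j) c c'
  backInRow zero i j pi le 0<c lt b = b
  backInRow (suc e) i j pi le 0<c lt b = backInRow e i j pi (<⇒≤ le) 0<c lt (stepBack< i (suc (e + j)) pi (s≤s z≤n , le) 0<c lt b)

  backRows : ∀ d i j {c c'} → 1 ≤ i → suc d + i ≤ n → j ≤ n → 0 < c → c < c' → Before i (suc j) c c' → Before (suc d + i) (suc n) c c'
  backRows d i j 1≤i le j≤ 0<c lt b = go d le r
    where
    pi : In n i
    pi = 1≤i , ≤-trans (m≤n+m i (suc d)) le
    r : Before (suc i) (suc n) _ _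
    r = rowBack pi 0<c (<-trans 0<c lt) (backInRow j i 0 pi (≤-trans (≤-reflexive (+-identityʳ j)) j≤) 0<c lt
          (subst (λ z → Before i (suc z) _ _) (sym (+-identityʳ j)) b))
    go : ∀ d → suc d + i ≤ n → Before (suc i) (suc n) _ _ → Before (suc d + i) (suc n) _ _
    go zero le r = r
    go (suc d) le r = rowBack pd 0<c (<-trans 0<c lt) (backInRow n (suc d + i) 0 pd (≤-reflexive (+-identityʳ n)) 0<c lt
          (subst (λ z → Before (suc d + i) (suc z) _ _) (sym (+-identityʳ n)) (go d (<⇒≤ le) r)))
      where
      pd : In n (suc d + i)
      pd = s≤s z≤n , <⇒≤ le

  back : ∀ i j i' j' {c c'} → In n i → In n i' → 1 ≤ j → j ≤ suc n → 1 ≤ j' → j' ≤ suc n →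
    (i' , j') ≼ (i , j) → 0 < c → c < c' → Before i j c c' → Before i' j' c c'
  back i (suc j) i' (suc j') {c} {c'} pi pi' 1≤j (s≤s j≤) 1≤j' (s≤s j'≤) (lower x) 0<c lt b =
    backInRow (n ∸ j') i' j' pi' (≤-reflexive (m∸n+n≡m j'≤)) 0<c lt
      (subst₂ (λ y z → Before y (suc z) c c') e (sym (m∸n+n≡m j'≤))
        (backRows (i' ∸ suc i) i j (proj₁ pi) (≤-trans (≤-reflexive e) (proj₂ pi')) j≤ 0<c lt b))
    where
    e : suc (i' ∸ suc i) + i ≡ i'
    e = trans (sym (+-suc (i' ∸ suc i) i)) (m∸n+n≡m x)
  back i (suc j) i' (suc j') pi pi' 1≤j (s≤s j≤) 1≤j' j'≤ (same (s≤s x)) 0<c lt b =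
    backInRow (j ∸ j') i j' pi (≤-trans (≤-reflexive (m∸n+n≡m x)) j≤) 0<c lt
      (subst (λ z → Before i (suc z) _ _) (sym (m∸n+n≡m x)) b)

  enter : ∀ i j → In n i → In n j → Before i j (h i j) (v (suc i) j)
  enter i j pi pj = j , suc j , ≤-refl , cur , new ≤-refl (proj₂ pj)

  leave : ∀ i j → In n i → In n j → Before i (suc j) (v i j) (h i (suc j))
  leave i j pi pj = j , suc j , ≤-refl , old (proj₁ pj) ≤-refl , cur

  crossLeave : ∀ i j {c d} → In n i → In n j → CrossOf i j c d → Before i (suc j) d c
  crossLeave i j pi pj (x , refl , refl) with crossEqs (loc i j pi pj) x
  ... | p , q , _ = subst₂ (Before i (suc j)) q p (leave i j pi pj)

  crossEnter : ∀ i j {c d} → In n i → In n j → CrossOf i j c d → (Before i j c d) × 0 < c × 0 < d × c < d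
  crossEnter i j pi pj (x , refl , refl) with crossEqs (loc i j pi pj) x
  ... | _ , _ , a , b , r = enter i j pi pj , a , b , r

  -- The pair enters the later cross in numerical order and therefore has this order on all earlier
  -- cuts, but the earlier cross leaves it reversed.
  crossOnce : ∀ i j i' j' {c d} → In n i → In n j → In n i' → In n j' → CrossOf i j c d → CrossOf i' j' c d → (i , suc j) ≼ (i' , j') → ⊥
  crossOnce i j i' j' pi pj pi' pj' x y o with crossEnter i' j' pi' pj' y
  ... | b , 0<c , 0<d , lt = asym i (suc j) pi (s≤s z≤n) (s≤s (proj₂ pj)) 0<c 0<d
     (back i' j' i (suc j) pi' pi (proj₁ pj') (m≤n⇒m≤1+n (proj₂ pj')) (s≤s z≤n) (s≤s (proj₂ pj)) o 0<c lt b) (crossLeave i j pi pj x)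

  crossUnique : ∀ i j i' j' {c d} → In n i → In n j → In n i' → In n j' → CrossOf i j c d → CrossOf i' j' c d → i ≡ i' × j ≡ j'
  crossUnique i j i' j' pi pj pi' pj' x y with ≼-total i j i' j'
  ... | inj₁ o = ⊥-elim (crossOnce i j i' j' pi pj pi' pj' x y o)
  ... | inj₂ (inj₁ o) = ⊥-elim (crossOnce i' j' i j pi' pj' pi pj y x o)
  ... | inj₂ (inj₂ e) = e

-- Crossings and inversions

b2n : Bool → ℕ
b2n true = 1
b2n false = 0

count-∷ : ∀ {A : Set} (p : A → Bool) x xs → countᵇ p (x ∷ xs) ≡ b2n (p x) + countᵇ p xs
count-∷ p x xs with p x
... | true = refl
... | false = refl

sumTo : (ℕ → ℕ) → ℕ → ℕ
sumTo f zero = 0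
sumTo f (suc m) = f 0 + sumTo (f ∘ suc) m

count-applyUpTo : ∀ (p : ℕ → Bool) (f : ℕ → ℕ) m → countᵇ p (applyUpTo f m) ≡ sumTo (b2n ∘ p ∘ f) m
count-applyUpTo p f zero = refl
count-applyUpTo p f (suc m) = trans (count-∷ p (f 0) _) (cong (b2n (p (f 0)) +_) (count-applyUpTo p (f ∘ suc) m))

sumTo-cong : ∀ {f g} m → (∀ j → j < m → f j ≡ g j) → sumTo f m ≡ sumTo g m
sumTo-cong zero e = refl
sumTo-cong (suc m) e = cong₂ _+_ (e 0 (s≤s z≤n)) (sumTo-cong m (λ j lt → e (suc j) (s≤s lt)))

interchange : ∀ a b c d → (a + b) + (c + d) ≡ (a + c) + (b + d)
interchange = solve 4 (λ a b c d → (a :+ b) :+ (c :+ d) := (a :+ c) :+ (b :+ d)) refl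

sumTo-+ : ∀ f g m → sumTo f m + sumTo g m ≡ sumTo (λ j → f j + g j) m
sumTo-+ f g zero = refl
sumTo-+ f g (suc m) = trans (interchange (f 0) _ (g 0) _) (cong (f 0 + g 0 +_) (sumTo-+ (f ∘ suc) (g ∘ suc) m))

sumTo-zero : ∀ f m → sumTo f m ≡ 0 → ∀ j → j < m → f j ≡ 0
sumTo-zero f (suc m) e zero _ = m+n≡0⇒m≡0 (f 0) e
sumTo-zero f (suc m) e (suc j) (s≤s lt) = sumTo-zero (f ∘ suc) m (m+n≡0⇒n≡0 (f 0) e) j lt

sumTo-zeros : ∀ f m → (∀ j → j < m → f j ≡ 0) → sumTo f m ≡ 0
sumTo-zeros f zero e = refl
sumTo-zeros f (suc m) e = cong₂ _+_ (e 0 (s≤s z≤n)) (sumTo-zeros (f ∘ suc) m (λ j lt → e (suc j) (s≤s lt)))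

sumTo-update : ∀ f f' m b → b < m → (∀ j → j < m → j ≢ b → f j ≡ f' j) → sumTo f' m + f b ≡ sumTo f m + f' b
sumTo-update f f' (suc m) zero lt e =
  trans (cong (λ z → f' 0 + z + f 0) (sym (sumTo-cong m (λ j j< → e (suc j) (s≤s j<) (λ ())))))
        (solve 3 (λ a b c → a :+ b :+ c := c :+ b :+ a) refl (f' 0) (sumTo (f ∘ suc) m) (f 0))
sumTo-update f f' (suc m) (suc b) (s≤s lt) e =
  trans (+-assoc (f' 0) _ _) (trans (cong₂ _+_ (sym (e 0 (s≤s z≤n) (λ ()))) (sumTo-update (f ∘ suc) (f' ∘ suc) m b lt (λ j j< ne → e (suc j) (s≤s j<) (ne ∘ suc-injective))))
        (sym (+-assoc (f 0) _ _)))

rowSum : (ℕ → ℕ → ℕ) → ℕ → ℕ → ℕ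
rowSum f n i = sumTo (λ j → f i (suc j)) n

gridSum : (ℕ → ℕ → ℕ) → ℕ → ℕ
gridSum f n = sumTo (λ i → rowSum f n (suc i)) n

gridSum-+ : ∀ f g n → gridSum f n + gridSum g n ≡ gridSum (λ i j → f i j + g i j) n
gridSum-+ f g n = trans (sumTo-+ _ _ n) (sumTo-cong n (λ i _ → sumTo-+ _ _ n))

gridSum-cong : ∀ {f g} n → (∀ i j → In n i → In n j → f i j ≡ g i j) → gridSum f n ≡ gridSum g n
gridSum-cong n e = sumTo-cong n (λ i i< → sumTo-cong n (λ j j< → e (suc i) (suc j) (s≤s z≤n , i<) (s≤s z≤n , j<)))

gridSum-zero : ∀ f n → gridSum f n ≡ 0 → ∀ i j → In n i → In n j → f i j ≡ 0
gridSum-zero f n e (suc i) (suc j) (_ , i<) (_ , j<) = sumTo-zero _ n (sumTo-zero _ n e i i<) j j<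

gridSum-zeros : ∀ f n → (∀ i j → In n i → In n j → f i j ≡ 0) → gridSum f n ≡ 0
gridSum-zeros f n e = sumTo-zeros _ n (λ i i< → sumTo-zeros _ n (λ j j< → e (suc i) (suc j) (s≤s z≤n , i<) (s≤s z≤n , j<)))

gridSum-update : ∀ f f' n a b → In n a → In n b →
  (∀ i j → In n i → In n j → ¬ (i ≡ a × j ≡ b) → f i j ≡ f' i j) → gridSum f' n + f a b ≡ gridSum f n + f' a b
gridSum-update f f' n (suc a) (suc b) (_ , a<) (_ , b<) e =
  +-cancelʳ-≡ (rowSum f n (suc a)) _ _ (trans (solve 3 (λ x y z → x :+ y :+ z := (x :+ z) :+ y) refl (gridSum f' n) (f (suc a) (suc b)) (rowSum f n (suc a)))
   (trans (cong (_+ f (suc a) (suc b)) (sumTo-update _ _ n a a< (λ i i< ne → sumTo-cong n (λ j j< → e (suc i) (suc j) (s≤s z≤n , i<) (s≤s z≤n , j<) (ne ∘ suc-injective ∘ proj₁)))))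
   (trans (+-assoc (gridSum f n) _ _) (trans (cong (gridSum f n +_) (sumTo-update _ _ n b b< (λ j j< ne → e (suc a) (suc j) (s≤s z≤n , a<) (s≤s z≤n , j<) (ne ∘ suc-injective ∘ proj₂))))
   (solve 3 (λ x y z → x :+ (y :+ z) := x :+ z :+ y) refl (gridSum f n) (rowSum f n (suc a)) (f' (suc a) (suc b)))))))

-- inversions of a list, 0 marking an absent entry
smaller : ℕ → ℕ → Bool
smaller x y = (y <ᵇ x) ∧ (0 <ᵇ y)

invz : List ℕ → ℕ
invz [] = 0
invz (x ∷ xs) = countᵇ (smaller x) xs + invz xs

ascends descends : Tile → ℕ → ℕ → ℕ
ascends t w s = b2n (isTile cross t ∧ (w <ᵇ s))
descends t w s = b2n (isTile cross t ∧ not (w <ᵇ s))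

<ᵇ-true : ∀ {a b} → a < b → (a <ᵇ b) ≡ true
<ᵇ-true {zero} {suc b} (s≤s z≤n) = refl
<ᵇ-true {suc a} {suc b} (s≤s p) = <ᵇ-true p

<ᵇ-false : ∀ {a b} → b ≤ a → (a <ᵇ b) ≡ false
<ᵇ-false {zero} {zero} _ = refl
<ᵇ-false {suc a} {zero} _ = refl
<ᵇ-false {suc a} {suc b} (s≤s p) = <ᵇ-false p

swapInv : ∀ w s R → 0 < w → 0 < s → w ≢ s → invz (s ∷ w ∷ R) + b2n (not (w <ᵇ s)) ≡ invz (w ∷ s ∷ R) + b2n (w <ᵇ s)
swapInv (suc w) (suc s) R _ _ ne
  rewrite count-∷ (smaller (suc s)) (suc w) R | count-∷ (smaller (suc w)) (suc s) R with <-cmp w s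
... | tri< lt _ _ rewrite <ᵇ-true lt | <ᵇ-false (<⇒≤ lt) =
  solve 3 (λ a b c → con 1 :+ a :+ (b :+ c) :+ con 0 := (b :+ (a :+ c)) :+ con 1) refl (countᵇ (smaller (suc s)) R) (countᵇ (smaller (suc w)) R) (invz R)
... | tri≈ _ e _ = ⊥-elim (ne (cong suc e))
... | tri> _ _ gt rewrite <ᵇ-true gt | <ᵇ-false (<⇒≤ gt) =
  solve 3 (λ a b c → a :+ (b :+ c) :+ con 1 := (con 1 :+ b :+ (a :+ c)) :+ con 0) refl (countᵇ (smaller (suc s)) R) (countᵇ (smaller (suc w)) R) (invz R)

swapZero : ∀ w R → invz (0 ∷ w ∷ R) ≡ invz (w ∷ 0 ∷ R)
swapZero w R rewrite count-∷ (smaller 0) w R | count-∷ (smaller w) 0 R with w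
... | zero = refl
... | suc w = solve 3 (λ a b c → a :+ (b :+ c) := b :+ (a :+ c)) refl (countᵇ (smaller 0) R) (countᵇ (smaller (suc w)) R) (invz R)

-- Only a cross exchanges two neighbouring pipes, which gains or loses one inversion. A 0 takes part
-- in no inversion, so moving it past a pipe is free.
cellInv : ∀ {t w e n s} R → Loc _≢_ t w e n s → invz (n ∷ e ∷ R) + descends t w s ≡ invz (w ∷ s ∷ R) + ascends t w s
cellInv R blankˡ = refl
cellInv R (horˡ {w} _) = cong (_+ 0) (swapZero w R)
cellInv R (verˡ {s} _) = cong (_+ 0) (sym (swapZero s R))
cellInv R (crossˡ x y ne) = swapInv _ _ R x y ne
cellInv R (relbowˡ _) = refl
cellInv R (jelbowˡ _) = refl
cellInv R (bumpˡ _ _) = refl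

countSwap : ∀ (p : ℕ → Bool) s w R → countᵇ p (s ∷ w ∷ R) ≡ countᵇ p (w ∷ s ∷ R)
countSwap p s w R rewrite count-∷ p s (w ∷ R) | count-∷ p w R | count-∷ p w (s ∷ R) | count-∷ p s R =
  solve 3 (λ a b c → a :+ (b :+ c) := b :+ (a :+ c)) refl (b2n (p s)) (b2n (p w)) (countᵇ p R)

cellCount : ∀ {P t w e n s} (p : ℕ → Bool) R → Loc P t w e n s → countᵇ p (n ∷ e ∷ R) ≡ countᵇ p (w ∷ s ∷ R)
cellCount {w = w} {e} {n} {s} p R l with transfer l
... | keep refl refl = refl
... | flipW refl refl _ = countSwap p s w R
... | flipS refl refl _ = countSwap p s w R
... | flipX refl refl _ _ = countSwap p s w R

-- For `rowInv`: the inversions of an entry with the entries behind it depend on these only as a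
-- multiset, and scanning the rest of the row preserves the multiset.
rowCount : ∀ {P} p m (t : ℕ → Tile) (hh vn vs : ℕ → ℕ) X → (∀ j → j < m → Loc P (t j) (hh j) (hh (suc j)) (vn j) (vs j)) →
  countᵇ p (applyUpTo vn m ++ hh m ∷ X) ≡ countᵇ p (hh 0 ∷ applyUpTo vs m ++ X)
rowCount p zero t hh vn vs X l = refl
rowCount p (suc m) t hh vn vs X l = calc
  countᵇ p (vn 0 ∷ applyUpTo (vn ∘ suc) m ++ hh (suc m) ∷ X)
    ≡⟨ count-∷ p (vn 0) _ ⟩
  b2n (p (vn 0)) + countᵇ p (applyUpTo (vn ∘ suc) m ++ hh (suc m) ∷ X)
    ≡⟨ cong (b2n (p (vn 0)) +_) (rowCount p m (t ∘ suc) (hh ∘ suc) (vn ∘ suc) (vs ∘ suc) X (λ j lt → l (suc j) (s≤s lt))) ⟩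
  b2n (p (vn 0)) + countᵇ p (hh 1 ∷ applyUpTo (vs ∘ suc) m ++ X)
    ≡⟨ sym (count-∷ p (vn 0) _) ⟩
  countᵇ p (vn 0 ∷ hh 1 ∷ applyUpTo (vs ∘ suc) m ++ X)
    ≡⟨ cellCount p _ (l 0 (s≤s z≤n)) ⟩
  countᵇ p (hh 0 ∷ vs 0 ∷ applyUpTo (vs ∘ suc) m ++ X) ∎
  where open ≡-Reasoning renaming (begin_ to calc_)

rowInv : ∀ m (t : ℕ → Tile) (hh vn vs : ℕ → ℕ) X → (∀ j → j < m → Loc _≢_ (t j) (hh j) (hh (suc j)) (vn j) (vs j)) →
  invz (applyUpTo vn m ++ hh m ∷ X) + sumTo (λ j → descends (t j) (hh j) (vs j)) m
    ≡ invz (hh 0 ∷ applyUpTo vs m ++ X) + sumTo (λ j → ascends (t j) (hh j) (vs j)) m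
rowInv zero t hh vn vs X l = refl
rowInv (suc m) t hh vn vs X l = calc
  countᵇ (smaller (vn 0)) OUT + invz OUT + (d0 + ds)
    ≡⟨ cong (λ z → z + invz OUT + (d0 + ds)) (rowCount _ m (t ∘ suc) (hh ∘ suc) (vn ∘ suc) (vs ∘ suc) X l') ⟩
  c + invz OUT + (d0 + ds)
    ≡⟨ solve 4 (λ c o d e → c :+ o :+ (d :+ e) := c :+ (o :+ e) :+ d) refl c (invz OUT) d0 ds ⟩
  c + (invz OUT + ds) + d0
    ≡⟨ cong (λ z → c + z + d0) (rowInv m (t ∘ suc) (hh ∘ suc) (vn ∘ suc) (vs ∘ suc) X l') ⟩
  c + (invz IN + as) + d0
    ≡⟨ solve 4 (λ c o d e → c :+ (o :+ e) :+ d := c :+ o :+ d :+ e) refl c (invz IN) d0 as ⟩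
  c + invz IN + d0 + as
    ≡⟨ cong (_+ as) (cellInv _ (l 0 (s≤s z≤n))) ⟩
  invz (hh 0 ∷ applyUpTo vs (suc m) ++ X) + a0 + as
    ≡⟨ +-assoc (invz (hh 0 ∷ applyUpTo vs (suc m) ++ X)) a0 as ⟩
  invz (hh 0 ∷ applyUpTo vs (suc m) ++ X) + (a0 + as) ∎
  where
  open ≡-Reasoning renaming (begin_ to calc_)
  OUT IN : List ℕ
  OUT = applyUpTo (vn ∘ suc) m ++ hh (suc m) ∷ X
  IN = hh 1 ∷ applyUpTo (vs ∘ suc) m ++ X
  c = countᵇ (smaller (vn 0)) IN
  d0 = descends (t 0) (hh 0) (vs 0)
  a0 = ascends (t 0) (hh 0) (vs 0)
  ds = sumTo (λ j → descends (t (suc j)) (hh (suc j)) (vs (suc j))) m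
  as = sumTo (λ j → ascends (t (suc j)) (hh (suc j)) (vs (suc j))) m
  l' : ∀ j → j < m → Loc _≢_ (t (suc j)) (hh (suc j)) (hh (suc (suc j))) (vn (suc j)) (vs (suc j))
  l' j lt = l (suc j) (s≤s lt)

count-none : ∀ {A : Set} (p : A → Bool) xs → (∀ x → p x ≡ false) → countᵇ p xs ≡ 0
count-none p [] e = refl
count-none p (x ∷ xs) e = trans (count-∷ p x xs) (cong₂ _+_ (cong b2n (e x)) (count-none p xs e))

invz-0∷ : ∀ X → invz (0 ∷ X) ≡ invz X
invz-0∷ X = cong (_+ invz X) (count-none (smaller 0) X (λ _ → refl))

invz-zeros : ∀ m (f : ℕ → ℕ) X → (∀ j → j < m → f j ≡ 0) → invz (applyUpTo f m ++ X) ≡ invz X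
invz-zeros zero f X e = refl
invz-zeros (suc m) f X e rewrite e 0 (s≤s z≤n) = trans (invz-0∷ (applyUpTo (f ∘ suc) m ++ X)) (invz-zeros m (f ∘ suc) X (λ j lt → e (suc j) (s≤s lt)))

count-all-none : ∀ (p : ℕ → Bool) (f : ℕ → ℕ) m → (∀ j → j < m → p (f j) ≡ false) → countᵇ p (applyUpTo f m) ≡ 0
count-all-none p f m e = trans (count-applyUpTo p f m) (sumTo-zeros _ m (λ j lt → cong b2n (e j lt)))

invz-increasing : ∀ m (f : ℕ → ℕ) → (∀ i j → i ≤ j → j < m → f i ≤ f j) → invz (applyUpTo f m) ≡ 0
invz-increasing zero f e = refl
invz-increasing (suc m) f e =
  cong₂ _+_ (count-all-none (smaller (f 0)) (f ∘ suc) m (λ j lt → cong (_∧ (0 <ᵇ f (suc j))) (<ᵇ-false (e 0 (suc j) z≤n (s≤s lt)))))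
    (invz-increasing m (f ∘ suc) (λ i j le lt → e (suc i) (suc j) (s≤s le) (s≤s lt)))

exitList : (ℕ → ℕ → ℕ) → ℕ → ℕ → ℕ → List ℕ
exitList h n i zero = []
exitList h n i (suc k) = h (suc i) (suc n) ∷ exitList h n (suc i) k

module Count {n T h v} (L : Lab _≢_ n T h v) where
  open Lab L

  asc desc : ℕ → ℕ → ℕ
  asc i j = ascends (T i j) (h i j) (v (suc i) j)
  desc i j = descends (T i j) (h i j) (v (suc i) j)

  rowsFrom : (ℕ → ℕ → ℕ) → ℕ → ℕ → ℕ
  rowsFrom f i zero = 0
  rowsFrom f i (suc k) = rowSum f n (suc i) + rowsFrom f (suc i) k

  -- With `k + i ≡ n` this is the boundary once the `k` lowest rows have been scanned.
  line : ℕ → ℕ → List ℕ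
  line i k = applyUpTo (λ j → v (suc i) (suc j)) n ++ exitList h n i k

  rowStep : ∀ i X → In n i → invz (applyUpTo (λ j → v i (suc j)) n ++ h i (suc n) ∷ X) + rowSum desc n i
    ≡ invz (applyUpTo (λ j → v (suc i) (suc j)) n ++ X) + rowSum asc n i
  rowStep i X pi = trans (rowInv n (λ j → T i (suc j)) (λ j → h i (suc j)) (λ j → v i (suc j)) (λ j → v (suc i) (suc j)) X
                          (λ j lt → loc i (suc j) pi (s≤s z≤n , lt)))
                   (cong (_+ rowSum asc n i) (trans (cong (λ z → invz (z ∷ S)) (left i pi)) (invz-0∷ S)))
    where S = applyUpTo (λ j → v (suc i) (suc j)) n ++ X

  lineInv : ∀ k i → k + i ≡ n → invz (line i k) + rowsFrom desc i k ≡ rowsFrom asc i k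
  lineInv zero i refl = trans (+-identityʳ _) (trans (cong invz (++[] (applyUpTo (λ j → v (suc n) (suc j)) n)))
    (invz-increasing n _ (λ a b le lt → subst₂ _≤_ (sym (bot (suc a) (s≤s z≤n , ≤-<-trans le lt))) (sym (bot (suc b) (s≤s z≤n , lt))) (s≤s le))))
    where
    ++[] : ∀ (xs : List ℕ) → xs ++ [] ≡ xs
    ++[] [] = refl
    ++[] (x ∷ xs) = cong (x ∷_) (++[] xs)
  lineInv (suc k) i e = calc
    invz (line i (suc k)) + (rowSum desc n (suc i) + D)
      ≡⟨ sym (+-assoc (invz (line i (suc k))) _ D) ⟩
    invz (line i (suc k)) + rowSum desc n (suc i) + D
      ≡⟨ cong (_+ D) (rowStep (suc i) (exitList h n (suc i) k) (s≤s z≤n , ≤-trans (s≤s (m≤n+m i k)) (≤-reflexive e))) ⟩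
    invz (line (suc i) k) + rowSum asc n (suc i) + D
      ≡⟨ solve 3 (λ a b c → a :+ b :+ c := b :+ (a :+ c)) refl (invz (line (suc i) k)) (rowSum asc n (suc i)) D ⟩
    rowSum asc n (suc i) + (invz (line (suc i) k) + D)
      ≡⟨ cong (rowSum asc n (suc i) +_) (lineInv k (suc i) (trans (+-suc k i) e)) ⟩
    rowSum asc n (suc i) + rowsFrom asc (suc i) k ∎
    where
    open ≡-Reasoning renaming (begin_ to calc_)
    D = rowsFrom desc (suc i) k

  rowsFrom-sum : ∀ f i k → rowsFrom f i k ≡ sumTo (λ r → rowSum f n (suc (i + r))) k
  rowsFrom-sum f i zero = refl
  rowsFrom-sum f i (suc k) = cong₂ _+_ (cong (λ z → rowSum f n (suc z)) (sym (+-identityʳ i)))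
    (trans (rowsFrom-sum f (suc i) k) (sumTo-cong k (λ r _ → cong (λ z → rowSum f n (suc z)) (sym (+-suc i r)))))

  invz-inversions : ∀ i k → k + i ≤ n → invz (exitList h n i k) ≡ inversions (exitList h n i k)
  invz-inversions i zero le = refl
  invz-inversions i (suc k) le = cong₂ _+_ (same-count (h (suc i) (suc n)) (suc i) k (≤-trans (≤-reflexive (+-suc k i)) le))
      (invz-inversions (suc i) k (≤-trans (≤-reflexive (+-suc k i)) le))
    where
    same-count : ∀ x i k → k + i ≤ n → countᵇ (smaller x) (exitList h n i k) ≡ countᵇ (λ y → y <ᵇ x) (exitList h n i k)
    same-count x i zero le = refl
    same-count x i (suc k) le rewrite count-∷ (smaller x) (h (suc i) (suc n)) (exitList h n (suc i) k)
                                | count-∷ (λ y → y <ᵇ x) (h (suc i) (suc n)) (exitList h n (suc i) k)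
      = cong₂ _+_ (cong b2n (trans (cong ((h (suc i) (suc n) <ᵇ x) ∧_) (<ᵇ-true (right (suc i) (s≤s z≤n , ≤-trans (s≤s (m≤n+m i k)) le)))) (∧-true _)))
                  (same-count x (suc i) k (≤-trans (≤-reflexive (+-suc k i)) le))
      where
      ∧-true : ∀ b → b ∧ true ≡ b
      ∧-true true = refl
      ∧-true false = refl

  -- No pipe leaves through the top, so after the last row only the exits remain on the boundary;
  -- and the bottom line, being increasing, starts the count at 0.
  countTheorem : inversions (exitList h n 0 n) + gridSum desc n ≡ gridSum asc n
  countTheorem = trans (cong₂ _+_ (trans (sym (invz-inversions 0 n (≤-reflexive (+-identityʳ n))))
                     (sym (invz-zeros n (λ j → v 1 (suc j)) (exitList h n 0 n) (λ j lt → top (suc j) (s≤s z≤n , lt))))) (sym (rowsFrom-sum desc 0 n)))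
                 (trans (lineInv n 0 (+-identityʳ n)) (rowsFrom-sum asc 0 n))

-- West and south edge of a cell are two positions on one cut, so they carry different pipes.
distinct : ∀ {R n T h v} → Lab R n T h v → Lab _≢_ n T h v
distinct {R} {n} {T} {h} {v} L = record { loc = λ i j pi pj → strengthen (loc i j pi pj) (ne i j pi pj) ; left = left ; top = top ; bot = bot ; right = right }
  where
  open Lab L
  open Cuts L
  strengthen : ∀ {t w e n s} → Loc R t w e n s → (0 < w → w ≢ s) → Loc _≢_ t w e n s
  strengthen blankˡ _ = blankˡ
  strengthen (horˡ x) _ = horˡ x
  strengthen (verˡ x) _ = verˡ x
  strengthen (crossˡ x y _) ne = crossˡ x y (ne x)
  strengthen (relbowˡ x) _ = relbowˡ x
  strengthen (jelbowˡ x) _ = jelbowˡ x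
  strengthen (bumpˡ x y) _ = bumpˡ x y
  ne : ∀ i j → In n i → In n j → 0 < h i j → h i j ≢ v (suc i) j
  ne i j pi pj 0<w e = 1+n≢n (sym (unique i j pi (proj₁ pj) (m≤n⇒m≤1+n (proj₂ pj)) 0<w cur
    (subst (At i j (suc j)) (sym e) (new ≤-refl (proj₂ pj)))))

isCross : (ℕ → ℕ → Tile) → ℕ → ℕ → ℕ
isCross T i j = b2n (isTile cross (T i j))

crossings : (ℕ → ℕ → Tile) → ℕ → ℕ
crossings T n = gridSum (isCross T) n

asc+desc : ∀ t w s → ascends t w s + descends t w s ≡ b2n (isTile cross t)
asc+desc t w s with isTile cross t | w <ᵇ s
... | true | true = refl
... | true | false = refl
... | false | _ = refl

module _ {R n T h v} (L : Lab R n T h v) where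
  private
    open module C' = Count (distinct L)

    total : gridSum asc n + gridSum desc n ≡ crossings T n
    total = trans (gridSum-+ asc desc n) (gridSum-cong {f = λ i j → asc i j + desc i j} n (λ i j _ _ → asc+desc (T i j) (h i j) (v (suc i) j)))

  -- Inversions are the ascending crosses minus the descending ones, `crossings` is the sum of both;
  -- equality forces twice the number of descending crosses to vanish.
  crossings-reduced : inversions (exitList h n 0 n) ≡ crossings T n → Lab _<_ n T h v
  crossings-reduced e = record { loc = λ i j pi pj → up (loc i j pi pj) (gridSum-zero desc n d0 i j pi pj) ; left = left ; top = top ; bot = bot ; right = right }
    where
    open Lab (distinct L)
    inv = inversions (exitList h n 0 n)
    D = gridSum desc n
    d0 : D ≡ 0
    d0 = m+n≡0⇒m≡0 D (+-cancelˡ-≡ inv (D + D) 0 (trans (sym (+-assoc inv D D)) (trans (cong (_+ D) countTheorem) (trans total (trans (sym e) (sym (+-identityʳ inv)))))))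
    up : ∀ {t w e n s} → Loc _≢_ t w e n s → descends t w s ≡ 0 → Loc _<_ t w e n s
    up blankˡ _ = blankˡ
    up (horˡ x) _ = horˡ x
    up (verˡ x) _ = verˡ x
    up (crossˡ {w} {s} x y _) d with w <? s
    ... | yes lt = crossˡ x y lt
    ... | no ge rewrite <ᵇ-false (≮⇒≥ ge) with d
    ...   | ()
    up (relbowˡ x) _ = relbowˡ x
    up (jelbowˡ x) _ = jelbowˡ x
    up (bumpˡ x y) _ = bumpˡ x y

module _ {n T h v} (L : Lab _<_ n T h v) where
  private
    open module C' = Count (distinct L)

  reduced-crossings : inversions (exitList h n 0 n) ≡ crossings T n
  reduced-crossings = trans (sym (+-identityʳ _)) (trans (cong (inversions (exitList h n 0 n) +_) (sym d0))
    (trans countTheorem (trans (sym (+-identityʳ _)) (trans (cong (gridSum asc n +_) (sym d0))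
      (trans (gridSum-+ asc desc n) (gridSum-cong {f = λ i j → asc i j + desc i j} n (λ i j _ _ → asc+desc (T i j) (h i j) (v (suc i) j))))))))
    where
    none : ∀ {t w e n s} → Loc _<_ t w e n s → descends t w s ≡ 0
    none blankˡ = refl
    none (horˡ x) = refl
    none (verˡ x) = refl
    none (crossˡ x y lt) rewrite <ᵇ-true lt = refl
    none (relbowˡ x) = refl
    none (jelbowˡ x) = refl
    none (bumpˡ x y) = refl
    d0 : gridSum desc n ≡ 0
    d0 = gridSum-zeros desc n (λ i j pi pj → none (Lab.loc L i j pi pj))

-- Exchanging two pipes

swapL : ℕ → ℕ → ℕ → ℕ
swapL p q l with l ≟ p | l ≟ q
... | yes _ | _     = q
... | no _  | yes _ = p
... | no _  | no _  = l

swapL-p : ∀ p q → swapL p q p ≡ q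
swapL-p p q with p ≟ p
... | yes _ = refl
... | no ne = ⊥-elim (ne refl)

swapL-q : ∀ p q → swapL p q q ≡ p
swapL-q p q with q ≟ p | q ≟ q
... | yes e | _ = e
... | no _ | yes _ = refl
... | no _ | no ne = ⊥-elim (ne refl)

swapL-other : ∀ p q l → l ≢ p → l ≢ q → swapL p q l ≡ l
swapL-other p q l np nq with l ≟ p | l ≟ q
... | yes e | _ = ⊥-elim (np e)
... | no _ | yes e = ⊥-elim (nq e)
... | no _ | no _ = refl

swapL-pos : ∀ p q l → 0 < p → 0 < q → 0 < l → 0 < swapL p q l
swapL-pos p q l 0<p 0<q 0<l with l ≟ p | l ≟ q
... | yes _ | _ = 0<q
... | no _ | yes _ = 0<p
... | no _ | no _ = 0<l

swapL-0 : ∀ p q → 0 < p → 0 < q → swapL p q 0 ≡ 0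
swapL-0 p q 0<p 0<q = swapL-other p q 0 (<⇒≢ 0<p) (<⇒≢ 0<q)

swapL-invol : ∀ p q l → swapL p q (swapL p q l) ≡ l
swapL-invol p q l with l ≟ p | l ≟ q
... | yes e | _ = trans (swapL-q p q) (sym e)
... | no _ | yes e = trans (swapL-p p q) (sym e)
... | no np | no nq = swapL-other p q l np nq

swapL-sym : ∀ p q l → swapL p q l ≡ swapL q p l
swapL-sym p q l with l ≟ p | l ≟ q
... | yes e | yes e' = trans (sym e') e
... | yes _ | no _ = refl
... | no _ | yes _ = refl
... | no _ | no _ = refl

mapLoc : ∀ {t w e n s} (f : ℕ → ℕ) → f 0 ≡ 0 → (∀ l → 0 < l → 0 < f l) → Loc Any² t w e n s → Loc Any² t (f w) (f e) (f n) (f s)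
mapLoc f z p blankˡ rewrite z = blankˡ
mapLoc f z p (horˡ x) rewrite z = horˡ (p _ x)
mapLoc f z p (verˡ x) rewrite z = verˡ (p _ x)
mapLoc f z p (crossˡ x y _) = crossˡ (p _ x) (p _ y) tt
mapLoc f z p (relbowˡ x) rewrite z = relbowˡ (p _ x)
mapLoc f z p (jelbowˡ x) rewrite z = jelbowˡ (p _ x)
mapLoc f z p (bumpˡ x y) = bumpˡ (p _ x) (p _ y)

castLoc : ∀ {R t t' w w' e e' n n' s s'} → t' ≡ t → w' ≡ w → e' ≡ e → n' ≡ n → s' ≡ s → Loc R t w e n s → Loc R t' w' e' n' s'
castLoc refl refl refl refl refl l = l

data Compare (i a : ℕ) : Set where
  less    : i < a → Compare i a
  equal   : i ≡ a → Compare i a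
  greater : a < i → Compare i a

compareℕ : ∀ i a → Compare i a
compareℕ i a with <-cmp i a
... | tri< x _ _ = less x
... | tri≈ _ x _ = equal x
... | tri> _ _ x = greater x

data Toggled : Tile → Tile → Set where
  uncross : Toggled cross bump
  recross : Toggled bump cross

OffCell : ℕ → ℕ → ℕ → (ℕ → ℕ → Tile) → (ℕ → ℕ → Tile) → Set
OffCell n a b T T' = ∀ i j → In n i → In n j → ¬ (i ≡ a × j ≡ b) → T' i j ≡ T i j

toggledLoc : ∀ {R t t' w e n s} → Toggled t t' → Loc R t w e n s → Loc Any² t' w (swapL w s e) (swapL w s n) s
toggledLoc {w = w} {s = s} uncross (crossˡ x y _) = castLoc refl refl (swapL-p w s) (swapL-q w s) refl (bumpˡ x y)
toggledLoc {w = w} {s = s} recross (bumpˡ x y) = castLoc refl refl (swapL-q w s) (swapL-p w s) refl (crossˡ x y tt)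

toggledPos : ∀ {R t t' w e n s} → Toggled t t' → Loc R t w e n s → 0 < w × 0 < s
toggledPos uncross (crossˡ x y _) = x , y
toggledPos recross (bumpˡ x y) = x , y

-- Toggling one cell between cross and bump exchanges its two pipes on every
-- edge produced at that cell or later in the scan.
module Toggle {R n T h v} (L : Lab R n T h v) (T' : ℕ → ℕ → Tile) (a b : ℕ) (pa : In n a) (pb : In n b)
              (tog : Toggled (T a b) (T' a b)) (off : OffCell n a b T T') where
  open Lab L
  open Cuts L

  p q : ℕ
  p = h a b
  q = v (suc a) b

  private
    0<p = proj₁ (toggledPos tog (loc a b pa pb))
    0<q = proj₂ (toggledPos tog (loc a b pa pb))

  sw : ℕ → ℕ
  sw = swapL p q

  h' v' : ℕ → ℕ → ℕ
  h' i j with <-cmp i a | b <? j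
  ... | tri< _ _ _ | _     = sw (h i j)
  ... | tri≈ _ _ _ | yes _ = sw (h i j)
  ... | tri≈ _ _ _ | no _  = h i j
  ... | tri> _ _ _ | _     = h i j
  v' i j with <-cmp i a | b ≤? j
  ... | tri< _ _ _ | _     = sw (v i j)
  ... | tri≈ _ _ _ | yes _ = sw (v i j)
  ... | tri≈ _ _ _ | no _  = v i j
  ... | tri> _ _ _ | _     = v i j

  h'-above : ∀ i j → i < a → h' i j ≡ sw (h i j)
  h'-above i j lt with <-cmp i a | b <? j
  ... | tri< _ _ _ | _ = refl
  ... | tri≈ ¬lt _ _ | _ = ⊥-elim (¬lt lt)
  ... | tri> ¬lt _ _ | _ = ⊥-elim (¬lt lt)
  h'-below : ∀ i j → a < i → h' i j ≡ h i j
  h'-below i j lt with <-cmp i a | b <? j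
  ... | tri> _ _ _ | _ = refl
  ... | tri≈ _ _ ¬gt | _ = ⊥-elim (¬gt lt)
  ... | tri< _ _ ¬gt | _ = ⊥-elim (¬gt lt)
  h'-right : ∀ j → b < j → h' a j ≡ sw (h a j)
  h'-right j lt with <-cmp a a | b <? j
  ... | tri< _ ne _ | _ = ⊥-elim (ne refl)
  ... | tri> _ ne _ | _ = ⊥-elim (ne refl)
  ... | tri≈ _ _ _ | yes _ = refl
  ... | tri≈ _ _ _ | no nlt = ⊥-elim (nlt lt)
  h'-left : ∀ j → j ≤ b → h' a j ≡ h a j
  h'-left j le with <-cmp a a | b <? j
  ... | tri< _ ne _ | _ = ⊥-elim (ne refl)
  ... | tri> _ ne _ | _ = ⊥-elim (ne refl)
  ... | tri≈ _ _ _ | yes lt = ⊥-elim (<⇒≱ lt le)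
  ... | tri≈ _ _ _ | no nlt = refl
  v'-above : ∀ i j → i < a → v' i j ≡ sw (v i j)
  v'-above i j lt with <-cmp i a | b ≤? j
  ... | tri< _ _ _ | _ = refl
  ... | tri≈ ¬lt _ _ | _ = ⊥-elim (¬lt lt)
  ... | tri> ¬lt _ _ | _ = ⊥-elim (¬lt lt)
  v'-below : ∀ i j → a < i → v' i j ≡ v i j
  v'-below i j lt with <-cmp i a | b ≤? j
  ... | tri> _ _ _ | _ = refl
  ... | tri≈ _ _ ¬gt | _ = ⊥-elim (¬gt lt)
  ... | tri< _ _ ¬gt | _ = ⊥-elim (¬gt lt)
  v'-right : ∀ j → b ≤ j → v' a j ≡ sw (v a j)
  v'-right j le with <-cmp a a | b ≤? j
  ... | tri< _ ne _ | _ = ⊥-elim (ne refl)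
  ... | tri> _ ne _ | _ = ⊥-elim (ne refl)
  ... | tri≈ _ _ _ | yes _ = refl
  ... | tri≈ _ _ _ | no nle = ⊥-elim (nle le)
  v'-left : ∀ j → j < b → v' a j ≡ v a j
  v'-left j lt with <-cmp a a | b ≤? j
  ... | tri< _ ne _ | _ = ⊥-elim (ne refl)
  ... | tri> _ ne _ | _ = ⊥-elim (ne refl)
  ... | tri≈ _ _ _ | yes le = ⊥-elim (<⇒≱ lt le)
  ... | tri≈ _ _ _ | no _ = refl

  -- p and q are used up at (a , b), so no other edge of that cut carries them
  fixed : ∀ {m l} → At a b m l → m < b ⊎ suc b < m → sw l ≡ l
  fixed {m} {l} at away = swapL-other p q l (λ { refl → ne₁ (u 0<p at cur) }) (λ { refl → ne₂ (u 0<q at (new ≤-refl (proj₂ pb))) })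
    where
    u : ∀ {c m m'} → 0 < c → At a b m c → At a b m' c → m ≡ m'
    u = unique a b pa (proj₁ pb) (m≤n⇒m≤1+n (proj₂ pb))
    ne₁ : m ≢ b
    ne₁ refl = [ <-irrefl refl , (λ lt → <-asym lt (n<1+n _)) ]′ away
    ne₂ : m ≢ suc b
    ne₂ refl = [ (λ lt → <-asym lt (n<1+n _)) , <-irrefl refl ]′ away

  -- The south edge of a cell just above row `a` may lie left of column `b`, where nothing is
  -- relabelled. It is then on the cut at (a , b), and `fixed` says that the exchange does not
  -- affect it.
  inS : ∀ i j → In n i → In n j → i < a → v' (suc i) j ≡ sw (v (suc i) j)
  inS i j pi pj lt with m≤n⇒m<n∨m≡n lt
  ... | inj₁ lt' = v'-above (suc i) j lt'
  ... | inj₂ refl with ≤-<-connex b j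
  ...   | inj₁ le = v'-right j le
  ...   | inj₂ lt' = trans (v'-left j lt') (sym (fixed (old (proj₁ pj) lt') (inj₁ lt')))

  swLoc : ∀ {t w e n s} → Loc R t w e n s → Loc Any² t (sw w) (sw e) (sw n) (sw s)
  swLoc l = mapLoc sw (swapL-0 p q 0<p 0<q) (λ l → swapL-pos p q l 0<p 0<q) (weaken l)

  loc' : ∀ i j → In n i → In n j → Loc Any² (T' i j) (h' i j) (h' i (suc j)) (v' i j) (v' (suc i) j)
  loc' i j pi pj with compareℕ i a
  ... | less lt = castLoc (off i j pi pj (<⇒≢ lt ∘ proj₁)) (h'-above i j lt) (h'-above i (suc j) lt) (v'-above i j lt) (inS i j pi pj lt) (swLoc (loc i j pi pj))
  ... | greater gt = castLoc (off i j pi pj (>⇒≢ gt ∘ proj₁)) (h'-below i j gt) (h'-below i (suc j) gt) (v'-below i j gt) (v'-below (suc i) j (m<n⇒m<1+n gt)) (weaken (loc i j pi pj))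
  ... | equal refl with compareℕ j b
  ...   | less lt = castLoc (off i j pi pj (<⇒≢ lt ∘ proj₂)) (h'-left j (<⇒≤ lt)) (h'-left (suc j) lt) (v'-left j lt) (v'-below (suc i) j ≤-refl) (weaken (loc i j pi pj))
  ...   | greater gt = castLoc (off i j pi pj (>⇒≢ gt ∘ proj₂)) (h'-right j gt) (h'-right (suc j) (m<n⇒m<1+n gt)) (v'-right j (<⇒≤ gt))
                           (trans (v'-below (suc i) j ≤-refl) (sym (fixed (new (<⇒≤ gt) (proj₂ pj)) (inj₂ (s≤s gt))))) (swLoc (loc i j pi pj))
  ...   | equal refl = castLoc refl (h'-left j ≤-refl) (h'-right (suc j) ≤-refl) (v'-right j ≤-refl) (v'-below (suc i) j ≤-refl) (toggledLoc tog (loc i j pi pj))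

  h'-cases : ∀ i j → h' i j ≡ h i j ⊎ h' i j ≡ sw (h i j)
  h'-cases i j with <-cmp i a | b <? j
  ... | tri< _ _ _ | _     = inj₂ refl
  ... | tri≈ _ _ _ | yes _ = inj₂ refl
  ... | tri≈ _ _ _ | no _  = inj₁ refl
  ... | tri> _ _ _ | _     = inj₁ refl

  v'-cases : ∀ i j → v' i j ≡ v i j ⊎ v' i j ≡ sw (v i j)
  v'-cases i j with <-cmp i a | b ≤? j
  ... | tri< _ _ _ | _     = inj₂ refl
  ... | tri≈ _ _ _ | yes _ = inj₂ refl
  ... | tri≈ _ _ _ | no _  = inj₁ refl
  ... | tri> _ _ _ | _     = inj₁ refl

  -- Exits below row `a` keep their labels, but they are on the cut at (a , b) and hence carry
  -- neither `p` nor `q`. So the exchange describes all exits uniformly.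
  exit' : ∀ r → In n r → h' r (suc n) ≡ sw (h r (suc n))
  exit' r pr with compareℕ r a
  ... | less lt = h'-above r (suc n) lt
  ... | equal refl = h'-right (suc n) (s≤s (proj₂ pb))
  ... | greater gt = trans (h'-below r (suc n) gt) (sym (fixed at (inj₂ (s≤s (≤-trans (s≤s (proj₂ pb)) (≤-trans (≤-reflexive (+-comm 1 n)) (+-monoʳ-≤ n (m<n⇒0<n∸m gt))))))))
    where
    at : At a b (suc n + (r ∸ a)) (h r (suc n))
    at = subst (λ z → At a b (suc n + (r ∸ a)) (h z (suc n))) (m∸n+n≡m (<⇒≤ gt))
          (out (r ∸ a) (m<n⇒0<n∸m gt) (≤-trans (≤-reflexive (m∸n+n≡m (<⇒≤ gt))) (proj₂ pr)))

  lab' : Lab Any² n T' h' v'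
  lab' = record
    { loc = loc'
    ; left = λ i pi → [ (λ e → trans e (left i pi)) , (λ e → trans e (trans (cong sw (left i pi)) z)) ]′ (h'-cases i 1)
    ; top = λ j pj → [ (λ e → trans e (top j pj)) , (λ e → trans e (trans (cong sw (top j pj)) z)) ]′ (v'-cases 1 j)
    ; bot = λ j pj → trans (v'-below (suc n) j (s≤s (proj₂ pa))) (bot j pj)
    ; right = λ i pi → subst (0 <_) (sym (exit' i pi)) (swapL-pos p q _ 0<p 0<q (right i pi))
    }
    where
    z : sw 0 ≡ 0
    z = swapL-0 p q 0<p 0<q

-- Drooping a pipe

-- The position of a row or column relative to two opposite sides of the droop rectangle; two zones
-- locate a cell.
data Zone : Set where
  before lo mid hi after : Zone

data InZone (a a' i : ℕ) : Zone → Set where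
  isBefore : i < a → InZone a a' i before
  isLo     : i ≡ a → InZone a a' i lo
  isMid    : a < i → i < a' → InZone a a' i mid
  isHi     : i ≡ a' → InZone a a' i hi
  isAfter  : a' < i → InZone a a' i after

zone : ℕ → ℕ → ℕ → Zone
zone a a' i = if i <ᵇ a then before else if i ≡ᵇ a then lo else if i <ᵇ a' then mid else if i ≡ᵇ a' then hi else after

≡ᵇ-refl : ∀ a → (a ≡ᵇ a) ≡ true
≡ᵇ-refl zero = refl
≡ᵇ-refl (suc a) = ≡ᵇ-refl a

≡ᵇ-false : ∀ {a b} → a ≢ b → (a ≡ᵇ b) ≡ false
≡ᵇ-false {zero} {zero} ne = ⊥-elim (ne refl)
≡ᵇ-false {zero} {suc b} ne = refl
≡ᵇ-false {suc a} {zero} ne = refl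
≡ᵇ-false {suc a} {suc b} ne = ≡ᵇ-false (ne ∘ cong suc)

zone-≡ : ∀ {a a' i z} → a < a' → InZone a a' i z → zone a a' i ≡ z
zone-≡ lt (isBefore x) rewrite <ᵇ-true x = refl
zone-≡ {a} lt (isLo refl) rewrite <ᵇ-false (≤-refl {a}) | ≡ᵇ-refl a = refl
zone-≡ lt (isMid x y) rewrite <ᵇ-false (<⇒≤ x) | ≡ᵇ-false (>⇒≢ x) | <ᵇ-true y = refl
zone-≡ {a} {a'} lt (isHi refl) rewrite <ᵇ-false (<⇒≤ lt) | ≡ᵇ-false (>⇒≢ lt) | <ᵇ-false (≤-refl {a'}) | ≡ᵇ-refl a' = refl
zone-≡ {a} lt (isAfter x) rewrite <ᵇ-false (<⇒≤ (<-trans lt x)) | ≡ᵇ-false (>⇒≢ (<-trans lt x)) | <ᵇ-false (<⇒≤ x) | ≡ᵇ-false (>⇒≢ x) = refl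

findZone : ∀ a a' i → Σ Zone (InZone a a' i)
findZone a a' i with compareℕ i a
... | less x = _ , isBefore x
... | equal x = _ , isLo x
... | greater x with compareℕ i a'
...   | less y = _ , isMid x y
...   | equal y = _ , isHi y
...   | greater y = _ , isAfter y

inZone : ∀ {a a'} i → a < a' → InZone a a' i (zone a a' i)
inZone {a} {a'} i lt with findZone a a' i
... | z , x = subst (InZone a a' i) (sym (zone-≡ lt x)) x

-- edge number i separates lines i ∸ 1 and i; it lies inside when a < i ≤ a'
inside : ℕ → ℕ → ℕ → Bool
inside a a' i = (a <ᵇ i) ∧ (i <ᵇ suc a')

firstIn secondIn : Zone → Bool
firstIn before = false
firstIn lo = false
firstIn mid = true
firstIn hi = true
firstIn after = false
secondIn before = false
secondIn lo = true
secondIn mid = true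
secondIn hi = false
secondIn after = false

∧-false : ∀ b → b ∧ false ≡ false
∧-false true = refl
∧-false false = refl

firstIn-≡ : ∀ {a a' i z} → a < a' → InZone a a' i z → inside a a' i ≡ firstIn z
firstIn-≡ lt (isBefore x) rewrite <ᵇ-false (<⇒≤ x) = refl
firstIn-≡ {a} lt (isLo refl) rewrite <ᵇ-false (≤-refl {a}) = refl
firstIn-≡ lt (isMid x y) rewrite <ᵇ-true x | <ᵇ-true (m<n⇒m<1+n y) = refl
firstIn-≡ {a} {a'} lt (isHi refl) rewrite <ᵇ-true lt | <ᵇ-true (≤-refl {suc a'}) = refl
firstIn-≡ {a} {a'} {i} lt (isAfter x) rewrite <ᵇ-false x = ∧-false (a <ᵇ i)

secondIn-≡ : ∀ {a a' i z} → a < a' → InZone a a' i z → inside a a' (suc i) ≡ secondIn z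
secondIn-≡ lt (isBefore x) rewrite <ᵇ-false x = refl
secondIn-≡ {a} lt (isLo refl) rewrite <ᵇ-true (≤-refl {suc a}) | <ᵇ-true lt = refl
secondIn-≡ lt (isMid x y) rewrite <ᵇ-true (m<n⇒m<1+n x) | <ᵇ-true y = refl
secondIn-≡ {a} {a'} lt (isHi refl) rewrite <ᵇ-false (≤-refl {a'}) = ∧-false (a <ᵇ suc a')
secondIn-≡ {a} {a'} {i} lt (isAfter x) rewrite <ᵇ-false (<⇒≤ x) = ∧-false (a <ᵇ suc i)

-- The default clauses cover the outside, the interior, and the combinations that `OldCell` and
-- `NewCell` exclude.
droopZ undroopZ : Zone → Zone → Tile → Tile
droopZ lo lo relbow = blank
droopZ lo lo bump = jelbow
droopZ mid lo cross = hor
droopZ hi lo ver = relbow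
droopZ hi lo jelbow = hor
droopZ lo mid cross = ver
droopZ lo hi hor = relbow
droopZ lo hi jelbow = ver
droopZ hi mid ver = cross
droopZ mid hi hor = cross
droopZ hi hi blank = jelbow
droopZ hi hi relbow = bump
droopZ _ _ t = t
undroopZ lo lo blank = relbow
undroopZ lo lo jelbow = bump
undroopZ mid lo hor = cross
undroopZ hi lo relbow = ver
undroopZ hi lo hor = jelbow
undroopZ lo mid ver = cross
undroopZ lo hi relbow = hor
undroopZ lo hi ver = jelbow
undroopZ hi mid cross = ver
undroopZ mid hi cross = hor
undroopZ hi hi jelbow = blank
undroopZ hi hi bump = relbow
undroopZ _ _ t = t

-- The edges along the upper or left side get `x`, those along the lower or right side get `y`:
-- drooping `p` uses 0 and `p`, undrooping uses `p` and 0.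
relabel : ℕ → ℕ → Zone → Bool → ℕ → ℕ
relabel x y lo true l = x
relabel x y hi true l = y
relabel x y _ _ l = l

relabel-false : ∀ x y z l → relabel x y z false l ≡ l
relabel-false x y before l = refl
relabel-false x y lo l = refl
relabel-false x y mid l = refl
relabel-false x y hi l = refl
relabel-false x y after l = refl

-- The interior counts as outside, because the rerouted pipe does not enter it.
data Outside : Zone → Zone → Set where
  above  : ∀ {z} → Outside before z
  below  : ∀ {z} → Outside after z
  leftOf : ∀ {z} → Outside z before
  rightOf : ∀ {z} → Outside z after
  middle : Outside mid mid

-- the cells of the rectangle before and after pipe p is drooped
data OldCell (p : ℕ) : Zone → Zone → Tile → ℕ → ℕ → ℕ → ℕ → Set where
  outside : ∀ {z z' t w e n s} → Outside z z' → Loc _<_ t w e n s → OldCell p z z' t w e n s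
  lolo-r : 0 < p → OldCell p lo lo relbow 0 p 0 p
  lolo-b : ∀ {q} → 0 < p → 0 < q → OldCell p lo lo bump q p q p
  midlo : ∀ {w} → 0 < w → w < p → OldCell p mid lo cross w w p p
  hilo-v : 0 < p → OldCell p hi lo ver 0 0 p p
  hilo-j : 0 < p → OldCell p hi lo jelbow p 0 p 0
  lomid : ∀ {s} → 0 < p → p < s → OldCell p lo mid cross p p s s
  himid : ∀ {s} → 0 < p → p < s → OldCell p hi mid ver 0 0 s s
  lohi-h : 0 < p → OldCell p lo hi hor p p 0 0
  lohi-j : 0 < p → OldCell p lo hi jelbow p 0 p 0
  midhi : ∀ {w} → 0 < w → w < p → OldCell p mid hi hor w w 0 0
  hihi-b : 0 < p → OldCell p hi hi blank 0 0 0 0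
  hihi-r : ∀ {s} → 0 < p → 0 < s → OldCell p hi hi relbow 0 s 0 s

data NewCell (p : ℕ) : Zone → Zone → Tile → ℕ → ℕ → ℕ → ℕ → Set where
  outside : ∀ {z z' t w e n s} → Outside z z' → Loc _<_ t w e n s → NewCell p z z' t w e n s
  lolo-r : 0 < p → NewCell p lo lo blank 0 0 0 0
  lolo-b : ∀ {q} → 0 < p → 0 < q → NewCell p lo lo jelbow q 0 q 0
  midlo : ∀ {w} → 0 < w → w < p → NewCell p mid lo hor w w 0 0
  hilo-v : 0 < p → NewCell p hi lo relbow 0 p 0 p
  hilo-j : 0 < p → NewCell p hi lo hor p p 0 0
  lomid : ∀ {s} → 0 < p → p < s → NewCell p lo mid ver 0 0 s s
  himid : ∀ {s} → 0 < p → p < s → NewCell p hi mid cross p p s s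
  lohi-h : 0 < p → NewCell p lo hi relbow 0 p 0 p
  lohi-j : 0 < p → NewCell p lo hi ver 0 0 p p
  midhi : ∀ {w} → 0 < w → w < p → NewCell p mid hi cross w w p p
  hihi-b : 0 < p → NewCell p hi hi jelbow p 0 p 0
  hihi-r : ∀ {s} → 0 < p → 0 < s → NewCell p hi hi bump p s p s

before-loc : ∀ {p z z' t w e n s} → OldCell p z z' t w e n s → Loc _<_ t w e n s
before-loc (outside _ l) = l
before-loc (lolo-r x) = relbowˡ x
before-loc (lolo-b x y) = bumpˡ y x
before-loc (midlo x y) = crossˡ x (<-trans x y) y
before-loc (hilo-v x) = verˡ x
before-loc (hilo-j x) = jelbowˡ x
before-loc (lomid x y) = crossˡ x (<-trans x y) y
before-loc (himid x y) = verˡ (<-trans x y)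
before-loc (lohi-h x) = horˡ x
before-loc (lohi-j x) = jelbowˡ x
before-loc (midhi x y) = horˡ x
before-loc (hihi-b x) = blankˡ
before-loc (hihi-r x y) = relbowˡ y

after-loc : ∀ {p z z' t w e n s} → NewCell p z z' t w e n s → Loc _<_ t w e n s
after-loc (outside _ l) = l
after-loc (lolo-r x) = blankˡ
after-loc (lolo-b x y) = jelbowˡ y
after-loc (midlo x y) = horˡ x
after-loc (hilo-v x) = relbowˡ x
after-loc (hilo-j x) = horˡ x
after-loc (lomid x y) = verˡ (<-trans x y)
after-loc (himid x y) = crossˡ x (<-trans x y) y
after-loc (lohi-h x) = relbowˡ x
after-loc (lohi-j x) = verˡ x
after-loc (midhi x y) = crossˡ x (<-trans x y) y
after-loc (hihi-b x) = jelbowˡ x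
after-loc (hihi-r x y) = bumpˡ x y

droopZ-outside : ∀ {z z'} t → Outside z z' → droopZ z z' t ≡ t
droopZ-outside t above = refl
droopZ-outside t below = refl
droopZ-outside {before} t leftOf = refl
droopZ-outside {lo} t leftOf = refl
droopZ-outside {mid} t leftOf = refl
droopZ-outside {hi} t leftOf = refl
droopZ-outside {after} t leftOf = refl
droopZ-outside {before} t rightOf = refl
droopZ-outside {lo} t rightOf = refl
droopZ-outside {mid} t rightOf = refl
droopZ-outside {hi} t rightOf = refl
droopZ-outside {after} t rightOf = refl
droopZ-outside t middle = refl

undroopZ-outside : ∀ {z z'} t → Outside z z' → undroopZ z z' t ≡ t
undroopZ-outside t above = refl
undroopZ-outside t below = refl
undroopZ-outside {before} t leftOf = refl
undroopZ-outside {lo} t leftOf = refl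
undroopZ-outside {mid} t leftOf = refl
undroopZ-outside {hi} t leftOf = refl
undroopZ-outside {after} t leftOf = refl
undroopZ-outside {before} t rightOf = refl
undroopZ-outside {lo} t rightOf = refl
undroopZ-outside {mid} t rightOf = refl
undroopZ-outside {hi} t rightOf = refl
undroopZ-outside {after} t rightOf = refl
undroopZ-outside t middle = refl

relabelLoc : ∀ {R} x y {z z' t w e n s} → Outside z z' → Loc R t w e n s →
  Loc R t (relabel x y z (firstIn z') w) (relabel x y z (secondIn z') e) (relabel x y z' (firstIn z) n) (relabel x y z' (secondIn z) s)
relabelLoc x y {z' = z'} above l = castLoc refl refl refl (relabel-false x y z' _) (relabel-false x y z' _) l
relabelLoc x y {z' = z'} below l = castLoc refl refl refl (relabel-false x y z' _) (relabel-false x y z' _) l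
relabelLoc x y {z} leftOf l = castLoc refl (relabel-false x y z _) (relabel-false x y z _) refl refl l
relabelLoc x y {z} rightOf l = castLoc refl (relabel-false x y z _) (relabel-false x y z _) refl refl l
relabelLoc x y middle l = l

droopCell : ∀ {p z z' t w e n s} → OldCell p z z' t w e n s →
  NewCell p z z' (droopZ z z' t) (relabel 0 p z (firstIn z') w) (relabel 0 p z (secondIn z') e) (relabel 0 p z' (firstIn z) n) (relabel 0 p z' (secondIn z) s)
droopCell {p} {t = t} (outside o l) = outside o (castLoc (droopZ-outside t o) refl refl refl refl (relabelLoc 0 p o l))
droopCell (lolo-r x) = lolo-r x
droopCell (lolo-b x y) = lolo-b x y
droopCell (midlo x y) = midlo x y
droopCell (hilo-v x) = hilo-v x
droopCell (hilo-j x) = hilo-j x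
droopCell (lomid x y) = lomid x y
droopCell (himid x y) = himid x y
droopCell (lohi-h x) = lohi-h x
droopCell (lohi-j x) = lohi-j x
droopCell (midhi x y) = midhi x y
droopCell (hihi-b x) = hihi-b x
droopCell (hihi-r x y) = hihi-r x y

undroopCell : ∀ {p z z' t w e n s} → NewCell p z z' t w e n s →
  OldCell p z z' (undroopZ z z' t) (relabel p 0 z (firstIn z') w) (relabel p 0 z (secondIn z') e) (relabel p 0 z' (firstIn z) n) (relabel p 0 z' (secondIn z) s)
undroopCell {p} {t = t} (outside o l) = outside o (castLoc (undroopZ-outside t o) refl refl refl refl (relabelLoc p 0 o l))
undroopCell (lolo-r x) = lolo-r x
undroopCell (lolo-b x y) = lolo-b x y
undroopCell (midlo x y) = midlo x y
undroopCell (hilo-v x) = hilo-v x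
undroopCell (hilo-j x) = hilo-j x
undroopCell (lomid x y) = lomid x y
undroopCell (himid x y) = himid x y
undroopCell (lohi-h x) = lohi-h x
undroopCell (lohi-j x) = lohi-j x
undroopCell (midhi x y) = midhi x y
undroopCell (hihi-b x) = hihi-b x
undroopCell (hihi-r x y) = hihi-r x y

undroop-droop : ∀ {p z z' t w e n s} → OldCell p z z' t w e n s → undroopZ z z' (droopZ z z' t) ≡ t
undroop-droop {t = t} (outside o l) = trans (cong (undroopZ _ _) (droopZ-outside t o)) (undroopZ-outside t o)
undroop-droop (lolo-r x) = refl
undroop-droop (lolo-b x y) = refl
undroop-droop (midlo x y) = refl
undroop-droop (hilo-v x) = refl
undroop-droop (hilo-j x) = refl
undroop-droop (lomid x y) = refl
undroop-droop (himid x y) = refl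
undroop-droop (lohi-h x) = refl
undroop-droop (lohi-j x) = refl
undroop-droop (midhi x y) = refl
undroop-droop (hihi-b x) = refl
undroop-droop (hihi-r x y) = refl

droop-undroop : ∀ {p z z' t w e n s} → NewCell p z z' t w e n s → droopZ z z' (undroopZ z z' t) ≡ t
droop-undroop {t = t} (outside o l) = trans (cong (droopZ _ _) (undroopZ-outside t o)) (droopZ-outside t o)
droop-undroop (lolo-r x) = refl
droop-undroop (lolo-b x y) = refl
droop-undroop (midlo x y) = refl
droop-undroop (hilo-v x) = refl
droop-undroop (hilo-j x) = refl
droop-undroop (lomid x y) = refl
droop-undroop (himid x y) = refl
droop-undroop (lohi-h x) = refl
droop-undroop (lohi-j x) = refl
droop-undroop (midhi x y) = refl
droop-undroop (hihi-b x) = refl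
droop-undroop (hihi-r x y) = refl

-- The rectangle of a min-droop

OnlyBump : ℕ → (ℕ → ℕ → Tile) → ℕ → ℕ → Set
OnlyBump n T a b = ∀ i j → In n i → In n j → T i j ≡ bump → i ≡ a × j ≡ b

record Rect (n a b a' b' : ℕ) : Set where
  field
    1≤a : 1 ≤ a
    1≤b : 1 ≤ b
    a<a' : a < a'
    b<b' : b < b'
    a'≤n : a' ≤ n
    b'≤n : b' ≤ n
  ina : In n a
  ina = 1≤a , ≤-trans (<⇒≤ a<a') a'≤n
  inb : In n b
  inb = 1≤b , ≤-trans (<⇒≤ b<b') b'≤n
  ina' : In n a'
  ina' = ≤-trans 1≤a (<⇒≤ a<a') , a'≤n
  inb' : In n b'
  inb' = ≤-trans 1≤b (<⇒≤ b<b') , b'≤n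
  rowIn : ∀ {i} → a < i → i ≤ a' → In n i
  rowIn x y = ≤-trans 1≤a (<⇒≤ x) , ≤-trans y a'≤n
  colIn : ∀ {j} → b < j → j ≤ b' → In n j
  colIn x y = ≤-trans 1≤b (<⇒≤ x) , ≤-trans y b'≤n

-- Crosses up to the corners and no crosses at `colE` and `rowE` together express the minimality of
-- `a'` and `b'`.
record CanDroop (T : ℕ → ℕ → Tile) (a b a' b' : ℕ) : Set where
  field
    corner : T a b ≡ relbow ⊎ T a b ≡ bump
    colX : ∀ i → a < i → i < a' → T i b ≡ cross
    rowX : ∀ j → b < j → j < b' → T a j ≡ cross
    colE : T a' b ≢ cross
    rowE : T a b' ≢ cross

-- The same minimality seen from the W-N turn: up and to the left, the sides end at the first tile
-- that is no cross. This makes undrooping deterministic.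
record CanUndroop (T : ℕ → ℕ → Tile) (a b a' b' : ℕ) : Set where
  field
    corner : T a' b' ≡ jelbow ⊎ T a' b' ≡ bump
    colX : ∀ i → a < i → i < a' → T i b' ≡ cross
    rowX : ∀ j → b < j → j < b' → T a' j ≡ cross
    colE : T a b' ≢ cross
    rowE : T a' b ≢ cross

upward : ∀ {a a'} (P : ℕ → Set) → P (suc a) → (∀ i → a < i → i < a' → P i → P (suc i)) → ∀ i → a < i → i ≤ a' → P i
upward {a} P p s (suc i) (s≤s a≤i) le with m≤n⇒m<n∨m≡n a≤i
... | inj₂ refl = p
... | inj₁ lt = s i lt le (upward P p s i lt (<⇒≤ le))

downward : ∀ {a a'} (P : ℕ → Set) → P a' → (∀ i → a < i → i < a' → P (suc i) → P i) → ∀ i → a < i → i ≤ a' → P i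
downward {a} {a'} P p s i lt le = go (a' ∸ i) i (m∸n+n≡m le) lt
  where
  go : ∀ d i → d + i ≡ a' → a < i → P i
  go zero i refl lt = p
  go (suc d) i e lt = s i lt (≤-trans (s≤s (m≤n+m i d)) (≤-reflexive e)) (go d (suc i) (trans (+-suc d i) e) (m<n⇒m<1+n lt))

module DroopCells (p : ℕ) (0<p : 0 < p) where

  midloFact : ∀ {t w e n s} → t ≡ cross → n ≡ p → Loc _<_ t w e n s → OldCell p mid lo t w e n s × 0 < e × e < p
  midloFact refl refl (crossˡ x y lt) = midlo x lt , x , lt

  lomidFact : ∀ {t w e n s} → t ≡ cross → w ≡ p → Loc _<_ t w e n s → OldCell p lo mid t w e n s × p < s
  lomidFact refl refl (crossˡ x y lt) = lomid x lt , lt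

  -- Labels on both sides of `p` are nonzero and different, which leaves only a cross or a bump.
  innerFact : ∀ {t w e n s} → t ≢ bump → 0 < w → w < p → p < n → Loc _<_ t w e n s → e ≡ w × s ≡ n
  innerFact nb 0<w w<p p<n (crossˡ x y lt) = refl , refl
  innerFact nb 0<w w<p () blankˡ
  innerFact nb 0<w w<p () (horˡ x)
  innerFact nb () w<p p<n (verˡ x)
  innerFact nb () w<p p<n (relbowˡ x)
  innerFact nb 0<w w<p p<n (jelbowˡ x) = ⊥-elim (<-asym w<p p<n)
  innerFact nb 0<w w<p p<n (bumpˡ x y) = ⊥-elim (nb refl)

  hiloFact : ∀ {t w e n s} → t ≢ cross → t ≢ bump → n ≡ p → Loc _<_ t w e n s → OldCell p hi lo t w e n s × e ≡ 0
  hiloFact nc nb refl (verˡ x) = hilo-v x , refl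
  hiloFact nc nb refl (jelbowˡ x) = hilo-j x , refl
  hiloFact nc nb refl (crossˡ x y lt) = ⊥-elim (nc refl)
  hiloFact nc nb refl (bumpˡ x y) = ⊥-elim (nb refl)
  hiloFact nc nb e blankˡ = ⊥-elim (<-irrefl e 0<p)
  hiloFact nc nb e (horˡ x) = ⊥-elim (<-irrefl e 0<p)
  hiloFact nc nb e (relbowˡ x) = ⊥-elim (<-irrefl e 0<p)

  himidFact : ∀ {t w e n s} → w ≡ 0 → p < n → Loc _<_ t w e n s → OldCell p hi mid t w e n s × e ≡ 0
  himidFact e lt (verˡ x) = himid 0<p lt , refl
  himidFact e () blankˡ
  himidFact e () (horˡ x)
  himidFact e () (relbowˡ x)
  himidFact refl lt (crossˡ () y _)
  himidFact refl lt (jelbowˡ ())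
  himidFact refl lt (bumpˡ () y)

  lohiFact : ∀ {t w e n s} → t ≢ cross → t ≢ bump → w ≡ p → Loc _<_ t w e n s → OldCell p lo hi t w e n s × s ≡ 0
  lohiFact nc nb refl (horˡ x) = lohi-h x , refl
  lohiFact nc nb refl (jelbowˡ x) = lohi-j x , refl
  lohiFact nc nb refl (crossˡ x y lt) = ⊥-elim (nc refl)
  lohiFact nc nb refl (bumpˡ x y) = ⊥-elim (nb refl)
  lohiFact nc nb e blankˡ = ⊥-elim (<-irrefl e 0<p)
  lohiFact nc nb e (verˡ x) = ⊥-elim (<-irrefl e 0<p)
  lohiFact nc nb e (relbowˡ x) = ⊥-elim (<-irrefl e 0<p)

  midhiFact : ∀ {t w e n s} → n ≡ 0 → 0 < w → w < p → Loc _<_ t w e n s → OldCell p mid hi t w e n s × s ≡ 0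
  midhiFact e 0<w lt (horˡ x) = midhi 0<w lt , refl
  midhiFact e () lt blankˡ
  midhiFact e () lt (verˡ x)
  midhiFact e () lt (relbowˡ x)
  midhiFact refl 0<w lt (crossˡ _ () _)
  midhiFact refl 0<w lt (jelbowˡ ())
  midhiFact refl 0<w lt (bumpˡ () y)

  hihiFact : ∀ {t w e n s} → w ≡ 0 → n ≡ 0 → Loc _<_ t w e n s → OldCell p hi hi t w e n s
  hihiFact _ _ blankˡ = hihi-b 0<p
  hihiFact _ _ (relbowˡ x) = hihi-r 0<p x
  hihiFact refl _ (horˡ ())
  hihiFact _ refl (verˡ ())
  hihiFact refl _ (crossˡ () _ _)
  hihiFact refl _ (jelbowˡ ())
  hihiFact refl _ (bumpˡ () _)

-- On the left side `p` runs north, so the pipes crossing it eastwards are smaller; on the top side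
-- `p` runs east, so those crossing it northwards are larger. Every interior cell thus meets a pipe
-- below `p` from the west and has one above `p` on its north edge, and both pass straight on.
module DroopFacts {n T h v a b a' b'} (L : Lab _<_ n T h v) (R : Rect n a b a' b') (D : CanDroop T a b a' b') (ob : OnlyBump n T a b) where
  open Lab L
  open Rect R
  open CanDroop D

  p : ℕ
  p = h a (suc b)

  private
    noBump : ∀ i j → In n i → In n j → (a < i ⊎ b < j) → T i j ≢ bump
    noBump i j pi pj x e with ob i j pi pj e
    ... | refl , refl = [ <-irrefl refl , <-irrefl refl ]′ x

    seFact : ∀ {t w e n s} → t ≡ relbow ⊎ t ≡ bump → Loc _<_ t w e n s → OldCell e lo lo t w e n s × s ≡ e × 0 < e
    seFact (inj₁ refl) (relbowˡ x) = lolo-r x , refl , x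
    seFact (inj₂ refl) (bumpˡ x y) = lolo-b y x , refl , y

    crossFact : ∀ {t w e n s} → t ≡ cross → Loc _<_ t w e n s → w ≡ e × n ≡ s × 0 < w × w < s
    crossFact refl (crossˡ x y lt) = refl , refl , x , lt

  c₀ = seFact corner (loc a b ina inb)

  0<p : 0 < p
  0<p = proj₂ (proj₂ c₀)

  private open module Cells = DroopCells p 0<p

  leftCol : ∀ i → a < i → i ≤ a' → v i b ≡ p
  leftCol = upward (λ i → v i b ≡ p) (proj₁ (proj₂ c₀)) (λ i x y e → trans (sym (proj₁ (proj₂ (crossFact (colX i x y) (loc i b (rowIn x (<⇒≤ y)) inb))))) e)

  topRow : ∀ j → b < j → j ≤ b' → h a j ≡ p
  topRow = upward (λ j → h a j ≡ p) refl (λ j x y e → trans (sym (proj₁ (crossFact (rowX j x y) (loc a j ina (colIn x (<⇒≤ y)))))) e)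

  SouthBig : ℕ → Set
  SouthBig i = ∀ j → b < j → j < b' → p < v i j

  private
    rowOf : ∀ i → a < i → i < a' → SouthBig i → ∀ j → b < j → j ≤ b' → 0 < h i j × h i j < p
    rowOf i x y sb = upward (λ j → 0 < h i j × h i j < p) (proj₂ (midloFact (colX i x y) (leftCol i x (<⇒≤ y)) (loc i b pi inb)))
      (λ j x' y' (0<w , w<p) → let e = proj₁ (innerFact (noBump i j pi (colIn x' (<⇒≤ y')) (inj₁ x)) 0<w w<p (sb j x' y') (loc i j pi (colIn x' (<⇒≤ y')))) in
         subst (0 <_) (sym e) 0<w , subst (_< p) (sym e) w<p)
      where pi = rowIn x (<⇒≤ y)

  southBig : ∀ i → a < i → i ≤ a' → SouthBig i
  southBig = upward SouthBig (λ j x y → proj₂ (lomidFact (rowX j x y) (topRow j x (<⇒≤ y)) (loc a j ina (colIn x (<⇒≤ y)))))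
    (λ i x y sb j x' y' → let (0<w , w<p) = rowOf i x y sb j x' (<⇒≤ y') in
      subst (p <_) (sym (proj₂ (innerFact (noBump i j (rowIn x (<⇒≤ y)) (colIn x' (<⇒≤ y')) (inj₁ x)) 0<w w<p (sb j x' y') (loc i j (rowIn x (<⇒≤ y)) (colIn x' (<⇒≤ y')))))) (sb j x' y'))

  westSmall : ∀ i → a < i → i < a' → ∀ j → b < j → j ≤ b' → 0 < h i j × h i j < p
  westSmall i x y = rowOf i x y (southBig i x (<⇒≤ y))

  private
    hilo! = hiloFact colE (noBump a' b ina' inb (inj₁ a<a')) (leftCol a' a<a' ≤-refl) (loc a' b ina' inb)
    lohi! = lohiFact rowE (noBump a b' ina inb' (inj₂ b<b')) (topRow b' b<b' ≤-refl) (loc a b' ina inb')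

  -- The corner (a' , b) is no cross, so its east edge is empty. Further right, an empty west edge
  -- together with a pipe on the north edge forces a vertical tile, and the emptiness spreads.
  bottomRow : ∀ j → b < j → j ≤ b' → h a' j ≡ 0
  bottomRow = upward (λ j → h a' j ≡ 0) (proj₂ hilo!) (λ j x y e → proj₂ (himidFact e (southBig a' a<a' ≤-refl j x y) (loc a' j ina' (colIn x (<⇒≤ y)))))

  rightCol : ∀ i → a < i → i ≤ a' → v i b' ≡ 0
  rightCol = upward (λ i → v i b' ≡ 0) (proj₂ lohi!) (λ i x y e → let (0<w , lt) = westSmall i x y b' b<b' ≤-refl in
     proj₂ (midhiFact e 0<w lt (loc i b' (rowIn x (<⇒≤ y)) inb')))

  cell : ∀ {i j z z'} → In n i → In n j → InZone a a' i z → InZone b b' j z' → OldCell p z z' (T i j) (h i j) (h i (suc j)) (v i j) (v (suc i) j)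
  cell pi pj (isBefore _) _ = outside above (loc _ _ pi pj)
  cell pi pj (isAfter _) _ = outside below (loc _ _ pi pj)
  cell pi pj (isLo _) (isBefore _) = outside leftOf (loc _ _ pi pj)
  cell pi pj (isMid _ _) (isBefore _) = outside leftOf (loc _ _ pi pj)
  cell pi pj (isHi _) (isBefore _) = outside leftOf (loc _ _ pi pj)
  cell pi pj (isLo _) (isAfter _) = outside rightOf (loc _ _ pi pj)
  cell pi pj (isMid _ _) (isAfter _) = outside rightOf (loc _ _ pi pj)
  cell pi pj (isHi _) (isAfter _) = outside rightOf (loc _ _ pi pj)
  cell pi pj (isMid _ _) (isMid _ _) = outside middle (loc _ _ pi pj)
  cell pi pj (isLo refl) (isLo refl) = proj₁ c₀
  cell pi pj (isMid x y) (isLo refl) = proj₁ (midloFact (colX _ x y) (leftCol _ x (<⇒≤ y)) (loc _ _ pi pj))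
  cell pi pj (isHi refl) (isLo refl) = proj₁ hilo!
  cell pi pj (isLo refl) (isMid x y) = proj₁ (lomidFact (rowX _ x y) (topRow _ x (<⇒≤ y)) (loc _ _ pi pj))
  cell pi pj (isLo refl) (isHi refl) = proj₁ lohi!
  cell pi pj (isHi refl) (isMid x y) = proj₁ (himidFact (bottomRow _ x (<⇒≤ y)) (southBig a' a<a' ≤-refl _ x y) (loc _ _ pi pj))
  cell pi pj (isMid x y) (isHi refl) = let (0<w , lt) = westSmall _ x y b' b<b' ≤-refl in proj₁ (midhiFact (rightCol _ x (<⇒≤ y)) 0<w lt (loc _ _ pi pj))
  cell pi pj (isHi refl) (isHi refl) = hihiFact (bottomRow b' b<b' ≤-refl) (rightCol a' a<a' ≤-refl) (loc _ _ pi pj)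

module UndroopCells (p : ℕ) (0<p : 0 < p) where

  midhiFact : ∀ {t w e n s} → t ≡ cross → s ≡ p → Loc _<_ t w e n s → NewCell p mid hi t w e n s × 0 < w × w < p
  midhiFact refl refl (crossˡ x y lt) = midhi x lt , x , lt

  himidFact : ∀ {t w e n s} → t ≡ cross → e ≡ p → Loc _<_ t w e n s → NewCell p hi mid t w e n s × p < n
  himidFact refl refl (crossˡ x y lt) = himid x lt , lt

  innerFact : ∀ {t w e n s} → t ≢ bump → 0 < e → e < p → p < s → Loc _<_ t w e n s → w ≡ e × n ≡ s
  innerFact nb 0<e e<p p<s (crossˡ x y lt) = refl , refl
  innerFact nb 0<e e<p () blankˡ
  innerFact nb 0<e e<p () (horˡ x)
  innerFact nb () e<p p<s (verˡ x)
  innerFact nb 0<e e<p p<s (relbowˡ x) = ⊥-elim (<-asym e<p p<s)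
  innerFact nb () e<p p<s (jelbowˡ x)
  innerFact nb 0<e e<p p<s (bumpˡ x y) = ⊥-elim (nb refl)

  hiloFact : ∀ {t w e n s} → t ≢ cross → t ≢ bump → e ≡ p → Loc _<_ t w e n s → NewCell p hi lo t w e n s × n ≡ 0
  hiloFact nc nb refl (horˡ x) = hilo-j x , refl
  hiloFact nc nb refl (relbowˡ x) = hilo-v x , refl
  hiloFact nc nb refl (crossˡ x y lt) = ⊥-elim (nc refl)
  hiloFact nc nb refl (bumpˡ x y) = ⊥-elim (nb refl)
  hiloFact nc nb e blankˡ = ⊥-elim (<-irrefl e 0<p)
  hiloFact nc nb e (verˡ x) = ⊥-elim (<-irrefl e 0<p)
  hiloFact nc nb e (jelbowˡ x) = ⊥-elim (<-irrefl e 0<p)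

  midloFact : ∀ {t w e n s} → s ≡ 0 → 0 < e → e < p → Loc _<_ t w e n s → NewCell p mid lo t w e n s × n ≡ 0
  midloFact z 0<e lt (horˡ x) = midlo 0<e lt , refl
  midloFact z () lt blankˡ
  midloFact z () lt (verˡ x)
  midloFact z () lt (jelbowˡ x)
  midloFact refl 0<e lt (crossˡ _ () _)
  midloFact refl 0<e lt (relbowˡ ())
  midloFact refl 0<e lt (bumpˡ x ())

  lohiFact : ∀ {t w e n s} → t ≢ cross → t ≢ bump → s ≡ p → Loc _<_ t w e n s → NewCell p lo hi t w e n s × w ≡ 0
  lohiFact nc nb refl (verˡ x) = lohi-j x , refl
  lohiFact nc nb refl (relbowˡ x) = lohi-h x , refl
  lohiFact nc nb refl (crossˡ x y lt) = ⊥-elim (nc refl)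
  lohiFact nc nb refl (bumpˡ x y) = ⊥-elim (nb refl)
  lohiFact nc nb e blankˡ = ⊥-elim (<-irrefl e 0<p)
  lohiFact nc nb e (horˡ x) = ⊥-elim (<-irrefl e 0<p)
  lohiFact nc nb e (jelbowˡ x) = ⊥-elim (<-irrefl e 0<p)

  lomidFact : ∀ {t w e n s} → e ≡ 0 → p < s → Loc _<_ t w e n s → NewCell p lo mid t w e n s × w ≡ 0
  lomidFact z lt (verˡ x) = lomid 0<p lt , refl
  lomidFact z () blankˡ
  lomidFact z () (horˡ x)
  lomidFact z () (jelbowˡ x)
  lomidFact refl lt (crossˡ () y _)
  lomidFact refl lt (relbowˡ ())
  lomidFact refl lt (bumpˡ x ())

  loloFact : ∀ {t w e n s} → e ≡ 0 → s ≡ 0 → Loc _<_ t w e n s → NewCell p lo lo t w e n s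
  loloFact _ _ blankˡ = lolo-r 0<p
  loloFact _ _ (jelbowˡ x) = lolo-b 0<p x
  loloFact refl _ (horˡ ())
  loloFact _ refl (verˡ ())
  loloFact refl _ (crossˡ () _ _)
  loloFact refl _ (relbowˡ ())
  loloFact refl _ (bumpˡ _ ())

-- The argument of `DroopFacts` from the opposite corner: facts spread to the west and to the north,
-- and an interior cell is recognised by its east and south edge.
module UndroopFacts {n T h v a b a' b'} (L : Lab _<_ n T h v) (R : Rect n a b a' b') (D : CanUndroop T a b a' b') (ob : OnlyBump n T a' b') where
  open Lab L
  open Rect R
  open CanUndroop D

  p : ℕ
  p = h a' b'

  private
    noBump : ∀ i j → In n i → In n j → (i < a' ⊎ j < b') → T i j ≢ bump
    noBump i j pi pj x e with ob i j pi pj e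
    ... | refl , refl = [ <-irrefl refl , <-irrefl refl ]′ x

    wnFact : ∀ {t w e n s} → t ≡ jelbow ⊎ t ≡ bump → Loc _<_ t w e n s → NewCell w hi hi t w e n s × n ≡ w × 0 < w
    wnFact (inj₁ refl) (jelbowˡ x) = hihi-b x , refl , x
    wnFact (inj₂ refl) (bumpˡ x y) = hihi-r x y , refl , x

    crossFact : ∀ {t w e n s} → t ≡ cross → Loc _<_ t w e n s → w ≡ e × n ≡ s × 0 < w × w < s
    crossFact refl (crossˡ x y lt) = refl , refl , x , lt

    c₀ = wnFact corner (loc a' b' ina' inb')

  0<p : 0 < p
  0<p = proj₂ (proj₂ c₀)

  private open module Cells = UndroopCells p 0<p

  rightCol : ∀ i → a < i → i ≤ a' → v i b' ≡ p
  rightCol = downward (λ i → v i b' ≡ p) (proj₁ (proj₂ c₀)) (λ i x y e → trans (proj₁ (proj₂ (crossFact (colX i x y) (loc i b' (rowIn x (<⇒≤ y)) inb')))) e)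

  bottomRow : ∀ j → b < j → j ≤ b' → h a' j ≡ p
  bottomRow = downward (λ j → h a' j ≡ p) refl (λ j x y e → trans (proj₁ (crossFact (rowX j x y) (loc a' j ina' (colIn x (<⇒≤ y))))) e)

  WestSmall : ℕ → Set
  WestSmall j = ∀ i → a < i → i < a' → 0 < h i j × h i j < p

  private
    colOf : ∀ j → b < j → j < b' → WestSmall (suc j) → ∀ i → a < i → i ≤ a' → p < v i j
    colOf j x y ws = downward (λ i → p < v i j) (proj₂ (himidFact (rowX j x y) (bottomRow (suc j) (m<n⇒m<1+n x) y) (loc a' j ina' pj)))
      (λ i x' y' lt → let (0<e , e<p) = ws i x' y' in
        subst (p <_) (sym (proj₂ (innerFact (noBump i j (rowIn x' (<⇒≤ y')) pj (inj₁ y')) 0<e e<p lt (loc i j (rowIn x' (<⇒≤ y')) pj)))) lt)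
      where pj = colIn x (<⇒≤ y)

  westSmall : ∀ j → b < j → j ≤ b' → WestSmall j
  westSmall = downward WestSmall (λ i x y → proj₂ (midhiFact (colX i x y) (rightCol (suc i) (m<n⇒m<1+n x) y) (loc i b' (rowIn x (<⇒≤ y)) inb')))
    (λ j x y ws i x' y' → let (0<e , e<p) = ws i x' y'
                              e = proj₁ (innerFact (noBump i j (rowIn x' (<⇒≤ y')) (colIn x (<⇒≤ y)) (inj₁ y')) 0<e e<p (colOf j x y ws (suc i) (m<n⇒m<1+n x') y') (loc i j (rowIn x' (<⇒≤ y')) (colIn x (<⇒≤ y)))) in
        subst (0 <_) (sym e) 0<e , subst (_< p) (sym e) e<p)

  northBig : ∀ j → b < j → j < b' → ∀ i → a < i → i ≤ a' → p < v i j
  northBig j x y = colOf j x y (westSmall (suc j) (m<n⇒m<1+n x) y)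

  private
    hilo! = hiloFact rowE (noBump a' b ina' inb (inj₂ b<b')) (bottomRow (suc b) ≤-refl b<b') (loc a' b ina' inb)
    lohi! = lohiFact colE (noBump a b' ina inb' (inj₁ a<a')) (rightCol (suc a) ≤-refl a<a') (loc a b' ina inb')

  leftCol : ∀ i → a < i → i ≤ a' → v i b ≡ 0
  leftCol = downward (λ i → v i b ≡ 0) (proj₂ hilo!) (λ i x y e → let (0<e , lt) = westSmall (suc b) ≤-refl b<b' i x y in
     proj₂ (midloFact e 0<e lt (loc i b (rowIn x (<⇒≤ y)) inb)))

  topRow : ∀ j → b < j → j ≤ b' → h a j ≡ 0
  topRow = downward (λ j → h a j ≡ 0) (proj₂ lohi!) (λ j x y e → proj₂ (lomidFact e (northBig j x y (suc a) ≤-refl a<a') (loc a j ina (colIn x (<⇒≤ y)))))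

  cell : ∀ {i j z z'} → In n i → In n j → InZone a a' i z → InZone b b' j z' → NewCell p z z' (T i j) (h i j) (h i (suc j)) (v i j) (v (suc i) j)
  cell pi pj (isBefore _) _ = outside above (loc _ _ pi pj)
  cell pi pj (isAfter _) _ = outside below (loc _ _ pi pj)
  cell pi pj (isLo _) (isBefore _) = outside leftOf (loc _ _ pi pj)
  cell pi pj (isMid _ _) (isBefore _) = outside leftOf (loc _ _ pi pj)
  cell pi pj (isHi _) (isBefore _) = outside leftOf (loc _ _ pi pj)
  cell pi pj (isLo _) (isAfter _) = outside rightOf (loc _ _ pi pj)
  cell pi pj (isMid _ _) (isAfter _) = outside rightOf (loc _ _ pi pj)
  cell pi pj (isHi _) (isAfter _) = outside rightOf (loc _ _ pi pj)
  cell pi pj (isMid _ _) (isMid _ _) = outside middle (loc _ _ pi pj)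
  cell pi pj (isHi refl) (isHi refl) = proj₁ c₀
  cell pi pj (isMid x y) (isHi refl) = proj₁ (midhiFact (colX _ x y) (rightCol _ (m<n⇒m<1+n x) y) (loc _ _ pi pj))
  cell pi pj (isHi refl) (isLo refl) = proj₁ hilo!
  cell pi pj (isHi refl) (isMid x y) = proj₁ (himidFact (rowX _ x y) (bottomRow _ (m<n⇒m<1+n x) y) (loc _ _ pi pj))
  cell pi pj (isLo refl) (isHi refl) = proj₁ lohi!
  cell pi pj (isLo refl) (isMid x y) = proj₁ (lomidFact (topRow _ (m<n⇒m<1+n x) y) (northBig _ x y (suc a) ≤-refl a<a') (loc _ _ pi pj))
  cell pi pj (isMid x y) (isLo refl) = let (0<w , lt) = westSmall (suc b) ≤-refl b<b' _ x y in proj₁ (midloFact (leftCol _ (m<n⇒m<1+n x) y) 0<w lt (loc _ _ pi pj))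
  cell pi pj (isLo refl) (isLo refl) = loloFact (topRow (suc b) ≤-refl b<b') (leftCol (suc a) ≤-refl a<a') (loc _ _ pi pj)

-- Droop and undroop of labelled tilings

inside-first : ∀ {a a'} → 1 ≤ a → inside a a' 1 ≡ false
inside-first {suc a} (s≤s z≤n) = refl

inside-last : ∀ {a a' n} → a' ≤ n → inside a a' (suc n) ≡ false
inside-last {a} {a'} {n} le rewrite <ᵇ-false le = ∧-false (a <ᵇ suc n)

module Redrawn (n a b a' b' : ℕ) (Rc : Rect n a b a' b') (x y : ℕ) where
  open Rect Rc

  newH newV : (ℕ → ℕ → ℕ) → ℕ → ℕ → ℕ
  newH h i j = relabel x y (zone a a' i) (inside b b' j) (h i j)
  newV v i j = relabel x y (zone b b' j) (inside a a' i) (v i j)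

  newLab : ∀ {T T' h v} → Lab _<_ n T h v →
    (∀ {i j z z'} → In n i → In n j → InZone a a' i z → InZone b b' j z' →
      Loc _<_ (T' i j) (relabel x y z (firstIn z') (h i j)) (relabel x y z (secondIn z') (h i (suc j)))
                       (relabel x y z' (firstIn z) (v i j)) (relabel x y z' (secondIn z) (v (suc i) j))) →
    Lab _<_ n T' (newH h) (newV v)
  newLab {T} {T'} {h} {v} L new = record
    { loc = λ i j pi pj → castLoc refl (flag (zone a a' i) (h i j) (firstIn-≡ b<b' (inZone j b<b'))) (flag (zone a a' i) (h i (suc j)) (secondIn-≡ b<b' (inZone j b<b')))
                                       (flag (zone b b' j) (v i j) (firstIn-≡ a<a' (inZone i a<a')))
                                       (flag (zone b b' j) (v (suc i) j) (secondIn-≡ a<a' (inZone i a<a'))) (new pi pj (inZone i a<a') (inZone j b<b'))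
    ; left = λ i pi → trans (off (zone a a' i) (inside-first {b} {b'} 1≤b)) (left i pi)
    ; top = λ j pj → trans (off (zone b b' j) (inside-first {a} {a'} 1≤a)) (top j pj)
    ; bot = λ j pj → trans (off (zone b b' j) (inside-last {a} a'≤n)) (bot j pj)
    ; right = λ i pi → subst (0 <_) (sym (off (zone a a' i) (inside-last {b} b'≤n))) (right i pi)
    }
    where
    open Lab L
    off : ∀ z {c l} → c ≡ false → relabel x y z c l ≡ l
    off z refl = relabel-false x y z _
    flag : ∀ z l {c d} → c ≡ d → relabel x y z c l ≡ relabel x y z d l
    flag z l refl = refl

  newExit : ∀ h r → newH h r (suc n) ≡ h r (suc n)
  newExit h r rewrite inside-last {b} b'≤n = relabel-false x y (zone a a' r) _

isBlank : (ℕ → ℕ → Tile) → ℕ → ℕ → ℕ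
isBlank T i j = b2n (isTile blank (T i j))

module Droop {n T h v a b a' b'} (L : Lab _<_ n T h v) (Rc : Rect n a b a' b') (D : CanDroop T a b a' b') (ob : OnlyBump n T a b) where
  open Rect Rc
  open DroopFacts L Rc D ob using (p; 0<p; cell) public
  open Redrawn n a b a' b' Rc 0 p

  T' : ℕ → ℕ → Tile
  T' i j = droopZ (zone a a' i) (zone b b' j) (T i j)

  h' v' : ℕ → ℕ → ℕ
  h' = newH h
  v' = newV v

  T'-zone : ∀ {i j z z'} → InZone a a' i z → InZone b b' j z' → T' i j ≡ droopZ z z' (T i j)
  T'-zone x y rewrite zone-≡ a<a' x | zone-≡ b<b' y = refl

  lab' : Lab _<_ n T' h' v'
  lab' = newLab L (λ pi pj x y → castLoc (T'-zone x y) refl refl refl refl (after-loc (droopCell (cell pi pj x y))))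

  undone : ∀ i j → In n i → In n j → undroopZ (zone a a' i) (zone b b' j) (T' i j) ≡ T i j
  undone i j pi pj = undroop-droop (cell pi pj (inZone i a<a') (inZone j b<b'))

  exit' : ∀ r → h' r (suc n) ≡ h r (suc n)
  exit' = newExit h

  wn-label : h' a' b' ≡ p
  wn-label rewrite zone-≡ a<a' (isHi {a} {a'} refl) | firstIn-≡ b<b' (isHi {b} {b'} refl) = refl

  private
    lem-hihi : ∀ {t w e m s} → OldCell p hi hi t w e m s → droopZ hi hi t ≡ jelbow ⊎ droopZ hi hi t ≡ bump
    lem-hihi (outside () _)
    lem-hihi (hihi-b _) = inj₁ refl
    lem-hihi (hihi-r _ _) = inj₂ refl
    lem-midhi : ∀ {t w e m s} → OldCell p mid hi t w e m s → droopZ mid hi t ≡ cross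
    lem-midhi (outside () _)
    lem-midhi (midhi _ _) = refl
    lem-himid : ∀ {t w e m s} → OldCell p hi mid t w e m s → droopZ hi mid t ≡ cross
    lem-himid (outside () _)
    lem-himid (himid _ _) = refl
    lem-lohi : ∀ {t w e m s} → OldCell p lo hi t w e m s → droopZ lo hi t ≢ cross
    lem-lohi (outside () _)
    lem-lohi (lohi-h _) ()
    lem-lohi (lohi-j _) ()
    lem-hilo : ∀ {t w e m s} → OldCell p hi lo t w e m s → droopZ hi lo t ≢ cross
    lem-hilo (outside () _)
    lem-hilo (hilo-v _) ()
    lem-hilo (hilo-j _) ()

  can' : CanUndroop T' a b a' b'
  can' = record
    { corner = subst (λ t → t ≡ jelbow ⊎ t ≡ bump) (sym (T'-zone (isHi refl) (isHi refl))) (lem-hihi (cell ina' inb' (isHi refl) (isHi refl)))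
    ; colX = λ i x y → trans (T'-zone (isMid x y) (isHi refl)) (lem-midhi (cell (rowIn x (<⇒≤ y)) inb' (isMid x y) (isHi refl)))
    ; rowX = λ j x y → trans (T'-zone (isHi refl) (isMid x y)) (lem-himid (cell ina' (colIn x (<⇒≤ y)) (isHi refl) (isMid x y)))
    ; colE = λ e → lem-lohi (cell ina inb' (isLo refl) (isHi refl)) (trans (sym (T'-zone (isLo refl) (isHi refl))) e)
    ; rowE = λ e → lem-hilo (cell ina' inb (isHi refl) (isLo refl)) (trans (sym (T'-zone (isHi refl) (isLo refl))) e)
    }

  -- The droop takes the r-turn away from (a , b), so a bump there becomes a j-elbow; the only tile
  -- that turns into a bump is an r-elbow in the opposite corner.
  only' : OnlyBump n T' a' b'
  only' i j pi pj e = go (inZone i a<a') (inZone j b<b') (cell pi pj (inZone i a<a') (inZone j b<b')) e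
    where
    go : ∀ {z z' w e m s} → InZone a a' i z → InZone b b' j z' → OldCell p z z' (T i j) w e m s → droopZ z z' (T i j) ≡ bump → i ≡ a' × j ≡ b'
    go {z} {z'} x y c e = lem x y c e (λ o e' → conflict o x y (ob i j pi pj (trans (sym (droopZ-outside (T i j) o)) e')))
      where
      conflict : ∀ {z z'} → Outside z z' → InZone a a' i z → InZone b b' j z' → i ≡ a × j ≡ b → ⊥
      conflict above (isBefore x) _ (refl , _) = <-irrefl refl x
      conflict below (isAfter x) _ (refl , _) = <-asym x a<a'
      conflict leftOf _ (isBefore x) (_ , refl) = <-irrefl refl x
      conflict rightOf _ (isAfter x) (_ , refl) = <-asym x b<b'
      conflict middle (isMid x _) _ (refl , _) = <-irrefl refl x
      lem : ∀ {z z' t w e m s} → InZone a a' i z → InZone b b' j z' → OldCell p z z' t w e m s → droopZ z z' t ≡ bump → (Outside z z' → droopZ z z' t ≡ bump → ⊥) → i ≡ a' × j ≡ b'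
      lem _ _ (outside o _) e f = ⊥-elim (f o e)
      lem (isHi x) (isHi y) (hihi-r _ _) e f = x , y
      lem _ _ (lolo-r _) () f
      lem _ _ (lolo-b _ _) () f
      lem _ _ (midlo _ _) () f
      lem _ _ (hilo-v _) () f
      lem _ _ (hilo-j _) () f
      lem _ _ (lomid _ _) () f
      lem _ _ (himid _ _) () f
      lem _ _ (lohi-h _) () f
      lem _ _ (lohi-j _) () f
      lem _ _ (midhi _ _) () f
      lem _ _ (hihi-b _) () f

  -- All pairs of zones except the two corners, the only cells where a droop can create or consume a
  -- blank.
  data Same : Zone → Zone → Set where
    rowOther : ∀ {z z'} → z ≢ lo → z ≢ hi → Same z z'
    rowLo : ∀ {z'} → z' ≢ lo → Same lo z'
    rowHi : ∀ {z'} → z' ≢ hi → Same hi z'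

  private
    same-blank : ∀ {z z' t w e m s} → Same z z' → OldCell p z z' t w e m s → isTile blank (droopZ z z' t) ≡ isTile blank t
    same-blank {t = t} sm (outside o _) = cong (isTile blank) (droopZ-outside t o)
    same-blank (rowOther ne _) (lolo-r _) = ⊥-elim (ne refl)
    same-blank (rowLo ne) (lolo-r _) = ⊥-elim (ne refl)
    same-blank sm (lolo-b _ _) = refl
    same-blank sm (midlo _ _) = refl
    same-blank sm (hilo-v _) = refl
    same-blank sm (hilo-j _) = refl
    same-blank sm (lomid _ _) = refl
    same-blank sm (himid _ _) = refl
    same-blank sm (lohi-h _) = refl
    same-blank sm (lohi-j _) = refl
    same-blank sm (midhi _ _) = refl
    same-blank (rowOther _ ne) (hihi-b _) = ⊥-elim (ne refl)
    same-blank (rowHi ne) (hihi-b _) = ⊥-elim (ne refl)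
    same-blank sm (hihi-r _ _) = refl

    lolo-blank : ∀ {t w e m s} → OldCell p lo lo t w e m s → isTile blank t ≡ false × isTile blank (droopZ lo lo t) ≡ isTile relbow t
    lolo-blank (outside () _)
    lolo-blank (lolo-r _) = refl , refl
    lolo-blank (lolo-b _ _) = refl , refl

    hihi-blank : ∀ {t w e m s} → OldCell p hi hi t w e m s → isTile blank t ≡ isTile jelbow (droopZ hi hi t) × isTile blank (droopZ hi hi t) ≡ false
    hihi-blank (outside () _)
    hihi-blank (hihi-b _) = refl , refl
    hihi-blank (hihi-r _ _) = refl , refl

    sameAt : ∀ i j → In n i → In n j → (∀ {z z'} → InZone a a' i z → InZone b b' j z' → Same z z') → isBlank T i j ≡ isBlank T' i j
    sameAt i j pi pj f = cong b2n (sym (same-blank (f (inZone i a<a') (inZone j b<b')) (cell pi pj (inZone i a<a') (inZone j b<b'))))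

  -- An r-elbow leaves a blank behind at (a , b), a j-elbow at (a' , b') has used one up, and bumps
  -- do neither. Counting an elbow at the turn as a blank therefore balances each row.
  Balanced : ℕ → Set
  Balanced i = rowSum (isBlank T) n i + b2n ((i ≡ᵇ a) ∧ isTile relbow (T a b)) ≡ rowSum (isBlank T') n i + b2n ((i ≡ᵇ a') ∧ isTile jelbow (T' a' b'))

  weight' : ∀ i → In n i → Balanced i
  weight' i pi = go (inZone i a<a')
    where
    off : ∀ {c d} → i ≢ c → b2n ((i ≡ᵇ c) ∧ d) ≡ 0
    off ne rewrite ≡ᵇ-false ne = refl
    on : ∀ {c d} → i ≡ c → b2n ((i ≡ᵇ c) ∧ d) ≡ b2n d
    on {c} refl rewrite ≡ᵇ-refl c = refl
    other : i ≢ a → i ≢ a' → Balanced i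
    other ne ne' = cong₂ _+_ (sumTo-cong n (λ j lt → sameAt i (suc j) pi (s≤s z≤n , lt) (λ { (isLo e) _ → ⊥-elim (ne e) ; (isHi e) _ → ⊥-elim (ne' e)
        ; (isBefore _) _ → rowOther (λ ()) (λ ()) ; (isMid _ _) _ → rowOther (λ ()) (λ ()) ; (isAfter _) _ → rowOther (λ ()) (λ ()) }))) (trans (off ne) (sym (off ne')))
    go : ∀ {z} → InZone a a' i z → Balanced i
    go (isBefore x) = other (<⇒≢ x) (<⇒≢ (<-trans x a<a'))
    go (isMid x y) = other (>⇒≢ x) (<⇒≢ y)
    go (isAfter x) = other (>⇒≢ (<-trans a<a' x)) (>⇒≢ x)
    go (isLo refl) = sym (trans (cong (rowSum (isBlank T') n i +_) (trans (off (<⇒≢ a<a')) (cong b2n (sym (proj₁ bl)))))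
       (trans (upd inb) (cong (rowSum (isBlank T) n i +_) (trans (cong b2n (trans (cong (isTile blank) (T'-zone (isLo refl) (isLo refl))) (proj₂ bl))) (sym (on refl))))))
      where
      bl = lolo-blank (cell ina inb (isLo refl) (isLo refl))
      upd : In n b → rowSum (isBlank T') n i + isBlank T i b ≡ rowSum (isBlank T) n i + isBlank T' i b
      upd (s≤s {n = c} z≤n , c≤) = sumTo-update _ _ n c c≤ (λ j lt ne → sameAt i (suc j) pi (s≤s z≤n , lt)
           (λ { (isLo _) (isLo e) → ⊥-elim (ne (suc-injective e)) ; (isLo _) (isBefore _) → rowLo (λ ()) ; (isLo _) (isMid _ _) → rowLo (λ ()) ; (isLo _) (isHi _) → rowLo (λ ()) ; (isLo _) (isAfter _) → rowLo (λ ())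
              ; (isHi e) _ → ⊥-elim (<⇒≢ a<a' e) ; (isBefore _) _ → rowOther (λ ()) (λ ()) ; (isMid _ _) _ → rowOther (λ ()) (λ ()) ; (isAfter _) _ → rowOther (λ ()) (λ ()) }))
    go (isHi refl) = sym (trans (cong (rowSum (isBlank T') n i +_) (trans (on refl) (cong b2n (trans (cong (isTile jelbow) (T'-zone (isHi refl) (isHi refl))) (sym (proj₁ bl))))))
       (trans (upd inb') (cong (rowSum (isBlank T) n i +_) (trans (cong b2n (trans (cong (isTile blank) (T'-zone (isHi refl) (isHi refl))) (proj₂ bl))) (sym (off (>⇒≢ a<a')))))))
      where
      bl = hihi-blank (cell ina' inb' (isHi refl) (isHi refl))
      upd : In n b' → rowSum (isBlank T') n i + isBlank T i b' ≡ rowSum (isBlank T) n i + isBlank T' i b'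
      upd (s≤s {n = c} z≤n , c≤) = sumTo-update _ _ n c c≤ (λ j lt ne → sameAt i (suc j) pi (s≤s z≤n , lt)
           (λ { (isHi _) (isHi e) → ⊥-elim (ne (suc-injective e)) ; (isHi _) (isBefore _) → rowHi (λ ()) ; (isHi _) (isMid _ _) → rowHi (λ ()) ; (isHi _) (isLo _) → rowHi (λ ()) ; (isHi _) (isAfter _) → rowHi (λ ())
              ; (isLo e) _ → ⊥-elim (>⇒≢ a<a' e) ; (isBefore _) _ → rowOther (λ ()) (λ ()) ; (isMid _ _) _ → rowOther (λ ()) (λ ()) ; (isAfter _) _ → rowOther (λ ()) (λ ()) }))

module Undroop {n T h v a b a' b'} (L : Lab _<_ n T h v) (Rc : Rect n a b a' b') (D : CanUndroop T a b a' b') (ob : OnlyBump n T a' b') where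
  open Rect Rc
  open UndroopFacts L Rc D ob using (p; 0<p; cell) public
  open Redrawn n a b a' b' Rc p 0

  T' : ℕ → ℕ → Tile
  T' i j = undroopZ (zone a a' i) (zone b b' j) (T i j)

  h' v' : ℕ → ℕ → ℕ
  h' = newH h
  v' = newV v

  T'-zone : ∀ {i j z z'} → InZone a a' i z → InZone b b' j z' → T' i j ≡ undroopZ z z' (T i j)
  T'-zone x y rewrite zone-≡ a<a' x | zone-≡ b<b' y = refl

  lab' : Lab _<_ n T' h' v'
  lab' = newLab L (λ pi pj x y → castLoc (T'-zone x y) refl refl refl refl (before-loc (undroopCell (cell pi pj x y))))

  redone : ∀ i j → In n i → In n j → droopZ (zone a a' i) (zone b b' j) (T' i j) ≡ T i j
  redone i j pi pj = droop-undroop (cell pi pj (inZone i a<a') (inZone j b<b'))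

  exit' : ∀ r → h' r (suc n) ≡ h r (suc n)
  exit' = newExit h

  se-label : h' a (suc b) ≡ p
  se-label rewrite zone-≡ a<a' (isLo {a} {a'} refl) | secondIn-≡ b<b' (isLo {b} {b'} refl) = refl

  private
    lem-lolo : ∀ {t w e m s} → NewCell p lo lo t w e m s → undroopZ lo lo t ≡ relbow ⊎ undroopZ lo lo t ≡ bump
    lem-lolo (outside () _)
    lem-lolo (lolo-r _) = inj₁ refl
    lem-lolo (lolo-b _ _) = inj₂ refl
    lem-midlo : ∀ {t w e m s} → NewCell p mid lo t w e m s → undroopZ mid lo t ≡ cross
    lem-midlo (outside () _)
    lem-midlo (midlo _ _) = refl
    lem-lomid : ∀ {t w e m s} → NewCell p lo mid t w e m s → undroopZ lo mid t ≡ cross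
    lem-lomid (outside () _)
    lem-lomid (lomid _ _) = refl
    lem-lohi : ∀ {t w e m s} → NewCell p lo hi t w e m s → undroopZ lo hi t ≢ cross
    lem-lohi (outside () _)
    lem-lohi (lohi-h _) ()
    lem-lohi (lohi-j _) ()
    lem-hilo : ∀ {t w e m s} → NewCell p hi lo t w e m s → undroopZ hi lo t ≢ cross
    lem-hilo (outside () _)
    lem-hilo (hilo-v _) ()
    lem-hilo (hilo-j _) ()

  can' : CanDroop T' a b a' b'
  can' = record
    { corner = subst (λ t → t ≡ relbow ⊎ t ≡ bump) (sym (T'-zone (isLo refl) (isLo refl))) (lem-lolo (cell ina inb (isLo refl) (isLo refl)))
    ; colX = λ i x y → trans (T'-zone (isMid x y) (isLo refl)) (lem-midlo (cell (rowIn x (<⇒≤ y)) inb (isMid x y) (isLo refl)))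
    ; rowX = λ j x y → trans (T'-zone (isLo refl) (isMid x y)) (lem-lomid (cell ina (colIn x (<⇒≤ y)) (isLo refl) (isMid x y)))
    ; colE = λ e → lem-hilo (cell ina' inb (isHi refl) (isLo refl)) (trans (sym (T'-zone (isHi refl) (isLo refl))) e)
    ; rowE = λ e → lem-lohi (cell ina inb' (isLo refl) (isHi refl)) (trans (sym (T'-zone (isLo refl) (isHi refl))) e)
    }

  only' : OnlyBump n T' a b
  only' i j pi pj e = go (inZone i a<a') (inZone j b<b') (cell pi pj (inZone i a<a') (inZone j b<b')) e
    where
    go : ∀ {z z' w e m s} → InZone a a' i z → InZone b b' j z' → NewCell p z z' (T i j) w e m s → undroopZ z z' (T i j) ≡ bump → i ≡ a × j ≡ b
    go {z} {z'} x y c e = lem x y c e (λ o e' → conflict o x y (ob i j pi pj (trans (sym (undroopZ-outside (T i j) o)) e')))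
      where
      conflict : ∀ {z z'} → Outside z z' → InZone a a' i z → InZone b b' j z' → i ≡ a' × j ≡ b' → ⊥
      conflict above (isBefore x) _ (refl , _) = <-asym x a<a'
      conflict below (isAfter x) _ (refl , _) = <-irrefl refl x
      conflict leftOf _ (isBefore x) (_ , refl) = <-asym x b<b'
      conflict rightOf _ (isAfter x) (_ , refl) = <-irrefl refl x
      conflict middle (isMid _ x) _ (refl , _) = <-irrefl refl x
      lem : ∀ {z z' t w e m s} → InZone a a' i z → InZone b b' j z' → NewCell p z z' t w e m s → undroopZ z z' t ≡ bump → (Outside z z' → undroopZ z z' t ≡ bump → ⊥) → i ≡ a × j ≡ b
      lem _ _ (outside o _) e f = ⊥-elim (f o e)
      lem (isLo x) (isLo y) (lolo-b _ _) e f = x , y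
      lem _ _ (lolo-r _) () f
      lem _ _ (hihi-r _ _) () f
      lem _ _ (midlo _ _) () f
      lem _ _ (hilo-v _) () f
      lem _ _ (hilo-j _) () f
      lem _ _ (lomid _ _) () f
      lem _ _ (himid _ _) () f
      lem _ _ (lohi-h _) () f
      lem _ _ (lohi-j _) () f
      lem _ _ (midhi _ _) () f
      lem _ _ (hihi-b _) () f

-- Grids as lists

nth-0 : ∀ (xs : List X) → nth xs 0 ≡ nothing
nth-0 [] = refl
nth-0 (_ ∷ _) = refl

isTile-cross : ∀ t → isTile cross t ≡ true → t ≡ cross
isTile-cross cross _ = refl

nth-just : ∀ (xs : List X) {i} → In (length xs) i → Σ X λ x → nth xs i ≡ just x
nth-just (x ∷ xs) {suc zero} p = x , refl
nth-just (x ∷ xs) {suc (suc i)} (_ , s≤s le) = nth-just xs (s≤s z≤n , le)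

nth-bound : ∀ (xs : List X) {i x} → nth xs i ≡ just x → In (length xs) i
nth-bound (y ∷ ys) {suc zero} e = s≤s z≤n , s≤s z≤n
nth-bound (y ∷ ys) {suc (suc i)} e = s≤s z≤n , s≤s (proj₂ (nth-bound ys e))

nth-ext : ∀ (xs ys : List X) → length xs ≡ length ys → (∀ i → In (length xs) i → nth xs i ≡ nth ys i) → xs ≡ ys
nth-ext [] [] e f = refl
nth-ext (x ∷ xs) (y ∷ ys) e f = cong₂ _∷_ (just-injective (f 1 (s≤s z≤n , s≤s z≤n)))
  (nth-ext xs ys (suc-injective e) (λ { (suc i) (_ , le) → f (suc (suc i)) (s≤s z≤n , s≤s le) }))

nth-applyUpTo : ∀ (f : ℕ → X) n i → i < n → nth (applyUpTo f n) (suc i) ≡ just (f i)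
nth-applyUpTo f (suc n) zero lt = refl
nth-applyUpTo f (suc n) (suc i) (s≤s lt) = nth-applyUpTo (f ∘ suc) n i lt

nth-map : ∀ (f : X → Y) xs {i x} → nth xs i ≡ just x → nth (map f xs) i ≡ just (f x)
nth-map f (x ∷ xs) {suc zero} refl = refl
nth-map f (x ∷ xs) {suc (suc i)} e = nth-map f xs e

nth-++ˡ : ∀ (xs ys : List X) {i x} → nth xs i ≡ just x → nth (xs ++ ys) i ≡ just x
nth-++ˡ (x ∷ xs) ys {suc zero} e = e
nth-++ˡ (x ∷ xs) ys {suc (suc i)} e = nth-++ˡ xs ys e

nth-last : ∀ (xs : List X) y → nth (xs ++ y ∷ []) (suc (length xs)) ≡ just y
nth-last [] y = refl
nth-last (x ∷ []) y = refl
nth-last (x ∷ x' ∷ xs) y = nth-last (x' ∷ xs) y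

modNth-spec : ∀ (f : X → Maybe X) i xs {x y} → nth xs i ≡ just x → f x ≡ just y →
  Σ (List X) λ ys → modNth f i xs ≡ just ys × length ys ≡ length xs × nth ys i ≡ just y × (∀ k → k ≢ i → nth ys k ≡ nth xs k)
modNth-spec f (suc zero) (x ∷ xs) refl e rewrite e = _ , refl , refl , refl ,
  λ { zero _ → refl ; (suc zero) ne → ⊥-elim (ne refl) ; (suc (suc k)) _ → refl }
modNth-spec f (suc (suc i)) (x ∷ xs) p e with modNth-spec f (suc i) xs p e
... | ys , q , len , on , off rewrite q = x ∷ ys , refl , cong suc len , on ,
  λ { zero _ → refl ; (suc zero) ne → refl ; (suc (suc k)) ne → off (suc k) (ne ∘ cong suc) }

tile : Grid → ℕ → ℕ → Tile
tile g i j = fromMaybe blank (tileAt g i j)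

record Sq (n : ℕ) (g : Grid) : Set where
  constructor mkSq
  field
    side : length g ≡ n
    rows : ∀ i row → nth g i ≡ just row → length row ≡ n

tileAt-in : ∀ {n g i j} → Sq n g → In n i → In n j → tileAt g i j ≡ just (tile g i j)
tileAt-in {n} {g} {i} {j} (mkSq len rows) pi pj with nth-just g {i} (subst (λ z → In z i) (sym len) pi)
... | row , e with nth-just row {j} (subst (λ z → In z j) (sym (rows i row e)) pj)
...   | t , e' rewrite e | e' = refl

mkGrid : ℕ → (ℕ → ℕ → Tile) → Grid
mkGrid n T = applyUpTo (λ i → applyUpTo (λ j → T (suc i) (suc j)) n) n

mkGrid-sq : ∀ n T → Sq n (mkGrid n T)
mkGrid-sq n T = mkSq (length-applyUpTo _ n) λ { (suc i) row e → rows i row (proj₂ (subst (λ z → In z (suc i)) (length-applyUpTo _ n) (nth-bound (mkGrid n T) e))) e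
                                         ; zero row e → ⊥-elim (1+n≰n {0} (proj₁ (nth-bound (mkGrid n T) e))) }
  where
  rows : ∀ i row → i < n → nth (mkGrid n T) (suc i) ≡ just row → length row ≡ n
  rows i row lt e with trans (sym (nth-applyUpTo (λ i → applyUpTo (λ j → T (suc i) (suc j)) n) n i lt)) e
  ... | refl = length-applyUpTo _ n

mkGrid-tile : ∀ n T i j → In n i → In n j → tile (mkGrid n T) i j ≡ T i j
mkGrid-tile n T (suc i) (suc j) (_ , i<) (_ , j<)
  rewrite nth-applyUpTo (λ i → applyUpTo (λ j → T (suc i) (suc j)) n) n i i< | nth-applyUpTo (λ j → T (suc i) (suc j)) n j j< = refl

grid-ext : ∀ {n g g'} → Sq n g → Sq n g' → (∀ i j → In n i → In n j → tile g i j ≡ tile g' i j) → g ≡ g'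
grid-ext {n} {g} {g'} s@(mkSq len rows) s'@(mkSq len' rows') e = nth-ext g g' (trans len (sym len')) row
  where
  row : ∀ i → In (length g) i → nth g i ≡ nth g' i
  row i pi with nth-just g pi | nth-just g' (subst (λ z → In z i) (trans len (sym len')) pi)
  ... | r , p | r' , p' = trans p (trans (cong just (nth-ext r r' (trans (rows i r p) (sym (rows' i r' p'))) λ j pj →
          trans (sym (at g p j)) (trans (tileAt-in s (in' pi) (inr pj)) (trans (cong just (e i j (in' pi) (inr pj))) (trans (sym (tileAt-in s' (in' pi) (inr pj))) (at g' p' j)))))) (sym p'))
    where
    in' : In (length g) i → In n i
    in' = subst (λ z → In z i) len
    inr : ∀ {j} → In (length r) j → In n j
    inr {j} = subst (λ z → In z j) (rows i r p)
    at : ∀ g {r} → nth g i ≡ just r → ∀ j → tileAt g i j ≡ nth r j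
    at g q j rewrite q = refl

record Modified (n : ℕ) (op : Grid → Maybe Grid) (g : Grid) (Hit : ℕ → ℕ → Set) (t : ℕ → ℕ → Tile) : Set where
  field
    grid′ : Grid
    result : op g ≡ just grid′
    sq : Sq n grid′
    on : ∀ i j → Hit i j → tile grid′ i j ≡ t i j
    off : ∀ i j → ¬ Hit i j → tile grid′ i j ≡ tile g i j

private
  modTile-modified : ∀ {n g i j t} f → Sq n g → In n i → In n j → f (tile g i j) ≡ just t →
    Modified n (modTile f i j) g (λ i' j' → i' ≡ i × j' ≡ j) (λ _ _ → t)
  modTile-modified {n} {g} {i} {j} {t} f s@(mkSq len rows) pi pj e
    with nth-just g {i} (subst (λ z → In z i) (sym len) pi)
  ... | row , er with nth-just row {j} (subst (λ z → In z j) (sym (rows i row er)) pj)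
  ...   | u , eu with modNth-spec f j row eu (subst (λ z → f z ≡ just t) (tl g er eu) e)
    where
    tl : ∀ g {row u} → nth g i ≡ just row → nth row j ≡ just u → tile g i j ≡ u
    tl g p q rewrite p | q = refl
  ...     | row' , q , rlen , rhere , raway with modNth-spec (modNth f j) i g er q
  ...       | g' , q' , glen , ghere , gaway = record
    { grid′ = g' ; result = q' ; sq = mkSq (trans glen len) rows'
    ; on = λ { _ _ (refl , refl) → tl g' ghere rhere }
    ; off = offs }
    where
    tl : ∀ g {row u} → nth g i ≡ just row → nth row j ≡ just u → tile g i j ≡ u
    tl g p q rewrite p | q = refl
    rows' : ∀ k r → nth g' k ≡ just r → length r ≡ n
    rows' k r p with k ≟ i
    ... | yes refl with trans (sym ghere) p
    ...   | refl = trans rlen (rows i row er)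
    rows' k r p | no ne = rows k r (trans (sym (gaway k ne)) p)
    offs : ∀ i' j' → ¬ (i' ≡ i × j' ≡ j) → tile g' i' j' ≡ tile g i' j'
    offs i' j' ne with i' ≟ i
    ... | no ni = cong (λ m → fromMaybe blank (m >>= λ r → nth r j')) (gaway i' ni)
    ... | yes refl with j' ≟ j
    ...   | yes refl = ⊥-elim (ne (refl , refl))
    ...   | no nj rewrite ghere | er = cong (fromMaybe blank) (raway j' nj)

-- opaque, like redraw-spec below: the modified grids must not be unfolded
abstract
  modTile-spec : ∀ {n g i j t} f → Sq n g → In n i → In n j → f (tile g i j) ≡ just t →
    Modified n (modTile f i j) g (λ i' j' → i' ≡ i × j' ≡ j) (λ _ _ → t)
  modTile-spec = modTile-modified

applyUpTo-cong : ∀ {f g : ℕ → X} n → (∀ x → f x ≡ g x) → applyUpTo f n ≡ applyUpTo g n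
applyUpTo-cong zero e = refl
applyUpTo-cong (suc n) e = cong₂ _∷_ (e 0) (applyUpTo-cong n (e ∘ suc))

rangeFrom-∷ : ∀ s len → rangeFrom s (suc len) ≡ s ∷ rangeFrom (suc s) len
rangeFrom-∷ s len = cong₂ _∷_ (+-identityʳ s) (applyUpTo-cong len (+-suc s))

-- `pos` parametrises a stretch of a row or of a column, so that one lemma serves all four loops of
-- a droop; its injectivity ensures that no cell is modified twice.
forEach-spec : ∀ {n} f (pos : ℕ → Cell) (φ : ℕ → ℕ → Tile) s len g → Sq n g → (∀ x y → pos x ≡ pos y → x ≡ y) →
  (∀ x → s ≤ x → x < len + s → In n (proj₁ (pos x)) × In n (proj₂ (pos x)) ×
       f (tile g (proj₁ (pos x)) (proj₂ (pos x))) ≡ just (φ (proj₁ (pos x)) (proj₂ (pos x)))) →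
  Modified n (forEach (rangeFrom s len) (λ x → modTile f (proj₁ (pos x)) (proj₂ (pos x)))) g
    (λ i j → Σ ℕ λ x → s ≤ x × x < len + s × (i , j) ≡ pos x) φ
forEach-spec f pos φ s zero g sq inj ok = record { grid′ = g ; result = refl ; sq = sq
  ; on = λ { i j (x , p , q , _) → ⊥-elim (<⇒≱ q p) } ; off = λ _ _ _ → refl }
forEach-spec {n} f pos φ s (suc len) g sq inj ok
  with ok s ≤-refl (s≤s (m≤n+m s len))
... | pi , pj , e with modTile-spec {g = g} f sq pi pj e
...   | M with forEach-spec f pos φ (suc s) len (Modified.grid′ M) (Modified.sq M) inj
               (λ x p q → let (pi' , pj' , e') = ok x (<⇒≤ p) (≤-trans q (≤-reflexive (+-suc len s))) in
                  pi' , pj' , trans (cong f (Modified.off M _ _ (λ { (a , b) → >⇒≢ p (inj x s (cong₂ _,_ a b)) }))) e')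
...     | N = record { grid′ = Modified.grid′ N
                     ; result = trans (cong (λ l → forEach l (λ x → modTile f (proj₁ (pos x)) (proj₂ (pos x))) g) (rangeFrom-∷ s len))
                                 (trans (cong (λ m → m >>= forEach (rangeFrom (suc s) len) (λ x → modTile f (proj₁ (pos x)) (proj₂ (pos x)))) (Modified.result M)) (Modified.result N))
                     ; sq = Modified.sq N ; on = on' ; off = off' }
  where
  on' : ∀ i j → (Σ ℕ λ x → s ≤ x × x < suc len + s × (i , j) ≡ pos x) → tile (Modified.grid′ N) i j ≡ φ i j
  on' i j (x , p , q , refl) with m≤n⇒m<n∨m≡n p
  ... | inj₁ lt = Modified.on N i j (x , lt , ≤-trans q (≤-reflexive (sym (+-suc len s))) , refl)
  ... | inj₂ refl = trans (Modified.off N i j (λ { (y , p' , _ , r) → <⇒≢ p' (inj s y r) })) (Modified.on M i j (refl , refl))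
  off' : ∀ i j → ¬ (Σ ℕ λ x → s ≤ x × x < suc len + s × (i , j) ≡ pos x) → tile (Modified.grid′ N) i j ≡ tile g i j
  off' i j miss = trans (Modified.off N i j (λ { (x , p , q , r) → miss (x , <⇒≤ p , ≤-trans q (≤-reflexive (+-suc len s)) , r) }))
                      (Modified.off M i j (λ { (refl , refl) → miss (s , ≤-refl , s≤s (m≤n+m s len) , refl) }))

findᵇ-∷ : ∀ (p : X → Bool) x xs → findᵇ p (x ∷ xs) ≡ (if p x then just x else findᵇ p xs)
findᵇ-∷ p x xs with p x
... | true = refl
... | false = refl

filterᵇ-∷ : ∀ (p : X → Bool) x xs → filterᵇ p (x ∷ xs) ≡ (if p x then x ∷ filterᵇ p xs else filterᵇ p xs)
filterᵇ-∷ p x xs with p x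
... | true = refl
... | false = refl

findᵇ-range : ∀ (p : ℕ → Bool) s len y → s ≤ y → y < len + s → p y ≡ true → (∀ x → s ≤ x → x < y → p x ≡ false) →
  findᵇ p (rangeFrom s len) ≡ just y
findᵇ-range p s zero y le lt _ _ = ⊥-elim (<⇒≱ lt le)
findᵇ-range p s (suc len) y le lt py none = trans (cong (findᵇ p) (rangeFrom-∷ s len)) (trans (findᵇ-∷ p s (rangeFrom (suc s) len)) go)
  where
  go : (if p s then just s else findᵇ p (rangeFrom (suc s) len)) ≡ just y
  go with m≤n⇒m<n∨m≡n le
  ... | inj₂ refl rewrite py = refl
  ... | inj₁ s<y rewrite none s ≤-refl s<y = findᵇ-range p (suc s) len y s<y (≤-trans lt (≤-reflexive (sym (+-suc len s)))) py (λ x a b → none x (<⇒≤ a) b)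

findFirst : ∀ (p : ℕ → Bool) s len → p (len + s) ≡ true →
  Σ ℕ λ y → s ≤ y × y ≤ len + s × p y ≡ true × (∀ x → s ≤ x → x < y → p x ≡ false)
findFirst p s zero e = s , ≤-refl , ≤-refl , e , λ x a b → ⊥-elim (<⇒≱ b a)
findFirst p s (suc len) e with p s in ps
... | true = s , ≤-refl , m≤n+m s (suc len) , ps , λ x a b → ⊥-elim (<⇒≱ b a)
... | false with findFirst p (suc s) len (subst (λ z → p z ≡ true) (sym (+-suc len s)) e)
...   | y , a , b , c , d = y , <⇒≤ a , ≤-trans b (≤-reflexive (+-suc len s)) , c , none
  where
  none : ∀ x → s ≤ x → x < y → p x ≡ false
  none x q r with m≤n⇒m<n∨m≡n q
  ... | inj₁ lt = d x lt r
  ... | inj₂ refl = ps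

filterNone : ∀ (q : ℕ → Bool) s len → (∀ x → s ≤ x → x < len + s → q x ≡ false) → filterᵇ q (rangeFrom s len) ≡ []
filterNone q s zero e = refl
filterNone q s (suc len) e = trans (cong (filterᵇ q) (rangeFrom-∷ s len)) (trans (filterᵇ-∷ q s _)
  (trans (cong (λ c → if c then s ∷ filterᵇ q (rangeFrom (suc s) len) else filterᵇ q (rangeFrom (suc s) len)) (e s ≤-refl (s≤s (m≤n+m s len))))
    (filterNone q (suc s) len (λ x u w → e x (<⇒≤ u) (≤-trans w (≤-reflexive (+-suc len s)))))))

lastFilter-range : ∀ (p : ℕ → Bool) s len y → s ≤ y → y < len + s → p y ≡ true → (∀ x → y < x → x < len + s → p x ≡ false) →
  last (filterᵇ p (rangeFrom s len)) ≡ just y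
lastFilter-range p s zero y le lt _ _ = ⊥-elim (<⇒≱ lt le)
lastFilter-range p s (suc len) y le lt py none = trans (cong (last ∘ filterᵇ p) (rangeFrom-∷ s len)) (trans (cong last (filterᵇ-∷ p s _)) go)
  where
  consLast : ∀ (x : ℕ) xs → last xs ≡ just y → last (x ∷ xs) ≡ just y
  consLast x (z ∷ zs) e = e
  go : last (if p s then s ∷ filterᵇ p (rangeFrom (suc s) len) else filterᵇ p (rangeFrom (suc s) len)) ≡ just y
  go with m≤n⇒m<n∨m≡n le
  ... | inj₂ refl rewrite py | filterNone p (suc s) len (λ x a b → none x a (≤-trans b (≤-reflexive (+-suc len s)))) = refl
  ... | inj₁ s<y with p s | lastFilter-range p (suc s) len y s<y (≤-trans lt (≤-reflexive (sym (+-suc len s)))) py (λ x a b → none x a (≤-trans b (≤-reflexive (+-suc len s))))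
  ...   | true | ih = consLast s (filterᵇ p (rangeFrom (suc s) len)) ih
  ...   | false | ih = ih

grow-sq : ∀ {n g} → Sq n g → Sq (suc n) (grow g)
grow-sq {n} {g} (mkSq len rows) = mkSq (trans (length-++ (map (λ row → row ++ (hor ∷ [])) g)) (trans (cong (_+ 1) (trans (length-map _ g) len)) (+-comm n 1))) rows'
  where
  rows' : ∀ i row → nth (grow g) i ≡ just row → length row ≡ suc n
  rows' i row e with nth-bound (grow g) e
  ... | 1≤i , i≤ with m≤n⇒m<n∨m≡n (≤-trans i≤ (≤-reflexive (trans (length-++ (map (λ row → row ++ (hor ∷ [])) g)) (trans (cong (_+ 1) (length-map _ g)) (+-comm (length g) 1)))))
  ...   | inj₁ (s≤s i≤n) with nth-just g (1≤i , i≤n)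
  ...     | r , er with trans (sym (nth-++ˡ (map _ g) _ (nth-map (λ row → row ++ (hor ∷ [])) g er))) e
  ...       | refl = trans (length-++ r) (trans (cong (_+ 1) (rows i r er)) (+-comm n 1))
  rows' i row e | 1≤i , i≤ | inj₂ refl with trans (sym (nth-last (map (λ row → row ++ (hor ∷ [])) g) _)) (trans (cong (λ z → nth (grow g) (suc z)) (length-map _ g)) e)
  ... | refl = trans (length-++ (map (λ _ → ver) g)) (trans (cong (_+ 1) (trans (length-map _ g) len)) (+-comm n 1))

module GrowTiles {n g} (s : Sq n g) where
  private
    len = Sq.side s
    rowAt : ∀ g i {j row t} → nth g i ≡ just row → nth row j ≡ just t → tile g i j ≡ t
    rowAt g i p q rewrite p | q = refl
    lastRow : nth (grow g) (suc n) ≡ just (map (λ _ → ver) g ++ (relbow ∷ []))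
    lastRow = subst (λ z → nth (grow g) (suc z) ≡ just (map (λ _ → ver) g ++ (relbow ∷ []))) (trans (length-map _ g) len)
                (nth-last (map (λ row → row ++ (hor ∷ [])) g) _)
    gj : ∀ {i} → In n i → Σ (List Tile) λ r → nth g i ≡ just r
    gj {i} pi = nth-just g (subst (λ z → In z i) (sym len) pi)
    upRow : ∀ {i r} → nth g i ≡ just r → nth (grow g) i ≡ just (r ++ (hor ∷ []))
    upRow er = nth-++ˡ (map (λ row → row ++ (hor ∷ [])) g) _ (nth-map (λ row → row ++ (hor ∷ [])) g er)

  grow-old : ∀ i j → In n i → In n j → tile (grow g) i j ≡ tile g i j
  grow-old i j pi pj with gj pi
  ... | r , er with nth-just r {j} (subst (λ z → In z j) (sym (Sq.rows s i r er)) pj)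
  ...   | t , et = trans (rowAt (grow g) i (upRow er) (nth-++ˡ r _ et)) (sym (rowAt g i er et))

  grow-right : ∀ i → In n i → tile (grow g) i (suc n) ≡ hor
  grow-right i pi with gj pi
  ... | r , er = rowAt (grow g) i (upRow er) (subst (λ z → nth (r ++ (hor ∷ [])) (suc z) ≡ just hor) (Sq.rows s i r er) (nth-last r hor))

  grow-bottom : ∀ j → In n j → tile (grow g) (suc n) j ≡ ver
  grow-bottom j pj = rowAt (grow g) (suc n) lastRow (nth-++ˡ (map (λ _ → ver) g) _ (nth-map (λ _ → ver) g (proj₂ (gj pj))))

  grow-corner : tile (grow g) (suc n) (suc n) ≡ relbow
  grow-corner = rowAt (grow g) (suc n) lastRow (subst (λ z → nth (map (λ _ → ver) g ++ (relbow ∷ [])) (suc z) ≡ just relbow) (trans (length-map _ g) len) (nth-last (map (λ _ → ver) g) relbow))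

  vtile-in : ∀ i j → In n i → In n j → vtile g i j ≡ just (tile g i j)
  vtile-in (suc i) (suc j) pi pj rewrite len | <ᵇ-true (proj₂ pi) | <ᵇ-true (proj₂ pj) = tileAt-in s pi pj

  vtile-grow : ∀ i j → In (suc n) i → In (suc n) j → vtile g i j ≡ just (tile (grow g) i j)
  vtile-grow (suc i) (suc j) (_ , s≤s i≤) (_ , s≤s j≤) with m≤n⇒m<n∨m≡n i≤ | m≤n⇒m<n∨m≡n j≤
  ... | inj₁ i< | inj₁ j< = trans (vtile-in (suc i) (suc j) (s≤s z≤n , i<) (s≤s z≤n , j<)) (cong just (sym (grow-old (suc i) (suc j) (s≤s z≤n , i<) (s≤s z≤n , j<))))
  ... | inj₁ i< | inj₂ refl = trans go (cong just (sym (grow-right (suc i) (s≤s z≤n , i<))))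
    where
    go : vtile g (suc i) (suc n) ≡ just hor
    go rewrite len | <ᵇ-true i< | <ᵇ-false (≤-refl {n}) = refl
  ... | inj₂ refl | inj₁ j< = trans go (cong just (sym (grow-bottom (suc j) (s≤s z≤n , j<))))
    where
    go : vtile g (suc n) (suc j) ≡ just ver
    go rewrite len | <ᵇ-true j< | <ᵇ-false (≤-refl {n}) = refl
  ... | inj₂ refl | inj₂ refl = trans go (cong just (sym grow-corner))
    where
    go : vtile g (suc n) (suc n) ≡ just relbow
    go rewrite len | <ᵇ-false (≤-refl {n}) | ≡ᵇ-refl n = refl

-- Min-droop as an operation on grids

bottomLeft topRight : Tile → Maybe Tile
bottomLeft t = if hasSeg SN t then (remSeg SN t >>= addSeg SE)
               else (if hasSeg WN t then (remSeg WN t >>= addSeg WE) else nothing)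
topRight t = if hasSeg WE t then (remSeg WE t >>= addSeg SE)
             else (if hasSeg WN t then (remSeg WN t >>= addSeg SN) else nothing)

-- What `minDroop` does after its two searches and the enlargement of the grid.
redraw : ℕ → ℕ → ℕ → ℕ → Grid → Maybe (Grid × Cell)
redraw a b a' b' g =
  modTile (remSeg SE) a b g >>=
  forEach (rangeFrom (suc a) (a' ∸ suc a)) (λ i → modTile (remSeg SN) i b) >>=
  modTile bottomLeft a' b >>=
  forEach (rangeFrom (suc b) (b' ∸ suc b)) (λ j → modTile (remSeg WE) a j) >>=
  modTile topRight a b' >>=
  forEach (rangeFrom (suc b) (b' ∸ suc b)) (λ j → modTile (addSeg WE) a' j) >>=
  forEach (rangeFrom (suc a) (a' ∸ suc a)) (λ i → modTile (addSeg SN) i b') >>=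
  modTile (addSeg WN) a' b' >>= λ g' →
  just (g' , (a' , b'))

minDroop-redraw : ∀ g a b a' b' → hasSeg SE (fromMaybe blank (vtile g a b)) ≡ true →
  findᵇ (λ i → not (isTileAt cross (vtile g i b))) (rangeFrom (suc a) (suc (length g) ∸ a)) ≡ just a' →
  findᵇ (λ j → not (isTileAt cross (vtile g a j))) (rangeFrom (suc b) (suc (length g) ∸ b)) ≡ just b' →
  minDroop g a b ≡ redraw a b a' b' (ensureSize (a' ⊔ b') g)
minDroop-redraw g a b a' b' e₁ e₂ e₃ rewrite e₁ | e₂ | e₃ = refl

bind : ∀ {m : Maybe X} {f : X → Maybe Y} {x y} → m ≡ just x → f x ≡ just y → (m >>= f) ≡ just y
bind refl e = e

eqZone : Zone → Zone → Bool
eqZone before before = true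
eqZone lo lo = true
eqZone mid mid = true
eqZone hi hi = true
eqZone after after = true
eqZone _ _ = false

eqZone-refl : ∀ z → eqZone z z ≡ true
eqZone-refl before = refl
eqZone-refl lo = refl
eqZone-refl mid = refl
eqZone-refl hi = refl
eqZone-refl after = refl

eqZone-sound : ∀ z z' → eqZone z z' ≡ true → z ≡ z'
eqZone-sound before before _ = refl
eqZone-sound lo lo _ = refl
eqZone-sound mid mid _ = refl
eqZone-sound hi hi _ = refl
eqZone-sound after after _ = refl

-- The eight edits act on eight disjoint pairs of zones. `Done d` says that exactly the pairs in `d`
-- have been redrawn, so each edit still meets an original tile, whose possible forms `OldCell`
-- lists.
module Redraw {n a b a' b' : ℕ} (Rc : Rect n a b a' b') (T : ℕ → ℕ → Tile) (p : ℕ) (H V : ℕ → ℕ → ℕ)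
  (cell : ∀ {i j z z'} → In n i → In n j → InZone a a' i z → InZone b b' j z' → OldCell p z z' (T i j) (H i j) (H i (suc j)) (V i j) (V (suc i) j)) where
  open Rect Rc

  private
    D : Set
    D = Zone → Zone → Bool
    _∪_ : Zone × Zone → D → D
    ((z , z') ∪ d) y y' = if eqZone y z ∧ eqZone y' z' then true else d y y'

    target : D → Zone → Zone → Tile → Tile
    target d z z' t = if d z z' then droopZ z z' t else t

    record Done (d : D) (g : Grid) : Set where
      field
        sq : Sq n g
        at : ∀ i j → In n i → In n j → tile g i j ≡ target d (zone a a' i) (zone b b' j) (T i j)

    Hit : Zone → Zone → ℕ → ℕ → Set
    Hit z z' i j = InZone a a' i z × InZone b b' j z'

    record Stage (d : D) (z z' : Zone) (op : Grid → Maybe Grid) (g : Grid) : Set where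
      field
        out : Grid
        result : op g ≡ just out
        done : Done ((z , z') ∪ d) out

    advance : ∀ {d g op} z z' {K} → Done d g → (M : Modified n op g K (λ i j → droopZ z z' (T i j))) →
      (∀ i j → In n i → In n j → Hit z z' i j → K i j) → (∀ i j → K i j → Hit z z' i j) → Stage d z z' op g
    advance {d} {g} z z' {K} dn M to from = record { out = grid′ ; result = result ; done = record { sq = sq ; at = at' } }
      where
      open Modified M
      at' : ∀ i j → In n i → In n j → tile grid′ i j ≡ target ((z , z') ∪ d) (zone a a' i) (zone b b' j) (T i j)
      at' i j pi pj with eqZone (zone a a' i) z ∧ eqZone (zone b b' j) z' in eq
      ... | true = trans (on i j (to i j pi pj (subst (InZone a a' i) zi (inZone i a<a') , subst (InZone b b' j) zj (inZone j b<b'))))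
                         (cong₂ (λ y y' → droopZ y y' (T i j)) (sym zi) (sym zj))
        where
        split : ∀ x y → x ∧ y ≡ true → x ≡ true × y ≡ true
        split true true _ = refl , refl
        zi = eqZone-sound _ _ (proj₁ (split (eqZone (zone a a' i) z) _ eq))
        zj = eqZone-sound _ _ (proj₂ (split (eqZone (zone a a' i) z) _ eq))
      ... | false = trans (off i j (λ k → bad (from i j k))) (Done.at dn i j pi pj)
        where
        bad : Hit z z' i j → ⊥
        bad (x , y) with trans (sym eq) (cong₂ _∧_ (trans (cong (λ w → eqZone w z) (zone-≡ a<a' x)) (eqZone-refl z)) (trans (cong (λ w → eqZone w z') (zone-≡ b<b' y)) (eqZone-refl z')))
        ... | ()

    fresh : ∀ {d g i j z z'} → Done d g → In n i → In n j → InZone a a' i z → InZone b b' j z' → d z z' ≡ false → tile g i j ≡ T i j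
    fresh {d} {i = i} {j} dn pi pj x y e = trans (Done.at dn i j pi pj) (trans (cong₂ (λ z z' → target d z z' (T i j)) (zone-≡ a<a' x) (zone-≡ b<b' y)) (off e))
      where
      off : ∀ {z z'} → d z z' ≡ false → target d z z' (T i j) ≡ T i j
      off q rewrite q = refl

    Acts : Zone → Zone → (Tile → Maybe Tile) → Set
    Acts z z' f = ∀ {t w e m s} → OldCell p z z' t w e m s → f t ≡ just (droopZ z z' t)

    single : ∀ {d g} i j z z' f → Done d g → d z z' ≡ false → In n i → In n j → Hit z z' i j →
      (∀ i' j' → Hit z z' i' j' → i' ≡ i × j' ≡ j) → Acts z z' f → Stage d z z' (modTile f i j) g
    single {g = g} i j z z' f dn e pi pj (x , y) uniq acts =
      advance z z' dn (record { grid′ = grid′ ; result = result ; sq = sq ; on = λ { i' j' (refl , refl) → on i' j' (refl , refl) } ; off = off }) (λ i' j' _ _ → uniq i' j') (λ { i' j' (refl , refl) → x , y })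
      where
      open Modified (modTile-spec {g = g} f (Done.sq dn) pi pj (trans (cong f (fresh dn pi pj x y e)) (acts (cell pi pj x y))))

    several : ∀ {d g} (pos : ℕ → Cell) z z' lo' hi' f → Done d g → d z z' ≡ false → lo' < hi' → (∀ x y → pos x ≡ pos y → x ≡ y) →
      (∀ x → lo' < x → x < hi' → In n (proj₁ (pos x)) × In n (proj₂ (pos x)) × Hit z z' (proj₁ (pos x)) (proj₂ (pos x))) →
      (∀ i j → Hit z z' i j → Σ ℕ λ x → lo' < x × x < hi' × (i , j) ≡ pos x) → Acts z z' f →
      Stage d z z' (forEach (rangeFrom (suc lo') (hi' ∸ suc lo')) (λ x → modTile f (proj₁ (pos x)) (proj₂ (pos x)))) g
    several pos z z' lo' hi' f dn e lt inj hit cover acts =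
      advance z z' dn (forEach-spec f pos (λ i j → droopZ z z' (T i j)) (suc lo') (hi' ∸ suc lo') _ (Done.sq dn) inj
          (λ x q r → let (pi , pj , (u , w)) = hit x q (conv r) in pi , pj , trans (cong f (fresh dn pi pj u w e)) (acts (cell pi pj u w))))
        (λ i j _ _ ht → let (x , q , r , s) = cover i j ht in x , q , ≤-trans r (≤-reflexive (sym end)) , s)
        (λ { i j (x , q , r , refl) → proj₂ (proj₂ (hit x q (conv r))) })
      where
      end : hi' ∸ suc lo' + suc lo' ≡ hi'
      end = m∸n+n≡m lt
      conv : ∀ {x} → x < hi' ∸ suc lo' + suc lo' → x < hi'
      conv r = ≤-trans r (≤-reflexive end)

    acts₁ : Acts lo lo (remSeg SE)
    acts₁ (outside () _)
    acts₁ (lolo-r _) = refl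
    acts₁ (lolo-b _ _) = refl
    acts₂ : Acts mid lo (remSeg SN)
    acts₂ (outside () _)
    acts₂ (midlo _ _) = refl
    acts₃ : Acts hi lo bottomLeft
    acts₃ (outside () _)
    acts₃ (hilo-v _) = refl
    acts₃ (hilo-j _) = refl
    acts₄ : Acts lo mid (remSeg WE)
    acts₄ (outside () _)
    acts₄ (lomid _ _) = refl
    acts₅ : Acts lo hi topRight
    acts₅ (outside () _)
    acts₅ (lohi-h _) = refl
    acts₅ (lohi-j _) = refl
    acts₆ : Acts hi mid (addSeg WE)
    acts₆ (outside () _)
    acts₆ (himid _ _) = refl
    acts₇ : Acts mid hi (addSeg SN)
    acts₇ (outside () _)
    acts₇ (midhi _ _) = refl
    acts₈ : Acts hi hi (addSeg WN)
    acts₈ (outside () _)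
    acts₈ (hihi-b _) = refl
    acts₈ (hihi-r _ _) = refl

    final : ∀ z z' t → target ((hi , hi) ∪ ((mid , hi) ∪ ((hi , mid) ∪ ((lo , hi) ∪ ((lo , mid) ∪ ((hi , lo) ∪ ((mid , lo) ∪ ((lo , lo) ∪ (λ _ _ → false))))))))) z z' t ≡ droopZ z z' t
    final before z' t = refl
    final after z' t = refl
    final lo before t = refl
    final lo lo t = refl
    final lo mid t = refl
    final lo hi t = refl
    final lo after t = refl
    final mid before t = refl
    final mid lo t = refl
    final mid mid t = refl
    final mid hi t = refl
    final mid after t = refl
    final hi before t = refl
    final hi lo t = refl
    final hi mid t = refl
    final hi hi t = refl
    final hi after t = refl

  private
    redrawn : ∀ g → Sq n g → (∀ i j → In n i → In n j → tile g i j ≡ T i j) →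
      Σ Grid λ g' → redraw a b a' b' g ≡ just (g' , (a' , b')) × Sq n g' × (∀ i j → In n i → In n j → tile g' i j ≡ droopZ (zone a a' i) (zone b b' j) (T i j))
    redrawn g s agree = Stage.out s₈ , eq , Done.sq (Stage.done s₈) , λ i j pi pj → trans (Done.at (Stage.done s₈) i j pi pj) (final (zone a a' i) (zone b b' j) (T i j))
      where
      d₀ : Done (λ _ _ → false) g
      d₀ = record { sq = s ; at = agree }
      s₁ = single a b lo lo (remSeg SE) d₀ refl ina inb (isLo refl , isLo refl) (λ { _ _ (isLo e , isLo e') → e , e' }) acts₁
      s₂ = several (λ i → (i , b)) mid lo a a' (remSeg SN) (Stage.done s₁) refl a<a' (λ _ _ → cong proj₁)
             (λ x q r → rowIn q (<⇒≤ r) , inb , isMid q r , isLo refl) (λ { i j (isMid q r , isLo refl) → i , q , r , refl }) acts₂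
      s₃ = single a' b hi lo bottomLeft (Stage.done s₂) refl ina' inb (isHi refl , isLo refl) (λ { _ _ (isHi e , isLo e') → e , e' }) acts₃
      s₄ = several (λ j → (a , j)) lo mid b b' (remSeg WE) (Stage.done s₃) refl b<b' (λ _ _ → cong proj₂)
             (λ x q r → ina , colIn q (<⇒≤ r) , isLo refl , isMid q r) (λ { i j (isLo refl , isMid q r) → j , q , r , refl }) acts₄
      s₅ = single a b' lo hi topRight (Stage.done s₄) refl ina inb' (isLo refl , isHi refl) (λ { _ _ (isLo e , isHi e') → e , e' }) acts₅
      s₆ = several (λ j → (a' , j)) hi mid b b' (addSeg WE) (Stage.done s₅) refl b<b' (λ _ _ → cong proj₂)
             (λ x q r → ina' , colIn q (<⇒≤ r) , isHi refl , isMid q r) (λ { i j (isHi refl , isMid q r) → j , q , r , refl }) acts₆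
      s₇ = several (λ i → (i , b')) mid hi a a' (addSeg SN) (Stage.done s₆) refl a<a' (λ _ _ → cong proj₁)
             (λ x q r → rowIn q (<⇒≤ r) , inb' , isMid q r , isHi refl) (λ { i j (isMid q r , isHi refl) → i , q , r , refl }) acts₇
      s₈ = single a' b' hi hi (addSeg WN) (Stage.done s₇) refl ina' inb' (isHi refl , isHi refl) (λ { _ _ (isHi e , isHi e') → e , e' }) acts₈
      eq : redraw a b a' b' g ≡ just (Stage.out s₈ , (a' , b'))
      eq = bind (bind (bind (bind (bind (bind (bind (bind (Stage.result s₁) (Stage.result s₂)) (Stage.result s₃)) (Stage.result s₄))
             (Stage.result s₅)) (Stage.result s₆)) (Stage.result s₇)) (Stage.result s₈)) refl

  abstract
    redraw-spec : ∀ g → Sq n g → (∀ i j → In n i → In n j → tile g i j ≡ T i j) →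
      Σ Grid λ g' → redraw a b a' b' g ≡ just (g' , (a' , b')) × Sq n g' × (∀ i j → In n i → In n j → tile g' i j ≡ droopZ (zone a a' i) (zone b b' j) (T i j))
    redraw-spec = redrawn

-- Tracing pipes

GoE GoN : Tile → Dir → Set
GoE t fromS = hasSeg SN t ≡ false × hasSeg SE t ≡ true
GoE t fromW = hasSeg WE t ≡ true
GoN t fromS = hasSeg SN t ≡ true
GoN t fromW = hasSeg WE t ≡ false × hasSeg WN t ≡ true

-- A successful run of `traceF`, freed of its fuel.
data Path (n : ℕ) (T : ℕ → ℕ → Tile) : ℕ → ℕ → Dir → ℕ → List Cell → Set where
  exitE : ∀ {i d} → GoE (T i n) d → Path n T i n d i ((i , n) ∷ [])
  goE : ∀ {i j d r ps} → GoE (T i j) d → j < n → Path n T i (suc j) fromW r ps → Path n T i j d r ((i , j) ∷ ps)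
  goN : ∀ {i j d r ps} → GoN (T (suc i) j) d → 1 ≤ i → Path n T i j fromS r ps → Path n T (suc i) j d r ((suc i , j) ∷ ps)

side : Dir → ℕ → ℕ → ℕ
side fromS w s = s
side fromW w s = w

leaves : ∀ {R t w e n s} d → Loc R t w e n s → 0 < side d w s → (GoE t d × e ≡ side d w s) ⊎ (GoN t d × n ≡ side d w s)
leaves fromS (verˡ x) p = inj₂ (refl , refl)
leaves fromS (crossˡ x y _) p = inj₂ (refl , refl)
leaves fromS (relbowˡ x) p = inj₁ ((refl , refl) , refl)
leaves fromS (bumpˡ x y) p = inj₁ ((refl , refl) , refl)
leaves fromW (horˡ x) p = inj₁ (refl , refl)
leaves fromW (crossˡ x y _) p = inj₁ (refl , refl)
leaves fromW (jelbowˡ x) p = inj₂ ((refl , refl) , refl)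
leaves fromW (bumpˡ x y) p = inj₂ ((refl , refl) , refl)

cameN : ∀ {R t w e n s} → Loc R t w e n s → 0 < n → Σ Dir λ d → GoN t d × side d w s ≡ n
cameN (verˡ x) p = fromS , refl , refl
cameN (crossˡ x y _) p = fromS , refl , refl
cameN (jelbowˡ x) p = fromW , (refl , refl) , refl
cameN (bumpˡ x y) p = fromW , (refl , refl) , refl

cameE : ∀ {R t w e n s} → Loc R t w e n s → 0 < e → Σ Dir λ d → GoE t d × side d w s ≡ e
cameE (horˡ x) p = fromW , refl , refl
cameE (crossˡ x y _) p = fromW , refl , refl
cameE (relbowˡ x) p = fromS , (refl , refl) , refl
cameE (bumpˡ x y) p = fromS , (refl , refl) , refl

path-region : ∀ {n T i j d r ps} → Path n T i j d r ps → All (λ c → proj₁ c ≤ i × j ≤ proj₂ c) ps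
path-region (exitE _) = (≤-refl , ≤-refl) ∷ []
path-region (goE _ _ p) = (≤-refl , ≤-refl) ∷ All.map (λ (a , b) → a , <⇒≤ b) (path-region p)
path-region (goN _ _ p) = (≤-refl , ≤-refl) ∷ All.map (λ (a , b) → m≤n⇒m≤1+n a , b) (path-region p)

path-unique : ∀ {n T i j d r ps} → Path n T i j d r ps → Unique ps
path-unique (exitE _) = [] ∷ []
path-unique (goE _ _ p) = All.map (λ { (_ , b) refl → <-irrefl refl b }) (path-region p) ∷ path-unique p
path-unique (goN _ _ p) = All.map (λ { (a , _) refl → <-irrefl refl a }) (path-region p) ∷ path-unique p

≤ᵇ-refl : ∀ n → (n ≤ᵇ n) ≡ true
≤ᵇ-refl zero = refl
≤ᵇ-refl (suc n) = <ᵇ-true (n<1+n n)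

trace-path : ∀ {n g i j d r ps} f → Sq n g → In n i → In n j → Path n (tile g) i j d r ps → length ps ≤ f → traceF n g f i j d ≡ just (r , ps)
trace-path {n} {g} {i} {d = fromS} (suc f) s pi pj (exitE (e , e')) le rewrite tileAt-in s pi pj | e | e' | ≤ᵇ-refl n = refl
trace-path {n} {g} {i} {d = fromW} (suc f) s pi pj (exitE e) le rewrite tileAt-in s pi pj | e | ≤ᵇ-refl n = refl
trace-path {suc n} {g} {i} {j} {fromS} (suc f) s pi pj (goE (e , e') lt p) (s≤s le)
  rewrite tileAt-in s pi pj | e | e' | <ᵇ-false (≤-pred lt) | trace-path f s pi (s≤s z≤n , lt) p le = refl
trace-path {suc n} {g} {i} {j} {fromW} (suc f) s pi pj (goE e lt p) (s≤s le)
  rewrite tileAt-in s pi pj | e | <ᵇ-false (≤-pred lt) | trace-path f s pi (s≤s z≤n , lt) p le = refl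
trace-path {n} {g} {suc (suc i)} {j} {fromS} (suc f) s pi pj (goN e 1≤i p) (s≤s le)
  rewrite tileAt-in s pi pj | e | trace-path f s (s≤s z≤n , <⇒≤ (proj₂ pi)) pj p le = refl
trace-path {n} {g} {suc (suc i)} {j} {fromW} (suc f) s pi pj (goN (e , e') 1≤i p) (s≤s le)
  rewrite tileAt-in s pi pj | e | e' | trace-path f s (s≤s z≤n , <⇒≤ (proj₂ pi)) pj p le = refl

module Pipes {R n T h v} (L : Lab R n T h v) where
  open Lab L
  open Cuts L

  label : Dir → ℕ → ℕ → ℕ
  label d i j = side d (h i j) (v (suc i) j)

  Visits : ℕ → Cell → Set
  Visits l (i , j) = In n i × In n j × (h i j ≡ l ⊎ v (suc i) j ≡ l)

  visit : ∀ d i j → In n i → In n j → Visits (label d i j) (i , j)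
  visit fromS i j pi pj = pi , pj , inj₂ refl
  visit fromW i j pi pj = pi , pj , inj₁ refl

  -- Each step goes up or to the right. With `k` columns to the right of (i , j), this bounds the
  -- length in `short`, which shows that the fuel `2 * n` is enough.
  record Traced (i k j : ℕ) (d : Dir) : Set where
    field
      row : ℕ
      cells : List Cell
      path : Path n T i j d row cells
      short : length cells ≤ i + k
      rowIn : 1 ≤ row
      rowUp : row ≤ i
      exitsAt : h row (suc n) ≡ label d i j
      visits : All (Visits (label d i j)) cells

  traced : ∀ i k j d → k + j ≡ n → In n i → In n j → 0 < label d i j → Traced i k j d
  traced i zero j d refl pi pj p with leaves d (loc i j pi pj) p
  ... | inj₁ (g , e) = record { path = exitE g ; short = ≤-trans (proj₁ pi) (m≤m+n i 0) ; rowIn = proj₁ pi ; rowUp = ≤-refl ; exitsAt = e ; visits = visit d i j pi pj ∷ [] }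
  traced (suc zero) zero j d refl pi pj p | inj₂ (g , e) = ⊥-elim (n≮0 (subst (0 <_) (trans (sym e) (top j pj)) p))
  traced (suc (suc i)) zero j d refl pi pj p | inj₂ (g , e) with traced (suc i) zero j fromS refl (s≤s z≤n , <⇒≤ (proj₂ pi)) pj (subst (0 <_) (sym e) p)
  ... | t = record { path = goN g (s≤s z≤n) (Traced.path t) ; short = s≤s (Traced.short t) ; rowIn = Traced.rowIn t ; rowUp = m≤n⇒m≤1+n (Traced.rowUp t)
                   ; exitsAt = trans (Traced.exitsAt t) e ; visits = visit d (suc (suc i)) j pi pj ∷ subst (λ z → All (Visits z) (Traced.cells t)) e (Traced.visits t) }
  traced i (suc k) j d eq pi pj p with leaves d (loc i j pi pj) p
  ... | inj₁ (g , e) with traced i k (suc j) fromW (trans (+-suc k j) eq) pi (s≤s z≤n , ≤-trans (s≤s (m≤n+m j k)) (≤-reflexive eq)) (subst (0 <_) (sym e) p)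
  ...   | t = record { path = goE g (≤-trans (s≤s (m≤n+m j k)) (≤-reflexive eq)) (Traced.path t) ; short = ≤-trans (s≤s (Traced.short t)) (≤-reflexive (sym (+-suc i k))) ; rowIn = Traced.rowIn t ; rowUp = Traced.rowUp t
                   ; exitsAt = trans (Traced.exitsAt t) e ; visits = visit d i j pi pj ∷ subst (λ z → All (Visits z) (Traced.cells t)) e (Traced.visits t) }
  traced (suc zero) (suc k) j d eq pi pj p | inj₂ (g , e) = ⊥-elim (n≮0 (subst (0 <_) (trans (sym e) (top j pj)) p))
  traced (suc (suc i)) (suc k) j d eq pi pj p | inj₂ (g , e) with traced (suc i) (suc k) j fromS eq (s≤s z≤n , <⇒≤ (proj₂ pi)) pj (subst (0 <_) (sym e) p)
  ... | t = record { path = goN g (s≤s z≤n) (Traced.path t) ; short = s≤s (Traced.short t) ; rowIn = Traced.rowIn t ; rowUp = m≤n⇒m≤1+n (Traced.rowUp t)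
                   ; exitsAt = trans (Traced.exitsAt t) e ; visits = visit d (suc (suc i)) j pi pj ∷ subst (λ z → All (Visits z) (Traced.cells t)) e (Traced.visits t) }

  trace : ∀ i j d → In n i → In n j → 0 < label d i j → Traced i (n ∸ j) j d
  trace i j d pi pj = traced i (n ∸ j) j d (m∸n+n≡m (proj₂ pj)) pi pj

  -- A label followed backwards ends on the bottom, in the column of that number. The part of the
  -- pipe before the cell appears as a prefix `qs` that can be put in front of any path from the
  -- cell.
  Reached : ℕ → ℕ → Dir → Set
  Reached i j d = In n (label d i j) × Σ (List Cell) λ qs → ∀ {r ps} → Path n T i j d r ps → Path n T n (label d i j) fromS r (qs ++ ps)

  private
    extend : ∀ {i j d i' j' d'} → label d' i' j' ≡ label d i j → (∀ {r ps} → Path n T i j d r ps → Path n T i' j' d' r ((i' , j') ∷ ps)) → Reached i' j' d' → Reached i j d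
    extend {i} {j} {d} {i'} {j'} e f (pl , qs , k) = subst (In n) e pl , qs ++ (i' , j') ∷ [] , λ {r} {ps} p →
      subst₂ (λ l cs → Path n T n l fromS r cs) e (sym (++-assoc qs _ ps)) (k (f p))

  reached : ∀ k i j d → k + i ≡ n → In n i → In n j → 0 < label d i j → Reached i j d
  reached k i (suc zero) fromW e pi pj p = ⊥-elim (n≮0 (subst (0 <_) (left i pi) p))
  reached k i (suc (suc j)) fromW e pi pj p =
    let pj' = s≤s z≤n , <⇒≤ (proj₂ pj)
        (d , g , q) = cameE (loc i (suc j) pi pj') p in
    extend q (goE g (proj₂ pj)) (reached k i (suc j) d e pi pj' (subst (0 <_) (sym q) p))
  reached zero i j fromS refl pi pj p = subst (In n) (sym (bot j pj)) pj , [] , λ {r} {ps} q → subst (λ l → Path n T n l fromS r ps) (sym (bot j pj)) q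
  reached (suc k) i j fromS e pi pj p =
    let pi' = s≤s z≤n , ≤-trans (s≤s (m≤n+m i k)) (≤-reflexive e)
        (d , g , q) = cameN (loc (suc i) j pi' pj) p in
    extend q (goN g (proj₁ pi)) (reached k (suc i) j d (trans (+-suc k i) e) pi' pj (subst (0 <_) (sym q) p))

  reach : ∀ i j d → In n i → In n j → 0 < label d i j → Reached i j d
  reach i j d pi pj = reached (n ∸ i) i j d (m∸n+n≡m (proj₂ pi)) pi pj

  label-bot : ∀ l → In n l → label fromS n l ≡ l
  label-bot = bot

  pipe : ∀ l → In n l → Traced n (n ∸ l) l fromS
  pipe l pl = trace n l fromS (≤-trans (proj₁ pl) (proj₂ pl) , ≤-refl) pl (subst (0 <_) (sym (bot l pl)) (proj₁ pl))

  Path-det : ∀ {i j d r ps r' ps'} → Path n T i j d r ps → Path n T i j d r' ps' → r ≡ r' × ps ≡ ps'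
  Path-det (exitE _) (exitE _) = refl , refl
  Path-det (exitE _) (goE _ lt _) = ⊥-elim (<-irrefl refl lt)
  Path-det {d = fromS} (exitE (e , _)) (goN e' _ _) with trans (sym e) e'
  ... | ()
  Path-det {d = fromW} (exitE e) (goN (e' , _) _ _) with trans (sym e) e'
  ... | ()
  Path-det (goE _ lt _) (exitE _) = ⊥-elim (<-irrefl refl lt)
  Path-det (goE _ _ p) (goE _ _ q) with Path-det p q
  ... | refl , refl = refl , refl
  Path-det {d = fromS} (goE (e , _) _ _) (goN e' _ _) with trans (sym e) e'
  ... | ()
  Path-det {d = fromW} (goE e _ _) (goN (e' , _) _ _) with trans (sym e) e'
  ... | ()
  Path-det {d = fromS} (goN e _ _) (exitE (e' , _)) with trans (sym e) e'
  ... | ()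
  Path-det {d = fromW} (goN (e , _) _ _) (exitE e') with trans (sym e) e'
  ... | ()
  Path-det {d = fromS} (goN e _ _) (goE (e' , _) _ _) with trans (sym e) e'
  ... | ()
  Path-det {d = fromW} (goN (e , _) _ _) (goE e' _ _) with trans (sym e) e'
  ... | ()
  Path-det (goN _ _ p) (goN _ _ q) with Path-det p q
  ... | refl , refl = refl , refl

  head∈ : ∀ {i j d r ps} → Path n T i j d r ps → (i , j) ∈ ps
  head∈ (exitE _) = here refl
  head∈ (goE _ _ _) = here refl
  head∈ (goN _ _ _) = here refl

  -- A path from the cell, prolonged back to the bottom, starts where the pipe starts; as tracing is
  -- deterministic, it is the pipe.
  visits⇒∈ : ∀ l (pl : In n l) c → Visits l c → c ∈ Traced.cells (pipe l pl)
  visits⇒∈ l pl (i , j) (pi , pj , inj₁ e) = go e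
    where
    go : h i j ≡ l → (i , j) ∈ Traced.cells (pipe l pl)
    go refl with reach i j fromW pi pj (proj₁ pl) | trace i j fromW pi pj (proj₁ pl)
    ... | _ , qs , k | t = subst ((i , j) ∈_) (proj₂ (Path-det (k (Traced.path t)) (Traced.path (pipe l pl)))) (∈-++⁺ʳ qs (head∈ (Traced.path t)))
  visits⇒∈ l pl (i , j) (pi , pj , inj₂ e) = go e
    where
    go : v (suc i) j ≡ l → (i , j) ∈ Traced.cells (pipe l pl)
    go refl with reach i j fromS pi pj (proj₁ pl) | trace i j fromS pi pj (proj₁ pl)
    ... | _ , qs , k | t = subst ((i , j) ∈_) (proj₂ (Path-det (k (Traced.path t)) (Traced.path (pipe l pl)))) (∈-++⁺ʳ qs (head∈ (Traced.path t)))

  ∈⇒visits : ∀ l (pl : In n l) c → c ∈ Traced.cells (pipe l pl) → Visits l c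
  ∈⇒visits l pl c m = subst (λ z → Visits z c) (bot l pl) (All.lookup (Traced.visits (pipe l pl)) m)

anyᵇ-true : ∀ (p : X → Bool) {x} xs → x ∈ xs → p x ≡ true → anyᵇ p xs ≡ true
anyᵇ-true p (x ∷ xs) (here refl) e rewrite e = refl
anyᵇ-true p (x ∷ xs) (there m) e rewrite anyᵇ-true p xs m e with p x
... | true = refl
... | false = refl

anyᵇ-sound : ∀ (p : X → Bool) xs → anyᵇ p xs ≡ true → Σ X λ x → x ∈ xs × p x ≡ true
anyᵇ-sound p (x ∷ xs) e with p x in eq
... | true = x , here refl , eq
... | false with anyᵇ-sound p xs e
...   | y , m , q = y , there m , q

≡ᵇ-sound : ∀ a b → (a ≡ᵇ b) ≡ true → a ≡ b
≡ᵇ-sound zero zero e = refl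
≡ᵇ-sound (suc a) (suc b) e = cong suc (≡ᵇ-sound a b e)

cellEq-refl : ∀ c → cellEq c c ≡ true
cellEq-refl (i , j) rewrite ≡ᵇ-refl i | ≡ᵇ-refl j = refl

cellEq-sound : ∀ c d → cellEq c d ≡ true → c ≡ d
cellEq-sound (i , j) (i' , j') e with i ≡ᵇ i' in p | j ≡ᵇ j' in q
... | true | true = cong₂ _,_ (≡ᵇ-sound i i' p) (≡ᵇ-sound j j' q)

memCell-true : ∀ {c} cs → c ∈ cs → memCell c cs ≡ true
memCell-true {c} cs m = anyᵇ-true (cellEq c) cs m (cellEq-refl c)

memCell-sound : ∀ {c} cs → memCell c cs ≡ true → c ∈ cs
memCell-sound {c} cs e with anyᵇ-sound (cellEq c) cs e
... | x , m , q with cellEq-sound c x q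
...   | refl = m

filter-∈ : ∀ (p : X → Bool) {x} xs → x ∈ xs → p x ≡ true → x ∈ filterᵇ p xs
filter-∈ p (x ∷ xs) (here refl) e rewrite filterᵇ-∷ p x xs | e = here refl
filter-∈ p (x ∷ xs) (there m) e with p x in eq
... | true = there (filter-∈ p xs m e)
... | false = filter-∈ p xs m e

filter-sound : ∀ (p : X → Bool) {x} xs → x ∈ filterᵇ p xs → x ∈ xs × p x ≡ true
filter-sound p (y ∷ xs) m with p y in eq
filter-sound p (y ∷ xs) (here refl) | true = here refl , eq
filter-sound p (y ∷ xs) (there m) | true with filter-sound p xs m
... | a , b = there a , b
filter-sound p (y ∷ xs) m | false with filter-sound p xs m
... | a , b = there a , b

filter-unique : ∀ (p : X → Bool) xs → Unique xs → Unique (filterᵇ p xs)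
filter-unique p [] [] = []
filter-unique p (x ∷ xs) (a ∷ u) with p x
... | true = All.tabulate (λ m → All.lookup a (proj₁ (filter-sound p xs m))) ∷ filter-unique p xs u
... | false = filter-unique p xs u

module Crosses {R n g h v} (s : Sq n g) (L : Lab R n (tile g) h v) where
  open Lab L
  open Cuts L
  open Pipes L

  tracePipe-≡ : ∀ l (pl : In n l) → tracePipe n g l ≡ just (Traced.row (pipe l pl) , Traced.cells (pipe l pl))
  tracePipe-≡ l pl = trace-path (2 * n) s (≤-trans (proj₁ pl) (proj₂ pl) , ≤-refl) pl (Traced.path (pipe l pl))
    (≤-trans (Traced.short (pipe l pl)) (+-monoʳ-≤ n (≤-trans (m∸n≤m n l) (m≤m+n n 0))))

  cellsOf : ∀ l → In n l → List Cell
  cellsOf l pl = Traced.cells (pipe l pl)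

  pathOf-≡ : ∀ l (pl : In n l) → pathOf (tracePipe n g l) ≡ cellsOf l pl
  pathOf-≡ l pl rewrite tracePipe-≡ l pl = refl

  Meets : ℕ → ℕ → Cell → Set
  Meets c d (i , j) = In n i × In n j × (CrossOf i j c d ⊎ CrossOf i j d c)

  common⇒meets : ∀ c d (pc : In n c) (pd : In n d) → c ≢ d → ∀ x → x ∈ commonCrosses g (cellsOf c pc) (cellsOf d pd) → Meets c d x
  common⇒meets c d pc pd ne (i , j) m with filter-sound _ (cellsOf c pc) m
  ... | mc , e with ∈⇒visits c pc (i , j) mc | memCell (i , j) (cellsOf d pd) in eq
  ...   | pi , pj , vc | true with ∈⇒visits d pd (i , j) (memCell-sound (cellsOf d pd) eq)
  ...     | _ , _ , vd = pi , pj , go vc vd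
    where
    tc : tile g i j ≡ cross
    tc = isTile-cross _ (trans (cong (isTileAt cross) (sym (tileAt-in s pi pj))) e)
    go : h i j ≡ c ⊎ v (suc i) j ≡ c → h i j ≡ d ⊎ v (suc i) j ≡ d → CrossOf i j c d ⊎ CrossOf i j d c
    go (inj₁ a) (inj₁ b) = ⊥-elim (ne (trans (sym a) b))
    go (inj₁ a) (inj₂ b) = inj₁ (tc , a , b)
    go (inj₂ a) (inj₁ b) = inj₂ (tc , b , a)
    go (inj₂ a) (inj₂ b) = ⊥-elim (ne (trans (sym a) b))

  meets⇒common : ∀ c d (pc : In n c) (pd : In n d) x → Meets c d x → x ∈ commonCrosses g (cellsOf c pc) (cellsOf d pd)
  meets⇒common c d pc pd (i , j) (pi , pj , m) = filter-∈ _ (cellsOf c pc) (visits⇒∈ c pc (i , j) (pi , pj , vc m))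
    (cong₂ _∧_ (memCell-true (cellsOf d pd) (visits⇒∈ d pd (i , j) (pi , pj , vd m))) (trans (cong (isTileAt cross) (tileAt-in s pi pj)) (cong (isTile cross) (tc m))))
    where
    tc : CrossOf i j c d ⊎ CrossOf i j d c → tile g i j ≡ cross
    tc (inj₁ (e , _)) = e
    tc (inj₂ (e , _)) = e
    vc : CrossOf i j c d ⊎ CrossOf i j d c → h i j ≡ c ⊎ v (suc i) j ≡ c
    vc (inj₁ (_ , a , b)) = inj₁ a
    vc (inj₂ (_ , a , b)) = inj₂ b
    vd : CrossOf i j c d ⊎ CrossOf i j d c → h i j ≡ d ⊎ v (suc i) j ≡ d
    vd (inj₁ (_ , a , b)) = inj₂ b
    vd (inj₂ (_ , a , b)) = inj₁ a

  common-unique : ∀ c d (pc : In n c) (pd : In n d) → Unique (commonCrosses g (cellsOf c pc) (cellsOf d pd))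
  common-unique c d pc pd = filter-unique _ (cellsOf c pc) (path-unique (Traced.path (pipe c pc)))

-- Bumpless pipe dreams as labelled tilings

T⇒≡ : ∀ {b} → T b → b ≡ true
T⇒≡ {true} _ = refl

≡⇒T : ∀ {b} → b ≡ true → T b
≡⇒T refl = tt

∧-split : ∀ x {y} → T (x ∧ y) → T x × T y
∧-split true p = tt , p

∧-join : ∀ x {y} → T x → T y → T (x ∧ y)
∧-join true _ q = q

all-T : ∀ (f : X → Bool) xs → T (allᵇ f xs) → ∀ i {x} → nth xs i ≡ just x → T (f x)
all-T f (x ∷ xs) p (suc zero) refl = proj₁ (∧-split (f x) p)
all-T f (x ∷ xs) p (suc (suc i)) e = all-T f xs (proj₂ (∧-split (f x) p)) (suc i) e

all-intro : ∀ (f : X → Bool) xs → (∀ i {x} → nth xs i ≡ just x → T (f x)) → T (allᵇ f xs)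
all-intro f [] p = tt
all-intro f (x ∷ xs) p = ∧-join (f x) (p 1 refl) (all-intro f xs (λ { zero e → ⊥-elim (1+n≰n {0} (proj₁ (nth-bound xs e))) ; (suc i) e → p (suc (suc i)) e }))

all-false : ∀ (f : X → Bool) xs → allᵇ f xs ≡ false → Σ ℕ λ i → Σ X λ x → nth xs i ≡ just x × f x ≡ false
all-false f (x ∷ xs) p with f x in e
... | false = 1 , x , refl , e
... | true with all-false f xs p
...   | suc i , y , q , r = suc (suc i) , y , q , r
...   | zero , y , q , r = ⊥-elim (1+n≰n {0} (proj₁ (nth-bound xs q)))

∧-falseʳ : ∀ x {y} → T x → x ∧ y ≡ false → y ≡ false
∧-falseʳ true _ e = e

∧-falseˡ : ∀ x {y} → T y → x ∧ y ≡ false → x ≡ false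
∧-falseˡ false _ e = refl
∧-falseˡ true {true} _ ()

oneTo-nth : ∀ {n c} → In n c → nth (oneTo n) c ≡ just c
oneTo-nth {n} {suc c} (_ , lt) = nth-applyUpTo suc n c lt

oneTo-in : ∀ {n i c} → nth (oneTo n) i ≡ just c → i ≡ c × In n c
oneTo-in {n} {i} e with subst (λ z → In z i) (length-applyUpTo suc n) (nth-bound (oneTo n) e)
... | pi with trans (sym (oneTo-nth pi)) e
...   | refl = refl , pi

-- Named copies of conditions that are local to `isBPD`; they agree with these by computation.
shapeᵇ noBumpᵇ edgesᵇ : ℕ → Perm → Grid → Bool
shapeᵇ n π g = (length g ≡ᵇ n) ∧ allᵇ (λ row → length row ≡ᵇ n) g ∧ (length π ≡ᵇ n)
noBumpᵇ n π g = allᵇ (λ i → allᵇ (λ j → not (isTile bump (tile g i j))) (oneTo n)) (oneTo n)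

edgeᵇ : ℕ → Grid → ℕ → ℕ → Bool
edgeᵇ n g i j =
    (if j ≡ᵇ n then hasE (tile g i j) else boolEq (hasE (tile g i j)) (hasW (tile g i (suc j)))) ∧
    (if i ≡ᵇ 1 then not (hasN (tile g i j)) else boolEq (hasN (tile g i j)) (hasS (tile g (i ∸ 1) j))) ∧
    (if j ≡ᵇ 1 then not (hasW (tile g i j)) else true) ∧
    (if i ≡ᵇ n then hasS (tile g i j) else true)
edgesᵇ n π g = allᵇ (λ i → allᵇ (λ j → edgeᵇ n g i j) (oneTo n)) (oneTo n)

crossingᵇ : ℕ → Grid → ℕ → ℕ → Bool
crossingᵇ n g c d =
  if c <ᵇ d
  then length (commonCrosses g (pathOf (tracePipe n g c)) (pathOf (tracePipe n g d))) ≤ᵇ 1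
  else true

crossingsᵇ : ℕ → Perm → Grid → Bool
crossingsᵇ n π g = allᵇ (λ c → allᵇ (λ d → crossingᵇ n g c d) (oneTo n)) (oneTo n)

record Edges (n : ℕ) (T : ℕ → ℕ → Tile) : Set where
  field
    east  : ∀ i j → In n i → 1 ≤ j → j < n → hasE (T i j) ≡ hasW (T i (suc j))
    north : ∀ i j → 1 ≤ i → i < n → In n j → hasN (T (suc i) j) ≡ hasS (T i j)
    left  : ∀ i → In n i → hasW (T i 1) ≡ false
    right : ∀ i → In n i → hasE (T i n) ≡ true
    top   : ∀ j → In n j → hasN (T 1 j) ≡ false
    bot   : ∀ j → In n j → hasS (T n j) ≡ true

occupied : ℕ → Bool
occupied l = 0 <ᵇ l

outE outN : Tile → ℕ → ℕ → ℕ
outE hor w s = w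
outE cross w s = w
outE relbow w s = s
outE bump w s = s
outE _ w s = 0
outN ver w s = s
outN cross w s = s
outN jelbow w s = w
outN bump w s = w
outN _ w s = 0

outLoc : ∀ t w s → occupied w ≡ hasW t → occupied s ≡ hasS t →
  Loc Any² t w (outE t w s) (outN t w s) s × occupied (outE t w s) ≡ hasE t × occupied (outN t w s) ≡ hasN t
outLoc blank zero zero p q = blankˡ , refl , refl
outLoc hor (suc w) zero p q = horˡ (s≤s z≤n) , refl , refl
outLoc ver zero (suc s) p q = verˡ (s≤s z≤n) , refl , refl
outLoc cross (suc w) (suc s) p q = crossˡ (s≤s z≤n) (s≤s z≤n) tt , refl , refl
outLoc relbow zero (suc s) p q = relbowˡ (s≤s z≤n) , refl , refl
outLoc jelbow (suc w) zero p q = jelbowˡ (s≤s z≤n) , refl , refl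
outLoc bump (suc w) (suc s) p q = bumpˡ (s≤s z≤n) (s≤s z≤n) , refl , refl

module Labels {n T} (E : Edges n T) where
  open Edges E

  -- indexed by the distance k of the row from the bottom
  H V : ℕ → ℕ → ℕ
  V zero j = j
  V (suc k) j = outN (T (n ∸ k) j) (H k j) (V k j)
  H k zero = 0
  H k (suc zero) = 0
  H k (suc (suc j)) = outE (T (n ∸ k) (suc j)) (H k (suc j)) (V k (suc j))

  private
    row : ∀ {k} → k < n → In n (n ∸ k)
    row {k} lt = m<n⇒0<n∸m lt , m∸n≤m n k

    Occ : ℕ → ℕ → Set
    Occ k j = occupied (H k j) ≡ hasW (T (n ∸ k) j) × occupied (V k j) ≡ hasS (T (n ∸ k) j)

    occ : ∀ k j → k < n → In n j → Occ k j
    occW : ∀ k j → k < n → In n j → occupied (H k j) ≡ hasW (T (n ∸ k) j)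
    occS : ∀ k j → k < n → In n j → occupied (V k j) ≡ hasS (T (n ∸ k) j)
    occ k j lt pj = occW k j lt pj , occS k j lt pj
    occW k (suc zero) lt pj = sym (left (n ∸ k) (row lt))
    occW k (suc (suc j)) lt pj = trans (proj₁ (proj₂ (outLoc (T (n ∸ k) (suc j)) (H k (suc j)) (V k (suc j)) (occW k (suc j) lt pj') (occS k (suc j) lt pj'))))
        (east (n ∸ k) (suc j) (row lt) (s≤s z≤n) (proj₂ pj))
      where
      pj' : In n (suc j)
      pj' = s≤s z≤n , <⇒≤ (proj₂ pj)
    occS zero (suc j) lt pj = sym (bot (suc j) pj)
    occS (suc k) j lt pj = trans (proj₂ (proj₂ (outLoc (T (n ∸ k) j) (H k j) (V k j) (occW k j (<⇒≤ lt) pj) (occS k j (<⇒≤ lt) pj))))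
        (trans (cong (λ z → hasN (T z j)) (sym e)) (north (n ∸ suc k) j (proj₁ (row lt)) (≤-trans (≤-reflexive e) (m∸n≤m n k)) pj))
      where
      e : suc (n ∸ suc k) ≡ n ∸ k
      e = sym (+-∸-assoc 1 (<⇒≤ lt))

  h v : ℕ → ℕ → ℕ
  h i j = H (n ∸ i) j
  v i j = V (suc n ∸ i) j

  private
    dist : ∀ {i} → In n i → n ∸ i < n
    dist {i} (1≤i , i≤n) = ∸-monoʳ-< 1≤i i≤n

    cellOut : ∀ i j → In n i → In n j →
      Loc Any² (T i j) (h i j) (outE (T i j) (h i j) (v (suc i) j)) (outN (T i j) (h i j) (v (suc i) j)) (v (suc i) j)
       × occupied (outE (T i j) (h i j) (v (suc i) j)) ≡ hasE (T i j) × occupied (outN (T i j) (h i j) (v (suc i) j)) ≡ hasN (T i j)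
    cellOut i j pi pj with occ (n ∸ i) j (dist pi) pj
    ... | p , q rewrite m∸[m∸n]≡n (proj₂ pi) = outLoc (T i j) (h i j) (v (suc i) j) p q

    hE : ∀ i j → In n i → In n j → h i (suc j) ≡ outE (T i j) (h i j) (v (suc i) j)
    hE i (suc j) pi pj rewrite m∸[m∸n]≡n (proj₂ pi) = refl

    vN : ∀ i j → In n i → In n j → v i j ≡ outN (T i j) (h i j) (v (suc i) j)
    vN i j pi pj rewrite +-∸-assoc 1 (proj₂ pi) | m∸[m∸n]≡n (proj₂ pi) = refl

    empty : ∀ {l} → occupied l ≡ false → l ≡ 0
    empty {zero} _ = refl

    full : ∀ {l} → occupied l ≡ true → 0 < l
    full {suc l} _ = s≤s z≤n

  labels : Lab Any² n T h v
  labels = record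
    { loc = λ i j pi pj → castLoc refl refl (hE i j pi pj) (vN i j pi pj) refl (proj₁ (cellOut i j pi pj))
    ; left = λ i pi → refl
    ; top = λ j pj → let p1 = ≤-refl , ≤-trans (proj₁ pj) (proj₂ pj) in
              empty (trans (cong occupied (vN 1 j p1 pj)) (trans (proj₂ (proj₂ (cellOut 1 j p1 pj))) (top j pj)))
    ; bot = λ j pj → cong (λ z → V z j) (n∸n≡0 n)
    ; right = λ i pi → let pn = ≤-trans (proj₁ pi) (proj₂ pi) , ≤-refl in
              full (trans (cong occupied (hE i n pi pn)) (trans (proj₁ (proj₂ (cellOut i n pi pn))) (right i pi)))
    }

Exits : ℕ → (ℕ → ℕ → ℕ) → Perm → Set
Exits n h π = ∀ r → In n r → nth π r ≡ just (h r (suc n))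

NoBump : ℕ → (ℕ → ℕ → Tile) → Set
NoBump n T = ∀ i j → In n i → In n j → T i j ≢ bump

record Drawing (n : ℕ) (π : Perm) (g : Grid) : Set where
  field
    sq : Sq n g
    len : length π ≡ n
    h v : ℕ → ℕ → ℕ
    lab : Lab _<_ n (tile g) h v
    exits : Exits n h π

if-true : ∀ b {x y : Bool} → b ≡ true → T (if b then x else y) → T x
if-true _ refl p = p

if-false : ∀ b {x y : Bool} → b ≡ false → T (if b then x else y) → T y
if-false _ refl p = p

boolEq-sound : ∀ x y → T (boolEq x y) → x ≡ y
boolEq-sound true true _ = refl
boolEq-sound false false _ = refl

boolEq-refl : ∀ x → T (boolEq x x)
boolEq-refl true = tt
boolEq-refl false = tt

not-sound : ∀ x → T (not x) → x ≡ false
not-sound false _ = refl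

length-two : ∀ {x y : X} xs → x ≢ y → x ∈ xs → y ∈ xs → 2 ≤ length xs
length-two (_ ∷ _) ne (here refl) (here refl) = ⊥-elim (ne refl)
length-two (_ ∷ _ ∷ _) ne (here refl) (there m) = s≤s (s≤s z≤n)
length-two (_ ∷ _ ∷ _) ne (there m) _ = s≤s (s≤s z≤n)

module FromBPD (n : ℕ) (π : Perm) (g : Grid) (b : T (isBPD n π g)) where
  private
    p₁ = ∧-split (shapeᵇ n π g) b
    p₂ = ∧-split (noBumpᵇ n π g) (proj₂ p₁)
    p₃ = ∧-split (edgesᵇ n π g) (proj₂ p₂)
    pipes : ∀ c → In n c → ∀ r ps → tracePipe n g c ≡ just (r , ps) → T (fromMaybe false (nth π r >>= λ v → just (v ≡ᵇ c)))
    pipes c pc r ps e with all-T _ (oneTo n) (proj₁ (∧-split (allᵇ _ (oneTo n)) (proj₂ (∧-split (edgesᵇ n π g) (proj₂ (∧-split (noBumpᵇ n π g) (proj₂ (∧-split (shapeᵇ n π g) b)))))))) c (oneTo-nth pc)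
    ... | w rewrite e = w
    p₄ = ∧-split (allᵇ _ (oneTo n)) {crossingsᵇ n π g} (proj₂ p₃)
    s₁ = ∧-split (length g ≡ᵇ n) (proj₁ p₁)
    s₂ = ∧-split (allᵇ (λ row → length row ≡ᵇ n) g) (proj₂ s₁)

  sq : Sq n g
  sq = mkSq (≡ᵇ-sound _ _ (T⇒≡ (proj₁ s₁))) (λ i row e → ≡ᵇ-sound _ _ (T⇒≡ (all-T _ g (proj₁ s₂) i e)))

  len : length π ≡ n
  len = ≡ᵇ-sound _ _ (T⇒≡ (proj₂ s₂))

  noBump : NoBump n (tile g)
  noBump i j pi pj e with all-T _ (oneTo n) (all-T _ (oneTo n) (proj₁ p₂) i (oneTo-nth pi)) j (oneTo-nth pj)
  ... | w rewrite e = w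

  private
    edge : ∀ i j → In n i → In n j → T (edgeᵇ n g i j)
    edge i j pi pj = all-T _ (oneTo n) (all-T _ (oneTo n) (proj₁ p₃) i (oneTo-nth pi)) j (oneTo-nth pj)

    t : ℕ → ℕ → Tile
    t = tile g

    E₁ : ∀ i j → In n i → In n j → T (if j ≡ᵇ n then hasE (t i j) else boolEq (hasE (t i j)) (hasW (t i (suc j))))
    E₁ i j pi pj = proj₁ (∧-split (if j ≡ᵇ n then hasE (t i j) else boolEq (hasE (t i j)) (hasW (t i (suc j)))) (edge i j pi pj))
    E₂₋ : ∀ i j → In n i → In n j → _
    E₂₋ i j pi pj = proj₂ (∧-split (if j ≡ᵇ n then hasE (t i j) else boolEq (hasE (t i j)) (hasW (t i (suc j)))) (edge i j pi pj))
    E₂ : ∀ i j → In n i → In n j → T (if i ≡ᵇ 1 then not (hasN (t i j)) else boolEq (hasN (t i j)) (hasS (t (i ∸ 1) j)))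
    E₂ i j pi pj = proj₁ (∧-split (if i ≡ᵇ 1 then not (hasN (t i j)) else boolEq (hasN (t i j)) (hasS (t (i ∸ 1) j))) (E₂₋ i j pi pj))
    E₃₋ : ∀ i j → In n i → In n j → _
    E₃₋ i j pi pj = ∧-split (if j ≡ᵇ 1 then not (hasW (t i j)) else true) (proj₂ (∧-split (if i ≡ᵇ 1 then not (hasN (t i j)) else boolEq (hasN (t i j)) (hasS (t (i ∸ 1) j))) (E₂₋ i j pi pj)))

    edges : Edges n t
    edges = record
      { east = λ i j pi 1≤j j<n → boolEq-sound _ _ (if-false (j ≡ᵇ n) (≡ᵇ-false (<⇒≢ j<n)) (E₁ i j pi (1≤j , <⇒≤ j<n)))
      ; north = λ { (suc i) j 1≤i i<n pj → boolEq-sound (hasN (t (suc (suc i)) j)) (hasS (t (suc i) j)) (E₂ (suc (suc i)) j (s≤s z≤n , i<n) pj) }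
      ; left = λ i pi → not-sound _ (proj₁ (E₃₋ i 1 pi (≤-refl , ≤-trans (proj₁ pi) (proj₂ pi))))
      ; right = λ i pi → T⇒≡ (if-true (n ≡ᵇ n) (≡ᵇ-refl n) (E₁ i n pi (≤-trans (proj₁ pi) (proj₂ pi) , ≤-refl)))
      ; top = λ j pj → not-sound _ (E₂ 1 j (≤-refl , ≤-trans (proj₁ pj) (proj₂ pj)) pj)
      ; bot = λ j pj → T⇒≡ (if-true (n ≡ᵇ n) (≡ᵇ-refl n) (proj₂ (E₃₋ n j (≤-trans (proj₁ pj) (proj₂ pj) , ≤-refl) pj)))
      }

    open Labels edges
    open Cuts labels
    open Pipes labels
    open Crosses sq labels

    atMostOne : ∀ c d → In n c → In n d → c < d → length (commonCrosses g (pathOf (tracePipe n g c)) (pathOf (tracePipe n g d))) ≤ 1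
    atMostOne c d pc pd lt = ≤ᵇ⇒≤ _ _ (if-true (c <ᵇ d) (<ᵇ-true lt) (all-T _ (oneTo n) (all-T _ (oneTo n) (proj₂ p₄) c (oneTo-nth pc)) d (oneTo-nth pd)))

    once : ∀ c d → In n c → In n d → c < d → ∀ x y → Meets c d x → Meets c d y → x ≢ y → ⊥
    once c d pc pd lt x y mx my ne with atMostOne c d pc pd lt
    ... | le rewrite pathOf-≡ c pc | pathOf-≡ d pd =
      <⇒≱ (length-two _ ne (meets⇒common c d pc pd x mx) (meets⇒common c d pc pd y my)) le

    labelIn : ∀ i j d → In n i → In n j → 0 < label d i j → In n (label d i j)
    labelIn i j d pi pj p = proj₁ (reach i j d pi pj p)

    -- of two crosses of one pair the later one would be descending
    ascending : ∀ i j → In n i → In n j → tile g i j ≡ cross → h i j < v (suc i) j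
    ascending i j pi@(1≤i , i≤n) pj@(s≤s {n = j₀} z≤n , j≤n) tc with crossEqs (Lab.loc labels i j pi pj) tc
    ... | _ , _ , 0<w , 0<s , _ with history (n ∸ i) i j₀ (m∸n+n≡m i≤n) 1≤i (<⇒≤ j≤n) 0<w 0<s (_ , _ , ≤-refl , cur , new ≤-refl j≤n)
    ...   | inj₁ lt = lt
    ...   | inj₂ other = conclude other
      where
      w s : ℕ
      w = h i j
      s = v (suc i) j
      pw : In n w
      pw = labelIn i j fromW pi pj 0<w
      ps : In n s
      ps = labelIn i j fromS pi pj 0<s
      here' : CrossOf i j w s
      here' = tc , refl , refl
      distinctCell : ∀ {i' j'} → (i' , suc j') ≼ (i , j) → (i , j) ≢ (i' , j')
      distinctCell (lower x) refl = <-irrefl refl x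
      distinctCell (same x) refl = <-irrefl refl x
      conclude : Crossed i j w s ⊎ Crossed i j s w → w < s
      conclude c with compareℕ w s
      ... | less lt = lt
      ... | equal e = ⊥-elim (1+n≢n (sym (unique i j pi (s≤s z≤n) (m≤n⇒m≤1+n j≤n) 0<w cur (subst (At i j (suc j)) (sym e) (new ≤-refl j≤n)))))
      conclude (inj₁ (i' , j' , pi' , pj' , o , x , _)) | greater gt = ⊥-elim (once s w ps pw gt (i , j) (i' , j') (pi , pj , inj₂ here') (pi' , pj' , inj₂ x) (distinctCell o))
      conclude (inj₂ (i' , j' , pi' , pj' , o , x , _)) | greater gt = ⊥-elim (once s w ps pw gt (i , j) (i' , j') (pi , pj , inj₂ here') (pi' , pj' , inj₁ x) (distinctCell o))

    upgrade : ∀ {t w e m s} → (t ≡ cross → w < s) → Loc Any² t w e m s → Loc _<_ t w e m s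
    upgrade f blankˡ = blankˡ
    upgrade f (horˡ x) = horˡ x
    upgrade f (verˡ x) = verˡ x
    upgrade f (crossˡ x y _) = crossˡ x y (f refl)
    upgrade f (relbowˡ x) = relbowˡ x
    upgrade f (jelbowˡ x) = jelbowˡ x
    upgrade f (bumpˡ x y) = bumpˡ x y

    exitOf : ∀ c (pc : In n c) → nth π (Traced.row (pipe c pc)) ≡ just c
    exitOf c pc with pipes c pc _ _ (tracePipe-≡ c pc)
    ... | q with nth π (Traced.row (pipe c pc))
    ...   | just x = cong just (≡ᵇ-sound x c (T⇒≡ q))

    exitLabel : ∀ r → In n r → In n (h r (suc n))
    exitLabel r pr = let pn = ≤-trans (proj₁ pr) (proj₂ pr) , ≤-refl
                         (d , _ , q) = cameE (Lab.loc labels r n pr pn) (Lab.right labels r pr) in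
      subst (In n) q (labelIn r n d pr pn (subst (0 <_) (sym q) (Lab.right labels r pr)))

  private
    drawn : Drawing n π g
    drawn = record { sq = sq ; len = len ; h = h ; v = v
      ; lab = record { loc = λ i j pi pj → upgrade (ascending i j pi pj) (loc i j pi pj) ; left = left ; top = top ; bot = bot ; right = right }
      -- A BPD prescribes the row in which each pipe ends. Because exit labels are distinct, the
      -- pipe named by the exit label of row `r` ends in row `r` itself.
      ; exits = λ r pr → let pl = exitLabel r pr
                             t' = pipe (h r (suc n)) pl in
          trans (cong (nth π) (sym (exitUnique (Traced.row t') r (Traced.rowIn t' , Traced.rowUp t') pr (trans (Traced.exitsAt t') (label-bot _ pl))))) (exitOf _ pl) }
      where open Lab labels

  abstract
    drawing : Drawing n π g
    drawing = drawn

hasE-loc : ∀ {R t w e n s} → Loc R t w e n s → hasE t ≡ occupied e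
hasE-loc blankˡ = refl
hasE-loc (horˡ (s≤s x)) = refl
hasE-loc (verˡ x) = refl
hasE-loc (crossˡ (s≤s x) y _) = refl
hasE-loc (relbowˡ (s≤s x)) = refl
hasE-loc (jelbowˡ x) = refl
hasE-loc (bumpˡ x (s≤s y)) = refl

hasW-loc : ∀ {R t w e n s} → Loc R t w e n s → hasW t ≡ occupied w
hasW-loc blankˡ = refl
hasW-loc (horˡ (s≤s x)) = refl
hasW-loc (verˡ x) = refl
hasW-loc (crossˡ (s≤s x) y _) = refl
hasW-loc (relbowˡ x) = refl
hasW-loc (jelbowˡ (s≤s x)) = refl
hasW-loc (bumpˡ (s≤s x) y) = refl

hasN-loc : ∀ {R t w e n s} → Loc R t w e n s → hasN t ≡ occupied n
hasN-loc blankˡ = refl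
hasN-loc (horˡ x) = refl
hasN-loc (verˡ (s≤s x)) = refl
hasN-loc (crossˡ x (s≤s y) _) = refl
hasN-loc (relbowˡ x) = refl
hasN-loc (jelbowˡ (s≤s x)) = refl
hasN-loc (bumpˡ (s≤s x) y) = refl

hasS-loc : ∀ {R t w e n s} → Loc R t w e n s → hasS t ≡ occupied s
hasS-loc blankˡ = refl
hasS-loc (horˡ x) = refl
hasS-loc (verˡ (s≤s x)) = refl
hasS-loc (crossˡ x (s≤s y) _) = refl
hasS-loc (relbowˡ (s≤s x)) = refl
hasS-loc (jelbowˡ x) = refl
hasS-loc (bumpˡ x (s≤s y)) = refl

if-intro : ∀ b {x y : Bool} → (b ≡ true → T x) → (b ≡ false → T y) → T (if b then x else y)
if-intro true f g = f refl
if-intro false f g = g refl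

not-true : ∀ {x} → x ≡ false → T (not x)
not-true refl = tt

module Meeting {n g h v} (s : Sq n g) (L : Lab _<_ n (tile g) h v) where
  open Cuts L
  open Order L
  open Crosses s L

  -- The smaller pipe travels east at every cross, so two crosses of one pair have the same
  -- orientation and `crossUnique` applies.
  meetOnce : ∀ c d x y → Meets c d x → Meets c d y → x ≡ y
  meetOnce c d (i , j) (i' , j') (pi , pj , m) (pi' , pj' , m') = go m m'
    where
    eqs : i ≡ i' × j ≡ j' → (i , j) ≡ (i' , j')
    eqs (refl , refl) = refl
    clash : ∀ {i j i' j'} → In n i → In n j → In n i' → In n j' → CrossOf i j c d → CrossOf i' j' d c → ⊥
    clash pi pj pi' pj' x y = <-asym (proj₂ (proj₂ (proj₂ (crossEnter _ _ pi pj x)))) (proj₂ (proj₂ (proj₂ (crossEnter _ _ pi' pj' y))))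
    go : CrossOf i j c d ⊎ CrossOf i j d c → CrossOf i' j' c d ⊎ CrossOf i' j' d c → (i , j) ≡ (i' , j')
    go (inj₁ x) (inj₁ y) = eqs (crossUnique i j i' j' pi pj pi' pj' x y)
    go (inj₂ x) (inj₂ y) = eqs (crossUnique i j i' j' pi pj pi' pj' x y)
    go (inj₁ x) (inj₂ y) = ⊥-elim (clash pi pj pi' pj' x y)
    go (inj₂ x) (inj₁ y) = ⊥-elim (clash pi' pj' pi pj y x)

  data Common (c d : ℕ) (xs : List Cell) : Set where
    none : xs ≡ [] → (∀ x → ¬ Meets c d x) → Common c d xs
    one  : ∀ x → xs ≡ x ∷ [] → Meets c d x → Common c d xs

  common : ∀ c d (pc : In n c) (pd : In n d) → c ≢ d → Common c d (commonCrosses g (cellsOf c pc) (cellsOf d pd))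
  common c d pc pd ne = go (commonCrosses g (cellsOf c pc) (cellsOf d pd)) (common-unique c d pc pd) (common⇒meets c d pc pd ne) (meets⇒common c d pc pd)
    where
    go : ∀ xs → Unique xs → (∀ x → x ∈ xs → Meets c d x) → (∀ x → Meets c d x → x ∈ xs) → Common c d xs
    go [] u f k = none refl (λ x m → absurd (k x m))
      where
      absurd : ∀ {x : Cell} → x ∈ [] → ⊥
      absurd ()
    go (x ∷ []) u f k = one x refl (f x (here refl))
    go (x ∷ y ∷ zs) ((x≢y ∷ _) ∷ _) f k = ⊥-elim (x≢y (meetOnce c d x y (f x (here refl)) (f y (there (here refl)))))

module ToBPD {n π g} (D : Drawing n π g) (nb : NoBump n (tile g)) where
  open Drawing D
  open Cuts lab
  open Pipes lab
  open Crosses sq lab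
  open Meeting sq lab
  private
    t : ℕ → ℕ → Tile
    t = tile g

    locs = Lab.loc lab

    shape : T (shapeᵇ n π g)
    shape = ∧-join (length g ≡ᵇ n) (eqT (Sq.side sq)) (∧-join (allᵇ (λ row → length row ≡ᵇ n) g) (all-intro _ g (λ i e → eqT (Sq.rows sq i _ e))) (eqT len))
      where
      eqT : ∀ {a} → a ≡ n → T (a ≡ᵇ n)
      eqT refl = ≡⇒T (≡ᵇ-refl n)

    grid-intro : ∀ (f : ℕ → ℕ → Bool) → (∀ i j → In n i → In n j → T (f i j)) → T (allᵇ (λ i → allᵇ (f i) (oneTo n)) (oneTo n))
    grid-intro f p = all-intro _ (oneTo n) (λ i e → all-intro _ (oneTo n) (λ j e' → p _ _ (proj₂ (oneTo-in {n} e)) (proj₂ (oneTo-in {n} e'))))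

    bumps : T (noBumpᵇ n π g)
    bumps = grid-intro _ (λ i j pi pj → not-true (isB (nb i j pi pj)))
      where
      isB : ∀ {t} → t ≢ bump → isTile bump t ≡ false
      isB {blank} _ = refl
      isB {hor} _ = refl
      isB {ver} _ = refl
      isB {cross} _ = refl
      isB {relbow} _ = refl
      isB {jelbow} _ = refl
      isB {bump} ne = ⊥-elim (ne refl)

    edge : ∀ i j → In n i → In n j → T (edgeᵇ n g i j)
    edge i j pi pj =
      ∧-join (if j ≡ᵇ n then hasE (t i j) else boolEq (hasE (t i j)) (hasW (t i (suc j))))
        (if-intro (j ≡ᵇ n) (λ e → ≡⇒T (trans (hasE-loc (locs i j pi pj)) (trans (cong (λ z → occupied (h i (suc z))) (≡ᵇ-sound j n e)) (<ᵇ-true (Lab.right lab i pi)))))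
           (λ e → let pj' = s≤s z≤n , ≤∧≢⇒< (proj₂ pj) (λ { refl → ff (trans (sym (≡ᵇ-refl n)) e) }) in
              subst (λ z → T (boolEq (hasE (t i j)) z)) (trans (hasE-loc (locs i j pi pj)) (sym (hasW-loc (locs i (suc j) pi pj')))) (boolEq-refl (hasE (t i j)))))
      (∧-join (if i ≡ᵇ 1 then not (hasN (t i j)) else boolEq (hasN (t i j)) (hasS (t (i ∸ 1) j)))
        (northOK i pi)
      (∧-join (if j ≡ᵇ 1 then not (hasW (t i j)) else true)
        (if-intro (j ≡ᵇ 1) (λ e → not-true (trans (hasW-loc (locs i j pi pj)) (cong occupied (trans (cong (h i) (≡ᵇ-sound j 1 e)) (Lab.left lab i pi))))) (λ _ → tt))
        (if-intro (i ≡ᵇ n) (λ e → ≡⇒T (trans (hasS-loc (locs i j pi pj)) (trans (cong (λ z → occupied (v (suc z) j)) (≡ᵇ-sound i n e)) (trans (cong occupied (Lab.bot lab j pj)) (<ᵇ-true (proj₁ pj)))))) (λ _ → tt))))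
      where
      ff : ∀ {A : Set} → true ≡ false → A
      ff ()
      northOK : ∀ i → In n i → T (if i ≡ᵇ 1 then not (hasN (t i j)) else boolEq (hasN (t i j)) (hasS (t (i ∸ 1) j)))
      northOK (suc zero) pi = not-true (trans (hasN-loc (locs 1 j pi pj)) (cong occupied (Lab.top lab j pj)))
      northOK (suc (suc i)) pi = subst (λ z → T (boolEq (hasN (t (suc (suc i)) j)) z)) (trans (hasN-loc (locs (suc (suc i)) j pi pj)) (sym (hasS-loc (locs (suc i) j (s≤s z≤n , <⇒≤ (proj₂ pi)) pj)))) (boolEq-refl (hasN (t (suc (suc i)) j)))

    crossOK : T (crossingsᵇ n π g)
    crossOK = grid-intro _ (λ c d pc pd → if-intro (c <ᵇ d) (λ e → few c d pc pd (<ᵇ⇒< c d (≡⇒T e))) (λ _ → tt))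
      where
      few : ∀ c d → In n c → In n d → c < d → T (length (commonCrosses g (pathOf (tracePipe n g c)) (pathOf (tracePipe n g d))) ≤ᵇ 1)
      few c d pc pd lt rewrite pathOf-≡ c pc | pathOf-≡ d pd with common c d pc pd (<⇒≢ lt)
      ... | none e _ rewrite e = tt
      ... | one x e _ rewrite e = tt

    pipeRow : ∀ c (pc : In n c) → nth π (Traced.row (pipe c pc)) ≡ just c
    pipeRow c pc = trans (exits _ (Traced.rowIn (pipe c pc) , Traced.rowUp (pipe c pc))) (cong just (trans (Traced.exitsAt (pipe c pc)) (label-bot c pc)))

  private
    -- refuted rather than built up, because the pipe condition is only nameable as a hypothesis
    notFalse : isBPD n π g ≡ false → ⊥
    notFalse e with all-false _ (oneTo n) (∧-falseˡ (allᵇ _ (oneTo n)) {crossingsᵇ n π g} crossOK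
                      (∧-falseʳ (edgesᵇ n π g) (grid-intro _ edge) (∧-falseʳ (noBumpᵇ n π g) bumps (∧-falseʳ (shapeᵇ n π g) shape e))))
    ... | i , c , q , w with proj₂ (oneTo-in {n} q)
    ...   | pc rewrite tracePipe-≡ c pc | pipeRow c pc | ≡ᵇ-refl c with w
    ...     | ()

  isBPD-true : T (isBPD n π g)
  isBPD-true with isBPD n π g in e
  ... | true = tt
  ... | false = ⊥-elim (notFalse e)

-- Uniqueness of labels, and toggling of two cells

locDet : ∀ {R R' t w e n s w' e' n' s'} → Loc R t w e n s → Loc R' t w' e' n' s' → w ≡ w' → s ≡ s' → e ≡ e' × n ≡ n'
locDet blankˡ blankˡ p q = refl , refl
locDet (horˡ _) (horˡ _) p q = p , refl
locDet (verˡ _) (verˡ _) p q = refl , q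
locDet (crossˡ _ _ _) (crossˡ _ _ _) p q = p , q
locDet (relbowˡ _) (relbowˡ _) p q = q , refl
locDet (jelbowˡ _) (jelbowˡ _) p q = refl , p
locDet (bumpˡ _ _) (bumpˡ _ _) p q = q , p

-- Labels spread from the left and the bottom border: the tile and its west and south label
-- determine the other two.
module LabUnique {R R' n T h v h' v'} (L : Lab R n T h v) (L' : Lab R' n T h' v') where
  private
    module L = Lab L
    module L' = Lab L'
    hU : ∀ k i j → k + i ≡ n → In n i → j ≤ n → h i (suc j) ≡ h' i (suc j)
    vU : ∀ k i j → k + i ≡ suc n → 1 ≤ i → In n j → v i j ≡ v' i j
    hU k i zero e pi lt = trans (L.left i pi) (sym (L'.left i pi))
    hU k i (suc j) e pi lt = proj₁ (locDet (L.loc i (suc j) pi (s≤s z≤n , lt)) (L'.loc i (suc j) pi (s≤s z≤n , lt))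
      (hU k i j e pi (<⇒≤ lt)) (vU k (suc i) (suc j) (trans (+-suc k i) (cong suc e)) (s≤s z≤n) (s≤s z≤n , lt)))
    vU zero .(suc n) j refl 1≤i pj = trans (L.bot j pj) (sym (L'.bot j pj))
    vU (suc k) i j e 1≤i pj@(s≤s {n = j₀} z≤n , j≤) = proj₂ (locDet (L.loc i j pi pj) (L'.loc i j pi pj)
      (hU k i j₀ (suc-injective e) pi (<⇒≤ j≤)) (vU k (suc i) j (trans (+-suc k i) e) (s≤s z≤n) pj))
      where
      pi : In n i
      pi = 1≤i , ≤-trans (m≤n+m i k) (≤-reflexive (suc-injective e))

  h-unique : ∀ i j → In n i → j ≤ n → h i (suc j) ≡ h' i (suc j)
  h-unique i j pi lt = hU (n ∸ i) i j (m∸n+n≡m (proj₂ pi)) pi lt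

  w-unique : ∀ i j → In n i → In n j → h i j ≡ h' i j
  w-unique i (suc j) pi (_ , lt) = h-unique i j pi (<⇒≤ lt)

  s-unique : ∀ i j → In n i → In n j → v (suc i) j ≡ v' (suc i) j
  s-unique i j pi pj = vU (n ∸ i) (suc i) j (trans (+-suc (n ∸ i) i) (cong suc (m∸n+n≡m (proj₂ pi)))) (s≤s z≤n) pj

labCong : ∀ {R n T T' h v} → (∀ i j → In n i → In n j → T' i j ≡ T i j) → Lab R n T h v → Lab R n T' h v
labCong e L = record { loc = λ i j pi pj → castLoc (e i j pi pj) refl refl refl refl (loc i j pi pj) ; left = left ; top = top ; bot = bot ; right = right }
  where open Lab L

exitList-length : ∀ h n i k → length (exitList h n i k) ≡ k
exitList-length h n i zero = refl
exitList-length h n i (suc k) = cong suc (exitList-length h n (suc i) k)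

exitList-nth : ∀ h n i k r → r < k → nth (exitList h n i k) (suc r) ≡ just (h (suc (r + i)) (suc n))
exitList-nth h n i (suc k) zero lt = refl
exitList-nth h n i (suc k) (suc r) (s≤s lt) = trans (exitList-nth h n (suc i) k r lt) (cong (λ z → just (h (suc z) (suc n))) (+-suc r i))

exitList-≡ : ∀ {n h π} → length π ≡ n → Exits n h π → exitList h n 0 n ≡ π
exitList-≡ {n} {h} {π} len ex = nth-ext _ π (trans (exitList-length h n 0 n) (sym len)) λ
  { (suc r) (_ , le) → let lt = subst (suc r ≤_) (exitList-length h n 0 n) le in
      trans (exitList-nth h n 0 n r lt) (trans (cong (λ z → just (h (suc z) (suc n))) (+-identityʳ r)) (sym (ex (suc r) (s≤s z≤n , lt)))) }

Pair : ℕ → ℕ → ℕ → ℕ → Set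
Pair c d w s = (w ≡ c × s ≡ d) ⊎ (w ≡ d × s ≡ c)

swapL-pair : ∀ {c d w s} → Pair c d w s → Pair c d (swapL c d w) (swapL c d s)
swapL-pair {c} {d} (inj₁ (refl , refl)) = inj₂ (swapL-p c d , swapL-q c d)
swapL-pair {c} {d} (inj₂ (refl , refl)) = inj₁ (swapL-q c d , swapL-p c d)

swapL-of-pair : ∀ {c d w s} → Pair c d w s → ∀ l → swapL w s l ≡ swapL c d l
swapL-of-pair (inj₁ (refl , refl)) l = refl
swapL-of-pair {c} {d} (inj₂ (refl , refl)) l = swapL-sym d c l

pair-unswap : ∀ {c d w s} → Pair c d (swapL c d w) (swapL c d s) → Pair c d w s
pair-unswap {c} {d} {w} {s} p = subst₂ (Pair c d) (swapL-invol c d w) (swapL-invol c d s) (swapL-pair p)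

module ToggleMore {R n T h v} (L : Lab R n T h v) (T' : ℕ → ℕ → Tile) (a b : ℕ) (pa : In n a) (pb : In n b)
              (tog : Toggled (T a b) (T' a b)) (off : OffCell n a b T T') where
  open Toggle L T' a b pa pb tog off public
  open Lab L
  open Cuts L

  later-in : ∀ i j → In n i → In n j → (a , suc b) ≼ (i , j) → h' i j ≡ sw (h i j) × v' (suc i) j ≡ sw (v (suc i) j)
  later-in i j pi pj (lower lt) = h'-above i j lt , inS i j pi pj lt
  later-in i j pi pj (same le) = h'-right j le , trans (v'-below (suc i) j ≤-refl) (sym (fixed (new (<⇒≤ le) (proj₂ pj)) (inj₂ (s≤s le))))

  earlier-in : ∀ i j → (i , j) ≼ (a , b) → h' i j ≡ h i j × v' (suc i) j ≡ v (suc i) j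
  earlier-in i j (lower lt) = h'-below i j lt , v'-below (suc i) j (m<n⇒m<1+n lt)
  earlier-in i j (same le) = h'-left j le , v'-below (suc i) j ≤-refl

  here-in : h' a b ≡ h a b × v' (suc a) b ≡ v (suc a) b
  here-in = earlier-in a b (same ≤-refl)

  any-in : ∀ i j → In n i → In n j → (h' i j ≡ h i j × v' (suc i) j ≡ v (suc i) j) ⊎ (h' i j ≡ sw (h i j) × v' (suc i) j ≡ sw (v (suc i) j))
  any-in i j pi pj with ≼-total a b i j
  ... | inj₁ x = inj₂ (later-in i j pi pj x)
  ... | inj₂ (inj₁ (lower x)) = inj₁ (earlier-in i j (lower x))
  ... | inj₂ (inj₁ (same x)) = inj₁ (earlier-in i j (same (<⇒≤ x)))
  ... | inj₂ (inj₂ (refl , refl)) = inj₁ here-in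

  crossings' : crossings T' n + isCross T a b ≡ crossings T n + isCross T' a b
  crossings' = gridSum-update (isCross T) (isCross T') n a b pa pb (λ i j pi pj ne → cong (b2n ∘ isTile cross) (sym (off i j pi pj ne)))

put : (ℕ → ℕ → Tile) → ℕ → ℕ → Tile → ℕ → ℕ → Tile
put T a b t x y with (x ≟ a) ×-dec (y ≟ b)
... | yes _ = t
... | no _ = T x y

put-here : ∀ T a b t → put T a b t a b ≡ t
put-here T a b t with (a ≟ a) ×-dec (b ≟ b)
... | yes _ = refl
... | no q = ⊥-elim (q (refl , refl))

put-off : ∀ T a b t x y → ¬ (x ≡ a × y ≡ b) → put T a b t x y ≡ T x y
put-off T a b t x y q with (x ≟ a) ×-dec (y ≟ b)
... | yes e = ⊥-elim (q e)
... | no _ = refl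

ne-cell : ∀ {a b a' b'} → (a , suc b) ≼ (a' , b') → ¬ (a' ≡ a × b' ≡ b)
ne-cell (lower x) (refl , _) = <-irrefl refl x
ne-cell (same x) (_ , refl) = <-irrefl refl x

-- Toggling two cells met by the same two pipes, (a , b) before (a' , b'), exchanges the pipes between them only.
module DoubleToggle {n T h v} (L : Lab _<_ n T h v) (T' : ℕ → ℕ → Tile) (a b a' b' : ℕ)
    (pa : In n a) (pb : In n b) (pa' : In n a') (pb' : In n b') (ord : (a , suc b) ≼ (a' , b'))
    (tog : Toggled (T a b) (T' a b)) (tog' : Toggled (T a' b') (T' a' b'))
    (opposite : isCross T a b + isCross T a' b' ≡ isCross T' a b + isCross T' a' b')
    (off : ∀ i j → In n i → In n j → ¬ (i ≡ a × j ≡ b) → ¬ (i ≡ a' × j ≡ b') → T' i j ≡ T i j)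
    (pair : Pair (h a b) (v (suc a) b) (h a' b') (v (suc a') b')) where

  private
    ne : ¬ (a' ≡ a × b' ≡ b)
    ne = ne-cell ord

    -- Only the first cell is toggled here. This tiling need not be reduced, so the labels are first
    -- carried through without any condition on crosses; counting restores the condition in `lab″`.
    T₁ : ℕ → ℕ → Tile
    T₁ = put T' a' b' (T a' b')

    T₁-there : T₁ a' b' ≡ T a' b'
    T₁-there = put-here T' a' b' (T a' b')

    T₁-off : ∀ i j → ¬ (i ≡ a' × j ≡ b') → T₁ i j ≡ T' i j
    T₁-off = put-off T' a' b' (T a' b')

    e₁ : T₁ a b ≡ T' a b
    e₁ = T₁-off a b (λ { (p , q) → ne (sym p , sym q) })

    off₁ : OffCell n a b T T₁
    off₁ i j pi pj x with (i ≟ a') ×-dec (j ≟ b')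
    ... | yes (refl , refl) = refl
    ... | no y = off i j pi pj x y

    module A₁ = ToggleMore L T₁ a b pa pb (subst (Toggled (T a b)) (sym e₁) tog) off₁
    module A₂ = ToggleMore A₁.lab' T' a' b' pa' pb' (subst (λ z → Toggled z (T' a' b')) (sym T₁-there) tog') (λ i j _ _ x → sym (T₁-off i j x))

    c d : ℕ
    c = h a b
    d = v (suc a) b

    mid-in : A₁.h' a' b' ≡ swapL c d (h a' b') × A₁.v' (suc a') b' ≡ swapL c d (v (suc a') b')
    mid-in = A₁.later-in a' b' pa' pb' ord

    pair₁ : Pair c d (A₁.h' a' b') (A₁.v' (suc a') b')
    pair₁ = subst₂ (Pair c d) (sym (proj₁ mid-in)) (sym (proj₂ mid-in)) (swapL-pair pair)

  h″ v″ : ℕ → ℕ → ℕ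
  h″ = A₂.h'
  v″ = A₂.v'

  exit″ : ∀ r → In n r → h″ r (suc n) ≡ h r (suc n)
  exit″ r pr = trans (A₂.exit' r pr) (trans (swapL-of-pair pair₁ (A₁.h' r (suc n))) (trans (cong (swapL c d) (A₁.exit' r pr)) (swapL-invol c d (h r (suc n)))))

  first-in : h″ a b ≡ h a b × v″ (suc a) b ≡ v (suc a) b
  first-in = trans (proj₁ (A₂.earlier-in a b (≼-weaken ord))) (proj₁ A₁.here-in) , trans (proj₂ (A₂.earlier-in a b (≼-weaken ord))) (proj₂ A₁.here-in)

  second-in : h″ a' b' ≡ swapL c d (h a' b') × v″ (suc a') b' ≡ swapL c d (v (suc a') b')
  second-in = trans (proj₁ A₂.here-in) (proj₁ mid-in) , trans (proj₂ A₂.here-in) (proj₂ mid-in)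

  private
    same-crossings : crossings T' n ≡ crossings T n
    same-crossings = +-cancelʳ-≡ (isCross T a b + isCross T a' b') _ _ (
        (trans (cong (crossings T' n +_) (+-comm (isCross T a b) _)) (trans (sym (+-assoc (crossings T' n) _ _))
        (trans (cong (λ z → crossings T' n + z + isCross T a b) (cong (b2n ∘ isTile cross) (sym T₁-there)))
        (trans (cong (_+ isCross T a b) A₂.crossings') (trans (+-assoc (crossings T₁ n) _ _) (trans (cong (crossings T₁ n +_) (+-comm (isCross T' a' b') _))
        (trans (sym (+-assoc (crossings T₁ n) _ _)) (trans (cong (_+ isCross T' a' b') A₁.crossings')
        (trans (+-assoc (crossings T n) _ _) (cong (crossings T n +_) (trans (cong (λ z → b2n (isTile cross z) + isCross T' a' b') e₁) (sym opposite)))))))))))))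

  exitList-same : exitList h″ n 0 n ≡ exitList h n 0 n
  exitList-same = nth-ext _ _ (trans (exitList-length h″ n 0 n) (sym (exitList-length h n 0 n))) λ
    { (suc r) (_ , le) → let lt = subst (suc r ≤_) (exitList-length h″ n 0 n) le in
        trans (exitList-nth h″ n 0 n r lt) (trans (cong just (exit″ (suc (r + 0)) (s≤s z≤n , ≤-trans (≤-reflexive (cong suc (+-identityʳ r))) lt)))
          (sym (exitList-nth h n 0 n r lt))) }

  lab″ : Lab _<_ n T' h″ v″
  lab″ = crossings-reduced A₂.lab' (trans (cong inversions exitList-same) (trans (reduced-crossings L) (sym same-crossings)))

-- Crosses and inversions drop together, so counting shows that no cross becomes descending.
module Uncross {n T h v} (L : Lab _<_ n T h v) (T' : ℕ → ℕ → Tile) (a b : ℕ) (pa : In n a) (pb : In n b)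
    (tc : T a b ≡ cross) (tb : T' a b ≡ bump) (off : OffCell n a b T T')
    (σ ρ : Perm) (lσ : length σ ≡ n) (lρ : length ρ ≡ n) (exσ : Exits n h σ)
    (exρ : ∀ r → In n r → nth ρ r ≡ just (swapL (h a b) (v (suc a) b) (h r (suc n))))
    (inv : inversions σ ≡ suc (inversions ρ)) where
  open ToggleMore L T' a b pa pb (subst₂ Toggled (sym tc) (sym tb) uncross) off public

  exits' : Exits n h' ρ
  exits' r pr = trans (exρ r pr) (cong just (sym (exit' r pr)))

  reduced' : Lab _<_ n T' h' v'
  reduced' = crossings-reduced lab' (trans (cong inversions (exitList-≡ {π = ρ} lρ exits')) (suc-injective (trans (sym inv) (trans (cong inversions (sym (exitList-≡ {π = σ} lσ exσ)))
     (trans (reduced-crossings L) (trans (sym (+-identityʳ _)) (trans (cong (λ z → crossings T n + b2n (isTile cross z)) (sym tb)) (trans (sym crossings')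
       (trans (cong (λ z → crossings T' n + b2n (isTile cross z)) tc) (+-comm (crossings T' n) 1))))))))))

-- Exchanges and inversions

data Replace (y x : ℕ) : List ℕ → List ℕ → Set where
  here  : ∀ {C} → Replace y x (y ∷ C) (x ∷ C)
  there : ∀ {z R R'} → Replace y x R R' → Replace y x (z ∷ R) (z ∷ R')

-- An exchange of two entries in inductive form, so that inversions can be compared by recursion
-- over the entries before and between them.
data Exchange (x y : ℕ) : List ℕ → List ℕ → Set where
  here  : ∀ {R R'} → Replace y x R R' → Exchange x y (x ∷ R) (y ∷ R')
  there : ∀ {z R R'} → Exchange x y R R' → Exchange x y (z ∷ R) (z ∷ R')

replace-count : ∀ {y x R R'} p → Replace y x R R' → countᵇ p R + b2n (p x) ≡ countᵇ p R' + b2n (p y)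
replace-count {y} {x} p (here {C}) rewrite count-∷ p y C | count-∷ p x C =
  solve 3 (λ a b c → a :+ b :+ c := c :+ b :+ a) refl (b2n (p y)) (countᵇ p C) (b2n (p x))
replace-count {y} {x} p (there {z} {R} {R'} r) rewrite count-∷ p z R | count-∷ p z R' =
  trans (+-assoc (b2n (p z)) _ _) (trans (cong (b2n (p z) +_) (replace-count p r)) (sym (+-assoc (b2n (p z)) _ _)))

exchange-count : ∀ {y x R R'} p → Exchange x y R R' → countᵇ p R ≡ countᵇ p R'
exchange-count {y} {x} p (here {R} {R'} r) rewrite count-∷ p x R | count-∷ p y R' =
  trans (+-comm (b2n (p x)) _) (trans (replace-count p r) (+-comm (countᵇ p R') _))
exchange-count p (there {z} {R} {R'} e) rewrite count-∷ p z R | count-∷ p z R' = cong (b2n (p z) +_) (exchange-count p e)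

-- Here `z` is an entry between the two exchanged ones: the left side counts its inversions with
-- them while `x` stands first, the right side after the exchange.
order-bits : ∀ x y z → x < y → b2n (z <ᵇ x) + b2n (y <ᵇ z) ≤ b2n (z <ᵇ y) + b2n (x <ᵇ z)
order-bits x y z lt with compareℕ z x
... | less zx rewrite <ᵇ-true zx | <ᵇ-true (<-trans zx lt) | <ᵇ-false (<⇒≤ (<-trans zx lt)) = m≤m+n 1 _
... | equal refl rewrite <ᵇ-false (≤-refl {z}) | <ᵇ-false (<⇒≤ lt) = z≤n
... | greater xz rewrite <ᵇ-false (<⇒≤ xz) | <ᵇ-true xz = ≤-trans (bit (y <ᵇ z)) (m≤n+m 1 _)
  where
  bit : ∀ b → b2n b ≤ 1
  bit true = ≤-refl
  bit false = z≤n

replace-inv : ∀ {x y R R'} → x < y → Replace y x R R' → inversions (x ∷ R) < inversions (y ∷ R')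
replace-inv {x} {y} lt (here {C}) rewrite count-∷ (λ z → z <ᵇ x) y C | count-∷ (λ z → z <ᵇ y) x C | <ᵇ-true lt | <ᵇ-false (<⇒≤ lt) =
  ≤-reflexive (cong suc (solve 3 (λ a b c → a :+ (b :+ c) := b :+ (a :+ c)) refl (countᵇ (λ z → z <ᵇ x) C) (countᵇ (λ z → z <ᵇ y) C) (inversions C)))
replace-inv {x} {y} lt (there {z} {R} {R'} r) rewrite count-∷ (λ u → u <ᵇ x) z R | count-∷ (λ u → u <ᵇ y) z R' =
  subst₂ _<_ (shuffle (b2n (z <ᵇ x)) (countᵇ (λ u → u <ᵇ x) R) (countᵇ (λ u → u <ᵇ z) R) (inversions R))
             (shuffle (b2n (z <ᵇ y)) (countᵇ (λ u → u <ᵇ y) R') (countᵇ (λ u → u <ᵇ z) R') (inversions R'))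
    (+-mono-≤-< ineq (replace-inv lt r))
  where
  shuffle : ∀ a b c d → (a + c) + (b + d) ≡ a + b + (c + d)
  shuffle = solve 4 (λ a b c d → (a :+ c) :+ (b :+ d) := a :+ b :+ (c :+ d)) refl
  ineq : b2n (z <ᵇ x) + countᵇ (λ u → u <ᵇ z) R ≤ b2n (z <ᵇ y) + countᵇ (λ u → u <ᵇ z) R'
  ineq = +-cancelʳ-≤ (b2n (x <ᵇ z)) _ _ (subst₂ _≤_
     (trans (solve 3 (λ a b c → (a :+ b) :+ c := a :+ (c :+ b)) refl (b2n (z <ᵇ x)) (b2n (y <ᵇ z)) (countᵇ (λ u → u <ᵇ z) R'))
        (trans (cong (b2n (z <ᵇ x) +_) (sym (replace-count (λ u → u <ᵇ z) r))) (sym (+-assoc (b2n (z <ᵇ x)) _ _))))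
     (solve 3 (λ a b c → (a :+ b) :+ c := a :+ c :+ b) refl (b2n (z <ᵇ y)) (b2n (x <ᵇ z)) (countᵇ (λ u → u <ᵇ z) R'))
     (+-monoˡ-≤ (countᵇ (λ u → u <ᵇ z) R') (order-bits x y z lt)))

exchange-inv : ∀ {x y R R'} → x < y → Exchange x y R R' → inversions R < inversions R'
exchange-inv lt (here r) = replace-inv lt r
exchange-inv lt (there {z} {R} {R'} e) rewrite exchange-count (λ u → u <ᵇ z) e = +-monoʳ-< (countᵇ (λ u → u <ᵇ z) R') (exchange-inv lt e)

mkReplace : ∀ {y x} (R R' : List ℕ) b → length R ≡ length R' → nth R b ≡ just y → nth R' b ≡ just x →
  (∀ i → i ≢ b → nth R i ≡ nth R' i) → Replace y x R R'
mkReplace (_ ∷ R) (_ ∷ R') (suc zero) l refl refl e = subst (λ z → Replace _ _ (_ ∷ R) (_ ∷ z)) (nth-ext R R' (suc-injective l) (λ { (suc i) _ → e (suc (suc i)) (λ ()) })) here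
mkReplace (z ∷ R) (z' ∷ R') (suc (suc b)) l p q e with e 1 (λ ())
... | refl = there (mkReplace R R' (suc b) (suc-injective l) p q (λ { zero _ → trans (nth-0 R) (sym (nth-0 R')) ; (suc i) ne → e (suc (suc i)) (ne ∘ suc-injective) }))

mkExchange : ∀ {x y} (R R' : List ℕ) a b → a < b → length R ≡ length R' → nth R a ≡ just x → nth R' a ≡ just y → nth R b ≡ just y → nth R' b ≡ just x →
  (∀ i → i ≢ a → i ≢ b → nth R i ≡ nth R' i) → Exchange x y R R'
mkExchange (_ ∷ R) (_ ∷ R') (suc zero) (suc (suc b)) lt l refl refl q q' e =
  here (mkReplace R R' (suc b) (suc-injective l) q q' (λ { zero _ → trans (nth-0 R) (sym (nth-0 R')) ; (suc i) ne → e (suc (suc i)) (λ ()) (ne ∘ suc-injective) }))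
mkExchange (_ ∷ R) (_ ∷ R') (suc zero) (suc zero) (s≤s ()) l p p' q q' e
mkExchange (z ∷ R) (z' ∷ R') (suc (suc a)) (suc zero) (s≤s ()) l p p' q q' e
mkExchange (z ∷ R) (z' ∷ R') (suc (suc a)) (suc (suc b)) (s≤s lt) l p p' q q' e with e 1 (λ ()) (λ ())
... | refl = there (mkExchange R R' (suc a) (suc b) lt (suc-injective l) p p' q q' (λ { zero _ _ → trans (nth-0 R) (sym (nth-0 R')) ; (suc i) ne ne' → e (suc (suc i)) (ne ∘ suc-injective) (ne' ∘ suc-injective) }))

module SwapPos (n : ℕ) (ρ : Perm) (len : length ρ ≡ n) (a b : ℕ) (pa : In n a) (pb : In n b) where
  σ : Perm
  σ = swapPos ρ a b

  length-σ : length σ ≡ n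
  length-σ = trans (length-map _ (oneTo (length ρ))) (trans (length-applyUpTo suc (length ρ)) len)

  private
    get : ℕ → ℕ
    get i = fromMaybe 0 (nth ρ i)
    get-≡ : ∀ i → In n i → nth ρ i ≡ just (get i)
    get-≡ i pi with nth-just ρ {i} (subst (λ z → In z i) (sym len) pi)
    ... | x , e rewrite e = refl
    at : ∀ i → In n i → nth σ i ≡ just (if i ≡ᵇ a then get b else (if i ≡ᵇ b then get a else get i))
    at i pi = nth-map _ (oneTo (length ρ)) (oneTo-nth (subst (λ z → In z i) (sym len) pi))

  σ-a : nth σ a ≡ nth ρ b
  σ-a = trans (at a pa) (trans (cong (λ z → just (if z then get b else (if a ≡ᵇ b then get a else get a))) (≡ᵇ-refl a)) (sym (get-≡ b pb)))

  σ-b : nth σ b ≡ nth ρ a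
  σ-b with a ≟ b
  ... | yes refl = σ-a
  ... | no ne = trans (at b pb) (trans (cong₂ (λ y z → just (if y then get b else (if z then get a else get b))) (≡ᵇ-false (ne ∘ sym)) (≡ᵇ-refl b)) (sym (get-≡ a pa)))

  σ-other : ∀ i → i ≢ a → i ≢ b → nth σ i ≡ nth ρ i
  σ-other i na nb with 1 ≤? i | i ≤? n
  ... | yes 1≤i | yes i≤n = trans (at i (1≤i , i≤n)) (trans (cong₂ (λ y z → just (if y then get b else (if z then get a else get i))) (≡ᵇ-false na) (≡ᵇ-false nb)) (sym (get-≡ i (1≤i , i≤n))))
  ... | no ne | _ = trans (outOf σ) (sym (outOf ρ))
    where
    outOf : ∀ xs → nth xs i ≡ nothing
    outOf xs with nth xs i in e
    ... | nothing = refl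
    ... | just _ = ⊥-elim (ne (proj₁ (nth-bound xs e)))
  ... | yes _ | no ne = trans (outOf σ length-σ) (sym (outOf ρ len))
    where
    outOf : ∀ xs → length xs ≡ n → nth xs i ≡ nothing
    outOf xs l with nth xs i in e
    ... | nothing = refl
    ... | just _ = ⊥-elim (ne (subst (i ≤_) l (proj₂ (nth-bound xs e))))

  -- If the larger entry stood first in `ρ`, the swap would have removed inversions instead of
  -- adding one.
  ascent : ∀ {x y} → a < b → nth ρ a ≡ just x → nth ρ b ≡ just y → x ≢ y → inversions σ ≡ suc (inversions ρ) → x < y
  ascent {x} {y} lt ex ey ne inv with compareℕ x y
  ... | less p = p
  ... | equal p = ⊥-elim (ne p)
  ... | greater p = ⊥-elim (<-asym (≤-reflexive (sym inv))
        (exchange-inv p (mkExchange σ ρ a b lt (trans length-σ (sym len)) (trans σ-a ey) ex (trans σ-b ex) ey (σ-other))))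

-- The two pipes through a bump

filterOne : ∀ (q : ℕ → Bool) s len c → s ≤ c → c < len + s → q c ≡ true → (∀ x → s ≤ x → x < len + s → x ≢ c → q x ≡ false) →
  filterᵇ q (rangeFrom s len) ≡ c ∷ []
filterOne q s zero c le lt _ _ = ⊥-elim (<⇒≱ lt le)
filterOne q s (suc len) c le lt qc e = trans (cong (filterᵇ q) (rangeFrom-∷ s len)) (trans (filterᵇ-∷ q s _) go)
  where
  go : (if q s then s ∷ filterᵇ q (rangeFrom (suc s) len) else filterᵇ q (rangeFrom (suc s) len)) ≡ c ∷ []
  go with m≤n⇒m<n∨m≡n le
  ... | inj₂ refl rewrite qc = cong (s ∷_) (filterNone q (suc s) len (λ x u w → e x (<⇒≤ u) (≤-trans w (≤-reflexive (+-suc len s))) (>⇒≢ u)))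
  ... | inj₁ s<c rewrite e s ≤-refl (s≤s (m≤n+m s len)) (<⇒≢ s<c) =
    filterOne q (suc s) len c s<c (≤-trans lt (≤-reflexive (sym (+-suc len s)))) qc (λ x u w → e x (<⇒≤ u) (≤-trans w (≤-reflexive (+-suc len s))))

filterTwo : ∀ (q : ℕ → Bool) s len c d → s ≤ c → c < d → d < len + s → q c ≡ true → q d ≡ true →
  (∀ x → s ≤ x → x < len + s → x ≢ c → x ≢ d → q x ≡ false) → filterᵇ q (rangeFrom s len) ≡ c ∷ d ∷ []
filterTwo q s zero c d le lt lt' _ _ _ = ⊥-elim (<⇒≱ lt' (≤-trans le (<⇒≤ lt)))
filterTwo q s (suc len) c d le lt lt' qc qd e = trans (cong (filterᵇ q) (rangeFrom-∷ s len)) (trans (filterᵇ-∷ q s _) go)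
  where
  end : d < len + suc s
  end = ≤-trans lt' (≤-reflexive (sym (+-suc len s)))
  go : (if q s then s ∷ filterᵇ q (rangeFrom (suc s) len) else filterᵇ q (rangeFrom (suc s) len)) ≡ c ∷ d ∷ []
  go with m≤n⇒m<n∨m≡n le
  ... | inj₂ refl rewrite qc = cong (s ∷_) (filterOne q (suc s) len d lt end qd (λ x u w ne → e x (<⇒≤ u) (≤-trans w (≤-reflexive (+-suc len s))) (>⇒≢ u) ne))
  ... | inj₁ s<c rewrite e s ≤-refl (s≤s (m≤n+m s len)) (<⇒≢ s<c) (<⇒≢ (<-trans s<c lt)) =
    filterTwo q (suc s) len c d s<c lt end qc qd (λ x u w → e x (<⇒≤ u) (≤-trans w (≤-reflexive (+-suc len s))))

filter-map : ∀ (p : Y → Bool) (F : X → Y) xs → filterᵇ p (map F xs) ≡ map F (filterᵇ (p ∘ F) xs)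
filter-map p F [] = refl
filter-map p F (x ∷ xs) with p (F x)
... | true = cong (F x ∷_) (filter-map p F xs)
... | false = filter-map p F xs

bumpLabels : ∀ {R t w e n s} → Loc R t w e n s → t ≡ bump → n ≡ w × e ≡ s × 0 < w × 0 < s
bumpLabels (bumpˡ x y) refl = refl , refl , x , y

module BumpCross {n g h v} (s : Sq n g) (L : Lab _<_ n (tile g) h v) (a b : ℕ) (pa : In n a) (pb : In n b) (tb : tile g a b ≡ bump) where
  open Lab L
  open Cuts L
  open Pipes L
  open Crosses s L
  open Meeting s L

  private
    bl = bumpLabels (loc a b pa pb) tb
    w z : ℕ
    w = h a b
    z = v (suc a) b
    pw : In n w
    pw = proj₁ (reach a b fromW pa pb (proj₁ (proj₂ (proj₂ bl))))
    pz : In n z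
    pz = proj₁ (reach a b fromS pa pb (proj₂ (proj₂ (proj₂ bl))))
    w≢z : w ≢ z
    w≢z e = 1+n≢n (sym (unique a b pa (proj₁ pb) (m≤n⇒m≤1+n (proj₂ pb)) (proj₁ pw) cur (subst (At a b (suc b)) (sym e) (new ≤-refl (proj₂ pb)))))

    F : ℕ → List Cell
    F c = pathOf (tracePipe n g c)

    hit : ∀ c → In n c → w ≡ c ⊎ z ≡ c → memCell (a , b) (F c) ≡ true
    hit c pc m rewrite pathOf-≡ c pc = memCell-true (cellsOf c pc) (visits⇒∈ c pc (a , b) (pa , pb , m))

    miss : ∀ c → In n c → w ≢ c → z ≢ c → memCell (a , b) (F c) ≡ false
    miss c pc x y rewrite pathOf-≡ c pc with memCell (a , b) (cellsOf c pc) in e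
    ... | false = refl
    ... | true with ∈⇒visits c pc (a , b) (memCell-sound (cellsOf c pc) e)
    ...   | _ , _ , inj₁ q = ⊥-elim (x q)
    ...   | _ , _ , inj₂ q = ⊥-elim (y q)

    -- `pipesThrough` runs over the columns, so the two pipes appear in numerical order, whichever
    -- of them enters the bump from the west.
    through : ∀ c d → (pc : In n c) (pd : In n d) → c < d → Pair c d w z → pipesThrough g (a , b) ≡ cellsOf c pc ∷ cellsOf d pd ∷ []
    through c d pc pd lt pr rewrite Sq.side s = trans (filter-map (memCell (a , b)) F (oneTo n))
      (trans (cong (map F) (filterTwo (memCell (a , b) ∘ F) 1 n c d (proj₁ pc) lt (≤-trans (s≤s (proj₂ pd)) (≤-reflexive (+-comm 1 n)))
         (hit c pc (is₁ pr)) (hit d pd (is₂ pr)) (λ x u q nc nd → miss x (u , ≤-pred (≤-trans q (≤-reflexive (+-comm n 1)))) (out₁ pr nc nd) (out₂ pr nc nd))))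
       (cong₂ (λ x y → x ∷ y ∷ []) (pathOf-≡ c pc) (pathOf-≡ d pd)))
      where
      is₁ : Pair c d w z → w ≡ c ⊎ z ≡ c
      is₁ (inj₁ (p , _)) = inj₁ p
      is₁ (inj₂ (_ , p)) = inj₂ p
      is₂ : Pair c d w z → w ≡ d ⊎ z ≡ d
      is₂ (inj₁ (_ , p)) = inj₂ p
      is₂ (inj₂ (p , _)) = inj₁ p
      out₁ : ∀ {x} → Pair c d w z → x ≢ c → x ≢ d → w ≢ x
      out₁ (inj₁ (p , _)) nc nd refl = nc p
      out₁ (inj₂ (p , _)) nc nd refl = nd p
      out₂ : ∀ {x} → Pair c d w z → x ≢ c → x ≢ d → z ≢ x
      out₂ (inj₁ (_ , p)) nc nd refl = nd p
      out₂ (inj₂ (_ , p)) nc nd refl = nc p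

    Answer : ℕ → ℕ → Set
    Answer c d = (crossOfBump g (a , b) ≡ noCross × (∀ x → ¬ Meets c d x)) ⊎ Σ Cell λ x → crossOfBump g (a , b) ≡ crossAt x × Meets c d x

    answer : ∀ c d → (pc : In n c) (pd : In n d) → c < d → Pair c d w z → Answer c d
    answer c d pc pd lt pr with common c d pc pd (<⇒≢ lt)
    ... | none e no-meet = inj₁ (go , no-meet)
      where
      go : crossOfBump g (a , b) ≡ noCross
      go rewrite through c d pc pd lt pr | e = refl
    ... | one x e m = inj₂ (x , go , m)
      where
      go : crossOfBump g (a , b) ≡ crossAt x
      go rewrite through c d pc pd lt pr | e = refl

    flipMeets : ∀ {c d x} → Meets c d x → Meets d c x
    flipMeets (p , q , inj₁ x) = p , q , inj₂ x
    flipMeets (p , q , inj₂ x) = p , q , inj₁ x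

  private
    crossInfo : (crossOfBump g (a , b) ≡ noCross × (∀ x → ¬ Meets w z x)) ⊎ Σ Cell λ x → crossOfBump g (a , b) ≡ crossAt x × Meets w z x
    crossInfo with compareℕ w z
    ... | less lt = answer w z pw pz lt (inj₁ (refl , refl))
    ... | equal e = ⊥-elim (w≢z e)
    ... | greater gt with answer z w pz pw gt (inj₂ (refl , refl))
    ...   | inj₁ (e , f) = inj₁ (e , λ x m → f x (flipMeets m))
    ...   | inj₂ (x , e , m) = inj₂ (x , e , flipMeets m)

  abstract
    crossOfBump-spec : (crossOfBump g (a , b) ≡ noCross × (∀ x → ¬ Meets w z x)) ⊎ Σ Cell λ x → crossOfBump g (a , b) ≡ crossAt x × Meets w z x
    crossOfBump-spec = crossInfo

-- States of the insertion

-- The invariant of the moving pipe. When the insertion stops, its exit row supplies the position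
-- `α ≤ k` of the cover.
record SmallExit (n k : ℕ) (h : ℕ → ℕ → ℕ) (l : ℕ) : Set where
  constructor mkSmall
  field
    row : ℕ
    rowIn : In n row
    row≤k : row ≤ k
    exit : h row (suc n) ≡ l

-- a grid about to be drooped at an r-turn (Ready), and a grid just drooped to a W–N turn (Landed)
record Ready (n : ℕ) (ρ : Perm) (k : ℕ) (g : Grid) (i j : ℕ) : Set where
  field
    drawing : Drawing n ρ g
  open Drawing drawing public
  field
    pi : In n i
    pj : In n j
    turn : tile g i j ≡ relbow ⊎ tile g i j ≡ bump
    only : OnlyBump n (tile g) i j
    small : SmallExit n k h (h i (suc j))

record Landed (n : ℕ) (ρ : Perm) (k : ℕ) (g : Grid) (i j : ℕ) : Set where
  field
    drawing : Drawing n ρ g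
  open Drawing drawing public
  field
    pi : In n i
    pj : In n j
    turn : tile g i j ≡ jelbow ⊎ tile g i j ≡ bump
    only : OnlyBump n (tile g) i j
    small : SmallExit n k h (h i j)

record Drooped (n : ℕ) (g : Grid) (a b : ℕ) (g' : Grid) (a' b' : ℕ) : Set where
  field
    rect : Rect n a b a' b'
    can : CanDroop (tile g) a b a' b'
    can' : CanUndroop (tile g') a b a' b'
    bwd : ∀ i j → In n i → In n j → tile g i j ≡ undroopZ (zone a a' i) (zone b b' j) (tile g' i j)
    weight : ∀ i → In n i → rowSum (isBlank (tile g)) n i + b2n ((i ≡ᵇ a) ∧ isTile relbow (tile g a b))
                          ≡ rowSum (isBlank (tile g')) n i + b2n ((i ≡ᵇ a') ∧ isTile jelbow (tile g' a' b'))

canUndroop-cong : ∀ {n T T' a b a' b'} → Rect n a b a' b' → (∀ i j → In n i → In n j → T' i j ≡ T i j) → CanUndroop T a b a' b' → CanUndroop T' a b a' b'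
canUndroop-cong R e c = record
  { corner = subst (λ t → t ≡ jelbow ⊎ t ≡ bump) (sym (e _ _ ina' inb')) corner
  ; colX = λ i x y → trans (e _ _ (rowIn x (<⇒≤ y)) inb') (colX i x y)
  ; rowX = λ j x y → trans (e _ _ ina' (colIn x (<⇒≤ y))) (rowX j x y)
  ; colE = λ q → colE (trans (sym (e _ _ ina inb')) q)
  ; rowE = λ q → rowE (trans (sym (e _ _ ina' inb)) q) }
  where
  open Rect R
  open CanUndroop c

canDroop-cong : ∀ {n T T' a b a' b'} → Rect n a b a' b' → (∀ i j → In n i → In n j → T' i j ≡ T i j) → CanDroop T a b a' b' → CanDroop T' a b a' b'
canDroop-cong R e c = record
  { corner = subst (λ t → t ≡ relbow ⊎ t ≡ bump) (sym (e _ _ ina inb)) corner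
  ; colX = λ i x y → trans (e _ _ (rowIn x (<⇒≤ y)) inb) (colX i x y)
  ; rowX = λ j x y → trans (e _ _ ina (colIn x (<⇒≤ y))) (rowX j x y)
  ; colE = λ q → colE (trans (sym (e _ _ ina' inb)) q)
  ; rowE = λ q → rowE (trans (sym (e _ _ ina inb')) q) }
  where
  open Rect R
  open CanDroop c

onlyBump-cong : ∀ {n T T' a b} → (∀ i j → In n i → In n j → T' i j ≡ T i j) → OnlyBump n T a b → OnlyBump n T' a b
onlyBump-cong e ob i j pi pj q = ob i j pi pj (trans (sym (e i j pi pj)) q)

module DroopGrid {n g h v a b a' b'} (s : Sq n g) (L : Lab _<_ n (tile g) h v) (R : Rect n a b a' b') (C : CanDroop (tile g) a b a' b') (ob : OnlyBump n (tile g) a b) where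
  open Rect R
  private
    module Dr = Droop L R C ob
    spec = Redraw.redraw-spec R (tile g) Dr.p h v Dr.cell g s (λ _ _ _ _ → refl)

  out : Grid
  out = proj₁ spec

  redraw-≡ : redraw a b a' b' g ≡ just (out , (a' , b'))
  redraw-≡ = proj₁ (proj₂ spec)

  sq' : Sq n out
  sq' = proj₁ (proj₂ (proj₂ spec))

  tile-≡ : ∀ i j → In n i → In n j → tile out i j ≡ Dr.T' i j
  tile-≡ = proj₂ (proj₂ (proj₂ spec))

  h′ v′ : ℕ → ℕ → ℕ
  h′ = Dr.h'
  v′ = Dr.v'

  lab' : Lab _<_ n (tile out) h′ v′
  lab' = labCong tile-≡ Dr.lab'

  exit' : ∀ r → h′ r (suc n) ≡ h r (suc n)
  exit' = Dr.exit'

  label' : h′ a' b' ≡ h a (suc b)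
  label' = Dr.wn-label

  only' : OnlyBump n (tile out) a' b'
  only' = onlyBump-cong tile-≡ Dr.only'

  target : tile g a' b' ≡ blank × tile out a' b' ≡ jelbow ⊎ tile g a' b' ≡ relbow × tile out a' b' ≡ bump
  target = go (Dr.cell ina' inb' (isHi refl) (isHi refl)) (trans (tile-≡ a' b' ina' inb') (Dr.T'-zone (isHi refl) (isHi refl)))
    where
    go : ∀ {t u w e m z} → OldCell Dr.p hi hi t w e m z → u ≡ droopZ hi hi t → t ≡ blank × u ≡ jelbow ⊎ t ≡ relbow × u ≡ bump
    go (outside () _) _
    go (hihi-b _) e = inj₁ (refl , e)
    go (hihi-r _ _) e = inj₂ (refl , e)

  drooped : Drooped n g a b out a' b'
  drooped = record
    { rect = R ; can = C
    ; can' = canUndroop-cong R tile-≡ Dr.can'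
    ; bwd = λ i j pi pj → sym (trans (cong (undroopZ (zone a a' i) (zone b b' j)) (tile-≡ i j pi pj)) (Dr.undone i j pi pj))
    ; weight = λ i pi → trans (Dr.weight' i pi) (cong₂ _+_
        (sumTo-cong n (λ j lt → cong (b2n ∘ isTile blank) (sym (tile-≡ i (suc j) pi (s≤s z≤n , lt)))))
        (cong (λ t → b2n ((i ≡ᵇ a') ∧ isTile jelbow t)) (sym (tile-≡ a' b' ina' inb'))))
    }

-- Min-droop of a state, forwards and backwards

notCross-true : ∀ {m t} → m ≡ just t → t ≢ cross → not (isTileAt cross m) ≡ true
notCross-true {t = blank} refl ne = refl
notCross-true {t = hor} refl ne = refl
notCross-true {t = ver} refl ne = refl
notCross-true {t = cross} refl ne = ⊥-elim (ne refl)
notCross-true {t = relbow} refl ne = refl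
notCross-true {t = jelbow} refl ne = refl
notCross-true {t = bump} refl ne = refl

notCross-false : ∀ {m t} → m ≡ just t → t ≡ cross → not (isTileAt cross m) ≡ false
notCross-false refl refl = refl

cross-sound : ∀ {m t} → m ≡ just t → not (isTileAt cross m) ≡ false → t ≡ cross
cross-sound {t = cross} refl e = refl

notCross-sound : ∀ {m t} → m ≡ just t → not (isTileAt cross m) ≡ true → t ≢ cross
notCross-sound refl () refl

seSeg : ∀ {m t} → m ≡ just t → t ≡ relbow ⊎ t ≡ bump → hasSeg SE (fromMaybe blank m) ≡ true
seSeg refl (inj₁ refl) = refl
seSeg refl (inj₂ refl) = refl

search-end : ∀ {a n a'} → a ≤ n → a' ≤ suc n → a' < suc n ∸ a + suc a
search-end {a} {n} le le' = ≤-trans (s≤s le') (≤-reflexive (sym (trans (+-suc (suc n ∸ a) a) (cong suc (m∸n+n≡m (m≤n⇒m≤1+n le))))))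

search : ∀ (p : ℕ → Bool) a n → a ≤ n → p (suc n) ≡ true →
  Σ ℕ λ a' → a < a' × a' ≤ suc n × p a' ≡ true × (∀ x → a < x → x < a' → p x ≡ false)
search p a n le e with findFirst p (suc a) (n ∸ a) (subst (λ z → p z ≡ true) (sym eq) e)
  where
  eq : n ∸ a + suc a ≡ suc n
  eq = trans (+-suc (n ∸ a) a) (cong suc (m∸n+n≡m le))
... | a' , x , y , z , w = a' , x , ≤-trans y (≤-reflexive (trans (+-suc (n ∸ a) a) (cong suc (m∸n+n≡m le)))) , z , w

growN-0 : ∀ {m} g → m ≡ 0 → growN m g ≡ g
growN-0 g refl = refl

ensureSize-small : ∀ {n g m} → Sq n g → m ≤ n → ensureSize m g ≡ g
ensureSize-small {n} {g} {m} s le = growN-0 g (trans (cong (m ∸_) (Sq.side s)) (m≤n⇒m∸n≡0 le))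

minDroop-in : ∀ {n g a b a' b'} → Sq n g → Rect n a b a' b' → CanDroop (tile g) a b a' b' → minDroop g a b ≡ redraw a b a' b' g
minDroop-in {n} {g} {a} {b} {a'} {b'} s R C = trans
  (minDroop-redraw g a b a' b' (seSeg (vt a b ina inb) corner)
    (subst (λ z → findᵇ (λ i → not (isTileAt cross (vtile g i b))) (rangeFrom (suc a) (suc z ∸ a)) ≡ just a') (sym (Sq.side s))
      (findᵇ-range _ (suc a) (suc n ∸ a) a' a<a' (search-end (proj₂ ina) (m≤n⇒m≤1+n a'≤n)) (notCross-true (vt a' b ina' inb) colE)
        (λ x u w → notCross-false (vt x b (rowIn u (<⇒≤ w)) inb) (colX x u w))))
    (subst (λ z → findᵇ (λ j → not (isTileAt cross (vtile g a j))) (rangeFrom (suc b) (suc z ∸ b)) ≡ just b') (sym (Sq.side s))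
      (findᵇ-range _ (suc b) (suc n ∸ b) b' b<b' (search-end (proj₂ inb) (m≤n⇒m≤1+n b'≤n)) (notCross-true (vt a b' ina inb') rowE)
        (λ x u w → notCross-false (vt a x ina (colIn u (<⇒≤ w))) (rowX x u w)))))
  (cong (redraw a b a' b') (ensureSize-small s (⊔-lub a'≤n b'≤n)))
  where
  open Rect R
  open CanDroop C
  vt : ∀ i j → In n i → In n j → vtile g i j ≡ just (tile g i j)
  vt = GrowTiles.vtile-in s

minDroop-grow : ∀ {n g a b a' b'} → Sq n g → In n a → In n b → Rect (suc n) a b a' b' → CanDroop (tile (grow g)) a b a' b' → a' ⊔ b' ≡ suc n →
  minDroop g a b ≡ redraw a b a' b' (grow g)
minDroop-grow {n} {g} {a} {b} {a'} {b'} s pa pb R C full = trans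
  (minDroop-redraw g a b a' b' (seSeg (vt a b ina inb) corner)
    (subst (λ z → findᵇ (λ i → not (isTileAt cross (vtile g i b))) (rangeFrom (suc a) (suc z ∸ a)) ≡ just a') (sym (Sq.side s))
      (findᵇ-range _ (suc a) (suc n ∸ a) a' a<a' (search-end (proj₂ pa) a'≤n) (notCross-true (vt a' b ina' inb) colE)
        (λ x u w → notCross-false (vt x b (rowIn u (<⇒≤ w)) inb) (colX x u w))))
    (subst (λ z → findᵇ (λ j → not (isTileAt cross (vtile g a j))) (rangeFrom (suc b) (suc z ∸ b)) ≡ just b') (sym (Sq.side s))
      (findᵇ-range _ (suc b) (suc n ∸ b) b' b<b' (search-end (proj₂ pb) b'≤n) (notCross-true (vt a b' ina inb') rowE)
        (λ x u w → notCross-false (vt a x ina (colIn u (<⇒≤ w))) (rowX x u w)))))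
  (cong (redraw a b a' b') (cong (λ z → growN z g) (trans (cong₂ _∸_ full (Sq.side s)) (m+n∸n≡m 1 n))))
  where
  open Rect R
  open CanDroop C
  vt : ∀ i j → In (suc n) i → In (suc n) j → vtile g i j ≡ just (tile (grow g) i j)
  vt = GrowTiles.vtile-grow s

record Target (n : ℕ) (g : Grid) (a b : ℕ) : Set where
  field
    a' b' : ℕ
    rect : Rect (suc n) a b a' b'
    can : CanDroop (tile (grow g)) a b a' b'

-- Just outside the square there are vertical tiles below and horizontal ones to the right, so both
-- searches end at `suc n` at the latest and one enlargement is enough.
findTarget : ∀ {n g a b} → Sq n g → In n a → In n b → tile g a b ≡ relbow ⊎ tile g a b ≡ bump → Target n g a b
findTarget {n} {g} {a} {b} s pa pb turn
  with search (λ i → not (isTileAt cross (vtile g i b))) a n (proj₂ pa) (notCross-true (GrowTiles.vtile-grow s (suc n) b (s≤s z≤n , ≤-refl) (up pb)) (λ e → nv (trans (sym (GrowTiles.grow-bottom s b pb)) e)))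
     | search (λ j → not (isTileAt cross (vtile g a j))) b n (proj₂ pb) (notCross-true (GrowTiles.vtile-grow s a (suc n) (up pa) (s≤s z≤n , ≤-refl)) (λ e → nh (trans (sym (GrowTiles.grow-right s a pa)) e)))
  where
  up : ∀ {i} → In n i → In (suc n) i
  up (x , y) = x , m≤n⇒m≤1+n y
  nv : ver ≢ cross
  nv ()
  nh : hor ≢ cross
  nh ()
... | a' , a<a' , a'≤ , pa' , colX | b' , b<b' , b'≤ , pb' , rowX = record
  { a' = a' ; b' = b' ; rect = R
  ; can = record
    { corner = subst (λ t → t ≡ relbow ⊎ t ≡ bump) (sym (GrowTiles.grow-old s a b pa pb)) turn
    ; colX = λ i x y → cross-sound (vt i b (rowIn x (<⇒≤ y)) inb) (colX i x y)
    ; rowX = λ j x y → cross-sound (vt a j ina (colIn x (<⇒≤ y))) (rowX j x y)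
    ; colE = notCross-sound (vt a' b ina' inb) pa'
    ; rowE = notCross-sound (vt a b' ina inb') pb' } }
  where
  R : Rect (suc n) a b a' b'
  R = record { 1≤a = proj₁ pa ; 1≤b = proj₁ pb ; a<a' = a<a' ; b<b' = b<b' ; a'≤n = a'≤ ; b'≤n = b'≤ }
  open Rect R
  vt : ∀ i j → In (suc n) i → In (suc n) j → vtile g i j ≡ just (tile (grow g) i j)
  vt = GrowTiles.vtile-grow s

shrink : ∀ {n g a b a' b'} → Sq n g → a' ≤ n → b' ≤ n → Rect (suc n) a b a' b' → CanDroop (tile (grow g)) a b a' b' →
  Rect n a b a' b' × CanDroop (tile g) a b a' b'
shrink {n} {g} {a} {b} {a'} {b'} s a'≤ b'≤ R C = R' , canDroop-cong R' (λ i j pi pj → sym (GrowTiles.grow-old s i j pi pj)) C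
  where
  R' : Rect n a b a' b'
  R' = record { 1≤a = Rect.1≤a R ; 1≤b = Rect.1≤b R ; a<a' = Rect.a<a' R ; b<b' = Rect.b<b' R ; a'≤n = a'≤ ; b'≤n = b'≤ }

record DroopsTo (n : ℕ) (ρ : Perm) (k : ℕ) (g : Grid) (i j : ℕ) : Set where
  field
    g' : Grid
    i' j' : ℕ
    result : minDroop g i j ≡ just (g' , (i' , j'))
    state : Landed n ρ k g' i' j'
    drooped : Drooped n g i j g' i' j'

module DroopState {n ρ k g a b a' b'} (A : Ready n ρ k g a b) (R : Rect n a b a' b') (C : CanDroop (tile g) a b a' b') where
  open Ready A
  open DroopGrid sq lab R C only

  droopsTo : DroopsTo n ρ k g a b
  droopsTo = record
    { g' = out ; i' = a' ; j' = b'
    ; result = trans (minDroop-in sq R C) redraw-≡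
    ; state = record
      { drawing = record { sq = sq' ; len = len ; h = h′ ; v = v′ ; lab = lab' ; exits = λ r pr → trans (exits r pr) (cong just (sym (exit' r))) }
      ; pi = Rect.ina' R ; pj = Rect.inb' R ; turn = [ inj₁ ∘ proj₂ , inj₂ ∘ proj₂ ]′ target ; only = only'
      ; small = mkSmall (SmallExit.row small) (SmallExit.rowIn small) (SmallExit.row≤k small) (trans (exit' _) (trans (SmallExit.exit small) (sym label'))) }
    ; drooped = drooped }

searchBack : ∀ (f : ℕ → Tile) m → f 1 ≢ cross → Σ ℕ λ a → 1 ≤ a × a ≤ suc m × f a ≢ cross × (∀ x → a < x → x ≤ suc m → f x ≡ cross)
searchBack f zero ne = 1 , ≤-refl , ≤-refl , ne , λ x u w → ⊥-elim (<⇒≱ u w)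
searchBack f (suc m) ne with isTile cross (f (suc (suc m))) in e
... | false = suc (suc m) , s≤s z≤n , ≤-refl , (λ q → ff (trans (sym e) (cong (isTile cross) q))) , λ x u w → ⊥-elim (<⇒≱ u w)
  where
  ff : false ≢ true
  ff ()
... | true with searchBack f m ne
...   | a , p , q , r , w = a , p , m≤n⇒m≤1+n q , r , last'
  where
  last' : ∀ x → a < x → x ≤ suc (suc m) → f x ≡ cross
  last' x u le with m≤n⇒m<n∨m≡n le
  ... | inj₁ (s≤s lt) = w x u lt
  ... | inj₂ refl = isTile-cross _ e

record DroopsFrom (n : ℕ) (ρ : Perm) (k : ℕ) (g' : Grid) (i' j' : ℕ) : Set where
  field
    g : Grid
    i j : ℕ
    result : minDroop g i j ≡ just (g' , (i' , j'))
    state : Ready n ρ k g i j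

wnLabels : ∀ {R t w e n s} → Loc R t w e n s → t ≡ jelbow ⊎ t ≡ bump → n ≡ w × 0 < w
wnLabels (jelbowˡ x) (inj₁ refl) = refl , x
wnLabels (bumpˡ x y) (inj₂ refl) = refl , x

-- No pipe crosses the top or the left border, so row 1 and column 1 contain no cross and the
-- searches upwards and to the left succeed within the square.
undroop : ∀ {n ρ k g' a' b'} → Landed n ρ k g' a' b' → DroopsFrom n ρ k g' a' b'
undroop {n} {ρ} {k} {g'} {a'} {b'} B = go a' b' refl refl pi pj
  where
  open Landed B
  open Lab lab
  lb = wnLabels (loc a' b' pi pj) turn
  go : ∀ x y → x ≡ a' → y ≡ b' → In n x → In n y → DroopsFrom n ρ k g' a' b'
  go (suc zero) y refl refl px py = ⊥-elim (n≮0 (subst (0 <_) (trans (sym (proj₁ lb)) (top b' pj)) (proj₂ lb)))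
  go (suc (suc _)) (suc zero) refl refl px py = ⊥-elim (n≮0 (subst (0 <_) (left a' pi) (proj₂ lb)))
  go (suc (suc x)) (suc (suc y)) refl refl px py
    with searchBack (λ i → tile g' i b') x (λ e → let c = crossEqs (loc 1 b' (≤-refl , ≤-trans (s≤s z≤n) (proj₂ px)) pj) e in
              n≮0 (subst (0 <_) (trans (sym (proj₁ (proj₂ c))) (top b' pj)) (proj₁ (proj₂ (proj₂ (proj₂ c))))))
       | searchBack (λ j → tile g' a' j) y (λ e → let c = crossEqs (loc a' 1 pi (≤-refl , ≤-trans (s≤s z≤n) (proj₂ py))) e in
              n≮0 (subst (0 <_) (left a' pi) (proj₁ (proj₂ (proj₂ c)))))
  ... | a , 1≤a , a≤ , colE , colX | b , 1≤b , b≤ , rowE , rowX = record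
    { g = mkGrid n U.T' ; i = a ; j = b
    ; result = trans (minDroop-in sqU R canU) (trans DG.redraw-≡ (cong (λ z → just (z , (a' , b'))) same-grid))
    ; state = record
       { drawing = record { sq = sqU ; len = len ; h = U.h' ; v = U.v' ; lab = labU ; exits = λ r pr → trans (exits r pr) (cong just (sym (U.exit' r))) }
       ; pi = Rect.ina R ; pj = Rect.inb R ; turn = CanDroop.corner canU ; only = onlyU
       ; small = mkSmall (SmallExit.row small) (SmallExit.rowIn small) (SmallExit.row≤k small) (trans (U.exit' _) (trans (SmallExit.exit small) (sym U.se-label))) } }
    where
    R : Rect n a b a' b'
    R = record { 1≤a = 1≤a ; 1≤b = 1≤b ; a<a' = s≤s a≤ ; b<b' = s≤s b≤ ; a'≤n = proj₂ pi ; b'≤n = proj₂ pj }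
    can : CanUndroop (tile g') a b a' b'
    can = record { corner = turn ; colX = λ i u w → colX i u (≤-pred w) ; rowX = λ j u w → rowX j u (≤-pred w) ; colE = colE ; rowE = rowE }
    module U = Undroop lab R can only
    sqU = mkGrid-sq n U.T'
    tU : ∀ i j → In n i → In n j → tile (mkGrid n U.T') i j ≡ U.T' i j
    tU = mkGrid-tile n U.T'
    canU = canDroop-cong R tU U.can'
    onlyU = onlyBump-cong tU U.only'
    labU = labCong tU U.lab'
    module DG = DroopGrid sqU labU R canU onlyU
    same-grid : DG.out ≡ g'
    same-grid = grid-ext DG.sq' sq (λ i j qi qj → trans (DG.tile-≡ i j qi qj) (trans (cong (droopZ (zone a a' i) (zone b b' j)) (tU i j qi qj)) (U.redone i j qi qj)))

-- If the upper sides of the two rectangles differed, the cell of column `b'` in the lower of them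
-- would be a cross for one and no cross for the other; likewise for the left sides. With equal
-- corners `undroopZ` gives back the tiles.
drooped-inj : ∀ {n g₁ g₂ g' a₁ b₁ a₂ b₂ a' b'} → Sq n g₁ → Sq n g₂ → Drooped n g₁ a₁ b₁ g' a' b' → Drooped n g₂ a₂ b₂ g' a' b' → g₁ ≡ g₂ × a₁ ≡ a₂ × b₁ ≡ b₂
drooped-inj {n} {g₁} {g₂} {g'} {a₁} {b₁} {a₂} {b₂} {a'} {b'} s₁ s₂ D₁ D₂ = go rows cols
  where
  module D₁ = Drooped D₁
  module D₂ = Drooped D₂
  rows : a₁ ≡ a₂
  rows with compareℕ a₁ a₂
  ... | less lt = ⊥-elim (CanUndroop.colE D₂.can' (CanUndroop.colX D₁.can' a₂ lt (Rect.a<a' D₂.rect)))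
  ... | equal e = e
  ... | greater gt = ⊥-elim (CanUndroop.colE D₁.can' (CanUndroop.colX D₂.can' a₁ gt (Rect.a<a' D₁.rect)))
  cols : b₁ ≡ b₂
  cols with compareℕ b₁ b₂
  ... | less lt = ⊥-elim (CanUndroop.rowE D₂.can' (CanUndroop.rowX D₁.can' b₂ lt (Rect.b<b' D₂.rect)))
  ... | equal e = e
  ... | greater gt = ⊥-elim (CanUndroop.rowE D₁.can' (CanUndroop.rowX D₂.can' b₁ gt (Rect.b<b' D₁.rect)))
  go : a₁ ≡ a₂ → b₁ ≡ b₂ → g₁ ≡ g₂ × a₁ ≡ a₂ × b₁ ≡ b₂
  go refl refl = grid-ext s₁ s₂ (λ i j pi pj → trans (D₁.bwd i j pi pj) (sym (D₂.bwd i j pi pj))) , refl , refl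

-- The case distinction after a droop

-- Both searches in a row pass over these tiles, the one for an r-elbow and the reverse one for a
-- j-elbow; hence a move along a row can be inverted.
Plain : Tile → Set
Plain t = t ≢ relbow × t ≢ jelbow

plain-blank : ∀ {t} → t ≡ blank → Plain t
plain-blank refl = (λ ()) , (λ ())
plain-ver : ∀ {t} → t ≡ ver → Plain t
plain-ver refl = (λ ()) , (λ ())
plain-hor : ∀ {t} → t ≡ hor → Plain t
plain-hor refl = (λ ()) , (λ ())
plain-cross : ∀ {t} → t ≡ cross → Plain t
plain-cross refl = (λ ()) , (λ ())

emptyW : ∀ {R t w e n s} → Loc R t w e n s → w ≡ 0 → t ≡ relbow ⊎ (Plain t × e ≡ 0)
emptyW blankˡ _ = inj₂ (plain-blank refl , refl)
emptyW (verˡ x) _ = inj₂ (plain-ver refl , refl)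
emptyW (relbowˡ x) _ = inj₁ refl
emptyW (horˡ ()) refl
emptyW (crossˡ () _ _) refl
emptyW (jelbowˡ ()) refl
emptyW (bumpˡ () _) refl

emptyE : ∀ {R t w e n s} → Loc R t w e n s → e ≡ 0 → t ≡ jelbow ⊎ (Plain t × w ≡ 0)
emptyE blankˡ _ = inj₂ (plain-blank refl , refl)
emptyE (verˡ x) _ = inj₂ (plain-ver refl , refl)
emptyE (jelbowˡ x) _ = inj₁ refl
emptyE (horˡ ()) refl
emptyE (crossˡ () _ _) refl
emptyE (relbowˡ ()) refl
emptyE (bumpˡ _ ()) refl

fullW : ∀ {R t w e n s} → Loc R t w e n s → 0 < w → t ≢ bump → t ≡ jelbow ⊎ (Plain t × e ≡ w)
fullW (horˡ x) _ _ = inj₂ (plain-hor refl , refl)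
fullW (crossˡ x y _) _ _ = inj₂ (plain-cross refl , refl)
fullW (jelbowˡ x) _ _ = inj₁ refl
fullW (bumpˡ x y) _ nb = ⊥-elim (nb refl)

fullE : ∀ {R t w e n s} → Loc R t w e n s → 0 < e → t ≢ bump → t ≡ relbow ⊎ (Plain t × w ≡ e)
fullE (horˡ x) _ _ = inj₂ (plain-hor refl , refl)
fullE (crossˡ x y _) _ _ = inj₂ (plain-cross refl , refl)
fullE (relbowˡ x) _ _ = inj₁ refl
fullE (bumpˡ x y) _ nb = ⊥-elim (nb refl)

module Rows {R n T h v} (L : Lab R n T h v) (i : ℕ) (pi : In n i) where
  open Lab L

  -- A pipe exits at the right end of every row, so an empty stretch must end, and it can end only
  -- with an r-elbow.
  nextR : ∀ d x → d + x ≡ suc n → 1 ≤ x → h i x ≡ 0 →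
    Σ ℕ λ j → x ≤ j × j ≤ n × T i j ≡ relbow × (∀ y → x ≤ y → y < j → Plain (T i y))
  nextR zero .(suc n) refl 1≤x z = ⊥-elim (n≮0 (subst (0 <_) z (right i pi)))
  nextR (suc d) x e 1≤x z with emptyW (loc i x pi (1≤x , ≤-trans (m≤n+m x d) (≤-reflexive (suc-injective e)))) z
  ... | inj₁ q = x , ≤-refl , ≤-trans (m≤n+m x d) (≤-reflexive (suc-injective e)) , q , λ y u w → ⊥-elim (<⇒≱ w u)
  ... | inj₂ (q , z') with nextR d (suc x) (trans (+-suc d x) e) (s≤s z≤n) z'
  ...   | j , u , w , r , f = j , <⇒≤ u , w , r , λ y a b → [ (λ lt → f y lt b) , (λ { refl → q }) ]′ (m≤n⇒m<n∨m≡n a)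

  -- A pipe running along the row without exiting from it must turn north, and without bumps it does
  -- so at a j-elbow.
  nextJ : ∀ d x p → d + x ≡ suc n → 1 ≤ x → 0 < p → h i x ≡ p → (∀ y → x ≤ y → y ≤ n → T i y ≢ bump) → h i (suc n) ≢ p →
    Σ ℕ λ j → x ≤ j × j ≤ n × T i j ≡ jelbow × h i j ≡ p × (∀ y → x ≤ y → y < j → Plain (T i y))
  nextJ zero .(suc n) p refl 1≤x 0<p z nb ne = ⊥-elim (ne z)
  nextJ (suc d) x p e 1≤x 0<p z nb ne with fullW (loc i x pi (1≤x , x≤)) (subst (0 <_) (sym z) 0<p) (nb x ≤-refl x≤)
    where x≤ = ≤-trans (m≤n+m x d) (≤-reflexive (suc-injective e))
  ... | inj₁ q = x , ≤-refl , ≤-trans (m≤n+m x d) (≤-reflexive (suc-injective e)) , q , z , λ y u w → ⊥-elim (<⇒≱ w u)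
  ... | inj₂ (q , z') with nextJ d (suc x) p (trans (+-suc d x) e) (s≤s z≤n) 0<p (trans z' z) (λ y u → nb y (<⇒≤ u)) ne
  ...   | j , u , w , r , lj , f = j , <⇒≤ u , w , r , lj , λ y a b → [ (λ lt → f y lt b) , (λ { refl → q }) ]′ (m≤n⇒m<n∨m≡n a)

  prevR : ∀ x p → x ≤ n → 0 < p → h i (suc x) ≡ p → (∀ y → 1 ≤ y → y ≤ x → T i y ≢ bump) →
    Σ ℕ λ j → 1 ≤ j × j ≤ x × T i j ≡ relbow × h i (suc j) ≡ p × (∀ y → j < y → y ≤ x → Plain (T i y))
  prevR zero p le 0<p z nb = ⊥-elim (n≮0 (subst (0 <_) (trans (sym z) (left i pi)) 0<p))
  prevR (suc x) p le 0<p z nb with fullE (loc i (suc x) pi (s≤s z≤n , le)) (subst (0 <_) (sym z) 0<p) (nb (suc x) (s≤s z≤n) ≤-refl)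
  ... | inj₁ q = suc x , s≤s z≤n , ≤-refl , q , z , λ y u w → ⊥-elim (<⇒≱ u w)
  ... | inj₂ (q , z') with prevR x p (<⇒≤ le) 0<p (trans z' z) (λ y u w → nb y u (m≤n⇒m≤1+n w))
  ...   | j , u , w , r , lj , f = j , u , m≤n⇒m≤1+n w , r , lj , λ y a b → [ (λ lt → f y a (≤-pred lt)) , (λ { refl → q }) ]′ (m≤n⇒m<n∨m≡n b)

  -- To the left of an empty edge either some pipe has turned north at a j-elbow, or the row is
  -- empty as far as its border.
  prevJ : ∀ x → x ≤ n → h i (suc x) ≡ 0 →
    (Σ ℕ λ j → 1 ≤ j × j ≤ x × T i j ≡ jelbow × (∀ y → j < y → y ≤ x → Plain (T i y))) ⊎ (∀ y → 1 ≤ y → y ≤ x → Plain (T i y))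
  prevJ zero le z = inj₂ (λ y u w → ⊥-elim (<⇒≱ u w))
  prevJ (suc x) le z with emptyE (loc i (suc x) pi (s≤s z≤n , le)) z
  ... | inj₁ q = inj₁ (suc x , s≤s z≤n , ≤-refl , q , λ y u w → ⊥-elim (<⇒≱ u w))
  ... | inj₂ (q , z') with prevJ x (<⇒≤ le) z'
  ...   | inj₁ (j , u , w , r , f) = inj₁ (j , u , m≤n⇒m≤1+n w , r , λ y a b → [ (λ lt → f y a (≤-pred lt)) , (λ { refl → q }) ]′ (m≤n⇒m<n∨m≡n b))
  ...   | inj₂ f = inj₂ (λ y a b → [ (λ lt → f y a (≤-pred lt)) , (λ { refl → q }) ]′ (m≤n⇒m<n∨m≡n b))

isRElbow-true : ∀ {n g i j} → Sq n g → In n i → In n j → tile g i j ≡ relbow → isRElbowAt g i j ≡ true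
isRElbow-true s pi pj e rewrite tileAt-in s pi pj | e = refl

isRElbow-false : ∀ {n g i j} → Sq n g → In n i → In n j → tile g i j ≢ relbow → isRElbowAt g i j ≡ false
isRElbow-false {n} {g} {i} {j} s pi pj ne rewrite tileAt-in s pi pj = go (tile g i j) ne
  where
  go : ∀ t → t ≢ relbow → isTile relbow t ≡ false
  go blank _ = refl
  go hor _ = refl
  go ver _ = refl
  go cross _ = refl
  go relbow ne = ⊥-elim (ne refl)
  go jelbow _ = refl
  go bump _ = refl

≤ᵇ-true : ∀ {a b} → a ≤ b → (a ≤ᵇ b) ≡ true
≤ᵇ-true {zero} le = refl
≤ᵇ-true {suc a} le = <ᵇ-true le

≤ᵇ-false : ∀ {a b} → b < a → (a ≤ᵇ b) ≡ false
≤ᵇ-false {suc a} (s≤s le) = <ᵇ-false le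

rElbowAfter-≡ : ∀ {n g i j j'} → Sq n g → In n i → In n j' → j < j' → tile g i j' ≡ relbow → (∀ x → j < x → x < j' → tile g i x ≢ relbow) →
  rElbowAfter g i j ≡ just j'
rElbowAfter-≡ {n} {g} {i} {j} {j'} s pi pj' lt e none rewrite Sq.side s =
  findᵇ-range (λ x → (j <ᵇ x) ∧ isRElbowAt g i x) 1 n j' (proj₁ pj') (≤-trans (s≤s (proj₂ pj')) (≤-reflexive (+-comm 1 n)))
    (cong₂ _∧_ (<ᵇ-true lt) (isRElbow-true s pi pj' e)) miss
  where
  miss : ∀ x → 1 ≤ x → x < j' → (j <ᵇ x) ∧ isRElbowAt g i x ≡ false
  miss x u w with ≤-<-connex x j
  ... | inj₁ le = cong (_∧ isRElbowAt g i x) (<ᵇ-false le)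
  ... | inj₂ gt = trans (cong ((j <ᵇ x) ∧_) (isRElbow-false s pi (u , ≤-trans (<⇒≤ w) (proj₂ pj')) (none x gt w))) (∧-zeroʳ _)

rElbowBefore-≡ : ∀ {n g i j j'} → Sq n g → In n i → In n j' → j' < j → tile g i j' ≡ relbow → (∀ x → j' < x → x < j → tile g i x ≢ relbow) →
  rElbowBefore g i j ≡ just j'
rElbowBefore-≡ {n} {g} {i} {j} {j'} s pi pj' lt e none rewrite Sq.side s =
  lastFilter-range (λ x → (x <ᵇ j) ∧ isRElbowAt g i x) 1 n j' (proj₁ pj') (≤-trans (s≤s (proj₂ pj')) (≤-reflexive (+-comm 1 n)))
    (cong₂ _∧_ (<ᵇ-true lt) (isRElbow-true s pi pj' e)) miss
  where
  miss : ∀ x → j' < x → x < n + 1 → (x <ᵇ j) ∧ isRElbowAt g i x ≡ false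
  miss x u w with ≤-<-connex j x
  ... | inj₁ le = cong (_∧ isRElbowAt g i x) (<ᵇ-false le)
  ... | inj₂ gt = trans (cong ((x <ᵇ j) ∧_) (isRElbow-false s pi (≤-trans (s≤s z≤n) u , ≤-pred (≤-trans w (≤-reflexive (+-comm n 1)))) (none x u gt))) (∧-zeroʳ _)

bump-stay : ∀ k g i j {r ps} → traceF (length g) g (2 * length g) i j fromS ≡ just (r , ps) → r ≤ k →
  afterDroop k g i j (just bump) ≡ continue (st g (droopAt i j))
bump-stay k g i j e le rewrite e | ≤ᵇ-true le = refl

bump-stop : ∀ k g i j {r ps g'} → traceF (length g) g (2 * length g) i j fromS ≡ just (r , ps) → k < r →
  crossOfBump g (i , j) ≡ noCross → setTile cross i j g ≡ just g' → afterDroop k g i j (just bump) ≡ stop g'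
bump-stop k g i j e gt c q rewrite e | ≤ᵇ-false gt | c | q = refl

bump-swap : ∀ k g i j {r ps a b g₁ g₂} → traceF (length g) g (2 * length g) i j fromS ≡ just (r , ps) → k < r →
  crossOfBump g (i , j) ≡ crossAt (a , b) → setTile cross i j g ≡ just g₁ → setTile bump a b g₁ ≡ just g₂ →
  afterDroop k g i j (just bump) ≡ continue (st g₂ (droopAt a b))
bump-swap k g i j e gt c q q' rewrite e | ≤ᵇ-false gt | c | q | q' = refl

module AfterDroop {n g i j} (k : ℕ) (s : Sq n g) (pi : In n i) (pj : In n j) where

  after-right : ∀ {j'} → tile g i j ≡ jelbow → i ≤ k → In n j' → j < j' → tile g i j' ≡ relbow → (∀ x → j < x → x < j' → tile g i x ≢ relbow) →
    afterDroop k g i j (tileAt g i j) ≡ continue (st g (droopAt i j'))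
  after-right e le pj' lt r none rewrite tileAt-in s pi pj | e | ≤ᵇ-true le | rElbowAfter-≡ s pi pj' lt r none = refl

  after-left : ∀ {j'} → tile g i j ≡ jelbow → k < i → In n j' → j' < j → tile g i j' ≡ relbow → (∀ x → j' < x → x < j → tile g i x ≢ relbow) →
    afterDroop k g i j (tileAt g i j) ≡ continue (st g (droopAt i j'))
  after-left e gt pj' lt r none rewrite tileAt-in s pi pj | e | ≤ᵇ-false gt | rElbowBefore-≡ s pi pj' lt r none = refl

  module AtBump {h v} (L : Lab _<_ n (tile g) h v) (tb : tile g i j ≡ bump) where
    open Pipes L
    open Crosses s L
    open Meeting s L
    open BumpCross s L i j pi pj tb

    private
      0<z : 0 < v (suc i) j
      0<z = proj₂ (proj₂ (proj₂ (bumpLabels (Lab.loc L i j pi pj) tb)))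
      tr = trace i j fromS pi pj 0<z

    exitRow : ℕ
    exitRow = Traced.row tr

    exitRow-in : In n exitRow
    exitRow-in = Traced.rowIn tr , ≤-trans (Traced.rowUp tr) (proj₂ pi)

    exitRow-≡ : h exitRow (suc n) ≡ v (suc i) j
    exitRow-≡ = Traced.exitsAt tr

    private
      traced-≡ : traceF (length g) g (2 * length g) i j fromS ≡ just (exitRow , Traced.cells tr)
      traced-≡ = subst (λ z → traceF z g (2 * z) i j fromS ≡ just (exitRow , Traced.cells tr)) (sym (Sq.side s))
        (trace-path (2 * n) s pi pj (Traced.path tr) (≤-trans (Traced.short tr) (+-mono-≤ (proj₂ pi) (≤-trans (m∸n≤m n j) (m≤m+n n 0)))))

      at-bump : afterDroop k g i j (tileAt g i j) ≡ afterDroop k g i j (just bump)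
      at-bump = cong (afterDroop k g i j) (trans (tileAt-in s pi pj) (cong just tb))

    after-stay : exitRow ≤ k → afterDroop k g i j (tileAt g i j) ≡ continue (st g (droopAt i j))
    after-stay le = trans at-bump (bump-stay k g i j traced-≡ le)

    private
      spec₁ = modTile-spec {g = g} {t = cross} (λ _ → just cross) s pi pj refl
      module M₁ = Modified spec₁

    after-stop : ∀ {g″} → k < exitRow → (∀ x → ¬ Meets (h i j) (v (suc i) j) x) → Sq n g″ → tile g″ i j ≡ cross → OffCell n i j (tile g) (tile g″) →
      afterDroop k g i j (tileAt g i j) ≡ stop g″
    after-stop {g″} gt apart s″ tc off = trans go (cong stop same-grid)
      where
      same-grid : M₁.grid′ ≡ g″
      same-grid = grid-ext M₁.sq s″ cell
        where
        cell : ∀ x y → In n x → In n y → tile M₁.grid′ x y ≡ tile g″ x y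
        cell x y px py with x ≟ i | y ≟ j
        ... | yes refl | yes refl = trans (M₁.on x y (refl , refl)) (sym tc)
        ... | yes _ | no ne = trans (M₁.off x y (ne ∘ proj₂)) (sym (off x y px py (ne ∘ proj₂)))
        ... | no ne | _ = trans (M₁.off x y (ne ∘ proj₁)) (sym (off x y px py (ne ∘ proj₁)))
      go : afterDroop k g i j (tileAt g i j) ≡ stop M₁.grid′
      go with crossOfBump-spec
      ... | inj₁ (e , _) = trans at-bump (bump-stop k g i j traced-≡ gt e M₁.result)
      ... | inj₂ (x , _ , m) = ⊥-elim (apart x m)

    after-swap : ∀ {g″ a b} → k < exitRow → Meets (h i j) (v (suc i) j) (a , b) → Sq n g″ → tile g″ i j ≡ cross → tile g″ a b ≡ bump →
      (∀ x y → In n x → In n y → ¬ (x ≡ i × y ≡ j) → ¬ (x ≡ a × y ≡ b) → tile g″ x y ≡ tile g x y) →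
      afterDroop k g i j (tileAt g i j) ≡ continue (st g″ (droopAt a b))
    after-swap {g″} {a} {b} gt meets@(pa , pb , mt) s″ tc tb″ off = trans go (cong (λ z → continue (st z (droopAt a b))) same-grid)
      where
      spec₂ = modTile-spec {g = M₁.grid′} {t = bump} (λ _ → just bump) M₁.sq pa pb refl
      module M₂ = Modified spec₂
      ta : tile g a b ≡ cross
      ta = [ proj₁ , proj₁ ]′ mt
      ne : ¬ (i ≡ a × j ≡ b)
      ne (refl , refl) = bx (trans (sym tb) ta)
        where
        bx : bump ≢ cross
        bx ()
      same-grid : M₂.grid′ ≡ g″
      same-grid = grid-ext M₂.sq s″ cell
        where
        cell : ∀ x y → In n x → In n y → tile M₂.grid′ x y ≡ tile g″ x y
        cell x y px py with (x ≟ a) ×-dec (y ≟ b)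
        ... | yes (refl , refl) = trans (M₂.on x y (refl , refl)) (sym tb″)
        ... | no na with x ≟ i | y ≟ j
        ...   | yes refl | yes refl = trans (M₂.off x y na) (trans (M₁.on x y (refl , refl)) (sym tc))
        ...   | yes _ | no q = trans (M₂.off x y na) (trans (M₁.off x y (q ∘ proj₂)) (sym (off x y px py (q ∘ proj₂) na)))
        ...   | no q | _ = trans (M₂.off x y na) (trans (M₁.off x y (q ∘ proj₁)) (sym (off x y px py (q ∘ proj₁) na)))
      go : afterDroop k g i j (tileAt g i j) ≡ continue (st M₂.grid′ (droopAt a b))
      go with crossOfBump-spec
      ... | inj₁ (_ , apart) = ⊥-elim (apart (a , b) meets)
      ... | inj₂ (x , e , m) with meetOnce (h i j) (v (suc i) j) x (a , b) m meets
      ...   | refl = trans at-bump (bump-swap k g i j traced-≡ gt e M₁.result M₂.result)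

-- The transitions between two droops

weightReady weightLanded : ℕ → Grid → ℕ → ℕ → ℕ → ℕ
weightReady n g i j r = rowSum (isBlank (tile g)) n r + b2n ((r ≡ᵇ i) ∧ isTile relbow (tile g i j))
weightLanded n g i j r = rowSum (isBlank (tile g)) n r + b2n ((r ≡ᵇ i) ∧ isTile jelbow (tile g i j))

-- Each transition carries what is needed to recover its source: the comparison of the row with `k`
-- for the two elbow moves, the exit row of the west pipe at the resulting bump for the two others.
data Trans (n k : ℕ) : Grid → ℕ → ℕ → Grid → ℕ → ℕ → Set where
  toRight : ∀ {g i j j'} → tile g i j ≡ jelbow → i ≤ k → j < j' → tile g i j' ≡ relbow → (∀ x → j < x → x < j' → Plain (tile g i x)) → Trans n k g i j g i j'
  toLeft : ∀ {g i j j'} → tile g i j ≡ jelbow → k < i → j' < j → tile g i j' ≡ relbow → (∀ x → j' < x → x < j → Plain (tile g i x)) → Trans n k g i j g i j'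
  stay  : ∀ {g i j h v} → Lab _<_ n (tile g) h v → tile g i j ≡ bump → SmallExit n k h (h i j) → Trans n k g i j g i j
  swap  : ∀ {g i j g' a b h' v'} → Lab _<_ n (tile g') h' v' → tile g' a b ≡ bump → tile g i j ≡ bump → tile g' i j ≡ cross → tile g a b ≡ cross →
          (∀ x y → In n x → In n y → ¬ (x ≡ i × y ≡ j) → ¬ (x ≡ a × y ≡ b) → tile g' x y ≡ tile g x y) →
          ¬ SmallExit n k h' (h' a b) → Pair (h' a b) (v' (suc a) b) (h' i j) (v' (suc i) j) → Trans n k g i j g' a b

transport-small : ∀ {R R' n k T h v h' v' i j} → Lab R n T h v → Lab R' n T h' v' → In n i → In n j → SmallExit n k h (h i j) → SmallExit n k h' (h' i j)
transport-small {n = n} {h' = h'} L L' pi pj (mkSmall r pr le e) = mkSmall r pr le (trans (sym (h-unique r n pr ≤-refl)) (trans e (w-unique _ _ pi pj)))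
  where open LabUnique L L'

clash : ∀ {A : Set} {t u v : Tile} → t ≡ u → t ≡ v → u ≢ v → A
clash refl q ne = ⊥-elim (ne q)

-- Elbow moves are told apart by whether the row is at most `k`, bump moves by whether the west pipe
-- of the bump exits from a row at most `k`. After a swap the former bump is the only cross of the
-- two pipes.
trans-inj : ∀ {n k g₁ i₁ j₁ g₂ i₂ j₂ g' i' j'} → Sq n g₁ → Sq n g₂ → Sq n g' → In n i₁ → In n j₁ → In n i₂ → In n j₂ → In n i' → In n j' →
  Trans n k g₁ i₁ j₁ g' i' j' → Trans n k g₂ i₂ j₂ g' i' j' → g₁ ≡ g₂ × i₁ ≡ i₂ × j₁ ≡ j₂
trans-inj {j₁ = j₁} {j₂ = j₂} s₁ s₂ s' p₁ q₁ p₂ q₂ p' q' (toRight e le lt r f) (toRight e' le' lt' r' f') with compareℕ j₁ j₂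
... | less x = ⊥-elim (proj₂ (f j₂ x lt') e')
... | equal x = refl , refl , x
... | greater x = ⊥-elim (proj₂ (f' j₁ x lt) e)
trans-inj s₁ s₂ s' p₁ q₁ p₂ q₂ p' q' (toRight e le lt r f) (toLeft e' gt lt' r' f') = ⊥-elim (<⇒≱ gt le)
trans-inj s₁ s₂ s' p₁ q₁ p₂ q₂ p' q' (toRight e le lt r f) (stay _ b _) = clash r b (λ ())
trans-inj s₁ s₂ s' p₁ q₁ p₂ q₂ p' q' (toRight e le lt r f) (swap _ b _ _ _ _ _ _) = clash r b (λ ())
trans-inj s₁ s₂ s' p₁ q₁ p₂ q₂ p' q' (toLeft e gt lt r f) (toRight e' le lt' r' f') = ⊥-elim (<⇒≱ gt le)
trans-inj {j₁ = j₁} {j₂ = j₂} s₁ s₂ s' p₁ q₁ p₂ q₂ p' q' (toLeft e le lt r f) (toLeft e' le' lt' r' f') with compareℕ j₁ j₂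
... | less x = ⊥-elim (proj₂ (f' j₁ lt x) e)
... | equal x = refl , refl , x
... | greater x = ⊥-elim (proj₂ (f j₂ lt' x) e')
trans-inj s₁ s₂ s' p₁ q₁ p₂ q₂ p' q' (toLeft e le lt r f) (stay _ b _) = clash r b (λ ())
trans-inj s₁ s₂ s' p₁ q₁ p₂ q₂ p' q' (toLeft e le lt r f) (swap _ b _ _ _ _ _ _) = clash r b (λ ())
trans-inj s₁ s₂ s' p₁ q₁ p₂ q₂ p' q' (stay _ b _) (toRight e le lt r f) = clash r b (λ ())
trans-inj s₁ s₂ s' p₁ q₁ p₂ q₂ p' q' (stay _ b _) (toLeft e le lt r f) = clash r b (λ ())
trans-inj s₁ s₂ s' p₁ q₁ p₂ q₂ p' q' (stay _ _ _) (stay _ _ _) = refl , refl , refl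
trans-inj s₁ s₂ s' p₁ q₁ p₂ q₂ p' q' (stay L _ sm) (swap L' _ _ _ _ _ ns _) = ⊥-elim (ns (transport-small L L' p' q' sm))
trans-inj s₁ s₂ s' p₁ q₁ p₂ q₂ p' q' (swap _ b _ _ _ _ _ _) (toRight e le lt r f) = clash r b (λ ())
trans-inj s₁ s₂ s' p₁ q₁ p₂ q₂ p' q' (swap _ b _ _ _ _ _ _) (toLeft e le lt r f) = clash r b (λ ())
trans-inj s₁ s₂ s' p₁ q₁ p₂ q₂ p' q' (swap L' _ _ _ _ _ ns _) (stay L _ sm) = ⊥-elim (ns (transport-small L L' p' q' sm))
trans-inj {n} {k} {g₁} {i₁} {j₁} {g₂} {i₂} {j₂} {g'} {i'} {j'} s₁ s₂ s' p₁ q₁ p₂ q₂ p' q' (swap {h' = h} {v' = v} L tb b₁ c₁ x₁ off₁ _ pr₁) (swap {h' = h₂} {v' = v₂} L₂ _ b₂ c₂ x₂ off₂ _ pr₂)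
  with cellEq'
  where
  open LabUnique L₂ L
  open Crosses s' L
  open Meeting s' L
  meets : ∀ {i j} → In n i → In n j → tile g' i j ≡ cross → Pair (h i' j') (v (suc i') j') (h i j) (v (suc i) j) → Meets (h i' j') (v (suc i') j') (i , j)
  meets pi pj c (inj₁ (x , y)) = pi , pj , inj₁ (c , x , y)
  meets pi pj c (inj₂ (x , y)) = pi , pj , inj₂ (c , x , y)
  pr₂' : Pair (h i' j') (v (suc i') j') (h i₂ j₂) (v (suc i₂) j₂)
  pr₂' = subst₂ (λ c d → Pair c d (h i₂ j₂) (v (suc i₂) j₂)) (w-unique i' j' p' q') (s-unique i' j' p' q')
           (subst₂ (Pair (h₂ i' j') (v₂ (suc i') j')) (w-unique i₂ j₂ p₂ q₂) (s-unique i₂ j₂ p₂ q₂) pr₂)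
  cellEq' : (i₁ , j₁) ≡ (i₂ , j₂)
  cellEq' = meetOnce _ _ (i₁ , j₁) (i₂ , j₂) (meets p₁ q₁ c₁ pr₁) (meets p₂ q₂ c₂ pr₂')
... | refl = grid-ext s₁ s₂ cell , refl , refl
  where
  cell : ∀ x y → In n x → In n y → tile g₁ x y ≡ tile g₂ x y
  cell x y px py with (x ≟ i₁) ×-dec (y ≟ j₁) | (x ≟ i') ×-dec (y ≟ j')
  ... | yes (refl , refl) | _ = trans b₁ (sym b₂)
  ... | no _ | yes (refl , refl) = trans x₁ (sym x₂)
  ... | no u | no w = trans (sym (off₁ x y px py u w)) (off₂ x y px py u w)

record Stop (n : ℕ) (g : Grid) (i j : ℕ) (g' : Grid) : Set where
  field
    wasBump : tile g i j ≡ bump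
    sq : Sq n g'
    isCross' : tile g' i j ≡ cross
    off : OffCell n i j (tile g) (tile g')

record Continues (n : ℕ) (ρ : Perm) (k : ℕ) (g : Grid) (i j : ℕ) : Set where
  field
    g' : Grid
    i' j' : ℕ
    result : afterDroop k g i j (tileAt g i j) ≡ continue (st g' (droopAt i' j'))
    state : Ready n ρ k g' i' j'
    move : Trans n k g i j g' i' j'
    weight : ∀ r → In n r → weightLanded n g i j r ≡ weightReady n g' i' j' r

noBumpAt : ∀ {n T i j t} → OnlyBump n T i j → T i j ≡ t → t ≢ bump → NoBump n T
noBumpAt ob e ne x y px py b with ob x y px py b
... | refl , refl = ne (trans (sym e) b)

vacuous : ∀ {n T i j} → NoBump n T → OnlyBump n T i j
vacuous nb x y px py b = ⊥-elim (nb x y px py b)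

relbowLabels : ∀ {R t w e n s} → Loc R t w e n s → t ≡ relbow → w ≡ 0 × s ≡ e × 0 < e
relbowLabels (relbowˡ x) refl = refl , refl , x

jelbowLabels : ∀ {R t w e n s} → Loc R t w e n s → t ≡ jelbow → e ≡ 0 × 0 < w
jelbowLabels (jelbowˡ x) refl = refl , x

enterSmall : ∀ {R n k T h v} (L : Lab R n T h v) i j d → In n i → In n j → i ≤ k → 0 < Pipes.label L d i j → SmallExit n k h (Pipes.label L d i j)
enterSmall L i j d pi pj le p = mkSmall row (rowIn , ≤-trans rowUp (proj₂ pi)) (≤-trans rowUp le) exitsAt
  where open Pipes.Traced (Pipes.trace L i j d pi pj p)

small-unique : ∀ {R n k T h v l r} → Lab R n T h v → SmallExit n k h l → In n r → h r (suc n) ≡ l → r ≤ k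
small-unique L (mkSmall r' pr' le e) pr e' = subst (_≤ _) (Cuts.exitUnique L _ _ pr' pr (trans e (sym e'))) le

module _ {n ρ k g i j} (B : Landed n ρ k g i j) where
  open Landed B
  open Lab lab using (loc)
  open AfterDroop k sq pi pj

  private
    sameDrawing : ∀ {i' j'} → In n i' → In n j' → tile g i' j' ≡ relbow ⊎ tile g i' j' ≡ bump → OnlyBump n (tile g) i' j' → SmallExit n k h (h i' (suc j')) → Ready n ρ k g i' j'
    sameDrawing pi' pj' t o sm = record { drawing = drawing ; pi = pi' ; pj = pj' ; turn = t ; only = o ; small = sm }

    rowWeight : ∀ {j'} → tile g i j ≡ jelbow → tile g i j' ≡ relbow → ∀ r → In n r → weightLanded n g i j r ≡ weightReady n g i j' r
    rowWeight e e' r _ rewrite e | e' = refl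

    atJ : tile g i j ≡ jelbow → Continues n ρ k g i j
    atJ tj with i ≤? k
    ... | yes le = cont (Rows.nextR lab i pi (n ∸ j) (suc j) (trans (+-suc (n ∸ j) j) (cong suc (m∸n+n≡m (proj₂ pj)))) (s≤s z≤n) (proj₁ (jelbowLabels (loc i j pi pj) tj)))
      where
      cont : _ → Continues n ρ k g i j
      cont (j' , lt , le' , r , f) = record
        { result = after-right tj le pj' lt r (λ x u w → proj₁ (f x u w))
        ; state = sameDrawing pi pj' (inj₁ r) (vacuous (noBumpAt only tj (λ ())))
            (subst (SmallExit n k h) (proj₁ (proj₂ lb)) (enterSmall lab i j' fromS pi pj' le (subst (0 <_) (sym (proj₁ (proj₂ lb))) (proj₂ (proj₂ lb)))))
        ; move = toRight tj le lt r f
        ; weight = rowWeight tj r }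
        where
        pj' : In n j'
        pj' = ≤-trans (s≤s z≤n) lt , le'
        lb = relbowLabels (loc i j' pi pj') r
    ... | no nle = cont j refl
      where
      nb : NoBump n (tile g)
      nb = noBumpAt only tj (λ ())
      cont : ∀ j₁ → j₁ ≡ j → Continues n ρ k g i j
      cont zero refl = ⊥-elim (n≮0 (proj₁ pj))
      cont (suc x) refl with Rows.prevR lab i pi x (h i j) (<⇒≤ (proj₂ pj)) (proj₂ (jelbowLabels (loc i j pi pj) tj)) refl (λ y u w → nb i y pi (u , ≤-trans w (<⇒≤ (proj₂ pj))))
      ... | j' , 1≤ , le , r , lj , f = record
        { result = after-left tj (≰⇒> nle) pj' (s≤s le) r (λ y u w → proj₁ (f y u (≤-pred w)))
        ; state = sameDrawing pi pj' (inj₁ r) (vacuous nb) (subst (SmallExit n k h) (sym lj) small)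
        ; move = toLeft tj (≰⇒> nle) (s≤s le) r (λ y u w → f y u (≤-pred w))
        ; weight = rowWeight tj r }
        where
        pj' : In n j'
        pj' = 1≤ , ≤-trans le (<⇒≤ (proj₂ pj))

    module Bumped (tb : tile g i j ≡ bump) where
      open AtBump lab tb
      open Cuts lab
      open Order lab
      open Crosses sq lab using (Meets)
      open Meeting sq lab
      bl = bumpLabels (loc i j pi pj) tb
      w z : ℕ
      w = h i j
      z = v (suc i) j
      0<w = proj₁ (proj₂ (proj₂ bl))
      0<z = proj₂ (proj₂ (proj₂ bl))

      -- The bump remains, but the motion passes to its other pipe, which also exits from a row at
      -- most `k`.
      stays : exitRow ≤ k → Continues n ρ k g i j
      stays le = record
        { result = after-stay le
        ; state = sameDrawing pi pj (inj₂ tb) only (mkSmall exitRow exitRow-in le (trans exitRow-≡ (sym (proj₁ (proj₂ bl)))))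
        ; move = stay lab tb small
        ; weight = λ r _ → cong (λ t → rowSum (isBlank (tile g)) n r + b2n t) (trans (cong (λ t → (r ≡ᵇ i) ∧ isTile jelbow t) tb) (sym (cong (λ t → (r ≡ᵇ i) ∧ isTile relbow t) tb))) }

      module Swaps (gt : k < exitRow) (a b : ℕ) (meets : Meets w z (a , b)) where
        pa = proj₁ meets
        pb = proj₁ (proj₂ meets)

        -- w leaves above z, hence they already crossed before (i , j), z travelling east
        exitOrder : Before 1 (suc n) w z
        exitOrder = subst₂ (Before 1 (suc n)) (SmallExit.exit small) exitRow-≡
          (exitBefore (SmallExit.row small) exitRow (SmallExit.rowIn small) exitRow-in (≤-<-trans (SmallExit.row≤k small) gt))

        1≤n : 1 ≤ n
        1≤n = ≤-trans (proj₁ pi) (proj₂ pi)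

        crossZW : CrossOf a b z w
        crossZW with proj₂ (proj₂ meets)
        ... | inj₂ x = x
        ... | inj₁ x = ⊥-elim (asym a (suc b) pa (s≤s z≤n) (s≤s (proj₂ pb)) 0<w 0<z
               (back 1 (suc n) a (suc b) (≤-refl , 1≤n) pa (s≤s z≤n) ≤-refl (s≤s z≤n) (s≤s (proj₂ pb)) (≼-exit pa (proj₂ pb)) 0<w (proj₂ (proj₂ (proj₂ (crossEnter a b pa pb x)))) exitOrder)
               (crossLeave a b pa pb x))

        tx : tile g a b ≡ cross
        tx = proj₁ crossZW

        -- The pair enters its cross with `z` before `w`, and so it stands on all earlier cuts; at
        -- (i , j), however, `w` comes from the west and stands before `z`.
        ord : (a , suc b) ≼ (i , j)
        ord with ≼-total a b i j
        ... | inj₁ o = o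
        ... | inj₂ (inj₂ (refl , refl)) = clash tx tb (λ ())
        ... | inj₂ (inj₁ o) = ⊥-elim (asym i j pi (proj₁ pj) (m≤n⇒m≤1+n (proj₂ pj)) 0<z 0<w
               (back a b i j pa pi (proj₁ pb) (m≤n⇒m≤1+n (proj₂ pb)) (proj₁ pj) (m≤n⇒m≤1+n (proj₂ pj)) (≼-weaken o) 0<z (proj₂ (proj₂ (proj₂ ce))) (proj₁ ce)) (enter i j pi pj))
          where
          ce = crossEnter a b pa pb crossZW

        T' : ℕ → ℕ → Tile
        T' = put (put (tile g) i j cross) a b bump

        T'-a : T' a b ≡ bump
        T'-a = put-here _ a b bump
        T'-i : T' i j ≡ cross
        T'-i = trans (put-off _ a b bump i j (ne-cell ord)) (put-here _ i j cross)
        T'-off : ∀ x y → ¬ (x ≡ a × y ≡ b) → ¬ (x ≡ i × y ≡ j) → T' x y ≡ tile g x y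
        T'-off x y u q = trans (put-off _ a b bump x y u) (put-off _ i j cross x y q)

        module DT = DoubleToggle lab T' a b i j pa pb pi pj ord (subst₂ Toggled (sym tx) (sym T'-a) uncross) (subst₂ Toggled (sym tb) (sym T'-i) recross)
          (trans (cong₂ (λ s t → b2n (isTile cross s) + b2n (isTile cross t)) tx tb) (sym (cong₂ (λ s t → b2n (isTile cross s) + b2n (isTile cross t)) T'-a T'-i)))
          (λ x y _ _ → T'-off x y) (inj₂ (sym (proj₂ (proj₂ crossZW)) , sym (proj₁ (proj₂ crossZW))))

        g' : Grid
        g' = mkGrid n T'
        s' : Sq n g'
        s' = mkGrid-sq n T'
        t' : ∀ x y → In n x → In n y → tile g' x y ≡ T' x y
        t' = mkGrid-tile n T'
        L' : Lab _<_ n (tile g') DT.h″ DT.v″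
        L' = labCong t' DT.lab″
        ba = bumpLabels (Lab.loc L' a b pa pb) (trans (t' a b pa pb) T'-a)

        only' : OnlyBump n (tile g') a b
        only' x y px py e with (x ≟ a) ×-dec (y ≟ b)
        ... | yes p = p
        ... | no u with (x ≟ i) ×-dec (y ≟ j)
        ...   | yes (refl , refl) = clash (trans (t' x y px py) T'-i) e (λ ())
        ...   | no q = ⊥-elim (q (only x y px py (trans (sym (trans (t' x y px py) (T'-off x y u q))) e)))

        seLabel : DT.h″ a (suc b) ≡ w
        seLabel = trans (proj₁ (proj₂ ba)) (trans (proj₂ DT.first-in) (proj₂ (proj₂ crossZW)))

        wnLabel : DT.h″ a b ≡ z
        wnLabel = trans (proj₁ DT.first-in) (proj₁ (proj₂ crossZW))

        blanks : ∀ r → In n r → rowSum (isBlank (tile g)) n r ≡ rowSum (isBlank (tile g')) n r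
        blanks r pr = sumTo-cong n (λ y lt → cell r (suc y) pr (s≤s z≤n , lt))
          where
          cell : ∀ x y → In n x → In n y → isBlank (tile g) x y ≡ isBlank (tile g') x y
          cell x y px py with (x ≟ a) ×-dec (y ≟ b)
          ... | yes (refl , refl) = trans (cong (b2n ∘ isTile blank) tx) (sym (cong (b2n ∘ isTile blank) (trans (t' x y px py) T'-a)))
          ... | no u with (x ≟ i) ×-dec (y ≟ j)
          ...   | yes (refl , refl) = trans (cong (b2n ∘ isTile blank) tb) (sym (cong (b2n ∘ isTile blank) (trans (t' x y px py) T'-i)))
          ...   | no q = cong (b2n ∘ isTile blank) (sym (trans (t' x y px py) (T'-off x y u q)))

        swaps : Continues n ρ k g i j
        swaps = record
          { result = after-swap gt meets s' (trans (t' i j pi pj) T'-i) (trans (t' a b pa pb) T'-a) (λ x y px py u q → trans (t' x y px py) (T'-off x y q u))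
          ; state = record
            { drawing = record { sq = s' ; len = len ; h = DT.h″ ; v = DT.v″ ; lab = L' ; exits = λ r pr → trans (exits r pr) (cong just (sym (DT.exit″ r pr))) }
            ; pi = pa ; pj = pb ; turn = inj₂ (trans (t' a b pa pb) T'-a) ; only = only'
            ; small = mkSmall (SmallExit.row small) (SmallExit.rowIn small) (SmallExit.row≤k small) (trans (DT.exit″ _ (SmallExit.rowIn small)) (trans (SmallExit.exit small) (sym seLabel))) }
          ; move = swap L' (trans (t' a b pa pb) T'-a) tb (trans (t' i j pi pj) T'-i) tx (λ x y px py u q → trans (t' x y px py) (T'-off x y q u))
              (λ sm → <⇒≱ gt (small-unique L' sm exitRow-in (trans (DT.exit″ _ exitRow-in) (trans exitRow-≡ (sym wnLabel)))))
              (subst₂ (Pair (DT.h″ a b) (DT.v″ (suc a) b)) (sym (proj₁ DT.second-in)) (sym (proj₂ DT.second-in))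
                (subst₂ (λ c d → Pair c d (swapL (h a b) (v (suc a) b) (h i j)) (swapL (h a b) (v (suc a) b) (v (suc i) j))) (sym (proj₁ DT.first-in)) (sym (proj₂ DT.first-in))
                  (swapL-pair (inj₂ (sym (proj₂ (proj₂ crossZW)) , sym (proj₁ (proj₂ crossZW)))))))
          ; weight = λ r pr → cong₂ _+_ (blanks r pr) (trans (cong (λ t → b2n ((r ≡ᵇ i) ∧ isTile jelbow t)) tb) (trans (cong b2n (∧-zeroʳ (r ≡ᵇ i)))
              (trans (sym (cong b2n (∧-zeroʳ (r ≡ᵇ a)))) (sym (cong (λ t → b2n ((r ≡ᵇ a) ∧ isTile relbow t)) (trans (t' a b pa pb) T'-a)))))) }

      stopGrid : Grid
      stopGrid = Modified.grid′ (modTile-spec {g = g} {t = cross} (λ _ → just cross) sq pi pj refl)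

      stopped : Stop n g i j stopGrid
      stopped = record { wasBump = tb ; sq = M.sq ; isCross' = M.on i j (refl , refl) ; off = λ x y _ _ → M.off x y }
        where module M = Modified (modTile-spec {g = g} {t = cross} (λ _ → just cross) sq pi pj refl)

      atBump : Continues n ρ k g i j ⊎ Σ Grid λ g' → afterDroop k g i j (tileAt g i j) ≡ stop g' × Stop n g i j g'
      atBump with exitRow ≤? k
      ... | yes le = inj₁ (stays le)
      ... | no nle with BumpCross.crossOfBump-spec sq lab i j pi pj tb
      ...   | inj₂ ((a , b) , _ , m) = inj₁ (Swaps.swaps (≰⇒> nle) a b m)
      ...   | inj₁ (_ , apart) = inj₂ (stopGrid , after-stop (≰⇒> nle) apart (Stop.sq stopped) (Stop.isCross' stopped) (Stop.off stopped) , stopped)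

  afterLanding : Continues n ρ k g i j ⊎ Σ Grid λ g' → afterDroop k g i j (tileAt g i j) ≡ stop g' × Stop n g i j g'
  afterLanding with turn
  ... | inj₁ tj = inj₁ (atJ tj)
  ... | inj₂ tb = Bumped.atBump tb

-- Tracing a transition back

record ComesFrom (n : ℕ) (ρ : Perm) (k : ℕ) (g : Grid) (i j : ℕ) : Set where
  field
    g₀ : Grid
    i₀ j₀ : ℕ
    state : Landed n ρ k g₀ i₀ j₀
    result : afterDroop k g₀ i₀ j₀ (tileAt g₀ i₀ j₀) ≡ continue (st g (droopAt i j))

-- With no j-elbow further left in a row `i ≤ k`, no move along the row can have led to this
-- r-elbow.
record IsStart (n k : ℕ) (g : Grid) (i j : ℕ) : Set where
  field
    elbow : tile g i j ≡ relbow
    low : i ≤ k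
    first : ∀ y → 1 ≤ y → y < j → Plain (tile g i y)

module _ {n ρ k g i j} (A : Ready n ρ k g i j) where
  open Ready A
  open Lab lab using (loc)

  private
    atR : tile g i j ≡ relbow → ComesFrom n ρ k g i j ⊎ IsStart n k g i j
    atR tr with i ≤? k
    ... | yes le = go j refl
      where
      go : ∀ j₁ → j₁ ≡ j → ComesFrom n ρ k g i j ⊎ IsStart n k g i j
      go zero refl = ⊥-elim (n≮0 (proj₁ pj))
      go (suc x) refl with Rows.prevJ lab i pi x (<⇒≤ (proj₂ pj)) (proj₁ (relbowLabels (loc i j pi pj) tr))
      ... | inj₂ f = inj₂ (record { elbow = tr ; low = le ; first = λ y u w → f y u (≤-pred w) })
      ... | inj₁ (j₀ , 1≤ , le' , tj , f) = inj₁ (record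
          { state = record { drawing = drawing ; pi = pi ; pj = pj₀ ; turn = inj₁ tj ; only = vacuous (noBumpAt only tr (λ ()))
                           ; small = enterSmall lab i j₀ fromW pi pj₀ le (proj₂ (jelbowLabels (loc i j₀ pi pj₀) tj)) }
          ; result = AfterDroop.after-right k sq pi pj₀ tj le pj (s≤s le') tr (λ y u w → proj₁ (f y u (≤-pred w))) })
        where
        pj₀ : In n j₀
        pj₀ = 1≤ , ≤-trans le' (<⇒≤ (proj₂ pj))
    -- The moving pipe exits from a row at most `k`, hence above row `i`, and must leave this row at
    -- a j-elbow further right.
    ... | no nle with Rows.nextJ lab i pi (n ∸ j) (suc j) (h i (suc j)) (trans (+-suc (n ∸ j) j) (cong suc (m∸n+n≡m (proj₂ pj)))) (s≤s z≤n)
                       (proj₂ (proj₂ (relbowLabels (loc i j pi pj) tr))) refl (λ y u w → noBumpAt only tr (λ ()) i y pi (≤-trans (s≤s z≤n) u , w))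
                       (λ e → nle (small-unique lab small pi e))
    ...   | j₀ , lt , le' , tj , lj , f = inj₁ (record
          { state = record { drawing = drawing ; pi = pi ; pj = pj₀ ; turn = inj₁ tj ; only = vacuous (noBumpAt only tr (λ ())) ; small = subst (SmallExit n k h) (sym lj) small }
          ; result = AfterDroop.after-left k sq pi pj₀ tj (≰⇒> nle) pj lt tr (λ y u w → proj₁ (f y u w)) })
        where
        pj₀ : In n j₀
        pj₀ = ≤-trans (s≤s z≤n) lt , le'

    module Bumped (tb : tile g i j ≡ bump) (row : ℕ) (rowIn' : In n row) (exitsAt : h row (suc n) ≡ h i j) where
      open Cuts lab
      open Order lab
      bl = bumpLabels (loc i j pi pj) tb
      q p : ℕ
      q = h i j
      p = v (suc i) j
      0<q = proj₁ (proj₂ (proj₂ bl))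
      0<p = proj₂ (proj₂ (proj₂ bl))
      smallP : SmallExit n k h p
      smallP = subst (SmallExit n k h) (proj₁ (proj₂ bl)) small
      1≤n : 1 ≤ n
      1≤n = ≤-trans (proj₁ pi) (proj₂ pi)

      stays : row ≤ k → ComesFrom n ρ k g i j
      stays le = record
        { state = record { drawing = drawing ; pi = pi ; pj = pj ; turn = inj₂ tb ; only = only ; small = mkSmall row rowIn' le exitsAt }
        ; result = AfterDroop.AtBump.after-stay k sq pi pj lab tb
            (small-unique lab smallP (AfterDroop.AtBump.exitRow-in k sq pi pj lab tb) (AfterDroop.AtBump.exitRow-≡ k sq pi pj lab tb)) }

      -- p leaves above q but enters (i , j) after it, so they cross later, q travelling east
      exitOrder : k < row → Before 1 (suc n) p q
      exitOrder gt = subst₂ (Before 1 (suc n)) (SmallExit.exit smallP) exitsAt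
        (exitBefore (SmallExit.row smallP) row (SmallExit.rowIn smallP) rowIn' (≤-<-trans (SmallExit.row≤k smallP) gt))

      crossed : k < row → Σ ℕ λ a → Σ ℕ λ b → In n a × In n b × CrossOf a b q p
      crossed gt with history (n ∸ 1) 1 n (m∸n+n≡m 1≤n) ≤-refl ≤-refl 0<p 0<q (exitOrder gt)
      ... | inj₂ (inj₂ (a , b , pa , pb , _ , x , _)) = a , b , pa , pb , x
      ... | inj₂ (inj₁ (a , b , pa , pb , o , x , lt)) = ⊥-elim (asym a (suc b) pa (s≤s z≤n) (s≤s (proj₂ pb)) 0<p 0<q
            (back 1 (suc n) a (suc b) (≤-refl , 1≤n) pa (s≤s z≤n) ≤-refl (s≤s z≤n) (s≤s (proj₂ pb)) (≼-exit pa (proj₂ pb)) 0<p lt (exitOrder gt)) (crossLeave a b pa pb x))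
      ... | inj₁ lt = ⊥-elim (asym i j pi (proj₁ pj) (m≤n⇒m≤1+n (proj₂ pj)) 0<p 0<q
            (back 1 (suc n) i j (≤-refl , 1≤n) pi (s≤s z≤n) ≤-refl (proj₁ pj) (m≤n⇒m≤1+n (proj₂ pj)) (≼-weaken (≼-exit pi (proj₂ pj))) 0<p lt (exitOrder gt)) (enter i j pi pj))

      module Swaps (gt : k < row) (a b : ℕ) (pa : In n a) (pb : In n b) (crossQP : CrossOf a b q p) where
        tx : tile g a b ≡ cross
        tx = proj₁ crossQP

        -- An earlier cross would leave the pair reversed, with `p` before `q`, and it would stay
        -- so; but at (i , j) the pipe `q` comes from the west and stands before `p`.
        ord : (i , suc j) ≼ (a , b)
        ord with ≼-total i j a b
        ... | inj₁ o = o
        ... | inj₂ (inj₂ (ei , ej)) = ⊥-elim (bx (trans (sym tb) (trans (cong₂ (tile g) ei ej) tx)))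
          where
          bx : bump ≢ cross
          bx ()
        ... | inj₂ (inj₁ o) = ⊥-elim (asym a (suc b) pa (s≤s z≤n) (s≤s (proj₂ pb)) 0<q 0<p
              (back i j a (suc b) pi pa (proj₁ pj) (m≤n⇒m≤1+n (proj₂ pj)) (s≤s z≤n) (s≤s (proj₂ pb)) o 0<q (proj₂ (proj₂ (proj₂ (crossEnter a b pa pb crossQP)))) (enter i j pi pj))
              (crossLeave a b pa pb crossQP))

        ne : ¬ (a ≡ i × b ≡ j)
        ne = ne-cell ord

        T' : ℕ → ℕ → Tile
        T' = put (put (tile g) a b bump) i j cross

        T'-i : T' i j ≡ cross
        T'-i = put-here _ i j cross
        T'-a : T' a b ≡ bump
        T'-a = trans (put-off _ i j cross a b ne) (put-here _ a b bump)
        T'-off : ∀ x y → ¬ (x ≡ i × y ≡ j) → ¬ (x ≡ a × y ≡ b) → T' x y ≡ tile g x y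
        T'-off x y u w = trans (put-off _ i j cross x y u) (put-off _ a b bump x y w)

        pair : Pair (h i j) (v (suc i) j) (h a b) (v (suc a) b)
        pair = inj₁ (proj₁ (proj₂ crossQP) , proj₂ (proj₂ crossQP))

        module DT = DoubleToggle lab T' i j a b pi pj pa pb ord (subst₂ Toggled (sym tb) (sym T'-i) recross) (subst₂ Toggled (sym tx) (sym T'-a) uncross)
          (trans (cong₂ (λ s t → b2n (isTile cross s) + b2n (isTile cross t)) tb tx) (sym (cong₂ (λ s t → b2n (isTile cross s) + b2n (isTile cross t)) T'-i T'-a)))
          (λ x y _ _ → T'-off x y) pair

        g₀ : Grid
        g₀ = mkGrid n T'
        s₀ : Sq n g₀
        s₀ = mkGrid-sq n T'
        t₀ : ∀ x y → In n x → In n y → tile g₀ x y ≡ T' x y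
        t₀ = mkGrid-tile n T'
        L₀ : Lab _<_ n (tile g₀) DT.h″ DT.v″
        L₀ = labCong t₀ DT.lab″
        tb₀ : tile g₀ a b ≡ bump
        tb₀ = trans (t₀ a b pa pb) T'-a

        wLabel : DT.h″ a b ≡ p
        wLabel = trans (proj₁ DT.second-in) (trans (cong (swapL q p) (proj₁ (proj₂ crossQP))) (swapL-p q p))
        sLabel : DT.v″ (suc a) b ≡ q
        sLabel = trans (proj₂ DT.second-in) (trans (cong (swapL q p) (proj₂ (proj₂ crossQP))) (swapL-q q p))

        only₀ : OnlyBump n (tile g₀) a b
        only₀ x y px py e with (x ≟ a) ×-dec (y ≟ b)
        ... | yes r = r
        ... | no w with (x ≟ i) ×-dec (y ≟ j)
        ...   | yes (refl , refl) = clash (trans (t₀ x y px py) T'-i) e (λ ())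
        ...   | no u = ⊥-elim (u (only x y px py (trans (sym (trans (t₀ x y px py) (T'-off x y u w))) e)))

        open AfterDroop k s₀ pa pb
        open AtBump L₀ tb₀ using (exitRow; exitRow-in; exitRow-≡; after-swap)

        exitRow-row : exitRow ≡ row
        exitRow-row = Cuts.exitUnique L₀ exitRow row exitRow-in rowIn' (trans exitRow-≡ (trans sLabel (trans (sym exitsAt) (sym (DT.exit″ row rowIn')))))

        swaps : ComesFrom n ρ k g i j
        swaps = record
          { g₀ = g₀ ; i₀ = a ; j₀ = b
          ; state = record
            { drawing = record { sq = s₀ ; len = len ; h = DT.h″ ; v = DT.v″ ; lab = L₀ ; exits = λ r pr → trans (exits r pr) (cong just (sym (DT.exit″ r pr))) }
            ; pi = pa ; pj = pb ; turn = inj₂ tb₀ ; only = only₀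
            ; small = mkSmall (SmallExit.row smallP) (SmallExit.rowIn smallP) (SmallExit.row≤k smallP) (trans (DT.exit″ _ (SmallExit.rowIn smallP)) (trans (SmallExit.exit smallP) (sym wLabel))) }
          ; result = after-swap (subst (k <_) (sym exitRow-row) gt)
              (pi , pj , inj₂ (trans (t₀ i j pi pj) T'-i , trans (proj₁ DT.first-in) (sym sLabel) , trans (proj₂ DT.first-in) (sym wLabel)))
              sq tx tb (λ x y px py w u → sym (trans (t₀ x y px py) (T'-off x y u w))) }

      atBump : ComesFrom n ρ k g i j
      atBump with row ≤? k
      ... | yes le = stays le
      ... | no nle = let (a , b , pa , pb , x) = crossed (≰⇒> nle) in Swaps.swaps (≰⇒> nle) a b pa pb x

  comesFrom : ComesFrom n ρ k g i j ⊎ IsStart n k g i j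
  comesFrom with turn
  ... | inj₁ tr = atR tr
  ... | inj₂ tb = let open Pipes.Traced (Pipes.trace lab i j fromW pi pj (proj₁ (proj₂ (proj₂ (bumpLabels (loc i j pi pj) tb))))) in
      inj₁ (Bumped.atBump tb row (rowIn , ≤-trans rowUp (proj₂ pi)) exitsAt)

-- Tracing back the last crossing

record StopsFrom (n : ℕ) (ρ : Perm) (k : ℕ) (D : Grid) : Set where
  field
    g : Grid
    i j : ℕ
    state : Landed n ρ k g i j
    result : afterDroop k g i j (tileAt g i j) ≡ stop D

module _ {n σ D} (Dσ : Drawing n σ D) (nb : NoBump n (tile D)) where
  open Drawing Dσ
  open Cuts lab

  -- The cover gives `x < y`, while in `σ` the pipe `y` exits above `x`; so the two have crossed.
  -- Opening this cross into a bump exchanges their exits and restores `ρ`.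
  module Unstop {k ρ} (lρ : length ρ ≡ n) (α β : ℕ) (1≤α : 1 ≤ α) (α≤k : α ≤ k) (k<β : k < β) (β≤n : β ≤ n)
      (eσ : σ ≡ swapPos ρ α β) (inv : inversions σ ≡ suc (inversions ρ)) where
    α<β : α < β
    α<β = ≤-<-trans α≤k k<β
    pα : In n α
    pα = 1≤α , ≤-trans (<⇒≤ α<β) β≤n
    pβ : In n β
    pβ = ≤-trans 1≤α (<⇒≤ α<β) , β≤n
    module S = SwapPos n ρ lρ α β pα pβ
    x y : ℕ
    x = h β (suc n)
    y = h α (suc n)
    ρα : nth ρ α ≡ just x
    ρα = trans (sym S.σ-b) (trans (cong (λ z → nth z β) (sym eσ)) (exits β pβ))
    ρβ : nth ρ β ≡ just y
    ρβ = trans (sym S.σ-a) (trans (cong (λ z → nth z α) (sym eσ)) (exits α pα))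
    x≢y : x ≢ y
    x≢y e = <⇒≢ α<β (exitUnique α β pα pβ (sym e))
    x<y : x < y
    x<y = S.ascent α<β ρα ρβ x≢y (trans (cong inversions (sym eσ)) inv)
    1≤n : 1 ≤ n
    1≤n = ≤-trans 1≤α (proj₂ pα)
    crossed : Σ ℕ λ a → Σ ℕ λ b → In n a × In n b × CrossOf a b x y
    crossed with history (n ∸ 1) 1 n (m∸n+n≡m 1≤n) ≤-refl ≤-refl (Lab.right lab α pα) (Lab.right lab β pβ) (exitBefore α β pα pβ α<β)
    ... | inj₁ lt = ⊥-elim (<-asym lt x<y)
    ... | inj₂ (inj₁ (_ , _ , _ , _ , _ , _ , lt)) = ⊥-elim (<-asym lt x<y)
    ... | inj₂ (inj₂ (a , b , pa , pb , _ , c , _)) = a , b , pa , pb , c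
    module Crossing (a b : ℕ) (pa : In n a) (pb : In n b) (cr : CrossOf a b x y) where
      tx : tile D a b ≡ cross
      tx = proj₁ cr
      hx : h a b ≡ x
      hx = proj₁ (proj₂ cr)
      vy : v (suc a) b ≡ y
      vy = proj₂ (proj₂ cr)
      T' : ℕ → ℕ → Tile
      T' = put (tile D) a b bump
      exρ : ∀ r → In n r → nth ρ r ≡ just (swapL (h a b) (v (suc a) b) (h r (suc n)))
      exρ r pr = trans go (cong₂ (λ c d → just (swapL c d (h r (suc n)))) (sym hx) (sym vy))
        where
        go : nth ρ r ≡ just (swapL x y (h r (suc n)))
        go with r ≟ α | r ≟ β
        ... | yes refl | _ = trans ρα (cong just (sym (swapL-q x y)))
        ... | no _ | yes refl = trans ρβ (cong just (sym (swapL-p x y)))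
        ... | no na | no nb = trans (sym (S.σ-other r na nb)) (trans (cong (λ z → nth z r) (sym eσ)) (trans (exits r pr)
                (cong just (sym (swapL-other x y _ (λ e → nb (exitUnique r β pr pβ e)) (λ e → na (exitUnique r α pr pα e)))))))
      module U = Uncross lab T' a b pa pb tx (put-here _ a b bump) (λ r c _ _ → put-off _ a b bump r c) σ ρ len lρ exits exρ inv
      g₀ : Grid
      g₀ = mkGrid n T'
      s₀ : Sq n g₀
      s₀ = mkGrid-sq n T'
      t₀ : ∀ r c → In n r → In n c → tile g₀ r c ≡ T' r c
      t₀ = mkGrid-tile n T'
      L₀ : Lab _<_ n (tile g₀) U.h' U.v'
      L₀ = labCong t₀ U.reduced'
      tb₀ : tile g₀ a b ≡ bump
      tb₀ = trans (t₀ a b pa pb) (put-here _ a b bump)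
      only₀ : OnlyBump n (tile g₀) a b
      only₀ r c pr pc e with (r ≟ a) ×-dec (c ≟ b)
      ... | yes q = q
      ... | no ne = ⊥-elim (nb r c pr pc (trans (sym (trans (t₀ r c pr pc) (put-off _ a b bump r c ne))) e))
      open AfterDroop k s₀ pa pb
      open AtBump L₀ tb₀ using (exitRow; exitRow-in; exitRow-≡; after-stop)
      exitRow-β : exitRow ≡ β
      exitRow-β = Cuts.exitUnique L₀ exitRow β exitRow-in pβ (trans exitRow-≡ (trans (proj₂ U.here-in) (trans vy (trans (sym (swapL-p x y))
         (trans (cong₂ (λ c d → swapL c d x) (sym hx) (sym vy)) (sym (U.exit' β pβ)))))))
      -- The relabelling acts on these two names only by exchanging them, so another cross of the
      -- pair would be a second cross of `x` and `y` in `D`.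
      apart : ∀ c → ¬ Crosses.Meets s₀ L₀ (U.h' a b) (U.v' (suc a) b) c
      apart (r , c) (pr , pc , m) = contra (Meeting.meetOnce sq lab x y (r , c) (a , b) (pr , pc , original m) (pa , pb , inj₁ cr))
        where
        tc : tile g₀ r c ≡ cross
        tc = [ proj₁ , proj₁ ]′ m
        contra : (r , c) ≢ (a , b)
        contra refl = clash tb₀ tc (λ ())
        tD : tile D r c ≡ cross
        tD = trans (sym (trans (t₀ r c pr pc) (put-off _ a b bump r c (λ { (refl , refl) → contra refl })))) tc
        toPair : _ → Pair x y (U.h' r c) (U.v' (suc r) c)
        toPair (inj₁ (_ , e , e')) = inj₁ (trans e (trans (proj₁ U.here-in) hx) , trans e' (trans (proj₂ U.here-in) vy))
        toPair (inj₂ (_ , e , e')) = inj₂ (trans e (trans (proj₂ U.here-in) vy) , trans e' (trans (proj₁ U.here-in) hx))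
        fromPair : Pair x y (h r c) (v (suc r) c) → CrossOf r c x y ⊎ CrossOf r c y x
        fromPair (inj₁ (e , e')) = inj₁ (tD , e , e')
        fromPair (inj₂ (e , e')) = inj₂ (tD , e , e')
        original : Cuts.CrossOf L₀ r c (U.h' a b) (U.v' (suc a) b) ⊎ Cuts.CrossOf L₀ r c (U.v' (suc a) b) (U.h' a b) → CrossOf r c x y ⊎ CrossOf r c y x
        original m with U.any-in r c pr pc
        ... | inj₁ (e , e') = fromPair (subst₂ (Pair x y) e e' (toPair m))
        ... | inj₂ (e , e') = fromPair (pair-unswap (subst₂ (Pair x y) (trans e (cong₂ (λ p q → swapL p q (h r c)) hx vy)) (trans e' (cong₂ (λ p q → swapL p q (v (suc r) c)) hx vy)) (toPair m)))

      stopsFrom : StopsFrom n ρ k D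
      stopsFrom = record
        { g = g₀ ; i = a ; j = b
        ; state = record
          { drawing = record { sq = s₀ ; len = lρ ; h = U.h' ; v = U.v' ; lab = L₀ ; exits = U.exits' }
          ; pi = pa ; pj = pb ; turn = inj₂ tb₀ ; only = only₀
          ; small = mkSmall α pα α≤k (trans (U.exit' α pα) (trans (cong₂ (λ c d → swapL c d (h α (suc n))) hx vy) (trans (swapL-q x y) (sym (trans (proj₁ U.here-in) hx))))) }
        ; result = after-stop (subst (k <_) (sym exitRow-β) k<β) apart sq tx (λ r c pr pc ne → sym (trans (t₀ r c pr pc) (put-off _ a b bump r c ne))) }

  unstop : ∀ {k ρ} → length ρ ≡ n → Covers n k ρ σ → StopsFrom n ρ k D
  unstop {k} {ρ} lρ (α , β , 1≤α , α≤k , k<β , β≤n , eσ , inv) = go Un.crossed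
    where
    module Un = Unstop {k} {ρ} lρ α β 1≤α α≤k k<β β≤n eσ inv
    go : (Σ ℕ λ a → Σ ℕ λ b → In n a × In n b × CrossOf a b Un.x Un.y) → StopsFrom n ρ k D
    go (a , b , pa , pb , cr) = Un.Crossing.stopsFrom a b pa pb cr

  -- The last crossing in terms of the labels of `D`, which two insertions with the same result
  -- share.
  record StopData (ρ : Perm) (i j : ℕ) : Set where
    field
      pi : In n i
      pj : In n j
      crossing : CrossOf i j (h i j) (v (suc i) j)
      row : ℕ
      rowIn : In n row
      initialExit : nth ρ row ≡ just (h i j)
      exchanged : ∀ r l → In n r → nth ρ r ≡ just l → h r (suc n) ≡ swapL (h i j) (v (suc i) j) l

  stopData : ∀ {ρ k g i j} → Landed n ρ k g i j → Stop n g i j D → StopData ρ i j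
  stopData {ρ} {k} {g} {i} {j} B S = record
    { pi = B.pi ; pj = B.pj ; crossing = S.isCross' , refl , refl
    ; row = SmallExit.row B.small ; rowIn = SmallExit.rowIn B.small
    ; initialExit = trans (B.exits _ (SmallExit.rowIn B.small)) (cong just (trans (SmallExit.exit B.small) (sym hp)))
    ; exchanged = λ r l pr e → trans (sym (h-unique r n pr ≤-refl)) (trans (T.exit' r pr) (trans (cong₂ (λ c d → swapL c d (B.h r (suc n))) (sym hp) (sym vq))
        (cong (swapL (h i j) (v (suc i) j)) (just-injective (trans (sym (B.exits r pr)) e))))) }
    where
    module B = Landed B
    module S = Stop S
    module T = ToggleMore B.lab (tile D) i j B.pi B.pj (subst₂ Toggled (sym S.wasBump) (sym S.isCross') recross) S.off
    open LabUnique T.lab' lab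
    hp : h i j ≡ B.h i j
    hp = trans (sym (w-unique i j B.pi B.pj)) (proj₁ T.here-in)
    vq : v (suc i) j ≡ B.v (suc i) j
    vq = trans (sym (s-unique i j B.pi B.pj)) (proj₂ T.here-in)

  -- the exchanged pair is read off from ρ and σ, and the crossing of a pair is unique
  stop-inj : ∀ {ρ k g₁ i₁ j₁ g₂ i₂ j₂} → Landed n ρ k g₁ i₁ j₁ → Landed n ρ k g₂ i₂ j₂ → Stop n g₁ i₁ j₁ D → Stop n g₂ i₂ j₂ D → g₁ ≡ g₂ × i₁ ≡ i₂ × j₁ ≡ j₂
  stop-inj {ρ} {k} {g₁} {i₁} {j₁} {g₂} {i₂} {j₂} B₁ B₂ S₁ S₂ = finish (crossUnique i₁ j₁ i₂ j₂ D₁.pi D₁.pj D₂.pi D₂.pj D₁.crossing (subst₂ (CrossOf i₂ j₂) (sym (proj₁ samePair)) (sym (proj₂ samePair)) D₂.crossing))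
    where
    open Order lab
    module D₁ = StopData (stopData B₁ S₁)
    module D₂ = StopData (stopData B₂ S₂)
    p₁ = h i₁ j₁
    q₁ = v (suc i₁) j₁
    p₂ = h i₂ j₂
    q₂ = v (suc i₂) j₂
    lt₁ : p₁ < q₁
    lt₁ = proj₂ (proj₂ (proj₂ (crossEnter i₁ j₁ D₁.pi D₁.pj D₁.crossing)))
    lt₂ : p₂ < q₂
    lt₂ = proj₂ (proj₂ (proj₂ (crossEnter i₂ j₂ D₂.pi D₂.pj D₂.crossing)))
    -- The row from which `p₁` exits in `ρ` lets out `q₁` in `σ`, and both descriptions of the
    -- exchange must agree on this row.
    image : swapL p₂ q₂ p₁ ≡ q₁
    image = trans (sym (D₂.exchanged D₁.row p₁ D₁.rowIn D₁.initialExit)) (trans (D₁.exchanged D₁.row p₁ D₁.rowIn D₁.initialExit) (swapL-p p₁ q₁))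
    samePair : p₁ ≡ p₂ × q₁ ≡ q₂
    samePair with p₁ ≟ p₂ | p₁ ≟ q₂
    ... | yes e | _ = e , trans (sym image) (trans (cong (swapL p₂ q₂) e) (swapL-p p₂ q₂))
    ... | no _ | yes e = ⊥-elim (<-asym lt₂ (subst₂ _<_ e (trans (sym image) (trans (cong (swapL p₂ q₂) e) (swapL-q p₂ q₂))) lt₁))
    ... | no u | no w = ⊥-elim (<⇒≢ lt₁ (trans (sym (swapL-other p₂ q₂ p₁ u w)) image))
    finish : i₁ ≡ i₂ × j₁ ≡ j₂ → g₁ ≡ g₂ × i₁ ≡ i₂ × j₁ ≡ j₂
    finish (refl , refl) = grid-ext (Landed.sq B₁) (Landed.sq B₂) cell , refl , refl
      where
      cell : ∀ x y → In n x → In n y → tile g₁ x y ≡ tile g₂ x y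
      cell x y px py with (x ≟ i₁) ×-dec (y ≟ j₁)
      ... | yes (refl , refl) = trans (Stop.wasBump S₁) (sym (Stop.wasBump S₂))
      ... | no ne = trans (sym (Stop.off S₁ x y px py ne)) (Stop.off S₂ x y px py ne)

-- Drooping out of the square

inSuc : ∀ {n i} → In (suc n) i → In n i ⊎ i ≡ suc n
inSuc (1≤i , i≤) with m≤n⇒m<n∨m≡n i≤
... | inj₁ (s≤s le) = inj₁ (1≤i , le)
... | inj₂ e = inj₂ e

module GrowLab {n g h v} (s : Sq n g) (L : Lab _<_ n (tile g) h v) where
  open Lab L
  open GrowTiles s

  -- The added column prolongs each old exit by a horizontal tile, whence `j ⊓ suc n`; the new pipe
  -- `suc n` turns in the added corner.
  hG vG : ℕ → ℕ → ℕ
  hG i j with i ≤? n | j ≤? suc n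
  ... | yes _ | _ = h i (j ⊓ suc n)
  ... | no _ | yes _ = 0
  ... | no _ | no _ = suc n
  vG i j with i ≤? suc n | j ≤? n
  ... | yes _ | yes _ = v i j
  ... | yes _ | no _ = 0
  ... | no _ | _ = j

  hG-old : ∀ i j → i ≤ n → j ≤ suc n → hG i j ≡ h i j
  hG-old i j le le' with i ≤? n | j ≤? suc n
  ... | yes _ | _ = cong (h i) (m≤n⇒m⊓n≡m le')
  ... | no q | _ = ⊥-elim (q le)
  hG-end : ∀ i → i ≤ n → hG i (suc (suc n)) ≡ h i (suc n)
  hG-end i le with i ≤? n | suc (suc n) ≤? suc n
  ... | yes _ | _ = cong (h i) (m≥n⇒m⊓n≡n (n≤1+n (suc n)))
  ... | no q | _ = ⊥-elim (q le)
  hG-row : ∀ j → j ≤ suc n → hG (suc n) j ≡ 0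
  hG-row j le with suc n ≤? n | j ≤? suc n
  ... | yes q | _ = ⊥-elim (1+n≰n q)
  ... | no _ | yes _ = refl
  ... | no _ | no q = ⊥-elim (q le)
  hG-corner : hG (suc n) (suc (suc n)) ≡ suc n
  hG-corner with suc n ≤? n | suc (suc n) ≤? suc n
  ... | yes q | _ = ⊥-elim (1+n≰n q)
  ... | no _ | yes q = ⊥-elim (1+n≰n q)
  ... | no _ | no _ = refl
  vG-old : ∀ i j → i ≤ suc n → j ≤ n → vG i j ≡ v i j
  vG-old i j le le' with i ≤? suc n | j ≤? n
  ... | yes _ | yes _ = refl
  ... | yes _ | no q = ⊥-elim (q le')
  ... | no q | _ = ⊥-elim (q le)
  vG-col : ∀ i → i ≤ suc n → vG i (suc n) ≡ 0
  vG-col i le with i ≤? suc n | suc n ≤? n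
  ... | yes _ | yes q = ⊥-elim (1+n≰n q)
  ... | yes _ | no _ = refl
  ... | no q | _ = ⊥-elim (q le)
  vG-bot : ∀ j → vG (suc (suc n)) j ≡ j
  vG-bot j with suc (suc n) ≤? suc n | j ≤? n
  ... | yes q | _ = ⊥-elim (1+n≰n q)
  ... | no _ | _ = refl

  growLab : Lab _<_ (suc n) (tile (grow g)) hG vG
  growLab = record { loc = locG ; left = leftG ; top = topG ; bot = λ j _ → vG-bot j ; right = rightG }
    where
    locG : ∀ i j → In (suc n) i → In (suc n) j → Loc _<_ (tile (grow g) i j) (hG i j) (hG i (suc j)) (vG i j) (vG (suc i) j)
    locG i j pi pj with inSuc pi | inSuc pj
    ... | inj₁ qi | inj₁ qj = castLoc (grow-old i j qi qj) (hG-old i j (proj₂ qi) (m≤n⇒m≤1+n (proj₂ qj))) (hG-old i (suc j) (proj₂ qi) (s≤s (proj₂ qj)))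
          (vG-old i j (m≤n⇒m≤1+n (proj₂ qi)) (proj₂ qj)) (vG-old (suc i) j (s≤s (proj₂ qi)) (proj₂ qj)) (loc i j qi qj)
    ... | inj₁ qi | inj₂ refl = castLoc (grow-right i qi) (hG-old i (suc n) (proj₂ qi) ≤-refl) (hG-end i (proj₂ qi))
          (vG-col i (m≤n⇒m≤1+n (proj₂ qi))) (vG-col (suc i) (s≤s (proj₂ qi))) (horˡ (right i qi))
    ... | inj₂ refl | inj₁ qj = castLoc (grow-bottom j qj) (hG-row j (m≤n⇒m≤1+n (proj₂ qj))) (hG-row (suc j) (s≤s (proj₂ qj)))
          (trans (vG-old (suc n) j ≤-refl (proj₂ qj)) (bot j qj)) (vG-bot j) (verˡ (proj₁ qj))
    ... | inj₂ refl | inj₂ refl = castLoc grow-corner (hG-row (suc n) ≤-refl) hG-corner (vG-col (suc n) ≤-refl) (vG-bot (suc n)) (relbowˡ (s≤s z≤n))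
    leftG : ∀ i → In (suc n) i → hG i 1 ≡ 0
    leftG i pi with inSuc pi
    ... | inj₁ qi = trans (hG-old i 1 (proj₂ qi) (s≤s z≤n)) (left i qi)
    ... | inj₂ refl = hG-row 1 (s≤s z≤n)
    topG : ∀ j → In (suc n) j → vG 1 j ≡ 0
    topG j pj with inSuc pj
    ... | inj₁ qj = trans (vG-old 1 j (s≤s z≤n) (proj₂ qj)) (top j qj)
    ... | inj₂ refl = vG-col 1 (s≤s z≤n)
    rightG : ∀ i → In (suc n) i → 0 < hG i (suc (suc n))
    rightG i pi with inSuc pi
    ... | inj₁ qi = subst (0 <_) (sym (hG-end i (proj₂ qi))) (right i qi)
    ... | inj₂ refl = subst (0 <_) (sym hG-corner) (s≤s z≤n)

  growOnly : ∀ {a b} → OnlyBump n (tile g) a b → OnlyBump (suc n) (tile (grow g)) a b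
  growOnly ob i j pi pj e with inSuc pi | inSuc pj
  ... | inj₁ qi | inj₁ qj = ob i j qi qj (trans (sym (grow-old i j qi qj)) e)
  ... | inj₁ qi | inj₂ refl = clash (grow-right i qi) e (λ ())
  ... | inj₂ refl | inj₁ qj = clash (grow-bottom j qj) e (λ ())
  ... | inj₂ refl | inj₂ refl = clash grow-corner e (λ ())

-- A grid that no permutation of length `n` describes after padding, so that no step of the chain
-- can record it.
Unfit : ℕ → Grid → Set
Unfit n D = ∀ σ → length σ ≡ n → ¬ T (isBPD (length D) (padPerm (length D) σ) D)

-- A cross in the last cell of the diagonal means that the last pipe does not exit from the last row.
cross-unfit : ∀ {n D} → Sq (suc n) D → tile D (suc n) (suc n) ≡ cross → Unfit n D
cross-unfit {n} {D} s tc σ lσ b with subst (λ z → T (isBPD z (padPerm z σ) D)) (Sq.side s) b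
... | b' = <-irrefl w≡s (proj₂ (proj₂ (proj₂ (proj₂ eqs))))
  where
  open Drawing (FromBPD.drawing (suc n) (padPerm (suc n) σ) D b')
  pn : In (suc n) (suc n)
  pn = s≤s z≤n , ≤-refl
  eqs = crossEqs (Lab.loc lab (suc n) (suc n) pn pn) tc
  padded : nth (padPerm (suc n) σ) (suc n) ≡ just (suc n)
  padded rewrite lσ | m+n∸n≡m 1 n = subst (λ z → nth (σ ++ (suc n + 0) ∷ []) (suc z) ≡ just (suc n)) lσ (trans (nth-last σ (suc n + 0)) (cong just (+-identityʳ (suc n))))
  w≡s : h (suc n) (suc n) ≡ v (suc (suc n)) (suc n)
  w≡s = trans (sym (proj₁ eqs)) (trans (just-injective (trans (sym (exits (suc n) pn)) padded)) (sym (Lab.bot lab (suc n) pn)))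

record Escapes (n k : ℕ) (g : Grid) (i j : ℕ) : Set where
  field
    g' : Grid
    i' j' : ℕ
    D : Grid
    droop : minDroop g i j ≡ just (g' , (i' , j'))
    result : afterDroop k g' i' j' (tileAt g' i' j') ≡ stop D
    unfit : Unfit n D

-- Drooping out of the square must end on the diagonal, at the pipe suc n, which crosses nothing.
module Escape {n ρ k g a b a' b'} (A : Ready n ρ k g a b) (k<n : k < n) (R : Rect (suc n) a b a' b') (C : CanDroop (tile (grow g)) a b a' b')
    (far : ¬ (a' ≤ n × b' ≤ n)) where
  open Ready A
  open GrowLab sq lab
  open GrowTiles sq
  open Rect R
  private
    sG = grow-sq sq
    module DG = DroopGrid sG growLab R C (growOnly only)
    pn : In (suc n) (suc n)
    pn = s≤s z≤n , ≤-refl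

    -- A droop ends on a blank or on an r-elbow, and among the added tiles only the corner is one of
    -- these.
    corner : a' ≡ suc n × b' ≡ suc n
    corner with inSuc ina' | inSuc inb'
    ... | inj₁ p | inj₁ q = ⊥-elim (far (proj₂ p , proj₂ q))
    ... | inj₂ p | inj₂ q = p , q
    ... | inj₁ p | inj₂ refl = ⊥-elim ([ (λ x → clash (grow-right a' p) (proj₁ x) (λ ())) , (λ x → clash (grow-right a' p) (proj₁ x) (λ ())) ]′ DG.target)
    ... | inj₂ refl | inj₁ p = ⊥-elim ([ (λ x → clash (grow-bottom b' p) (proj₁ x) (λ ())) , (λ x → clash (grow-bottom b' p) (proj₁ x) (λ ())) ]′ DG.target)

  module AtCorner (ea : a' ≡ suc n) (eb : b' ≡ suc n) where
    private
      g' = DG.out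
      tb : tile g' a' b' ≡ bump
      tb = [ (λ x → clash (trans (cong₂ (tile (grow g)) ea eb) grow-corner) (proj₁ x) (λ ())) , proj₂ ]′ DG.target
      open AfterDroop k DG.sq' ina' inb'
      open AtBump DG.lab' tb using (exitRow; exitRow-in; exitRow-≡; after-stop)
      open Cuts DG.lab'
      open Pipes DG.lab'

      lastLabel : DG.v′ (suc a') b' ≡ suc n
      lastLabel = trans (cong (λ z → DG.v′ (suc z) b') ea) (trans (cong (DG.v′ (suc (suc n))) eb) (Lab.bot DG.lab' (suc n) pn))

      lastExit : DG.h′ (suc n) (suc (suc n)) ≡ suc n
      lastExit = trans (DG.exit' (suc n)) hG-corner

      exitRow-last : exitRow ≡ suc n
      exitRow-last = exitUnique exitRow (suc n) exitRow-in pn (trans exitRow-≡ (trans lastLabel (sym lastExit)))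

      -- In the last row only the column `suc n` has this pipe on its south edge, and there stands
      -- the bump. For a cell further up, the pipe already appears on the cut as an exit, and
      -- nowhere else.
      notCrossed : ∀ r c {l} → In (suc n) r → In (suc n) c → CrossOf r c l (suc n) → ⊥
      notCrossed r c pr pc (tc , _ , e) with inSuc pr
      ... | inj₂ refl = clash (trans (cong₂ (tile g') (sym ea) (trans (sym (Lab.bot DG.lab' c pc)) (trans e (sym eb)))) tb) tc (λ ())
      ... | inj₁ qr = <-irrefl (unique r c pr (proj₁ pc) (m≤n⇒m≤1+n (proj₂ pc)) (s≤s z≤n) (subst (At r c (suc c)) e (new ≤-refl (proj₂ pc))) outAt)
            (≤-trans (s≤s (s≤s (proj₂ pc))) (≤-trans (≤-reflexive (+-comm 1 (suc (suc n)))) (+-monoʳ-≤ (suc (suc n)) 0<d)))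
        where
        d = suc n ∸ r
        0<d : 1 ≤ d
        0<d = m<n⇒0<n∸m (s≤s (proj₂ qr))
        row : d + r ≡ suc n
        row = m∸n+n≡m (proj₂ pr)
        outAt : At r c (suc (suc n) + d) (suc n)
        outAt = subst (At r c (suc (suc n) + d)) (trans (cong (λ z → DG.h′ z (suc (suc n))) row) lastExit) (out d 0<d (≤-reflexive row))

      -- Travelling east it would be the smaller pipe of the cross, but no label exceeds `suc n`.
      notFirst : ∀ r c {l} → In (suc n) r → In (suc n) c → CrossOf r c (suc n) l → ⊥
      notFirst r c pr pc x@(tc , refl' , refl) = <⇒≱ (subst (_< DG.v′ (suc r) c) refl' (proj₂ (proj₂ (proj₂ (proj₂ eqs)))))
          (proj₂ (proj₁ (reach r c fromS pr pc (proj₁ (proj₂ (proj₂ (proj₂ eqs)))))))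
        where eqs = crossEqs (Lab.loc DG.lab' r c pr pc) tc

      apart : ∀ x → ¬ Crosses.Meets DG.sq' DG.lab' (DG.h′ a' b') (DG.v′ (suc a') b') x
      apart (r , c) (pr , pc , inj₁ (t , u , w)) = notCrossed r c pr pc (t , u , trans w lastLabel)
      apart (r , c) (pr , pc , inj₂ (t , u , w)) = notFirst r c pr pc (t , trans u lastLabel , w)

      module Md = Modified (modTile-spec {g = g'} {t = cross} (λ _ → just cross) DG.sq' ina' inb' refl)

      size : a' ⊔ b' ≡ suc n
      size = trans (cong₂ _⊔_ ea eb) (⊔-idem (suc n))

    atCorner : Escapes n k g a b
    atCorner = record
      { droop = trans (minDroop-grow sq pi pj R C size) DG.redraw-≡
      ; result = after-stop (subst (k <_) (sym exitRow-last) (m<n⇒m<1+n k<n)) apart Md.sq (Md.on a' b' (refl , refl)) (λ x y _ _ → Md.off x y)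
      ; unfit = cross-unfit Md.sq (trans (cong₂ (tile Md.grid′) (sym ea) (sym eb)) (Md.on a' b' (refl , refl))) }

  escapes : Escapes n k g a b
  escapes = AtCorner.atCorner (proj₁ corner) (proj₂ corner)

droopReady : ∀ {n ρ k g i j} → Ready n ρ k g i j → k < n → DroopsTo n ρ k g i j ⊎ Escapes n k g i j
droopReady {n} A k<n with findTarget (Ready.sq A) (Ready.pi A) (Ready.pj A) (Ready.turn A)
... | t with (Target.a' t ≤? n) ×-dec (Target.b' t ≤? n)
...   | yes (p , q) = let (R , C) = shrink (Ready.sq A) p q (Target.rect t) (Target.can t) in inj₁ (DroopState.droopsTo A R C)
...   | no far = inj₂ (Escape.escapes A k<n (Target.rect t) (Target.can t) far)

step-droop : ∀ b k g i j {g' i' j'} → minDroop g i j ≡ just (g' , (i' , j')) → step b k (st g (droopAt i j)) ≡ afterDroop k g' i' j' (tileAt g' i' j')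
step-droop b k g i j e rewrite e = refl

-- Runs of the insertion

-- The last transition is the outermost, since two insertions are compared backwards from their
-- common result.
data Moves (n : ℕ) (ρ : Perm) (k : ℕ) (g₀ : Grid) (i₀ j₀ : ℕ) : Grid → ℕ → ℕ → Set where
  none : Moves n ρ k g₀ i₀ j₀ g₀ i₀ j₀
  more : ∀ {g i j g' i' j'} → Moves n ρ k g₀ i₀ j₀ g i j → Ready n ρ k g i j → (d : DroopsTo n ρ k g i j) →
         Ready n ρ k g' i' j' → Trans n k (DroopsTo.g' d) (DroopsTo.i' d) (DroopsTo.j' d) g' i' j' → Moves n ρ k g₀ i₀ j₀ g' i' j'

drooped-inj′ : ∀ {n g₁ g₂ a₁ b₁ a₂ b₂ g₁' a₁' b₁' g₂' a₂' b₂'} → Sq n g₁ → Sq n g₂ → Drooped n g₁ a₁ b₁ g₁' a₁' b₁' → Drooped n g₂ a₂ b₂ g₂' a₂' b₂' →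
  g₁' ≡ g₂' × a₁' ≡ a₂' × b₁' ≡ b₂' → g₁ ≡ g₂ × a₁ ≡ a₂ × b₁ ≡ b₂
drooped-inj′ s₁ s₂ d₁ d₂ (refl , refl , refl) = drooped-inj s₁ s₂ d₁ d₂

start-first : ∀ {n k g₀ i₀ j₀ g i j} → In n j₀ → IsStart n k g i j → Trans n k g₀ i₀ j₀ g i j → ⊥
start-first pj S (toRight e le lt r f) = proj₂ (IsStart.first S _ (proj₁ pj) lt) e
start-first pj S (toLeft e gt lt r f) = <⇒≱ gt (IsStart.low S)
start-first pj S (stay _ b _) = clash (IsStart.elbow S) b (λ ())
start-first pj S (swap _ b _ _ _ _ _ _) = clash (IsStart.elbow S) b (λ ())

-- Injectivity removes the last transitions in pairs, and by `start-first` neither history can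
-- continue past a start.
moves-unique : ∀ {n ρ k g₁ i₁ j₁ g₂ i₂ j₂ g i j} → IsStart n k g₁ i₁ j₁ → IsStart n k g₂ i₂ j₂ →
  Moves n ρ k g₁ i₁ j₁ g i j → Moves n ρ k g₂ i₂ j₂ g i j → g₁ ≡ g₂ × i₁ ≡ i₂ × j₁ ≡ j₂
moves-unique S₁ S₂ none none = refl , refl , refl
moves-unique S₁ S₂ none (more _ _ d _ t) = ⊥-elim (start-first (Landed.pj (DroopsTo.state d)) S₁ t)
moves-unique S₁ S₂ (more _ _ d _ t) none = ⊥-elim (start-first (Landed.pj (DroopsTo.state d)) S₂ t)
moves-unique S₁ S₂ (more m₁ A₁ d₁ A t₁) (more m₂ A₂ d₂ _ t₂)
  with drooped-inj′ (Ready.sq A₁) (Ready.sq A₂) (DroopsTo.drooped d₁) (DroopsTo.drooped d₂)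
         (trans-inj (Landed.sq B₁) (Landed.sq B₂) (Ready.sq A) (Landed.pi B₁) (Landed.pj B₁) (Landed.pi B₂) (Landed.pj B₂) (Ready.pi A) (Ready.pj A) t₁ t₂)
  where
  B₁ = DroopsTo.state d₁
  B₂ = DroopsTo.state d₂
... | refl , refl , refl = moves-unique S₁ S₂ m₁ m₂

record Finished (n : ℕ) (ρ : Perm) (k : ℕ) (g₀ : Grid) (i₀ j₀ : ℕ) (D : Grid) : Set where
  field
    g : Grid
    i j : ℕ
    moves : Moves n ρ k g₀ i₀ j₀ g i j
    ready : Ready n ρ k g i j
    droops : DroopsTo n ρ k g i j
    stops : Stop n (DroopsTo.g' droops) (DroopsTo.i' droops) (DroopsTo.j' droops) D

finished-unique : ∀ {n σ D ρ k g₁ i₁ j₁ g₂ i₂ j₂} → Drawing n σ D → NoBump n (tile D) → IsStart n k g₁ i₁ j₁ → IsStart n k g₂ i₂ j₂ →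
  Finished n ρ k g₁ i₁ j₁ D → Finished n ρ k g₂ i₂ j₂ D → g₁ ≡ g₂ × i₁ ≡ i₂ × j₁ ≡ j₂
finished-unique Dσ nb S₁ S₂ F₁ F₂
  with drooped-inj′ (Ready.sq (Finished.ready F₁)) (Ready.sq (Finished.ready F₂)) (DroopsTo.drooped (Finished.droops F₁)) (DroopsTo.drooped (Finished.droops F₂))
         (stop-inj Dσ nb (DroopsTo.state (Finished.droops F₁)) (DroopsTo.state (Finished.droops F₂)) (Finished.stops F₁) (Finished.stops F₂))
... | refl , refl , refl = moves-unique S₁ S₂ (Finished.moves F₁) (Finished.moves F₂)

Fits : ℕ → Grid → Set
Fits n D = Σ Perm λ σ → length σ ≡ n × T (isBPD (length D) (padPerm (length D) σ) D)

continue-injective : ∀ {s s'} → continue s ≡ continue s' → s ≡ s'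
continue-injective refl = refl

stop-injective : ∀ {D D'} → stop D ≡ stop D' → D ≡ D'
stop-injective refl = refl

stop-weight : ∀ {n g i j D} → Stop n g i j D → ∀ r → In n r → weightLanded n g i j r ≡ rowSum (isBlank (tile D)) n r
stop-weight {n} {g} {i} {j} {D} S r pr = trans (cong₂ _+_ (sumTo-cong n (λ y lt → cell (suc y) (s≤s z≤n , lt)))
     (trans (cong (λ t → b2n ((r ≡ᵇ i) ∧ isTile jelbow t)) wasBump) (cong b2n (∧-zeroʳ (r ≡ᵇ i))))) (+-identityʳ _)
  where
  open Stop S
  cell : ∀ y → In n y → isBlank (tile g) r y ≡ isBlank (tile D) r y
  cell y py with (r ≟ i) ×-dec (y ≟ j)
  ... | yes (refl , refl) = trans (cong (b2n ∘ isTile blank) wasBump) (sym (cong (b2n ∘ isTile blank) isCross'))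
  ... | no ne = cong (b2n ∘ isTile blank) (sym (off r y pr py ne))

module Run {n : ℕ} {ρ : Perm} {k : ℕ} (k<n : k < n) (b : ℕ) (g₀ : Grid) (i₀ j₀ : ℕ) where

  -- Recursion on the given run: `step` is a function, so the run must follow the transitions that
  -- the invariant predicts. An escape would halt with a grid excluded by `Fits`.
  run : ∀ {g i j D} → Moves n ρ k g₀ i₀ j₀ g i j → Ready n ρ k g i j → Runs b k (st g (droopAt i j)) D → Fits n D →
    Finished n ρ k g₀ i₀ j₀ D × (∀ r → In n r → weightReady n g i j r ≡ rowSum (isBlank (tile D)) n r)
  run {g} {i} {j} m A R fits with droopReady A k<n
  run {g} {i} {j} m A (halt e) (σ , lσ , f) | inj₂ esc
    with stop-injective (trans (sym e) (trans (step-droop b k g i j (Escapes.droop esc)) (Escapes.result esc)))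
  ... | refl = ⊥-elim (Escapes.unfit esc σ lσ f)
  run {g} {i} {j} m A (next e _) _ | inj₂ esc with trans (sym e) (trans (step-droop b k g i j (Escapes.droop esc)) (Escapes.result esc))
  ... | ()
  run {g} {i} {j} m A R fits | inj₁ d with afterLanding (DroopsTo.state d)
  run {g} {i} {j} m A (halt e) fits | inj₁ d | inj₂ (D , q , S)
    with stop-injective (trans (sym e) (trans (step-droop b k g i j (DroopsTo.result d)) q))
  ... | refl = record { moves = m ; ready = A ; droops = d ; stops = S } ,
      λ r pr → trans (Drooped.weight (DroopsTo.drooped d) r pr) (stop-weight S r pr)
  run {g} {i} {j} m A (next e _) fits | inj₁ d | inj₂ (D , q , S) with trans (sym e) (trans (step-droop b k g i j (DroopsTo.result d)) q)
  ... | ()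
  run {g} {i} {j} m A (halt e) fits | inj₁ d | inj₁ c with trans (sym e) (trans (step-droop b k g i j (DroopsTo.result d)) (Continues.result c))
  ... | ()
  run {g} {i} {j} m A (next e R) fits | inj₁ d | inj₁ c
    with continue-injective (trans (sym e) (trans (step-droop b k g i j (DroopsTo.result d)) (Continues.result c)))
  ... | refl = let (F , w) = run (more m A d (Continues.state c) (Continues.move c)) (Continues.state c) R fits in
      F , λ r pr → trans (Drooped.weight (DroopsTo.drooped d) r pr) (trans (Continues.weight c r pr) (w r pr))

record Started (n : ℕ) (ρ : Perm) (k b : ℕ) (D : Grid) : Set where
  field
    j : ℕ
    state : Ready n ρ k D b j
    isStart : IsStart n k D b j
    result : step b k (st D begin) ≡ continue (st D (droopAt b j))

begin-step : ∀ b k g j → rElbowAfter (ensureSize b g) b 0 ≡ just j → step b k (st g begin) ≡ continue (st (ensureSize b g) (droopAt b j))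
begin-step b k g j e rewrite e = refl

beginAt : ∀ {n k b j g} → Sq n g → In n b → In n j → tile g b j ≡ relbow → (∀ y → 1 ≤ y → y < j → Plain (tile g b y)) →
  step b k (st g begin) ≡ continue (st g (droopAt b j))
beginAt {n} {k} {b} {j} {g} s pb pj r f = subst (λ z → step b k (st g begin) ≡ continue (st z (droopAt b j))) small
  (begin-step b k g j (subst (λ z → rElbowAfter z b 0 ≡ just j) (sym small) (rElbowAfter-≡ s pb pj (proj₁ pj) r (λ x u w → proj₁ (f x u w)))))
  where
  small : ensureSize b g ≡ g
  small = ensureSize-small s (proj₂ pb)

started : ∀ {n ρ k b D} → Drawing n ρ D → NoBump n (tile D) → k < n → 1 ≤ b → b ≤ k → Started n ρ k b D
started {n} {ρ} {k} {b} {D} Dr nb k<n 1≤b b≤k = go (Rows.nextR lab b pb n 1 (+-comm n 1) ≤-refl (Lab.left lab b pb))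
  where
  open Drawing Dr
  pb : In n b
  pb = 1≤b , ≤-trans b≤k (<⇒≤ k<n)
  go : _ → Started n ρ k b D
  go (j , 1≤j , j≤n , r , f) = record
    { j = j
    ; state = record { drawing = Dr ; pi = pb ; pj = pj ; turn = inj₁ r ; only = vacuous nb
        ; small = subst (SmallExit n k h) (proj₁ (proj₂ lb)) (enterSmall lab b j fromS pb pj b≤k (subst (0 <_) (sym (proj₁ (proj₂ lb))) (proj₂ (proj₂ lb)))) }
    ; isStart = record { elbow = r ; low = b≤k ; first = f }
    ; result = beginAt {k = k} sq pb pj r f }
    where
    pj : In n j
    pj = 1≤j , j≤n
    lb = relbowLabels (Lab.loc lab b j pb pj) r

record Inserted (n : ℕ) (ρ : Perm) (k b : ℕ) (D D' : Grid) : Set where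
  field
    j : ℕ
    isStart : IsStart n k D b j
    finished : Finished n ρ k D b j D'
    weight : ∀ r → In n r → rowSum (isBlank (tile D)) n r + b2n (r ≡ᵇ b) ≡ rowSum (isBlank (tile D')) n r

private
  insertedRun : ∀ {n ρ k b D D'} → k < n → 1 ≤ b → b ≤ k → T (isBPD n ρ D) → LeftInsert b k D D' → Fits n D' → Inserted n ρ k b D D'
  insertedRun {n} {ρ} {k} {b} {D} {D'} k<n 1≤b b≤k bpd R fits with started (FromBPD.drawing n ρ D bpd) (FromBPD.noBump n ρ D bpd) k<n 1≤b b≤k
  insertedRun {n} {ρ} {k} {b} {D} {D'} k<n 1≤b b≤k bpd (halt e) fits | S with trans (sym e) (Started.result S)
  ... | ()
  insertedRun {n} {ρ} {k} {b} {D} {D'} k<n 1≤b b≤k bpd (next e R) fits | S with continue-injective (trans (sym e) (Started.result S))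
  ... | refl = let (F , w) = Run.run k<n b D b (Started.j S) none (Started.state S) R fits in
    record { j = Started.j S ; isStart = Started.isStart S ; finished = F
      ; weight = λ r pr → trans (cong (λ t → rowSum (isBlank (tile D)) n r + b2n t) (sym (trans (cong (λ t → (r ≡ᵇ b) ∧ isTile relbow t) (IsStart.elbow (Started.isStart S))) (∧-identityʳ (r ≡ᵇ b))))) (w r pr) }

abstract
  inserted : ∀ {n ρ k b D D'} → k < n → 1 ≤ b → b ≤ k → T (isBPD n ρ D) → LeftInsert b k D D' → Fits n D' → Inserted n ρ k b D D'
  inserted = insertedRun

-- Finitely many states: since the algorithm is deterministic, running it backwards from a halting state never repeats a state.
tiles : List Tile
tiles = blank ∷ hor ∷ ver ∷ cross ∷ relbow ∷ jelbow ∷ bump ∷ []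

∈-tiles : ∀ t → t ∈ tiles
∈-tiles blank = here refl
∈-tiles hor = there (here refl)
∈-tiles ver = there (there (here refl))
∈-tiles cross = there (there (there (here refl)))
∈-tiles relbow = there (there (there (there (here refl))))
∈-tiles jelbow = there (there (there (there (there (here refl)))))
∈-tiles bump = there (there (there (there (there (there (here refl))))))

listsOf : ℕ → List X → List (List X)
listsOf zero xs = [] ∷ []
listsOf (suc m) xs = cartesianProductWith _∷_ xs (listsOf m xs)

∈-listsOf : ∀ m (as : List X) xs → length xs ≡ m → (∀ i x → nth xs i ≡ just x → x ∈ as) → xs ∈ listsOf m as
∈-listsOf zero as [] e f = here refl
∈-listsOf (suc m) as (x ∷ xs) e f = ∈-cartesianProductWith⁺ _∷_ (f 1 x refl) (∈-listsOf m as xs (suc-injective e) rest)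
  where
  rest : ∀ i y → nth xs i ≡ just y → y ∈ as
  rest zero y q = ⊥-elim (1+n≰n {0} (proj₁ (nth-bound xs q)))
  rest (suc i) y q = f (suc (suc i)) y q

Place : Set
Place = Grid × (ℕ × ℕ)

places : ℕ → List Place
places n = cartesianProduct (listsOf n (listsOf n tiles)) (cartesianProduct (oneTo n) (oneTo n))

∈-places : ∀ {n g i j} → Sq n g → In n i → In n j → (g , (i , j)) ∈ places n
∈-places {n} {g} s pi pj = ∈-cartesianProduct⁺ (∈-listsOf n _ g (Sq.side s) (λ i row e → ∈-listsOf n _ row (Sq.rows s i row e) (λ _ t _ → ∈-tiles t)))
    (∈-cartesianProduct⁺ (one pi) (one pj))
  where
  one : ∀ {i} → In n i → i ∈ oneTo n
  one {suc i} (_ , lt) = ∈-applyUpTo⁺ suc lt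

at : Place → State
at (g , (i , j)) = st g (droopAt i j)

at-injective : ∀ {x y} → at x ≡ at y → x ≡ y
at-injective refl = refl

module Backwards {n : ℕ} {ρ : Perm} {k : ℕ} (D : Grid) where

  Valid : Place → Set
  Valid (g , (i , j)) = Ready n ρ k g i j

  -- `m` counts the steps before the halting one. They are demanded for every `b`, because the row
  -- inserted into becomes known only when a start is found; `step` consults `b` only in the phase
  -- `begin`.
  data Leads : ℕ → Place → Set where
    done : ∀ {x} → Valid x → (∀ b → step b k (at x) ≡ stop D) → Leads 0 x
    next : ∀ {m x y} → Valid x → (∀ b → step b k (at x) ≡ continue (at y)) → Leads m y → Leads (suc m) x

  valid : ∀ {m x} → Leads m x → Valid x
  valid (done v _) = v
  valid (next v _ _) = v

  leads-unique : ∀ {m m' x} → Leads m x → Leads m' x → m ≡ m'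
  leads-unique (done _ _) (done _ _) = refl
  leads-unique (done _ e) (next _ e' _) with trans (sym (e 0)) (e' 0)
  ... | ()
  leads-unique (next _ e _) (done _ e') with trans (sym (e 0)) (e' 0)
  ... | ()
  leads-unique (next _ e l) (next _ e' l') with at-injective (continue-injective (trans (sym (e 0)) (e' 0)))
  ... | refl = cong suc (leads-unique l l')

  nthPlace : ∀ {m x} → Leads m x → (p : Fin (suc m)) → Σ Place λ y → Leads (m ∸ toℕ p) y
  nthPlace {x = x} l Fin.zero = x , l
  nthPlace (next _ _ l) (Fin.suc p) = nthPlace l p

  private
    member : ∀ {m x} (l : Leads m x) p → proj₁ (nthPlace l p) ∈ places n
    member l p = ∈-places (Ready.sq v) (Ready.pi v) (Ready.pj v)
      where v = valid (proj₂ (nthPlace l p))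

  -- The states of such a run have different numbers of steps ahead of them and are therefore
  -- distinct, but there is one more of them than there are places.
  bounded : ∀ {x} → ¬ Leads (length (places n)) x
  bounded l with pigeonhole (n<1+n (length (places n))) (λ p → index (member l p))
  ... | p , q , p<q , e = <-irrefl (∸-cancelˡ-≡ (≤-pred (toℕ<n p)) (≤-pred (toℕ<n q)) (leads-unique (proj₂ (nthPlace l p)) (subst (Leads _) (sym same-place) (proj₂ (nthPlace l q))))) p<q
    where
    same-place : proj₁ (nthPlace l p) ≡ proj₁ (nthPlace l q)
    same-place = trans (lookup-index (member l p)) (trans (cong (lookup (places n)) e) (sym (lookup-index (member l q))))

  StartFound : Set
  StartFound = Σ ℕ λ m → Σ Grid λ g → Σ ℕ λ i → Σ ℕ λ j → Leads m (g , (i , j)) × IsStart n k g i j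

  extend : ∀ m → StartFound ⊎ (Σ Place (Leads m)) → StartFound ⊎ (Σ Place (Leads (suc m)))
  extend m (inj₁ s) = inj₁ s
  extend m (inj₂ ((g , (i , j)) , l)) with comesFrom (valid l)
  ... | inj₂ S = inj₁ (m , g , i , j , l , S)
  ... | inj₁ c = inj₂ ((DF.g , (DF.i , DF.j)) , next DF.state (λ b → trans (step-droop b k DF.g DF.i DF.j DF.result) (ComesFrom.result c)) l)
    where module DF = DroopsFrom (undroop (ComesFrom.state c))

  -- A search of bounded depth: tracing back as many times as there are places without meeting a
  -- start would contradict `bounded`.
  findStart : ∀ {x} → Leads 0 x → StartFound
  findStart l with search' (length (places n))
    where
    search' : ∀ m → StartFound ⊎ Σ Place (Leads m)
    search' zero = inj₂ (_ , l)
    search' (suc m) = extend m (search' m)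
  ... | inj₁ s = s
  ... | inj₂ (_ , l') = ⊥-elim (bounded l')

  runs : ∀ {m x} b → Leads m x → Runs b k (at x) D
  runs b (done _ e) = halt (e b)
  runs b (next _ e l) = next (e b) (runs b l)

private
  ontoRun : ∀ {n ρ σ k D} → length ρ ≡ n → Covers n k ρ σ → T (isBPD n σ D) →
    Σ ℕ λ b → Σ Grid λ D₀ → 1 ≤ b × b ≤ k × T (isBPD n ρ D₀) × LeftInsert b k D₀ D
  ontoRun {n} {ρ} {σ} {k} {D} lρ cov bpd = go (findStart (done DF.state (λ b → trans (step-droop b k DF.g DF.i DF.j DF.result) (StopsFrom.result S))))
    where
    open Backwards {n} {ρ} {k} D
    S = unstop (FromBPD.drawing n σ D bpd) (FromBPD.noBump n σ D bpd) lρ cov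
    module DF = DroopsFrom (undroop (StopsFrom.state S))
    go : StartFound → _
    go (m , g , i , j , l , St) = i , g , proj₁ V.pi , IsStart.low St , ToBPD.isBPD-true V.drawing (noBumpAt V.only (IsStart.elbow St) (λ ())) ,
        next (beginAt {k = k} V.sq V.pi V.pj (IsStart.elbow St) (IsStart.first St)) (runs i l)
      where module V = Ready (valid l)

abstract
  insertion-onto : ∀ {n ρ σ k D} → length ρ ≡ n → Covers n k ρ σ → T (isBPD n σ D) →
    Σ ℕ λ b → Σ Grid λ D₀ → 1 ≤ b × b ≤ k × T (isBPD n ρ D₀) × LeftInsert b k D₀ D
  insertion-onto = ontoRun

-- The correspondence

module Identity (n : ℕ) where
  h₁ v₁ : ℕ → ℕ → ℕ
  h₁ i j = if i <ᵇ j then i else 0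
  v₁ i j = if j <ᵇ i then j else 0

  I : Grid
  I = idBPD n

  private
    diag : ℕ → ℕ → Tile
    diag i j = if i ≡ᵇ j then relbow else (if j <ᵇ i then ver else hor)

  I-row : ∀ i → In n i → nth I i ≡ just (map (diag i) (oneTo n))
  I-row i pi = nth-map (λ i → map (diag i) (oneTo n)) (oneTo n) (oneTo-nth pi)

  I-sq : Sq n I
  I-sq = mkSq len rows
    where
    len : length I ≡ n
    len = trans (length-map _ (oneTo n)) (length-applyUpTo suc n)
    rows : ∀ i row → nth I i ≡ just row → length row ≡ n
    rows i row e with trans (sym (I-row i (subst (λ z → In z i) len (nth-bound I e)))) e
    ... | refl = trans (length-map _ (oneTo n)) (length-applyUpTo suc n)

  I-tile : ∀ i j → In n i → In n j → tile I i j ≡ diag i j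
  I-tile i j pi pj rewrite I-row i pi | nth-map (diag i) (oneTo n) (oneTo-nth pj) = refl

  I-lab : Lab _<_ n (tile I) h₁ v₁
  I-lab = record
    { loc = locI
    ; left = λ { (suc i) pi → refl }
    ; top = λ { (suc j) pj → refl }
    ; bot = λ j pj → cong (λ z → if z then j else 0) (<ᵇ-true (s≤s (proj₂ pj)))
    ; right = λ i pi → subst (0 <_) (sym (cong (λ z → if z then i else 0) (<ᵇ-true (s≤s (proj₂ pi))))) (proj₁ pi) }
    where
    locI : ∀ i j → In n i → In n j → Loc _<_ (tile I i j) (h₁ i j) (h₁ i (suc j)) (v₁ i j) (v₁ (suc i) j)
    locI i j pi pj rewrite I-tile i j pi pj with compareℕ i j
    ... | less lt rewrite ≡ᵇ-false (<⇒≢ lt) | <ᵇ-false (<⇒≤ lt) | <ᵇ-true lt | <ᵇ-true (m<n⇒m<1+n lt) | <ᵇ-false lt = horˡ (proj₁ pi)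
    ... | equal refl rewrite ≡ᵇ-refl i | <ᵇ-false (≤-refl {i}) | <ᵇ-true (≤-refl {suc i}) = relbowˡ (proj₁ pi)
    ... | greater gt rewrite ≡ᵇ-false (>⇒≢ gt) | <ᵇ-true gt | <ᵇ-false (<⇒≤ gt) | <ᵇ-false gt | <ᵇ-true (m<n⇒m<1+n gt) = verˡ (proj₁ pj)

  I-drawing : Drawing n (idPerm n) I
  I-drawing = record { sq = I-sq ; len = length-applyUpTo suc n ; h = h₁ ; v = v₁ ; lab = I-lab
    ; exits = λ r pr → trans (oneTo-nth pr) (cong just (sym (cong (λ z → if z then r else 0) (<ᵇ-true (s≤s (proj₂ pr)))))) }

  I-noBump : NoBump n (tile I)
  I-noBump i j pi pj e with trans (sym (I-tile i j pi pj)) e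
  ... | q with i ≡ᵇ j | j <ᵇ i
  I-noBump i j pi pj e | () | true | _
  I-noBump i j pi pj e | () | false | true
  I-noBump i j pi pj e | () | false | false

  I-bpd : T (isBPD n (idPerm n) I)
  I-bpd = ToBPD.isBPD-true I-drawing I-noBump

  I-blank : ∀ i → In n i → rowSum (isBlank (tile I)) n i ≡ 0
  I-blank i pi = sumTo-zeros _ n (λ j lt → trans (cong (b2n ∘ isTile blank) (I-tile i (suc j) pi (s≤s z≤n , lt))) (notBlank (i ≡ᵇ suc j) (suc j <ᵇ i)))
    where
    notBlank : ∀ x y → b2n (isTile blank (if x then relbow else (if y then ver else hor))) ≡ 0
    notBlank true _ = refl
    notBlank false true = refl
    notBlank false false = refl

  -- Row i must let pipe i out, which enters it in column i; this determines the rows from the bottom up.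
  module Only {D} (Dr : Drawing n (idPerm n) D) (nb : NoBump n (tile D)) where
    open Drawing Dr
    open Lab lab

    exit-i : ∀ i → In n i → h i (suc n) ≡ i
    exit-i i pi = just-injective (trans (sym (exits i pi)) (oneTo-nth pi))

    -- The state of the boundary below row `i`: every pipe larger than `i` has already left.
    Line : ℕ → Set
    Line i = (∀ j → In n j → j ≤ i → v (suc i) j ≡ j) × (∀ j → In n j → i < j → v (suc i) j ≡ 0)

    private
      emptyWS : ∀ {t w e m s} → Loc _<_ t w e m s → 0 < s → e ≡ 0 → t ≡ ver × w ≡ 0 × m ≡ s
      emptyWS (verˡ x) p q = refl , refl , refl
      emptyWS (relbowˡ ()) p refl
      emptyWS (crossˡ () _ _) p refl
      emptyWS (bumpˡ _ ()) p refl

      passing : ∀ {t w e m s} → Loc _<_ t w e m s → 0 < w → s ≡ 0 → Plain t → t ≡ hor × m ≡ 0 × e ≡ w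
      passing (horˡ x) p q f = refl , refl , refl
      passing (jelbowˡ x) p q f = ⊥-elim (proj₂ f refl)
      passing (crossˡ x () _) p refl f
      passing (bumpˡ x ()) p refl f

      relbowNorth : ∀ {t w e m s} → Loc _<_ t w e m s → t ≡ relbow → m ≡ 0
      relbowNorth (relbowˡ x) refl = refl

    row : ∀ i → In n i → Line i → (∀ j → In n j → tile D i j ≡ diag i j) × (∀ j → In n j → j < i → v i j ≡ j) × (∀ j → In n j → i ≤ j → v i j ≡ 0)
    row i pi (low , high) with Rows.prevR lab i pi n i ≤-refl (proj₁ pi) (exit-i i pi) (λ y u w → nb i y pi (u , w))
    ... | j₀ , 1≤j₀ , j₀≤n , r , lj , f = go colEq
      where
      pj₀ : In n j₀
      pj₀ = 1≤j₀ , j₀≤n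
      rl = relbowLabels (loc i j₀ pi pj₀) r
      -- The r-elbow that starts the exiting pipe `i` takes it from the south edge, and by `Line`
      -- the only south edge carrying `i` is in column `i`.
      colEq : j₀ ≡ i
      colEq with ≤-<-connex j₀ i
      ... | inj₁ le = trans (sym (low j₀ pj₀ le)) (trans (proj₁ (proj₂ rl)) lj)
      ... | inj₂ gt = ⊥-elim (n≮0 (subst (0 <_) (trans (sym (trans (proj₁ (proj₂ rl)) lj)) (high j₀ pj₀ gt)) (proj₁ pi)))
      go : j₀ ≡ i → _
      go refl = tiles' , northLow , northHigh
        where
        east : ∀ d j → d + suc j ≡ i → h i (suc j) ≡ 0
        east zero j e = trans (cong (h i) e) (proj₁ rl)
        east (suc d) j e = proj₁ (proj₂ (emptyWS (loc i (suc j) pi pj) (subst (0 <_) (sym (low (suc j) pj (<⇒≤ j<i))) (s≤s z≤n)) (east d (suc j) (trans (+-suc d (suc j)) e))))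
          where
          j<i : suc j < i
          j<i = ≤-trans (s≤s (m≤n+m (suc j) d)) (≤-reflexive e)
          pj : In n (suc j)
          pj = s≤s z≤n , ≤-trans (<⇒≤ j<i) (proj₂ pi)
        left! : ∀ j → In n j → j < i → tile D i j ≡ ver × v i j ≡ j
        left! j pj lt = proj₁ c , trans (proj₂ (proj₂ c)) sLabel
          where
          sLabel : v (suc i) j ≡ j
          sLabel = low j pj (<⇒≤ lt)
          c = emptyWS (loc i j pi pj) (subst (0 <_) (sym sLabel) (proj₁ pj)) (east (i ∸ suc j) j (m∸n+n≡m lt))
        west : ∀ j → i < j → j ≤ suc n → h i j ≡ i
        west = upward (λ j → h i j ≡ i) lj (λ j u w e → trans (proj₂ (proj₂ (passing (loc i j pi (≤-trans (s≤s z≤n) u , ≤-pred w)) (subst (0 <_) (sym e) (proj₁ pi)) (high j (≤-trans (s≤s z≤n) u , ≤-pred w) u) (f j u (≤-pred w))))) e)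
        right! : ∀ j → In n j → i < j → tile D i j ≡ hor × v i j ≡ 0
        right! j pj lt = let c = passing (loc i j pi pj) (subst (0 <_) (sym (west j lt (m≤n⇒m≤1+n (proj₂ pj)))) (proj₁ pi)) (high j pj lt) (f j lt (proj₂ pj)) in proj₁ c , proj₁ (proj₂ c)
        tiles' : ∀ j → In n j → tile D i j ≡ diag i j
        tiles' j pj with compareℕ i j
        ... | less lt rewrite ≡ᵇ-false (<⇒≢ lt) | <ᵇ-false (<⇒≤ lt) = proj₁ (right! j pj lt)
        ... | equal refl rewrite ≡ᵇ-refl i = r
        ... | greater gt rewrite ≡ᵇ-false (>⇒≢ gt) | <ᵇ-true gt = proj₁ (left! j pj gt)
        northLow : ∀ j → In n j → j < i → v i j ≡ j
        northLow j pj lt = proj₂ (left! j pj lt)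
        northHigh : ∀ j → In n j → i ≤ j → v i j ≡ 0
        northHigh j pj le with m≤n⇒m<n∨m≡n le
        ... | inj₁ lt = proj₂ (right! j pj lt)
        ... | inj₂ refl = relbowNorth (loc i i pi pi) r

    lines : ∀ d i → d + i ≡ n → 1 ≤ i → Line i
    lines zero .n refl 1≤i = (λ j pj _ → bot j pj) , (λ j pj lt → ⊥-elim (<⇒≱ lt (proj₂ pj)))
    lines (suc d) i e 1≤i with row (suc i) (s≤s z≤n , ≤-trans (s≤s (m≤n+m i d)) (≤-reflexive e)) (lines d (suc i) (trans (+-suc d i) e) (s≤s z≤n))
    ... | _ , lo' , hi' = (λ j pj le → lo' j pj (s≤s le)) , (λ j pj lt → hi' j pj lt)

    only-I : D ≡ I
    only-I = grid-ext sq I-sq (λ i j pi pj → trans (proj₁ (row i pi (lines (n ∸ i) i (m∸n+n≡m (proj₂ pi)) (proj₁ pi))) j pj) (sym (I-tile i j pi pj)))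

-- From single insertions to biwords

oneTo-map-cong : ∀ n {f g : ℕ → ℕ} → (∀ i → In n i → f i ≡ g i) → map f (oneTo n) ≡ map g (oneTo n)
oneTo-map-cong n {f} {g} e = nth-ext _ _ (trans (length-map f (oneTo n)) (sym (length-map g (oneTo n)))) λ i pi →
  let pi' = subst (λ z → In z i) (trans (length-map f (oneTo n)) (length-applyUpTo suc n)) pi in
  trans (nth-map f (oneTo n) (oneTo-nth pi')) (trans (cong just (e i pi')) (sym (nth-map g (oneTo n) (oneTo-nth pi'))))

wtBPD-rows : ∀ {n D} → Sq n D → wtBPD n D ≡ map (rowSum (isBlank (tile D)) n) (oneTo n)
wtBPD-rows {n} {D} s = oneTo-map-cong n (λ i pi → trans (count-applyUpTo _ suc n) (sumTo-cong n (λ j lt → cong (b2n ∘ isTileAt blank) (tileAt-in s pi (s≤s z≤n , lt)))))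

≡ᵇ-sym : ∀ a b → (a ≡ᵇ b) ≡ (b ≡ᵇ a)
≡ᵇ-sym zero zero = refl
≡ᵇ-sym zero (suc b) = refl
≡ᵇ-sym (suc a) zero = refl
≡ᵇ-sym (suc a) (suc b) = ≡ᵇ-sym a b

-- The same chains, built at the end as `Rec` builds them: the last step of the chain belongs to the
-- first biletter.
data SnocChain (n : ℕ) : Chain → Perm → Set where
  nil  : SnocChain n [] (idPerm n)
  snoc : ∀ {c ρ k σ} → SnocChain n c ρ → Covers n k ρ σ → SnocChain n (c ++ (k , σ) ∷ []) σ

toSnoc : ∀ {n c₀ ρ c π} → SnocChain n c₀ ρ → IsChain n ρ c π → SnocChain n (c₀ ++ c) π
toSnoc {n} {c₀} {ρ} S chain-nil = subst (λ z → SnocChain n z ρ) (sym (++-identityʳ c₀)) S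
toSnoc {n} {c₀} {π = π} S (chain-cons {σ = σ} {k = k} {c = c} cov ch) = subst (λ z → SnocChain n z π) (++-assoc c₀ ((k , σ) ∷ []) c) (toSnoc (snoc S cov) ch)

snoc-length : ∀ {n c π} → SnocChain n c π → length π ≡ n
snoc-length {n} nil = length-applyUpTo suc n
snoc-length (snoc {ρ = ρ} S (_ , _ , _ , _ , _ , _ , refl , _)) = trans (length-map _ (oneTo (length ρ))) (trans (length-applyUpTo suc (length ρ)) (snoc-length S))

uip : ∀ {A : Set} {x y : A} (p q : x ≡ y) → p ≡ q
uip refl refl = refl

Runs-det : ∀ {b k s D D'} → Runs b k s D → Runs b k s D' → D ≡ D'
Runs-det (halt e) (halt e') = stop-injective (trans (sym e) e')
Runs-det (halt e) (next e' _) with trans (sym e) e'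
... | ()
Runs-det (next e _) (halt e') with trans (sym e) e'
... | ()
Runs-det (next e r) (next e' r') with continue-injective (trans (sym e) e')
... | refl = Runs-det r r'

Runs-irrelevant : ∀ {b k s D} (r r' : Runs b k s D) → r ≡ r'
Runs-irrelevant (halt e) (halt e') = cong halt (uip e e')
Runs-irrelevant (halt e) (next e' _) with trans (sym e) e'
... | ()
Runs-irrelevant (next e _) (halt e') with trans (sym e) e'
... | ()
Runs-irrelevant (next e r) (next e' r') with continue-injective (trans (sym e) e')
... | refl = cong₂ next (uip e e') (Runs-irrelevant r r')

snoc-injective : ∀ {c c' : Chain} {x y} → c ++ x ∷ [] ≡ c' ++ y ∷ [] → c ≡ c' × x ≡ y
snoc-injective {c} {c'} e = ∷ʳ-injective c c' e

Rec-det : ∀ {n Q D D' c c'} → Rec n Q D c → Rec n Q D' c' → c ≡ c' → D ≡ D'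
Rec-det rec-nil rec-nil e = refl
Rec-det (rec-cons {c = c} r l _) (rec-cons {c = c'} r' l' _) e with snoc-injective {c} {c'} e
... | refl , refl with Rec-det r r' refl
...   | refl = Runs-det l l'

-- Words of the bijection carry their recording, so equal biwords give equal elements only if
-- recordings are unique; this holds because all intermediate grids are determined. The equation `e`
-- keeps the two chains apart, as an index of the form `c ++ x ∷ []` cannot be matched directly.
Rec-irrelevant : ∀ {n Q D c c'} (r : Rec n Q D c) (r' : Rec n Q D c') (e : c ≡ c') → subst (Rec n Q D) e r ≡ r'
Rec-irrelevant rec-nil rec-nil refl = refl
Rec-irrelevant (rec-cons {c = c} r l t) (rec-cons {c = c'} r' l' t') e with snoc-injective {c} {c'} e
... | refl , refl with Rec-det r r' refl
...   | refl with uip e refl | Rec-irrelevant r r' refl | Runs-irrelevant l l' | T-irrelevant t t'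
...     | refl | refl | refl | refl = refl

Rec-nil-inv : ∀ {n Q D c} → Rec n Q D c → c ≡ [] → Q ≡ [] × D ≡ idBPD n
Rec-nil-inv rec-nil e = refl , refl
Rec-nil-inv (rec-cons {c = []} _ _ _) ()
Rec-nil-inv (rec-cons {c = _ ∷ _} _ _ _) ()

record RecSnoc (n : ℕ) (Q : Biword) (D' : Grid) (c : Chain) (k : ℕ) (σ : Perm) : Set where
  field
    b : ℕ
    Q₀ : Biword
    D : Grid
    split : Q ≡ (b , k) ∷ Q₀
    record₀ : Rec n Q₀ D c
    insertion : LeftInsert b k D D'
    fits : T (isBPD (length D') (padPerm (length D') σ) D')

Rec-snoc-inv : ∀ {n Q D' c' c k σ} → Rec n Q D' c' → c' ≡ c ++ (k , σ) ∷ [] → RecSnoc n Q D' c k σ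
Rec-snoc-inv {c = []} rec-nil ()
Rec-snoc-inv {c = _ ∷ _} rec-nil ()
Rec-snoc-inv {c = c} (rec-cons {c = c₁} r l f) e with snoc-injective {c₁} {c} e
... | refl , refl = record { split = refl ; record₀ = r ; insertion = l ; fits = f }

covers-k<n : ∀ {n k} ρ {σ} → Covers n k ρ σ → k < n
covers-k<n _ (_ , _ , _ , _ , k<β , β≤n , _) = <-≤-trans k<β β≤n

valid-cons : ∀ b k Q → T (validBiword ((b , k) ∷ Q)) → (1 ≤ b × b ≤ k) × T (validBiword Q)
valid-cons b k Q p with ∧-split ((1 ≤ᵇ b) ∧ (b ≤ᵇ k)) p
... | q , r = (≤ᵇ⇒≤ 1 b (proj₁ (∧-split (1 ≤ᵇ b) q)) , ≤ᵇ⇒≤ b k (proj₂ (∧-split (1 ≤ᵇ b) q))) , r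

cons-valid : ∀ b k Q → 1 ≤ b → b ≤ k → T (validBiword Q) → T (validBiword ((b , k) ∷ Q))
cons-valid b k Q p q r = ∧-join ((1 ≤ᵇ b) ∧ (b ≤ᵇ k)) (∧-join (1 ≤ᵇ b) (≤⇒≤ᵇ p) (≤⇒≤ᵇ q)) r

padPerm-self : ∀ {n} σ → length σ ≡ n → padPerm n σ ≡ σ
padPerm-self σ refl rewrite n∸n≡0 (length σ) = ++-identityʳ σ

sound : ∀ {n c π Q D} → SnocChain n c π → Rec n Q D c → T (validBiword Q) → T (isBPD n π D) × wtBPD n D ≡ wtBiword n Q
insertedAt : ∀ {n c ρ k σ Q D'} → SnocChain n c ρ → Covers n k ρ σ → (R : RecSnoc n Q D' c k σ) → T (validBiword Q) → Inserted n ρ k (RecSnoc.b R) (RecSnoc.D R) D'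

insertedAt {n} {c} {ρ} {k} {σ} {Q} S cov R val = inserted (covers-k<n ρ cov) (proj₁ (proj₁ vc)) (proj₂ (proj₁ vc)) (proj₁ (sound S (RecSnoc.record₀ R) (proj₂ vc))) (RecSnoc.insertion R) (σ , snoc-length (snoc S cov) , RecSnoc.fits R)
  where vc = valid-cons (RecSnoc.b R) k (RecSnoc.Q₀ R) (subst (T ∘ validBiword) (RecSnoc.split R) val)

sound {n} nil r val with Rec-nil-inv r refl
... | refl , refl = Identity.I-bpd n , trans (wtBPD-rows (Identity.I-sq n)) (oneTo-map-cong n (λ i pi → Identity.I-blank n i pi))
sound {n} {Q = Q} {D'} (snoc {c = c} {ρ} {k} {σ} S cov) r val = go (Rec-snoc-inv {c = c} r refl)
  where
  lσ : length σ ≡ n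
  lσ = snoc-length (snoc S cov)
  go : RecSnoc n Q D' c k σ → T (isBPD n σ D') × wtBPD n D' ≡ wtBiword n Q
  go R = bpd , trans (wtBPD-rows sq') (trans (oneTo-map-cong n row) (cong (wtBiword n) (sym R.split)))
    where
    module R = RecSnoc R
    vc = valid-cons R.b k R.Q₀ (subst (T ∘ validBiword) R.split val)
    Ins = insertedAt S cov R val
    -- The insertion stayed inside the square, so the padding in `fits` is empty and `D'` is a BPD
    -- of `σ` itself.
    sq' : Sq n D'
    sq' = Stop.sq (Finished.stops (Inserted.finished Ins))
    bpd : T (isBPD n σ D')
    bpd = subst (λ z → T (isBPD n z D')) (padPerm-self σ lσ) (subst (λ z → T (isBPD z (padPerm z σ) D')) (Sq.side sq') R.fits)
    prior = sound S R.record₀ (proj₂ vc)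
    prior-row : ∀ i → In n i → rowSum (isBlank (tile R.D)) n i ≡ countᵇ (λ bk → proj₁ bk ≡ᵇ i) R.Q₀
    prior-row i pi = just-injective (trans (sym (nth-map (rowSum (isBlank (tile R.D)) n) (oneTo n) (oneTo-nth pi)))
        (trans (cong (λ z → nth z i) (trans (sym (wtBPD-rows (FromBPD.sq n ρ R.D (proj₁ prior)))) (proj₂ prior))) (nth-map _ (oneTo n) (oneTo-nth pi))))
    row : ∀ i → In n i → rowSum (isBlank (tile D')) n i ≡ countᵇ (λ bk → proj₁ bk ≡ᵇ i) ((R.b , k) ∷ R.Q₀)
    row i pi = trans (sym (Inserted.weight Ins i pi)) (trans (+-comm _ (b2n (i ≡ᵇ R.b))) (trans (cong₂ _+_ (cong b2n (≡ᵇ-sym i R.b)) (prior-row i pi))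
        (sym (count-∷ (λ bk → proj₁ bk ≡ᵇ i) (R.b , k) R.Q₀))))

-- With `D'`, `k` and both permutations fixed, the last insertion can be traced back in only one
-- way, which yields its row `b` and the grid before it; the rest is induction along the chain.
injective : ∀ {n c π Q Q' D} → SnocChain n c π → Rec n Q D c → Rec n Q' D c → T (validBiword Q) → T (validBiword Q') → Q ≡ Q'
injective nil r r' val val' = trans (proj₁ (Rec-nil-inv r refl)) (sym (proj₁ (Rec-nil-inv r' refl)))
injective {n} {Q = Q} {Q'} {D'} (snoc {c = c} {ρ} {k} {σ} S cov) r r' val val' = go (Rec-snoc-inv {c = c} r refl) (Rec-snoc-inv {c = c} r' refl)
  where
  bpd = proj₁ (sound (snoc S cov) r val)
  tailValid : ∀ {Q b Q₀} → Q ≡ (b , k) ∷ Q₀ → T (validBiword Q) → T (validBiword Q₀)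
  tailValid {b = b} {Q₀} refl v = proj₂ (valid-cons b k Q₀ v)
  go : RecSnoc n Q D' c k σ → RecSnoc n Q' D' c k σ → Q ≡ Q'
  go R R' = conclude (finished-unique (FromBPD.drawing n σ D' bpd) (FromBPD.noBump n σ D' bpd) (Inserted.isStart I₁) (Inserted.isStart I₂) (Inserted.finished I₁) (Inserted.finished I₂))
    where
    I₁ = insertedAt S cov R val
    I₂ = insertedAt S cov R' val'
    conclude : RecSnoc.D R ≡ RecSnoc.D R' × RecSnoc.b R ≡ RecSnoc.b R' × Inserted.j I₁ ≡ Inserted.j I₂ → Q ≡ Q'
    conclude (eD , eb , _) = trans (RecSnoc.split R) (trans (cong₂ (λ b q → (b , k) ∷ q) eb
        (injective S (RecSnoc.record₀ R) (subst (λ z → Rec n (RecSnoc.Q₀ R') z c) (sym eD) (RecSnoc.record₀ R')) (tailValid (RecSnoc.split R) val) (tailValid (RecSnoc.split R') val')))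
        (sym (RecSnoc.split R')))

onto : ∀ {n c π D} → SnocChain n c π → T (isBPD n π D) → Σ Biword λ Q → T (validBiword Q) × Rec n Q D c
onto {n} {D = D} nil bpd = [] , tt , subst (λ z → Rec n [] z []) (sym (Identity.Only.only-I n (FromBPD.drawing n (idPerm n) D bpd) (FromBPD.noBump n (idPerm n) D bpd))) rec-nil
onto {n} {D = D} (snoc {c = c} {ρ} {k} {σ} S cov) bpd with insertion-onto (snoc-length S) cov bpd
... | b , D₀ , 1≤b , b≤k , bpd₀ , ins with onto S bpd₀
...   | Q , val , r = (b , k) ∷ Q , cons-valid b k Q 1≤b b≤k val , rec-cons r ins
        (subst (λ z → T (isBPD z (padPerm z σ) D)) (sym (Sq.side (FromBPD.sq n σ D bpd))) (subst (λ z → T (isBPD n z D)) (sym (padPerm-self σ (snoc-length (snoc S cov)))) bpd))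

-- Reading off the final grid of a recording is a map to BPDs; `word` shows that it is onto and
-- `unique` that it is injective, and equality of weights restricts it to each monomial `m`.
correspondence : ∀ {n c} {P : Grid → Set} {m : Monomial} → (∀ {D} (p p' : P D) → p ≡ p') →
  (∀ {D} → P D → Σ Biword λ Q → T (validBiword Q) × Rec n Q D c) →
  (∀ {Q D} → Rec n Q D c → T (validBiword Q) → P D × wtBPD n D ≡ wtBiword n Q) →
  (∀ {Q Q' D} → Rec n Q D c → Rec n Q' D c → T (validBiword Q) → T (validBiword Q') → Q ≡ Q') →
  (Σ Grid λ D → P D × (wtBPD n D ≡ m)) ↔ (Σ Biword λ Q → T (validBiword Q) × (Σ Grid λ D → Rec n Q D c) × (wtBiword n Q ≡ m))
correspondence {n} {c} {P} {m} prop word drawn unique = mk↔ₛ′ to from to-from from-to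
  where
  BPDs = Σ Grid λ D → P D × (wtBPD n D ≡ m)
  Words = Σ Biword λ Q → T (validBiword Q) × (Σ Grid λ D → Rec n Q D c) × (wtBiword n Q ≡ m)

  to : BPDs → Words
  to (D , p , w) = let (Q , val , r) = word p in Q , val , (D , r) , trans (sym (proj₂ (drawn r val))) w

  from : Words → BPDs
  from (Q , val , (D , r) , w) = D , proj₁ (drawn r val) , trans (proj₂ (drawn r val)) w

  from-to : ∀ x → from (to x) ≡ x
  from-to (D , p , w) = cong₂ (λ p q → D , p , q) (prop _ _) (uip _ _)

  sameWord : ∀ {Q Q' D} (val : T (validBiword Q)) (val' : T (validBiword Q')) (r : Rec n Q D c) (r' : Rec n Q' D c) (w : wtBiword n Q ≡ m) (w' : wtBiword n Q' ≡ m) →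
    Q ≡ Q' → _≡_ {A = Words} (Q , val , (D , r) , w) (Q' , val' , (D , r') , w')
  sameWord val val' r r' w w' refl with T-irrelevant val val' | Rec-irrelevant r r' refl | uip w w'
  ... | refl | refl | refl = refl

  to-from : ∀ y → to (from y) ≡ y
  to-from (Q , val , (D , r) , w) = let (_ , val' , r') = word (proj₁ (drawn r val)) in sameWord val' val r' r _ w (unique r' r val' val)

theorem3p6 : (n : ℕ) (π : Perm) → IsPerm n π →
    (c : Chain) → MixedChain n c π →
    (m : Monomial) →
    (Σ Grid λ D → T (isBPD n π D) × (wtBPD n D ≡ m))
    ↔ (Σ Biword λ Q → T (validBiword Q) × (Σ Grid λ D → Rec n Q D c) × (wtBiword n Q ≡ m))
theorem3p6 n π _ c chain m = correspondence T-irrelevant (onto S) (sound S) (injective S)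
  where
  S : SnocChain n c π
  S = toSnoc nil chain
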